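{- Let $\Sigma$ be a set of generators and let $r=\langle l,r'\rangle$ be a rewrite rule in $\mathbf T_\Sigma$, with $l,r'\colon i\to j$. For terms $g,h\colon m\to n$ in $\mathbf T_\Sigma$, we have $g\Rightarrow_rh$ if and only if $\langle\!\langle\ulcorner\lfloor g\rfloor^{\mathbf T}_\Sigma\urcorner\rangle\!\rangle_\Sigma\rightsquigarrow_{\langle\!\langle\lfloor r\rfloor^{\mathbf T}_\Sigma\rangle\!\rangle_\Sigma}\langle\!\langle\ulcorner\lfloor h\rfloor^{\mathbf T}_\Sigma\urcorner\rangle\!\rangle_\Sigma$, where $\rightsquigarrow$ is traced double pushout (DPO) rewriting with interfaces.
   Context: Terms. A set of generators $\Sigma$ has functions $\mathrm{dom},\mathrm{cod}\colon\Sigma\to\mathbb N$. $\mathbf T_\Sigma$ is the symmetric traced PROP freely generated over $\Sigma$. A rewrite rule is a pair $\langle l,r'\rangle$ of terms of the same type $i\to j$. For $g,h\colon m\to n$, $g\Rightarrow_{\langle l,r'\rangle}h$ if there exists $c\colon j+m\to i+n$ in $\mathbf T_\Sigma$ with $g=\mathrm{Tr}^i((l\otimes\mathrm{id}_m);c)$ and $h=\mathrm{Tr}^i((r'\otimes\mathrm{id}_m);c)$ by the axioms of symmetric traced monoidal categories. Hypergraphs. A hypergraph has vertices and hyperedges with ordered lists of sources and targets; $\mathbf{Hyp}_\Sigma$ is the category of finite hypergraphs whose hyperedges are labelled by generators of $\Sigma$ of matching arity and coarity, with label- and source/target-preserving homomorphisms. Write $n$ also for the discrete hypergraph with vertices $0,\dots,n-1$.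 $\mathsf{Csp}_D(\mathbf{Hyp}_\Sigma)$ is the PROP of isomorphism classes of cospans $m\to F\leftarrow n$ in $\mathbf{Hyp}_\Sigma$, composed by pushout, tensored by coproduct; its canonical trace sends $x+m\to F\leftarrow x+n$ to $m\to F'\leftarrow n$, where $F'$ is $F$ with the $a$-th input and $a$-th output vertices merged for each $a<x$. The map $\langle\!\langle\lfloor-\rfloor^{\mathbf T}_\Sigma\rangle\!\rangle_\Sigma\colon\mathbf T_\Sigma\to\mathsf{Csp}_D(\mathbf{Hyp}_\Sigma)$ is the traced PROP morphism (it factors through the inclusion $\lfloor-\rfloor^{\mathbf T}_\Sigma$ into the free hypergraph category on $\Sigma$) sending a generator $\phi\colon k\to l$ to the cospan $k\to E_\phi\leftarrow l$ with a single $\phi$-labelled hyperedge on $k+l$ distinct vertices, the sources and targets picked in order by the legs. The folding $\ulcorner-\urcorner$ bends inputs to outputs: if the interpretation of $f$ is $m\xrightarrow{a}F\xleftarrow{b}n$, then $\langle\!\langle\ulcorner\lfloor f\rfloor^{\mathbf T}_\Sigma\urcorner\rangle\!\rangle_\Sigma$ is $0\to F\xleftarrow{[a,b]}m+n$, regarded as a morphism $F\leftarrow m+n$. Partial monogamy. The degree of a vertex is (number of hyperedge target positions, number of hyperedge source positions) it occupies. A cospan $m\xrightarrow{f}F\xleftarrow{g}n$ is partial monogamous if $f,g$ are mono and each vertex has degree $(0,0)$ if in both images, $(0,1)$ if in the image of $f$ only, $(1,0)$ if in the image of $g$ only, and $(0,0)$ or $(1,1)$ otherwise. DPO rewriting.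 The DPO rule $\langle\!\langle\lfloor r\rfloor^{\mathbf T}_\Sigma\rangle\!\rangle_\Sigma$ is the span $L\xleftarrow{[a_1,a_2]}i+j\to R$ given by $L\leftarrow i+j$ and $R\leftarrow i+j$, the folded interpretations of $l$ and $r'$. For $G\xleftarrow{[b_1,b_2]}m+n$ and $H\leftarrow m+n$, there is a traced rewrite $G\rightsquigarrow H$ if there exist a cospan $i+j\xrightarrow{[c_1,c_2]}C\xleftarrow{[d_1,d_2]}m+n$ and morphisms $L\to G\leftarrow C$ and $C\to H\leftarrow R$ such that $L\to G\leftarrow C$ is a pushout of $L\leftarrow i+j\to C$, $C\to H\leftarrow R$ is a pushout of $C\leftarrow i+j\to R$, the maps $m+n\to G$ and $m+n\to H$ factor through $[d_1,d_2]$ via $C\to G$ and $C\to H$ respectively, and $i+j\to C\to G$ is a traced boundary complement, meaning: $c_1$ and $c_2$ are mono and $j+m\xrightarrow{[c_2,d_1]}C\xleftarrow{[d_2,c_1]}n+i$ is a partial monogamous cospan. -}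

module Defs where

open import Data.Nat using (ℕ; zero; suc; _+_)
open import Data.Nat.Properties using (+-assoc; +-identityʳ)
open import Data.Fin using (Fin; zero; suc; _↑ˡ_; _↑ʳ_; splitAt; punchIn; punchOut)
open import Data.Fin.Properties
  using (_≟_; punchInᵢ≢i; punchIn-punchOut; punchOut-punchIn; punchOut-cong; splitAt-↑ˡ; splitAt-↑ʳ)
open import Data.List using (List; length; map; concat; tabulate; filter)
open import Data.List.Properties using (length-map; length-tabulate; map-∘; map-cong; map-id)
open import Data.Product using (Σ-syntax; ∃; _×_; _,_; proj₁)
open import Data.Sum using (_⊎_; inj₁; inj₂; [_,_]′)
open import Function using (_∘_)
open import Relation.Nullary using (¬_; yes; no; contradiction)
open import Relation.Binary.PropositionalEquality
  using (_≡_; _≢_; refl; sym; trans; cong; subst₂)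

record Generators : Set₁ where
  field
    Gen : Set
    dom : Gen → ℕ
    cod : Gen → ℕ

open Generators public

private variable
  S : Generators
  i j k l m m′ n n′ p p′ q x y : ℕ

infixl 6 _⨾_
infixl 7 _⊗_

-- Representatives of the morphisms of the free symmetric traced PROP; the
-- morphisms themselves are these terms up to _≈_ below.  Composition is
-- diagrammatic and the trace is taken over the leftmost x wires.
data Term (S : Generators) : ℕ → ℕ → Set where
  gen : (φ : Gen S) → Term S (dom S φ) (cod S φ)
  id  : (n : ℕ) → Term S n n
  σ   : (m n : ℕ) → Term S (m + n) (n + m)
  _⨾_ : Term S m n → Term S n p → Term S m p
  _⊗_ : Term S m n → Term S p q → Term S (m + p) (n + q)
  Tr  : (x : ℕ) → Term S (x + m) (x + n) → Term S m n

-- A PROP is strict, but m + (n + p) and (m + n) + p are only propositionally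
-- equal; cast moves a term along such an equality of types.
cast : m ≡ m′ → n ≡ n′ → Term S m n → Term S m′ n′
cast = subst₂ (Term _)

infix 4 _≈_

data _≈_ {S : Generators} : Term S m n → Term S m n → Set where
  ≈-refl  : {f : Term S m n} → f ≈ f
  ≈-sym   : {f g : Term S m n} → f ≈ g → g ≈ f
  ≈-trans : {f g h : Term S m n} → f ≈ g → g ≈ h → f ≈ h
  ⨾-cong  : {f f′ : Term S m n} {g g′ : Term S n p} →
            f ≈ f′ → g ≈ g′ → f ⨾ g ≈ f′ ⨾ g′
  ⊗-cong  : {f f′ : Term S m n} {g g′ : Term S p q} →
            f ≈ f′ → g ≈ g′ → f ⊗ g ≈ f′ ⊗ g′
  Tr-cong : {f f′ : Term S (x + m) (x + n)} → f ≈ f′ → Tr x f ≈ Tr x f′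

  ⨾-idˡ   : (f : Term S m n) → id m ⨾ f ≈ f
  ⨾-idʳ   : (f : Term S m n) → f ⨾ id n ≈ f
  ⨾-assoc : (f : Term S m n) (g : Term S n p) (h : Term S p q) →
            (f ⨾ g) ⨾ h ≈ f ⨾ (g ⨾ h)

  ⊗-id    : id m ⊗ id n ≈ id (m + n)
  ⊗-⨾     : (f : Term S m n) (g : Term S n p) (h : Term S i j) (k : Term S j l) →
            (f ⨾ g) ⊗ (h ⨾ k) ≈ (f ⊗ h) ⨾ (g ⊗ k)
  ⊗-idˡ   : (f : Term S m n) → id 0 ⊗ f ≈ f
  ⊗-idʳ   : (f : Term S m n) → cast (+-identityʳ m) (+-identityʳ n) (f ⊗ id 0) ≈ f
  ⊗-assoc : (f : Term S m m′) (g : Term S n n′) (h : Term S p p′) →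
            cast (+-assoc m n p) (+-assoc m′ n′ p′) ((f ⊗ g) ⊗ h) ≈ f ⊗ (g ⊗ h)

  σ-natural : (f : Term S m n) (g : Term S p q) → (f ⊗ g) ⨾ σ n q ≈ σ m p ⨾ (g ⊗ f)
  σ-inverse : σ m n ⨾ σ n m ≈ id (m + n)
  σ-unit    : cast (+-identityʳ m) refl (σ m 0) ≈ id m
  σ-hexagon : σ m (n + p) ≈
              cast (+-assoc m n p) (+-assoc n m p) (σ m n ⊗ id p)
              ⨾ cast refl (sym (+-assoc n p m)) (id n ⊗ σ m p)

  tightening : (f : Term S m n) (g : Term S (x + n) (x + p)) (h : Term S p q) →
               Tr x ((id x ⊗ f) ⨾ g ⨾ (id x ⊗ h)) ≈ f ⨾ Tr x g ⨾ h
  sliding    : (f : Term S (x + m) (y + n)) (g : Term S y x) →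
               Tr x (f ⨾ (g ⊗ id n)) ≈ Tr y ((g ⊗ id m) ⨾ f)
  vanishing₀ : (f : Term S m n) → Tr 0 f ≈ f
  vanishing₊ : (f : Term S ((x + y) + m) ((x + y) + n)) →
               Tr (x + y) f ≈ Tr y (Tr x (cast (+-assoc x y m) (+-assoc x y n) f))
  superposing : (f : Term S (x + m) (x + n)) →
                Tr x f ⊗ id p ≈ Tr x (cast (+-assoc x m p) (+-assoc x n p) (f ⊗ id p))
  yanking    : Tr x (σ x x) ≈ id x

record RewriteRule (S : Generators) (i j : ℕ) : Set where
  constructor ⟨_,_⟩
  field
    lhs rhs : Term S i j

infix 3 _⇒⟨_⟩_

_⇒⟨_⟩_ : {i j m n : ℕ} → Term S m n → RewriteRule S i j → Term S m n → Set
_⇒⟨_⟩_ {S} {i} {j} {m} {n} g ⟨ l , r ⟩ h =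
  Σ[ c ∈ Term S (j + m) (i + n) ]
    (g ≈ Tr i ((l ⊗ id m) ⨾ c)) × (h ≈ Tr i ((r ⊗ id m) ⨾ c))

record Hypergraph (S : Generators) : Set where
  field
    #V #E   : ℕ
    label   : Fin #E → Gen S
    sources : Fin #E → List (Fin #V)
    targets : Fin #E → List (Fin #V)
    arity   : ∀ e → length (sources e) ≡ dom S (label e)
    coarity : ∀ e → length (targets e) ≡ cod S (label e)

open Hypergraph public

infix 2 _⟶_

record _⟶_ {S : Generators} (F G : Hypergraph S) : Set where
  field
    onV : Fin (#V F) → Fin (#V G)
    onE : Fin (#E F) → Fin (#E G)
    onE-label   : ∀ e → label G (onE e) ≡ label F e
    onE-sources : ∀ e → sources G (onE e) ≡ map onV (sources F e)
    onE-targets : ∀ e → targets G (onE e) ≡ map onV (targets F e)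

open _⟶_ public

private variable
  F G H K : Hypergraph S

infix 4 _≐_

_≐_ : (F ⟶ G) → (F ⟶ G) → Set
f ≐ g = (∀ v → onV f v ≡ onV g v) × (∀ e → onE f e ≡ onE g e)

infixr 9 _∘ₕ_

_∘ₕ_ : (G ⟶ H) → (F ⟶ G) → (F ⟶ H)
g ∘ₕ f = record
  { onV = onV g ∘ onV f
  ; onE = onE g ∘ onE f
  ; onE-label   = λ e → trans (onE-label g _) (onE-label f e)
  ; onE-sources = λ e → trans (onE-sources g _)
      (trans (cong (map (onV g)) (onE-sources f e)) (sym (map-∘ _)))
  ; onE-targets = λ e → trans (onE-targets g _)
      (trans (cong (map (onV g)) (onE-targets f e)) (sym (map-∘ _)))
  }

Mono : (F ⟶ G) → Set
Mono {S} {F} {G} f = {K : Hypergraph S} (g h : K ⟶ F) → f ∘ₕ g ≐ f ∘ₕ h → g ≐ h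

record IsCoequalizer {F G Q : Hypergraph S} (f g : F ⟶ G) (e : G ⟶ Q) : Set where
  field
    commutes  : e ∘ₕ f ≐ e ∘ₕ g
    universal : {K : Hypergraph S} (h : G ⟶ K) → h ∘ₕ f ≐ h ∘ₕ g →
                Σ[ u ∈ (Q ⟶ K) ] (u ∘ₕ e ≐ h) × (∀ u′ → u′ ∘ₕ e ≐ h → u′ ≐ u)

--     f
--  A ───→ B
--  │g     │s
--  ↓      ↓
--  C ───→ P
--     t
record IsPushout {A B C P : Hypergraph S}
                 (f : A ⟶ B) (g : A ⟶ C) (s : B ⟶ P) (t : C ⟶ P) : Set where
  field
    commutes  : s ∘ₕ f ≐ t ∘ₕ g
    universal : {K : Hypergraph S} (h : B ⟶ K) (k : C ⟶ K) → h ∘ₕ f ≐ k ∘ₕ g →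
                Σ[ u ∈ (P ⟶ K) ] ((u ∘ₕ s ≐ h) × (u ∘ₕ t ≐ k))
                  × (∀ u′ → u′ ∘ₕ s ≐ h → u′ ∘ₕ t ≐ k → u′ ≐ u)

discrete : ℕ → Hypergraph S
discrete n = record
  { #V = n ; #E = 0
  ; label = λ () ; sources = λ () ; targets = λ () ; arity = λ () ; coarity = λ () }

-- Every morphism out of a discrete hypergraph is, up to ≐, of this form.
pick : (Fin n → Fin (#V F)) → (discrete n ⟶ F)
pick f = record
  { onV = f ; onE = λ ()
  ; onE-label = λ () ; onE-sources = λ () ; onE-targets = λ () }

[_,_] : {F : Hypergraph S} → (discrete m ⟶ F) → (discrete n ⟶ F) → (discrete (m + n) ⟶ F)
[_,_] {m = m} f g = pick ([ onV f , onV g ]′ ∘ splitAt m)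

infixl 6 _⊕_

_⊕_ : Hypergraph S → Hypergraph S → Hypergraph S
_⊕_ {S} F G = record
  { #V = #V F + #V G
  ; #E = #E F + #E G
  ; label   = lab ∘ splitAt (#E F)
  ; sources = src ∘ splitAt (#E F)
  ; targets = tgt ∘ splitAt (#E F)
  ; arity   = ar ∘ splitAt (#E F)
  ; coarity = coar ∘ splitAt (#E F)
  }
  where
  lab : Fin (#E F) ⊎ Fin (#E G) → Gen S
  lab = [ label F , label G ]′
  src tgt : Fin (#E F) ⊎ Fin (#E G) → List (Fin (#V F + #V G))
  src = [ map (_↑ˡ #V G) ∘ sources F , map (#V F ↑ʳ_) ∘ sources G ]′
  tgt = [ map (_↑ˡ #V G) ∘ targets F , map (#V F ↑ʳ_) ∘ targets G ]′
  ar : ∀ e → length (src e) ≡ dom S (lab e)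
  ar (inj₁ e) = trans (length-map _ (sources F e)) (arity F e)
  ar (inj₂ e) = trans (length-map _ (sources G e)) (arity G e)
  coar : ∀ e → length (tgt e) ≡ cod S (lab e)
  coar (inj₁ e) = trans (length-map _ (targets F e)) (coarity F e)
  coar (inj₂ e) = trans (length-map _ (targets G e)) (coarity G e)

ι₁ : F ⟶ F ⊕ G
ι₁ {F = F} {G = G} = record
  { onV = _↑ˡ #V G
  ; onE = _↑ˡ #E G
  ; onE-label   = λ e → cong [ label F , label G ]′ (splitAt-↑ˡ (#E F) e (#E G))
  ; onE-sources = λ e → cong [ map (_↑ˡ #V G) ∘ sources F , map (#V F ↑ʳ_) ∘ sources G ]′
                             (splitAt-↑ˡ (#E F) e (#E G))
  ; onE-targets = λ e → cong [ map (_↑ˡ #V G) ∘ targets F , map (#V F ↑ʳ_) ∘ targets G ]′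
                             (splitAt-↑ˡ (#E F) e (#E G))
  }

ι₂ : G ⟶ F ⊕ G
ι₂ {G = G} {F = F} = record
  { onV = #V F ↑ʳ_
  ; onE = #E F ↑ʳ_
  ; onE-label   = λ e → cong [ label F , label G ]′ (splitAt-↑ʳ (#E F) (#E G) e)
  ; onE-sources = λ e → cong [ map (_↑ˡ #V G) ∘ sources F , map (#V F ↑ʳ_) ∘ sources G ]′
                             (splitAt-↑ʳ (#E F) (#E G) e)
  ; onE-targets = λ e → cong [ map (_↑ˡ #V G) ∘ targets F , map (#V F ↑ʳ_) ∘ targets G ]′
                             (splitAt-↑ʳ (#E F) (#E G) e)
  }

↑-elim : ∀ m {n} (P : Fin (m + n) → Set) →
         (∀ a → P (a ↑ˡ n)) → (∀ b → P (m ↑ʳ b)) → ∀ v → P v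
↑-elim zero    P l r v       = r v
↑-elim (suc m) P l r zero    = l zero
↑-elim (suc m) P l r (suc v) = ↑-elim m (P ∘ suc) (l ∘ suc) r v

copair : (F ⟶ K) → (G ⟶ K) → (F ⊕ G ⟶ K)
copair {F = F} {K = K} {G = G} h k = record
  { onV = onV′
  ; onE = onE′ ∘ splitAt (#E F)
  ; onE-label   = lab ∘ splitAt (#E F)
  ; onE-sources = src ∘ splitAt (#E F)
  ; onE-targets = tgt ∘ splitAt (#E F)
  }
  where
  onV′ : Fin (#V F + #V G) → Fin (#V K)
  onV′ = [ onV h , onV k ]′ ∘ splitAt (#V F)
  onE′ : Fin (#E F) ⊎ Fin (#E G) → Fin (#E K)
  onE′ = [ onE h , onE k ]′
  lab : ∀ e → label K (onE′ e) ≡ [ label F , label G ]′ e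
  lab (inj₁ e) = onE-label h e
  lab (inj₂ e) = onE-label k e
  mapˡ : ∀ vs → map (onV h) vs ≡ map onV′ (map (_↑ˡ #V G) vs)
  mapˡ vs = trans (map-cong (λ v → sym (cong [ onV h , onV k ]′ (splitAt-↑ˡ (#V F) v (#V G)))) vs)
                  (map-∘ vs)
  mapʳ : ∀ vs → map (onV k) vs ≡ map onV′ (map (#V F ↑ʳ_) vs)
  mapʳ vs = trans (map-cong (λ v → sym (cong [ onV h , onV k ]′ (splitAt-↑ʳ (#V F) (#V G) v))) vs)
                  (map-∘ vs)
  src : ∀ e → sources K (onE′ e) ≡
              map onV′ ([ map (_↑ˡ #V G) ∘ sources F , map (#V F ↑ʳ_) ∘ sources G ]′ e)
  src (inj₁ e) = trans (onE-sources h e) (mapˡ _)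
  src (inj₂ e) = trans (onE-sources k e) (mapʳ _)
  tgt : ∀ e → targets K (onE′ e) ≡
              map onV′ ([ map (_↑ˡ #V G) ∘ targets F , map (#V F ↑ʳ_) ∘ targets G ]′ e)
  tgt (inj₁ e) = trans (onE-targets h e) (mapˡ _)
  tgt (inj₂ e) = trans (onE-targets k e) (mapʳ _)

copair-ι₁ : (h : F ⟶ K) (k : G ⟶ K) → copair h k ∘ₕ ι₁ {F = F} {G = G} ≐ h
copair-ι₁ {F = F} {G = G} h k =
  (λ v → cong [ onV h , onV k ]′ (splitAt-↑ˡ (#V F) v (#V G))) ,
  (λ e → cong [ onE h , onE k ]′ (splitAt-↑ˡ (#E F) e (#E G)))

copair-ι₂ : (h : F ⟶ K) (k : G ⟶ K) → copair h k ∘ₕ ι₂ {G = G} {F = F} ≐ k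
copair-ι₂ {F = F} {G = G} h k =
  (λ v → cong [ onV h , onV k ]′ (splitAt-↑ʳ (#V F) (#V G) v)) ,
  (λ e → cong [ onE h , onE k ]′ (splitAt-↑ʳ (#E F) (#E G) e))

⊕-ext : (F G : Hypergraph S) (u w : F ⊕ G ⟶ K) →
        u ∘ₕ ι₁ ≐ w ∘ₕ ι₁ → u ∘ₕ ι₂ ≐ w ∘ₕ ι₂ → u ≐ w
⊕-ext F G u w (lV , lE) (rV , rE) =
  ↑-elim (#V F) (λ v → onV u v ≡ onV w v) lV rV ,
  ↑-elim (#E F) (λ e → onE u e ≡ onE w e) lE rE

-- The quotient of Fin n by the equivalence relation generated by
-- f a ∼ g a for all a, with a chosen representative of each class.
record Merge {k n : ℕ} (f g : Fin k → Fin n) : Set where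
  field
    size     : ℕ
    quot     : Fin n → Fin size
    rep      : Fin size → Fin n
    quot-rep : ∀ w → quot (rep w) ≡ w
    merges   : ∀ a → quot (f a) ≡ quot (g a)
    minimal  : {p : ℕ} (h : Fin n → Fin p) → (∀ a → h (f a) ≡ h (g a)) →
               ∀ v → h (rep (quot v)) ≡ h v

merge₁ : (u v : Fin n) → Merge {1} (λ _ → u) (λ _ → v)
merge₁ {suc n} u v with u ≟ v
... | yes u≡v = record
  { size = suc n ; quot = λ w → w ; rep = λ w → w
  ; quot-rep = λ _ → refl ; merges = λ _ → u≡v ; minimal = λ _ _ _ → refl }
... | no u≢v = record
  { size = n ; quot = quot′ ; rep = punchIn v
  ; quot-rep = quot-rep′ ; merges = λ _ → merges′ ; minimal = λ h eq → minimal′ h (eq zero) }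
  where
  v≢u : v ≢ u
  v≢u = u≢v ∘ sym
  quot′ : Fin (suc n) → Fin n
  quot′ w with v ≟ w
  ... | yes _   = punchOut v≢u
  ... | no  v≢w = punchOut v≢w
  quot-rep′ : ∀ w → quot′ (punchIn v w) ≡ w
  quot-rep′ w with v ≟ punchIn v w
  ... | yes eq = contradiction (sym eq) (punchInᵢ≢i v w)
  ... | no  _  = trans (punchOut-cong v refl) (punchOut-punchIn v)
  merges′ : quot′ u ≡ quot′ v
  merges′ with v ≟ u | v ≟ v
  ... | yes v≡u | _       = contradiction v≡u v≢u
  ... | no  _   | yes _   = punchOut-cong v refl
  ... | no  _   | no  v≢v = contradiction refl v≢v
  minimal′ : (h : Fin (suc n) → Fin p) → h u ≡ h v → ∀ w → h (punchIn v (quot′ w)) ≡ h w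
  minimal′ h eq w with v ≟ w
  ... | yes v≡w = trans (cong h (punchIn-punchOut v≢u)) (trans eq (cong h v≡w))
  ... | no  v≢w = cong h (punchIn-punchOut v≢w)

merge : ∀ k (f g : Fin k → Fin n) → Merge f g
merge zero f g = record
  { size = _ ; quot = λ w → w ; rep = λ w → w
  ; quot-rep = λ _ → refl ; merges = λ () ; minimal = λ _ _ _ → refl }
merge (suc k) f g = record
  { size = M₂.size
  ; quot = M₂.quot ∘ M₁.quot
  ; rep = M₁.rep ∘ M₂.rep
  ; quot-rep = λ w → trans (cong M₂.quot (M₁.quot-rep _)) (M₂.quot-rep w)
  ; merges = λ { zero → cong M₂.quot (M₁.merges zero) ; (suc a) → M₂.merges a }
  ; minimal = λ h eq v →
      let h₁ = M₁.minimal h (λ _ → eq zero) in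
      trans (M₂.minimal (h ∘ M₁.rep)
              (λ a → trans (h₁ (f (suc a))) (trans (eq (suc a)) (sym (h₁ (g (suc a))))))
              (M₁.quot v))
            (h₁ v)
  }
  where
  module M₁ = Merge (merge₁ (f zero) (g zero))
  module M₂ = Merge (merge k (M₁.quot ∘ f ∘ suc) (M₁.quot ∘ g ∘ suc))

record Coequalizer {F G : Hypergraph S} (f g : F ⟶ G) : Set where
  field
    object        : Hypergraph S
    arrow         : G ⟶ object
    isCoequalizer : IsCoequalizer f g arrow

-- F with the vertices f a and g a merged for each a < k.
coequalizer : {F : Hypergraph S} (f g : discrete k ⟶ F) → Coequalizer f g
coequalizer {S} {k} {F} f g = record
  { object = Q
  ; arrow  = record
    { onV = quot ; onE = λ e → e
    ; onE-label = λ _ → refl ; onE-sources = λ _ → refl ; onE-targets = λ _ → refl }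
  ; isCoequalizer = record
    { commutes  = merges , λ ()
    ; universal = λ h eq → factor h eq , (minimal (onV h) (proj₁ eq) , λ _ → refl) ,
        λ u′ (eqV , eqE) → (λ w → trans (cong (onV u′) (sym (quot-rep w))) (eqV (rep w))) , eqE
    }
  }
  where
  open Merge (merge k (onV f) (onV g))
  Q : Hypergraph S
  Q = record
    { #V = size ; #E = #E F
    ; label = label F
    ; sources = map quot ∘ sources F
    ; targets = map quot ∘ targets F
    ; arity = λ e → trans (length-map quot (sources F e)) (arity F e)
    ; coarity = λ e → trans (length-map quot (targets F e)) (coarity F e)
    }
  factor : (h : F ⟶ K) → h ∘ₕ f ≐ h ∘ₕ g → Q ⟶ K
  factor h (eq , _) = record
    { onV = onV h ∘ rep
    ; onE = onE h
    ; onE-label = onE-label h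
    ; onE-sources = λ e → trans (onE-sources h e) (lemma (sources F e))
    ; onE-targets = λ e → trans (onE-targets h e) (lemma (targets F e))
    }
    where
    lemma : ∀ vs → map (onV h) vs ≡ map (onV h ∘ rep) (map quot vs)
    lemma vs = trans (map-cong (λ v → sym (minimal (onV h) eq v)) vs) (map-∘ vs)

record Pushout {A B C : Hypergraph S} (f : A ⟶ B) (g : A ⟶ C) : Set where
  field
    object    : Hypergraph S
    inˡ       : B ⟶ object
    inʳ       : C ⟶ object
    isPushout : IsPushout f g inˡ inʳ

pushout : {F G : Hypergraph S} (f : discrete k ⟶ F) (g : discrete k ⟶ G) → Pushout f g
pushout {F = F} {G = G} f g = record
  { object = object
  ; inˡ = arrow ∘ₕ ι₁
  ; inʳ = arrow ∘ₕ ι₂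
  ; isPushout = record
    { commutes  = commutes
    ; universal = λ h k (eqV , _) →
        let c₁V , c₁E = copair-ι₁ h k
            c₂V , c₂E = copair-ι₂ h k
            u , (uV , uE) , unique = universal (copair h k)
              ((λ a → trans (c₁V _) (trans (eqV a) (sym (c₂V _)))) , λ ())
        in u
         , ( ((λ v → trans (uV _) (c₁V v)) , (λ e → trans (uE _) (c₁E e)))
           , ((λ v → trans (uV _) (c₂V v)) , (λ e → trans (uE _) (c₂E e))) )
         , λ u′ (lV , lE) (rV , rE) → unique u′
             (⊕-ext F G (u′ ∘ₕ arrow) (copair h k)
               ((λ v → trans (lV v) (sym (c₁V v))) , (λ e → trans (lE e) (sym (c₁E e))))
               ((λ v → trans (rV v) (sym (c₂V v))) , (λ e → trans (rE e) (sym (c₂E e)))))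
    }
  }
  where
  open Coequalizer (coequalizer (ι₁ {F = F} {G = G} ∘ₕ f) (ι₂ {G = G} {F = F} ∘ₕ g))
  open IsCoequalizer isCoequalizer

-- A representative of a morphism of the PROP of cospans.
record Cospan (S : Generators) (m n : ℕ) : Set where
  field
    apex    : Hypergraph S
    inputs  : discrete m ⟶ apex
    outputs : discrete n ⟶ apex

open Cospan public

genᶜ : (φ : Gen S) → Cospan S (dom S φ) (cod S φ)
genᶜ {S} φ = record
  { apex = record
    { #V = dom S φ + cod S φ
    ; #E = 1
    ; label   = λ _ → φ
    ; sources = λ _ → tabulate (_↑ˡ cod S φ)
    ; targets = λ _ → tabulate (dom S φ ↑ʳ_)
    ; arity   = λ _ → length-tabulate _
    ; coarity = λ _ → length-tabulate _
    }
  ; inputs  = pick (_↑ˡ cod S φ)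
  ; outputs = pick (dom S φ ↑ʳ_)
  }

idᶜ : (n : ℕ) → Cospan S n n
idᶜ n = record { apex = discrete n ; inputs = pick (λ v → v) ; outputs = pick (λ v → v) }

σᶜ : (m n : ℕ) → Cospan S (m + n) (n + m)
σᶜ m n = record
  { apex    = discrete (m + n)
  ; inputs  = pick (λ v → v)
  ; outputs = [ pick (m ↑ʳ_) , pick (_↑ˡ n) ]
  }

_⨾ᶜ_ : Cospan S m n → Cospan S n p → Cospan S m p
P ⨾ᶜ Q = record
  { apex = object ; inputs = inˡ ∘ₕ inputs P ; outputs = inʳ ∘ₕ outputs Q }
  where open Pushout (pushout (outputs P) (inputs Q))

_⊗ᶜ_ : Cospan S m n → Cospan S p q → Cospan S (m + p) (n + q)
P ⊗ᶜ Q = record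
  { apex    = apex P ⊕ apex Q
  ; inputs  = [ ι₁ ∘ₕ inputs P , ι₂ ∘ₕ inputs Q ]
  ; outputs = [ ι₁ ∘ₕ outputs P , ι₂ ∘ₕ outputs Q ]
  }

Trᶜ : (x : ℕ) → Cospan S (x + m) (x + n) → Cospan S m n
Trᶜ {m = m} {n = n} x P = record
  { apex    = object
  ; inputs  = arrow ∘ₕ inputs P ∘ₕ pick (x ↑ʳ_)
  ; outputs = arrow ∘ₕ outputs P ∘ₕ pick (x ↑ʳ_)
  }
  where
  open Coequalizer (coequalizer (inputs P ∘ₕ pick {n = x} (_↑ˡ m))
                                (outputs P ∘ₕ pick {n = x} (_↑ˡ n)))

⟦_⟧ : Term S m n → Cospan S m n
⟦ gen φ ⟧  = genᶜ φ
⟦ id n ⟧   = idᶜ n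
⟦ σ m n ⟧  = σᶜ m n
⟦ f ⨾ g ⟧  = ⟦ f ⟧ ⨾ᶜ ⟦ g ⟧
⟦ f ⊗ g ⟧  = ⟦ f ⟧ ⊗ᶜ ⟦ g ⟧
⟦ Tr x f ⟧ = Trᶜ x ⟦ f ⟧

-- A cospan 0 → graph ← m + n, written as the morphism graph ← m + n.
record Folded (S : Generators) (m n : ℕ) : Set where
  field
    graph     : Hypergraph S
    interface : discrete (m + n) ⟶ graph

open Folded public

⌜_⌝ : Cospan S m n → Folded S m n
⌜ P ⌝ = record { graph = apex P ; interface = [ inputs P , outputs P ] }

inDegree outDegree : (F : Hypergraph S) → Fin (#V F) → ℕ
inDegree  F v = length (filter (v ≟_) (concat (tabulate (targets F))))
outDegree F v = length (filter (v ≟_) (concat (tabulate (sources F))))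

degree : (F : Hypergraph S) → Fin (#V F) → ℕ × ℕ
degree F v = inDegree F v , outDegree F v

_∈im_ : Fin (#V G) → (F ⟶ G) → Set
v ∈im f = ∃ λ a → onV f a ≡ v

_∉im_ : Fin (#V G) → (F ⟶ G) → Set
v ∉im f = ¬ (v ∈im f)

record PartialMonogamous (P : Cospan S m n) : Set where
  field
    mono-inputs  : Mono (inputs P)
    mono-outputs : Mono (outputs P)
    degree-both    : ∀ v → v ∈im inputs P → v ∈im outputs P → degree (apex P) v ≡ (0 , 0)
    degree-input   : ∀ v → v ∈im inputs P → v ∉im outputs P → degree (apex P) v ≡ (0 , 1)
    degree-output  : ∀ v → v ∉im inputs P → v ∈im outputs P → degree (apex P) v ≡ (1 , 0)
    degree-neither : ∀ v → v ∉im inputs P → v ∉im outputs P →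
                     degree (apex P) v ≡ (0 , 0) ⊎ degree (apex P) v ≡ (1 , 1)

-- The span  graph left ← i + j → graph right.
record DPORule (S : Generators) (i j : ℕ) : Set where
  field
    left right : Folded S i j

open DPORule public

⟦_⟧ʳ : RewriteRule S i j → DPORule S i j
⟦ ⟨ l , r ⟩ ⟧ʳ = record { left = ⌜ ⟦ l ⟧ ⌝ ; right = ⌜ ⟦ r ⟧ ⌝ }

record TracedBoundaryComplement {C : Hypergraph S}
         (c₁ : discrete i ⟶ C) (c₂ : discrete j ⟶ C)
         (d₁ : discrete m ⟶ C) (d₂ : discrete n ⟶ C) : Set where
  field
    mono-c₁ : Mono c₁
    mono-c₂ : Mono c₂
    partialMonogamous :
      PartialMonogamous (record { apex = C ; inputs = [ c₂ , d₁ ] ; outputs = [ d₂ , c₁ ] })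

infix 3 _⇝⟨_⟩_

record _⇝⟨_⟩_ {S : Generators} {i j m n : ℕ}
         (𝐆 : Folded S m n) (ρ : DPORule S i j) (𝐇 : Folded S m n) : Set where
  field
    C  : Hypergraph S
    c₁ : discrete i ⟶ C
    c₂ : discrete j ⟶ C
    d₁ : discrete m ⟶ C
    d₂ : discrete n ⟶ C

    L⟶G : graph (left ρ) ⟶ graph 𝐆
    C⟶G : C ⟶ graph 𝐆
    C⟶H : C ⟶ graph 𝐇
    R⟶H : graph (right ρ) ⟶ graph 𝐇

    leftPushout  : IsPushout (interface (left ρ)) [ c₁ , c₂ ] L⟶G C⟶G
    rightPushout : IsPushout [ c₁ , c₂ ] (interface (right ρ)) C⟶H R⟶H

    interface-G : C⟶G ∘ₕ [ d₁ , d₂ ] ≐ interface 𝐆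
    interface-H : C⟶H ∘ₕ [ d₁ , d₂ ] ≐ interface 𝐇

    complement : TracedBoundaryComplement c₁ c₂ d₁ d₂

-- A partial monogamous cospan is, on the level of vertices, a bijection between the places
-- where a vertex is produced (targets of hyperedges, inputs) and those where it is consumed
-- (sources, outputs). It is therefore read back as the term Tr(π ⨾ (boxes ⊗ id)), where π is
-- the permutation term of that bijection; isolated vertices off the boundary become traced
-- identity wires. The axioms make permutation terms functorial in the bijection, so the
-- term depends only on the isomorphism class of the cospan, and reading back commutes with
-- ⨾, ⊗ and Tr. Hence reading back ⟦ f ⟧ gives f, which yields completeness:
-- ⟦ f ⟧ ≅ ⟦ g ⟧ implies f ≈ g. Soundness, and the fact that reading back is inverse to ⟦_⟧,
-- follow from the universal properties of composites, sums and traces of cospans.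
--
-- By the same universal properties, Trⁱ((l ⊗ id) ⨾ c) denotes the pushout of ⟦ l ⟧ and ⟦ c ⟧
-- along i + j, and a traced boundary complement is, with its legs regrouped, exactly a
-- partial monogamous cospan j + m → C ← i + n, that is, the denotation of a context c.

module Submission where

open import Data.Nat using (ℕ; zero; suc; _+_; _≤_; z≤n; s≤s)
open import Data.Nat.Properties using (+-assoc; +-identityʳ)
import Data.Nat.Properties as ℕₚ
open import Data.Empty using (⊥)
open import Data.Fin as Fin using (Fin; zero; suc; toℕ; punchIn; punchOut; _↑ˡ_; _↑ʳ_; splitAt; join)
open import Data.Fin.Properties
  using (_≟_; any?; punchOut-injective; punchOut-cong; punchInᵢ≢i; punchIn-punchOut; punchOut-punchIn; punchIn-injective;
         splitAt-↑ˡ; splitAt-↑ʳ; splitAt-join; join-splitAt; ↑ˡ-injective;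
         toℕ-injective; toℕ-cast; toℕ-↑ˡ; toℕ-↑ʳ; cast-is-id; suc-injective)
open import Data.Fin.Permutation
  using (Permutation; _⟨$⟩ʳ_; _⟨$⟩ˡ_; remove; punchIn-permute; _∘ₚ_; cast-id; permutation)
  renaming (id to idₚ; inverseˡ to perm-inverseˡ; inverseʳ to perm-inverseʳ)
open import Data.List using (List; length; map; lookup; tabulate; concat; filter; _++_; []; _∷_)
open import Data.List.Properties using (length-++; length-map; lookup-tabulate; map-id)
open import Data.Product using (Σ; Σ-syntax; _×_; _,_; proj₁; proj₂; ∃)
open import Data.Sum as Sum using (_⊎_; inj₁; inj₂; [_,_]′)
open import Data.Sum.Properties using (inj₂-injective) renaming (map-id to ⊎-map-id)
open import Function using (_∘_)
open import Function.Bundles using (_⇔_; mk⇔)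
open import Relation.Binary.Bundles using (Setoid)
open import Relation.Binary.PropositionalEquality using (_≡_; _≢_; refl; sym; trans; cong; cong₂; subst)
import Relation.Binary.Reasoning.Setoid
open import Relation.Nullary using (yes; no; contradiction; Dec)
open import Defs

private variable
  S : Generators
  i j k k′ l m m′ n n′ p p′ q x y : ℕ
  X Y Z W : Hypergraph S
  P P′ Q Q′ R : Cospan S m n

≈-setoid : (S : Generators) (m n : ℕ) → Setoid _ _
≈-setoid S m n = record
  { Carrier = Term S m n
  ; _≈_ = _≈_
  ; isEquivalence = record { refl = ≈-refl ; sym = ≈-sym ; trans = ≈-trans }
  }

module ≈-Reasoning {S : Generators} {m n : ℕ} =
  Relation.Binary.Reasoning.Setoid (≈-setoid S m n)
open ≈-Reasoning

≈-reflexive : {f g : Term S m n} → f ≡ g → f ≈ g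
≈-reflexive refl = ≈-refl

⨾-congˡ : {f : Term S m n} {g h : Term S n p} → g ≈ h → f ⨾ g ≈ f ⨾ h
⨾-congˡ = ⨾-cong ≈-refl

⨾-congʳ : {f g : Term S m n} {h : Term S n p} → f ≈ g → f ⨾ h ≈ g ⨾ h
⨾-congʳ e = ⨾-cong e ≈-refl

⊗-congˡ : {f : Term S m n} {g h : Term S p q} → g ≈ h → f ⊗ g ≈ f ⊗ h
⊗-congˡ = ⊗-cong ≈-refl

⊗-congʳ : {f g : Term S m n} {h : Term S p q} → f ≈ g → f ⊗ h ≈ g ⊗ h
⊗-congʳ e = ⊗-cong e ≈-refl

id⊗-⨾ : {f : Term S m n} {g : Term S n p} → id k ⊗ (f ⨾ g) ≈ (id k ⊗ f) ⨾ (id k ⊗ g)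
id⊗-⨾ = ≈-trans (⊗-congʳ (≈-sym (⨾-idˡ _))) (⊗-⨾ _ _ _ _)

⨾-⊗id : {f : Term S m n} {g : Term S n p} → (f ⨾ g) ⊗ id k ≈ (f ⊗ id k) ⨾ (g ⊗ id k)
⨾-⊗id = ≈-trans (⊗-congˡ (≈-sym (⨾-idˡ _))) (⊗-⨾ _ _ _ _)

⊗-split : {f : Term S m n} {g : Term S p q} → f ⊗ g ≈ (f ⊗ id p) ⨾ (id n ⊗ g)
⊗-split = ≈-trans (⊗-cong (≈-sym (⨾-idʳ _)) (≈-sym (⨾-idˡ _))) (⊗-⨾ _ _ _ _)

⊗-split′ : {f : Term S m n} {g : Term S p q} → f ⊗ g ≈ (id m ⊗ g) ⨾ (f ⊗ id q)
⊗-split′ = ≈-trans (⊗-cong (≈-sym (⨾-idˡ _)) (≈-sym (⨾-idʳ _))) (⊗-⨾ _ _ _ _)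

interchange : {f : Term S m n} {g : Term S p q} →
              (f ⊗ id p) ⨾ (id n ⊗ g) ≈ (id m ⊗ g) ⨾ (f ⊗ id q)
interchange = ≈-trans (≈-sym ⊗-split) ⊗-split′

-- For left factors of concrete arity the cast in ⊗-assoc computes away.
⊗-assoc₁ : {f : Term S 1 1} {g : Term S m n} {h : Term S p q} → (f ⊗ g) ⊗ h ≈ f ⊗ (g ⊗ h)
⊗-assoc₁ = ⊗-assoc _ _ _

⊗-assoc₂ : {f : Term S 2 2} {g : Term S m n} {h : Term S p q} → (f ⊗ g) ⊗ h ≈ f ⊗ (g ⊗ h)
⊗-assoc₂ = ⊗-assoc _ _ _

id⊗id⊗ : {f : Term S m n} → id 1 ⊗ (id 1 ⊗ f) ≈ id 2 ⊗ f
id⊗id⊗ = ≈-trans (≈-sym ⊗-assoc₁) (⊗-congʳ ⊗-id)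

σ₁ : ∀ n → Term S (2 + n) (2 + n)
σ₁ n = σ 1 1 ⊗ id n

σ₁-natural : {f : Term S m n} → σ₁ m ⨾ (id 1 ⊗ (id 1 ⊗ f)) ≈ (id 1 ⊗ (id 1 ⊗ f)) ⨾ σ₁ n
σ₁-natural = ≈-trans (⨾-congˡ id⊗id⊗) (≈-trans interchange (⨾-congʳ (≈-sym id⊗id⊗)))

σ₁-involutive : σ₁ {S} n ⨾ σ₁ n ≈ id (2 + n)
σ₁-involutive = ≈-trans (≈-sym ⨾-⊗id) (≈-trans (⊗-congʳ σ-inverse) ⊗-id)

σ₁-⊗id : σ₁ {S} n ⊗ id p ≈ σ₁ (n + p)
σ₁-⊗id = ≈-trans ⊗-assoc₂ (⊗-congˡ ⊗-id)

⨾-assoc′ : {f : Term S m n} {g : Term S n p} {h : Term S p q} → f ⨾ (g ⨾ h) ≈ f ⨾ g ⨾ h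
⨾-assoc′ = ≈-sym (⨾-assoc _ _ _)

yang-baxter₀ : σ₁ {S} 1 ⨾ (id 1 ⊗ σ 1 1) ⨾ σ₁ 1 ≈ (id 1 ⊗ σ 1 1) ⨾ σ₁ 1 ⨾ (id 1 ⊗ σ 1 1)
yang-baxter₀ = begin
  σ₁ 1 ⨾ (id 1 ⊗ σ 1 1) ⨾ σ₁ 1                     ≈⟨ ⨾-congʳ (≈-sym (σ-hexagon {m = 1} {n = 1} {p = 1})) ⟩
  σ 1 2 ⨾ (σ 1 1 ⊗ id 1)                           ≈⟨ ≈-sym (σ-natural (id 1) (σ 1 1)) ⟩
  (id 1 ⊗ σ 1 1) ⨾ σ 1 2                           ≈⟨ ⨾-congˡ (σ-hexagon {m = 1} {n = 1} {p = 1}) ⟩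
  (id 1 ⊗ σ 1 1) ⨾ (σ₁ 1 ⨾ (id 1 ⊗ σ 1 1))         ≈⟨ ⨾-assoc′ ⟩
  (id 1 ⊗ σ 1 1) ⨾ σ₁ 1 ⨾ (id 1 ⊗ σ 1 1)           ∎

yang-baxter : σ₁ {S} (suc n) ⨾ (id 1 ⊗ σ₁ n) ⨾ σ₁ (suc n)
            ≈ (id 1 ⊗ σ₁ n) ⨾ σ₁ (suc n) ⨾ (id 1 ⊗ σ₁ n)
yang-baxter {n = n} = begin
  σ₁ (suc n) ⨾ (id 1 ⊗ σ₁ n) ⨾ σ₁ (suc n)
    ≈⟨ ⨾-cong (⨾-cong (≈-sym σ₁-⊗id) (≈-sym ⊗-assoc₁)) (≈-sym σ₁-⊗id) ⟩
  (σ₁ 1 ⊗ id n) ⨾ ((id 1 ⊗ σ 1 1) ⊗ id n) ⨾ (σ₁ 1 ⊗ id n)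
    ≈⟨ ≈-sym (≈-trans ⨾-⊗id (⨾-congʳ ⨾-⊗id)) ⟩
  (σ₁ 1 ⨾ (id 1 ⊗ σ 1 1) ⨾ σ₁ 1) ⊗ id n
    ≈⟨ ⊗-congʳ yang-baxter₀ ⟩
  ((id 1 ⊗ σ 1 1) ⨾ σ₁ 1 ⨾ (id 1 ⊗ σ 1 1)) ⊗ id n
    ≈⟨ ≈-trans ⨾-⊗id (⨾-congʳ ⨾-⊗id) ⟩
  ((id 1 ⊗ σ 1 1) ⊗ id n) ⨾ (σ₁ 1 ⊗ id n) ⨾ ((id 1 ⊗ σ 1 1) ⊗ id n)
    ≈⟨ ⨾-cong (⨾-cong ⊗-assoc₁ σ₁-⊗id) ⊗-assoc₁ ⟩
  (id 1 ⊗ σ₁ n) ⨾ σ₁ (suc n) ⨾ (id 1 ⊗ σ₁ n) ∎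

-- Moves wire 0 to position b, keeping the order of the others.
ins : Fin (suc n) → Term S (suc n) (suc n)
ins zero = id _
ins {n = suc n} (suc b) = σ₁ n ⨾ (id 1 ⊗ ins b)

ins-⊗id : (b : Fin (suc n)) → ins {S = S} b ⊗ id p ≈ ins (b ↑ˡ p)
ins-⊗id zero = ⊗-id
ins-⊗id {n = suc n} (suc b) = ≈-trans ⨾-⊗id
  (⨾-cong σ₁-⊗id (≈-trans ⊗-assoc₁ (⊗-congˡ (ins-⊗id b))))

ins-swap : (c : Fin (2 + n)) (d : Fin (1 + n)) (c′ : Fin (1 + n)) →
           punchIn (punchIn c d) c′ ≡ c →
           ins {S = S} (suc d) ⨾ ins c ≈ (id 1 ⊗ ins c′) ⨾ ins (punchIn c d)
ins-swap zero d zero e = ≈-trans (⨾-idʳ _) (≈-sym (≈-trans (⨾-congʳ ⊗-id) (⨾-idˡ _)))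
ins-swap (suc c) zero c′ refl = begin
  σ₁ _ ⨾ (id 1 ⊗ id _) ⨾ (σ₁ _ ⨾ (id 1 ⊗ ins c))  ≈⟨ ⨾-congʳ (≈-trans (⨾-congˡ ⊗-id) (⨾-idʳ _)) ⟩
  σ₁ _ ⨾ (σ₁ _ ⨾ (id 1 ⊗ ins c))                  ≈⟨ ⨾-assoc′ ⟩
  σ₁ _ ⨾ σ₁ _ ⨾ (id 1 ⊗ ins c)                    ≈⟨ ⨾-congʳ σ₁-involutive ⟩
  id _ ⨾ (id 1 ⊗ ins c)                           ≈⟨ ⨾-idˡ _ ⟩
  id 1 ⊗ ins c                                    ≈⟨ ≈-sym (⨾-idʳ _) ⟩
  (id 1 ⊗ ins c) ⨾ id _                           ∎
ins-swap {n = suc n} (suc c) (suc d) (suc c′) e = begin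
  σ₁ _ ⨾ (id 1 ⊗ (σ₁ _ ⨾ (id 1 ⊗ ins d))) ⨾ (σ₁ _ ⨾ (id 1 ⊗ ins c))
    ≈⟨ ⨾-congʳ (⨾-congˡ id⊗-⨾) ⟩
  σ₁ _ ⨾ ((id 1 ⊗ σ₁ _) ⨾ (id 1 ⊗ (id 1 ⊗ ins d))) ⨾ (σ₁ _ ⨾ (id 1 ⊗ ins c))
    ≈⟨ ≈-trans (⨾-congʳ ⨾-assoc′) ⨾-assoc′ ⟩
  σ₁ _ ⨾ (id 1 ⊗ σ₁ _) ⨾ (id 1 ⊗ (id 1 ⊗ ins d)) ⨾ σ₁ _ ⨾ (id 1 ⊗ ins c)
    ≈⟨ ⨾-congʳ (≈-trans (⨾-assoc _ _ _) (⨾-congˡ (≈-sym σ₁-natural))) ⟩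
  σ₁ _ ⨾ (id 1 ⊗ σ₁ _) ⨾ (σ₁ _ ⨾ (id 1 ⊗ (id 1 ⊗ ins d))) ⨾ (id 1 ⊗ ins c)
    ≈⟨ ⨾-congʳ ⨾-assoc′ ⟩
  σ₁ _ ⨾ (id 1 ⊗ σ₁ _) ⨾ σ₁ _ ⨾ (id 1 ⊗ (id 1 ⊗ ins d)) ⨾ (id 1 ⊗ ins c)
    ≈⟨ ⨾-congʳ (⨾-congʳ yang-baxter) ⟩
  (id 1 ⊗ σ₁ _) ⨾ σ₁ _ ⨾ (id 1 ⊗ σ₁ _) ⨾ (id 1 ⊗ (id 1 ⊗ ins d)) ⨾ (id 1 ⊗ ins c)
    ≈⟨ ≈-trans (⨾-assoc _ _ _) (≈-trans (⨾-assoc _ _ _) (⨾-congˡ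
         (≈-sym (≈-trans id⊗-⨾ (≈-trans (⨾-congʳ id⊗-⨾) (⨾-assoc _ _ _)))))) ⟩
  (id 1 ⊗ σ₁ _) ⨾ σ₁ _ ⨾ (id 1 ⊗ (ins (suc d) ⨾ ins c))
    ≈⟨ ⨾-congˡ (⊗-congˡ (ins-swap c d c′ (suc-injective e))) ⟩
  (id 1 ⊗ σ₁ _) ⨾ σ₁ _ ⨾ (id 1 ⊗ ((id 1 ⊗ ins c′) ⨾ ins (punchIn c d)))
    ≈⟨ ≈-trans (⨾-congˡ id⊗-⨾) ⨾-assoc′ ⟩
  (id 1 ⊗ σ₁ _) ⨾ σ₁ _ ⨾ (id 1 ⊗ (id 1 ⊗ ins c′)) ⨾ (id 1 ⊗ ins (punchIn c d))
    ≈⟨ ⨾-congʳ (≈-trans (⨾-assoc _ _ _) (⨾-congˡ σ₁-natural)) ⟩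
  (id 1 ⊗ σ₁ _) ⨾ ((id 1 ⊗ (id 1 ⊗ ins c′)) ⨾ σ₁ _) ⨾ (id 1 ⊗ ins (punchIn c d))
    ≈⟨ ⨾-congʳ ⨾-assoc′ ⟩
  (id 1 ⊗ σ₁ _) ⨾ (id 1 ⊗ (id 1 ⊗ ins c′)) ⨾ σ₁ _ ⨾ (id 1 ⊗ ins (punchIn c d))
    ≈⟨ ≈-trans (⨾-assoc _ _ _) (⨾-congʳ (≈-sym id⊗-⨾)) ⟩
  (id 1 ⊗ (σ₁ _ ⨾ (id 1 ⊗ ins c′))) ⨾ (σ₁ _ ⨾ (id 1 ⊗ ins (punchIn c d))) ∎

perm : Permutation m n → Term S m n
perm {m = zero}  {n = zero}  π = id 0
perm {m = zero}  {n = suc n} π with () ← π ⟨$⟩ˡ zero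
perm {m = suc m} {n = zero}  π with () ← π ⟨$⟩ʳ zero
perm {m = suc m} {n = suc n} π = (id 1 ⊗ perm (remove zero π)) ⨾ ins (π ⟨$⟩ʳ zero)

remove-unique : (π : Permutation (suc m) (suc n)) (i : Fin (suc m)) {j : Fin m} {b : Fin n} →
                π ⟨$⟩ʳ punchIn i j ≡ punchIn (π ⟨$⟩ʳ i) b → remove i π ⟨$⟩ʳ j ≡ b
remove-unique π i e = punchIn-injective (π ⟨$⟩ʳ i) _ _ (trans (sym (punchIn-permute π i _)) e)

perm-cong : (π ρ : Permutation m n) → (∀ a → π ⟨$⟩ʳ a ≡ ρ ⟨$⟩ʳ a) → perm {S = S} π ≈ perm ρ
perm-cong {m = zero}  {n = zero}  π ρ e = ≈-refl
perm-cong {m = zero}  {n = suc n} π ρ e with () ← π ⟨$⟩ˡ zero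
perm-cong {m = suc m} {n = zero}  π ρ e with () ← π ⟨$⟩ʳ zero
perm-cong {m = suc m} {n = suc n} π ρ e = ⨾-cong
  (⊗-congˡ (perm-cong (remove zero π) (remove zero ρ) λ a → remove-unique π zero
    (trans (e (suc a)) (trans (punchIn-permute ρ zero a)
      (cong (λ b → punchIn b _) (sym (e zero)))))))
  (≈-reflexive (cong ins (e zero)))

perm-id : perm {S = S} (idₚ {n}) ≈ id n
perm-id {n = zero} = ≈-refl
perm-id {n = suc n} = ≈-trans (⨾-idʳ _) (≈-trans
  (⊗-congˡ (≈-trans (perm-cong (remove zero idₚ) idₚ λ a → remove-unique idₚ zero refl) perm-id))
  ⊗-id)

ins-perm : (b : Fin (suc m)) (ρ : Permutation (suc m) (suc n)) →
           ins {S = S} b ⨾ perm ρ ≈ (id 1 ⊗ perm (remove b ρ)) ⨾ ins (ρ ⟨$⟩ʳ b)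
ins-perm zero ρ = ⨾-idˡ _
ins-perm {m = suc m} {n = zero} b ρ with () ← remove zero ρ ⟨$⟩ʳ zero
ins-perm {m = suc m} {n = suc n} (suc b) ρ = begin
  σ₁ _ ⨾ (id 1 ⊗ ins b) ⨾ ((id 1 ⊗ perm ρ′) ⨾ ins c)
    ≈⟨ ≈-trans ⨾-assoc′ (⨾-congʳ (≈-trans (⨾-assoc _ _ _) (⨾-congˡ (≈-sym id⊗-⨾)))) ⟩
  σ₁ _ ⨾ (id 1 ⊗ (ins b ⨾ perm ρ′)) ⨾ ins c
    ≈⟨ ⨾-congʳ (⨾-congˡ (≈-trans (⊗-congˡ (ins-perm b ρ′)) id⊗-⨾)) ⟩
  σ₁ _ ⨾ ((id 1 ⊗ (id 1 ⊗ perm ρ″)) ⨾ (id 1 ⊗ ins d)) ⨾ ins c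
    ≈⟨ ⨾-congʳ (≈-trans ⨾-assoc′ (≈-trans (⨾-congʳ σ₁-natural) (⨾-assoc _ _ _))) ⟩
  (id 1 ⊗ (id 1 ⊗ perm ρ″)) ⨾ ins (suc d) ⨾ ins c
    ≈⟨ ≈-trans (⨾-assoc _ _ _) (⨾-congˡ (ins-swap c d c′ c′-spec)) ⟩
  (id 1 ⊗ (id 1 ⊗ perm ρ″)) ⨾ ((id 1 ⊗ ins c′) ⨾ ins (punchIn c d))
    ≈⟨ ≈-trans ⨾-assoc′ (⨾-congʳ (≈-sym id⊗-⨾)) ⟩
  (id 1 ⊗ ((id 1 ⊗ perm ρ″) ⨾ ins c′)) ⨾ ins (punchIn c d)
    ≈⟨ ⨾-cong (⊗-congˡ (⨾-congʳ (⊗-congˡ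
         (perm-cong ρ″ (remove zero (remove (suc b) ρ)) ρ″-spec))))
         (≈-reflexive (cong ins (sym (punchIn-permute ρ zero b)))) ⟩
  (id 1 ⊗ perm (remove (suc b) ρ)) ⨾ ins (ρ ⟨$⟩ʳ suc b) ∎
  where
  ρ′ = remove zero ρ
  ρ″ = remove b ρ′
  c = ρ ⟨$⟩ʳ zero
  d = ρ′ ⟨$⟩ʳ b
  c′ = remove (suc b) ρ ⟨$⟩ʳ zero
  c′-spec : punchIn (punchIn c d) c′ ≡ c
  c′-spec = trans (cong (λ z → punchIn z c′) (sym (punchIn-permute ρ zero b)))
                  (sym (punchIn-permute ρ (suc b) zero))
  ρ″-spec : ∀ a → ρ″ ⟨$⟩ʳ a ≡ remove zero (remove (suc b) ρ) ⟨$⟩ʳ a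
  ρ″-spec a = remove-unique ρ′ b (remove-unique ρ zero (trans
    (punchIn-permute ρ (suc b) (suc a))
    (trans (cong₂ punchIn (punchIn-permute ρ zero b) (punchIn-permute (remove (suc b) ρ) zero a))
           (punchIn-punchIn c d c′ c′-spec _))))
    where
    punchIn-punchIn : ∀ {n} (c : Fin (2 + n)) (d c′ : Fin (1 + n)) →
                      punchIn (punchIn c d) c′ ≡ c → (e : Fin n) →
                      punchIn (punchIn c d) (punchIn c′ e) ≡ punchIn c (punchIn d e)
    punchIn-punchIn zero d zero _ e = refl
    punchIn-punchIn (suc c) zero c′ refl e = refl
    punchIn-punchIn (suc c) (suc d) (suc c′) eq zero = refl
    punchIn-punchIn (suc c) (suc d) (suc c′) eq (suc e) =
      cong suc (punchIn-punchIn c d c′ (suc-injective eq) e)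

perm-⨾ : (π : Permutation m n) (ρ : Permutation n p) → perm {S = S} π ⨾ perm ρ ≈ perm (π ∘ₚ ρ)
perm-⨾ {m = zero}  {n = zero}  {p = zero} π ρ = ⨾-idˡ _
perm-⨾ {m = zero}  {n = suc n} π ρ with () ← π ⟨$⟩ˡ zero
perm-⨾ {m = suc m} {n = zero}  π ρ with () ← π ⟨$⟩ʳ zero
perm-⨾ {n = zero}  {p = suc p} π ρ with () ← ρ ⟨$⟩ˡ zero
perm-⨾ {n = suc n} {p = zero}  π ρ with () ← ρ ⟨$⟩ʳ zero
perm-⨾ {m = suc m} {n = suc n} {p = suc p} π ρ = begin
  (id 1 ⊗ perm π′) ⨾ ins b ⨾ perm ρ
    ≈⟨ ≈-trans (⨾-assoc _ _ _) (⨾-congˡ (ins-perm b ρ)) ⟩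
  (id 1 ⊗ perm π′) ⨾ ((id 1 ⊗ perm (remove b ρ)) ⨾ ins (ρ ⟨$⟩ʳ b))
    ≈⟨ ≈-trans ⨾-assoc′ (⨾-congʳ (≈-sym id⊗-⨾)) ⟩
  (id 1 ⊗ (perm π′ ⨾ perm (remove b ρ))) ⨾ ins (ρ ⟨$⟩ʳ b)
    ≈⟨ ⨾-congʳ (⊗-congˡ (≈-trans (perm-⨾ π′ (remove b ρ)) (perm-cong _ _ λ a →
         sym (remove-unique (π ∘ₚ ρ) zero (trans (cong (ρ ⟨$⟩ʳ_) (punchIn-permute π zero a))
                                                 (punchIn-permute ρ b _)))))) ⟩
  (id 1 ⊗ perm (remove zero (π ∘ₚ ρ))) ⨾ ins (ρ ⟨$⟩ʳ b) ∎
  where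
  π′ = remove zero π
  b = π ⟨$⟩ʳ zero

-- Objects m of the PROP presented as iterated sums, so that the coherence isomorphisms
-- between them are given by pattern matching on elements instead of arithmetic on Fin m.
data Code : Set where
  fin : ℕ → Code
  _⊞_ : Code → Code → Code
  Σᶜ  : (k : ℕ) → (Fin k → ℕ) → Code

private variable
  a a′ a″ b b′ b″ c c′ d d′ : Code

infixr 5 _⊞_

total : ∀ k → (Fin k → ℕ) → ℕ
total zero    f = 0
total (suc k) f = f zero + total k (f ∘ suc)

⌊_⌋ : Code → ℕ
⌊ fin n ⌋      = n
⌊ a ⊞ b ⌋      = ⌊ a ⌋ + ⌊ b ⌋
⌊ Σᶜ k f ⌋     = total k f

El : Code → Set
El (fin n)  = Fin n
El (a ⊞ b)  = El a ⊎ El b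
El (Σᶜ k f) = Σ (Fin k) (Fin ∘ f)

infix 4 _⇄_

record _⇄_ (a b : Code) : Set where
  field
    to      : El a → El b
    from    : El b → El a
    to-from : ∀ y → to (from y) ≡ y
    from-to : ∀ x → from (to x) ≡ x

open _⇄_ public

to-injective : (π : a ⇄ b) {u v : El a} → to π u ≡ to π v → u ≡ v
to-injective π e = trans (sym (from-to π _)) (trans (cong (from π) e) (from-to π _))

idᵇ : a ⇄ a
idᵇ = record { to = λ x → x ; from = λ x → x ; to-from = λ _ → refl ; from-to = λ _ → refl }

infixl 6 _⍮_

_⍮_ : a ⇄ b → b ⇄ c → a ⇄ c
π ⍮ ρ = record
  { to = to ρ ∘ to π
  ; from = from π ∘ from ρ
  ; to-from = λ y → trans (cong (to ρ) (to-from π _)) (to-from ρ y)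
  ; from-to = λ x → trans (cong (from π) (from-to ρ _)) (from-to π x)
  }

infix 8 _⁻¹

_⁻¹ : a ⇄ b → b ⇄ a
π ⁻¹ = record { to = from π ; from = to π ; to-from = from-to π ; from-to = to-from π }

infixr 7 _⊞₁_

_⊞₁_ : a ⇄ b → c ⇄ d → (a ⊞ c) ⇄ (b ⊞ d)
π ⊞₁ ρ = record
  { to = Sum.map (to π) (to ρ)
  ; from = Sum.map (from π) (from ρ)
  ; to-from = λ { (inj₁ y) → cong inj₁ (to-from π y) ; (inj₂ y) → cong inj₂ (to-from ρ y) }
  ; from-to = λ { (inj₁ x) → cong inj₁ (from-to π x) ; (inj₂ x) → cong inj₂ (from-to ρ x) }
  }

assocʳ : ∀ a b c → ((a ⊞ b) ⊞ c) ⇄ (a ⊞ (b ⊞ c))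
assocʳ a b c = record
  { to = Sum.assocʳ ; from = Sum.assocˡ
  ; to-from = λ { (inj₁ _) → refl ; (inj₂ (inj₁ _)) → refl ; (inj₂ (inj₂ _)) → refl }
  ; from-to = λ { (inj₁ (inj₁ _)) → refl ; (inj₁ (inj₂ _)) → refl ; (inj₂ _) → refl }
  }

swapᵇ : ∀ a b → (a ⊞ b) ⇄ (b ⊞ a)
swapᵇ a b = record
  { to = Sum.swap ; from = Sum.swap
  ; to-from = λ { (inj₁ _) → refl ; (inj₂ _) → refl }
  ; from-to = λ { (inj₁ _) → refl ; (inj₂ _) → refl }
  }

unitʳ : ∀ a → (a ⊞ fin 0) ⇄ a
unitʳ a = record
  { to = λ { (inj₁ x) → x ; (inj₂ ()) }
  ; from = inj₁
  ; to-from = λ _ → refl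
  ; from-to = λ { (inj₁ _) → refl ; (inj₂ ()) }
  }

unitˡ : ∀ a → (fin 0 ⊞ a) ⇄ a
unitˡ a = record
  { to = λ { (inj₁ ()) ; (inj₂ x) → x }
  ; from = inj₂
  ; to-from = λ _ → refl
  ; from-to = λ { (inj₁ ()) ; (inj₂ _) → refl }
  }

Σ-suc : ∀ k (f : Fin (suc k) → ℕ) → Σᶜ (suc k) f ⇄ (fin (f zero) ⊞ Σᶜ k (f ∘ suc))
Σ-suc k f = record
  { to = λ { (zero , i) → inj₁ i ; (suc e , i) → inj₂ (e , i) }
  ; from = λ { (inj₁ i) → zero , i ; (inj₂ (e , i)) → suc e , i }
  ; to-from = λ { (inj₁ _) → refl ; (inj₂ _) → refl }
  ; from-to = λ { (zero , _) → refl ; (suc _ , _) → refl }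
  }

Σ-zero : ∀ f → Σᶜ zero f ⇄ fin 0
Σ-zero f = record { to = λ () ; from = λ () ; to-from = λ () ; from-to = λ () }

join⇄ : ∀ m n → (fin m ⊞ fin n) ⇄ fin (m + n)
join⇄ m n = record
  { to = join m n ; from = splitAt m ; to-from = join-splitAt m n ; from-to = splitAt-join m n }

enumΣ : ∀ k f → Σᶜ k f ⇄ fin (total k f)
enumΣ zero    f = Σ-zero f
enumΣ (suc k) f = Σ-suc k f ⍮ ((idᵇ ⊞₁ enumΣ k (f ∘ suc)) ⍮ join⇄ (f zero) (total k (f ∘ suc)))

enum : ∀ a → a ⇄ fin ⌊ a ⌋
enum (fin n) = idᵇ
enum (a ⊞ b) = (enum a ⊞₁ enum b) ⍮ join⇄ ⌊ a ⌋ ⌊ b ⌋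
enum (Σᶜ k f) = enumΣ k f

⇄⇒↔ : fin m ⇄ fin n → Permutation m n
⇄⇒↔ π = permutation (to π) (from π) (to-from π) (from-to π)

perm-⊗ : (π : Permutation m n) (ρ : Permutation p q) (τ : Permutation (m + p) (n + q)) →
         (∀ u → τ ⟨$⟩ʳ (u ↑ˡ p) ≡ (π ⟨$⟩ʳ u) ↑ˡ q) →
         (∀ v → τ ⟨$⟩ʳ (m ↑ʳ v) ≡ n ↑ʳ (ρ ⟨$⟩ʳ v)) →
         perm {S = S} π ⊗ perm ρ ≈ perm τ
perm-⊗ {m = zero}  {n = zero}  π ρ τ l r =
  ≈-trans (⊗-idˡ _) (perm-cong ρ τ λ v → sym (r v))
perm-⊗ {m = zero}  {n = suc n} π ρ τ l r with () ← π ⟨$⟩ˡ zero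
perm-⊗ {m = suc m} {n = zero}  π ρ τ l r with () ← π ⟨$⟩ʳ zero
perm-⊗ {m = suc m} {n = suc n} {p = p} {q = q} π ρ τ l r = begin
  ((id 1 ⊗ perm π′) ⨾ ins b₀) ⊗ perm ρ
    ≈⟨ ≈-trans (⊗-congˡ (≈-sym (⨾-idʳ _))) (⊗-⨾ _ _ _ _) ⟩
  ((id 1 ⊗ perm π′) ⊗ perm ρ) ⨾ (ins b₀ ⊗ id _)
    ≈⟨ ⨾-cong ⊗-assoc₁ (ins-⊗id b₀) ⟩
  (id 1 ⊗ (perm π′ ⊗ perm ρ)) ⨾ ins (b₀ ↑ˡ _)
    ≈⟨ ⨾-cong (⊗-congˡ (perm-⊗ π′ ρ (remove zero τ) l′ r′))
              (≈-reflexive (cong ins (sym (l zero)))) ⟩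
  (id 1 ⊗ perm (remove zero τ)) ⨾ ins (τ ⟨$⟩ʳ zero) ∎
  where
  π′ = remove zero π
  b₀ = π ⟨$⟩ʳ zero
  punchIn-↑ˡ : ∀ {n} (b : Fin (suc n)) (c : Fin n) q → punchIn b c ↑ˡ q ≡ punchIn (b ↑ˡ q) (c ↑ˡ q)
  punchIn-↑ˡ zero c q = refl
  punchIn-↑ˡ (suc b) zero q = refl
  punchIn-↑ˡ (suc b) (suc c) q = cong suc (punchIn-↑ˡ b c q)
  punchIn-↑ʳ : ∀ {n} (b : Fin (suc n)) (c : Fin q) → suc n ↑ʳ c ≡ punchIn (b ↑ˡ q) (n ↑ʳ c)
  punchIn-↑ʳ zero c = refl
  punchIn-↑ʳ {n = suc n} (suc b) c = cong suc (punchIn-↑ʳ b c)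
  l′ : ∀ u → remove zero τ ⟨$⟩ʳ (u ↑ˡ p) ≡ (π′ ⟨$⟩ʳ u) ↑ˡ q
  l′ u = remove-unique τ zero (trans (l (suc u))
    (trans (cong (_↑ˡ q) (punchIn-permute π zero u))
    (trans (punchIn-↑ˡ b₀ _ q) (cong (λ z → punchIn z ((π′ ⟨$⟩ʳ u) ↑ˡ q)) (sym (l zero))))))
  r′ : ∀ v → remove zero τ ⟨$⟩ʳ (m ↑ʳ v) ≡ n ↑ʳ (ρ ⟨$⟩ʳ v)
  r′ v = remove-unique τ zero (trans (r v)
    (trans (punchIn-↑ʳ b₀ (ρ ⟨$⟩ʳ v)) (cong (λ z → punchIn z (n ↑ʳ (ρ ⟨$⟩ʳ v))) (sym (l zero)))))

perm-cast : (e : m ≡ m′) (e′ : n ≡ n′) (f : Term S m n) →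
            cast e e′ f ≈ perm (cast-id (sym e)) ⨾ f ⨾ perm (cast-id e′)
perm-cast refl refl f = ≈-sym (≈-trans (⨾-cong (≈-trans (⨾-congʳ cast-refl) (⨾-idˡ _)) cast-refl) (⨾-idʳ _))
  where
  cast-refl : perm {S = S} (cast-id {n} refl) ≈ id n
  cast-refl = ≈-trans (perm-cong (cast-id refl) idₚ (cast-is-id refl)) perm-id

opaque
  ⟪_⟫ : a ⇄ b → Term S ⌊ a ⌋ ⌊ b ⌋
  ⟪_⟫ {a} {b} π = perm (⇄⇒↔ (enum a ⁻¹ ⍮ π ⍮ enum b))

  ⟪⟫-cong : (π ρ : a ⇄ b) → (∀ x → to π x ≡ to ρ x) → ⟪_⟫ {S = S} π ≈ ⟪ ρ ⟫
  ⟪⟫-cong {b = b} π ρ e = perm-cong _ _ λ x → cong (to (enum b)) (e _)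

  ⟪⟫-id : (π : a ⇄ a) → (∀ x → to π x ≡ x) → ⟪_⟫ {S = S} π ≈ id ⌊ a ⌋
  ⟪⟫-id {a = a} π e = ≈-trans
    (perm-cong _ idₚ λ x → trans (cong (to (enum a)) (e _)) (to-from (enum a) x)) perm-id

  ⟪⟫-⨾ : (π : a ⇄ b) (ρ : b ⇄ c) → ⟪_⟫ {S = S} π ⨾ ⟪ ρ ⟫ ≈ ⟪ π ⍮ ρ ⟫
  ⟪⟫-⨾ {b = b} {c = c} π ρ = ≈-trans (perm-⨾ _ _)
    (perm-cong _ _ λ x → cong (to (enum c) ∘ to ρ) (from-to (enum b) _))

  ⟪⟫-⊗ : (π : a ⇄ b) (ρ : c ⇄ d) → ⟪_⟫ {S = S} π ⊗ ⟪ ρ ⟫ ≈ ⟪ π ⊞₁ ρ ⟫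
  ⟪⟫-⊗ {a = a} {b = b} {c = c} {d = d} π ρ = perm-⊗ _ _ _
    (λ u → cong (λ z → join ⌊ b ⌋ ⌊ d ⌋ (Sum.map (to (enum b)) (to (enum d))
             (Sum.map (to π) (to ρ) (Sum.map (from (enum a)) (from (enum c)) z))))
             (splitAt-↑ˡ ⌊ a ⌋ u ⌊ c ⌋))
    (λ v → cong (λ z → join ⌊ b ⌋ ⌊ d ⌋ (Sum.map (to (enum b)) (to (enum d))
             (Sum.map (to π) (to ρ) (Sum.map (from (enum a)) (from (enum c)) z))))
             (splitAt-↑ʳ ⌊ a ⌋ ⌊ c ⌋ v))

  ⟪⟫-perm : (π : a ⇄ b) (τ : Permutation ⌊ a ⌋ ⌊ b ⌋) →
            (∀ x → τ ⟨$⟩ʳ to (enum a) x ≡ to (enum b) (to π x)) →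
            ⟪_⟫ {S = S} π ≈ perm τ
  ⟪⟫-perm {a = a} π τ e = perm-cong _ _ λ x →
    trans (sym (e _)) (cong (τ ⟨$⟩ʳ_) (to-from (enum a) x))

  perm-⟪⟫ : (τ : Permutation ⌊ a ⌋ ⌊ b ⌋) (π : a ⇄ b) →
            (∀ x → τ ⟨$⟩ʳ to (enum a) x ≡ to (enum b) (to π x)) →
            perm {S = S} τ ≈ ⟪ π ⟫
  perm-⟪⟫ τ π e = ≈-sym (⟪⟫-perm π τ e)

  ⟪⟫-swap₁₁ : ⟪_⟫ {S = S} (swapᵇ (fin 1) (fin 1)) ≈ σ 1 1
  ⟪⟫-swap₁₁ = ≈-trans (⨾-cong (≈-trans (⊗-congˡ (≈-trans (⨾-idʳ _) ⊗-id)) ⊗-id)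
                      (≈-trans (⨾-congˡ ⊗-id) (≈-trans (⨾-idʳ _) (⊗-idʳ _)))) (⨾-idˡ _)

⟪⟫-inverse : (π : a ⇄ b) → ⟪_⟫ {S = S} π ⨾ ⟪ π ⁻¹ ⟫ ≈ id ⌊ a ⌋
⟪⟫-inverse π = ≈-trans (⟪⟫-⨾ _ _) (⟪⟫-id _ (from-to π))

id≈ : ∀ a → id {S} ⌊ a ⌋ ≈ ⟪ idᵇ {a} ⟫
id≈ a = ≈-sym (⟪⟫-id idᵇ λ _ → refl)

⟪⟫-cast : (π : a ⇄ b) (e : ⌊ a ⌋ ≡ ⌊ b ⌋) →
          (∀ x → toℕ (to (enum a) x) ≡ toℕ (to (enum b) (to π x))) →
          perm {S = S} (cast-id e) ≈ ⟪ π ⟫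
⟪⟫-cast π e h = perm-⟪⟫ (cast-id e) π λ x → toℕ-injective (trans (toℕ-cast e _) (h x))

⟪⟫-cast⁻¹ : (π : a ⇄ b) (e : ⌊ b ⌋ ≡ ⌊ a ⌋) →
          (∀ x → toℕ (to (enum a) x) ≡ toℕ (to (enum b) (to π x))) →
          perm {S = S} (cast-id e) ≈ ⟪ π ⁻¹ ⟫
⟪⟫-cast⁻¹ π e h = ⟪⟫-cast (π ⁻¹) e λ y → trans (cong (toℕ ∘ to (enum _)) (sym (to-from π y))) (sym (h (from π y)))

private
  assoc-toℕ : ∀ a b c x → toℕ (to (enum ((a ⊞ b) ⊞ c)) x) ≡ toℕ (to (enum (a ⊞ (b ⊞ c))) (Sum.assocʳ x))
  assoc-toℕ a b c (inj₁ (inj₁ x)) = trans (toℕ-↑ˡ _ ⌊ c ⌋) (trans (toℕ-↑ˡ _ ⌊ b ⌋) (sym (toℕ-↑ˡ _ (⌊ b ⌋ + ⌊ c ⌋))))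
  assoc-toℕ a b c (inj₁ (inj₂ x)) = trans (toℕ-↑ˡ _ ⌊ c ⌋) (trans (toℕ-↑ʳ ⌊ a ⌋ _)
    (sym (trans (toℕ-↑ʳ ⌊ a ⌋ _) (cong (⌊ a ⌋ +_) (toℕ-↑ˡ _ ⌊ c ⌋)))))
  assoc-toℕ a b c (inj₂ x) = trans (toℕ-↑ʳ (⌊ a ⌋ + ⌊ b ⌋) _) (trans (+-assoc ⌊ a ⌋ ⌊ b ⌋ _)
    (sym (trans (toℕ-↑ʳ ⌊ a ⌋ _) (cong (⌊ a ⌋ +_) (toℕ-↑ʳ ⌊ b ⌋ _)))))

cast-assoc : ∀ a b c a′ b′ c′ (f : Term S ((⌊ a ⌋ + ⌊ b ⌋) + ⌊ c ⌋) ((⌊ a′ ⌋ + ⌊ b′ ⌋) + ⌊ c′ ⌋)) →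
             cast (+-assoc ⌊ a ⌋ ⌊ b ⌋ ⌊ c ⌋) (+-assoc ⌊ a′ ⌋ ⌊ b′ ⌋ ⌊ c′ ⌋) f
             ≈ ⟪ assocʳ a b c ⁻¹ ⟫ ⨾ f ⨾ ⟪ assocʳ a′ b′ c′ ⟫
cast-assoc a b c a′ b′ c′ f = ≈-trans (perm-cast (+-assoc ⌊ a ⌋ ⌊ b ⌋ ⌊ c ⌋) _ f)
  (⨾-cong (⨾-congʳ (⟪⟫-cast⁻¹ (assocʳ a b c) (sym (+-assoc ⌊ a ⌋ ⌊ b ⌋ ⌊ c ⌋)) (assoc-toℕ a b c)))
          (⟪⟫-cast (assocʳ a′ b′ c′) (+-assoc ⌊ a′ ⌋ ⌊ b′ ⌋ ⌊ c′ ⌋) (assoc-toℕ a′ b′ c′)))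

⊗-assoc-⟪⟫ : ∀ a b c a′ b′ c′ {f : Term S ⌊ a ⌋ ⌊ a′ ⌋} {g : Term S ⌊ b ⌋ ⌊ b′ ⌋} {h : Term S ⌊ c ⌋ ⌊ c′ ⌋} →
             ((f ⊗ g) ⊗ h) ⨾ ⟪ assocʳ a′ b′ c′ ⟫ ≈ ⟪ assocʳ a b c ⟫ ⨾ (f ⊗ (g ⊗ h))
⊗-assoc-⟪⟫ a b c a′ b′ c′ {f} {g} {h} = begin
  ((f ⊗ g) ⊗ h) ⨾ ⟪ assocʳ a′ b′ c′ ⟫
    ≈⟨ ≈-trans (≈-sym (⨾-idˡ _)) (≈-trans (⨾-congʳ (≈-sym (⟪⟫-inverse (assocʳ a b c)))) (⨾-assoc _ _ _)) ⟩
  ⟪ assocʳ a b c ⟫ ⨾ (⟪ assocʳ a b c ⁻¹ ⟫ ⨾ (((f ⊗ g) ⊗ h) ⨾ ⟪ assocʳ a′ b′ c′ ⟫))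
    ≈⟨ ⨾-congˡ (≈-trans ⨾-assoc′ (≈-trans (≈-sym (cast-assoc a b c a′ b′ c′ _)) (⊗-assoc f g h))) ⟩
  ⟪ assocʳ a b c ⟫ ⨾ (f ⊗ (g ⊗ h)) ∎

⊗-id₀ : ∀ a b {f : Term S ⌊ a ⌋ ⌊ b ⌋} → (f ⊗ id 0) ⨾ ⟪ unitʳ b ⟫ ≈ ⟪ unitʳ a ⟫ ⨾ f
⊗-id₀ a b {f} = begin
  (f ⊗ id 0) ⨾ ⟪ unitʳ b ⟫
    ≈⟨ ≈-trans (≈-sym (⨾-idˡ _)) (≈-trans (⨾-congʳ (≈-sym (⟪⟫-inverse (unitʳ a)))) (⨾-assoc _ _ _)) ⟩
  ⟪ unitʳ a ⟫ ⨾ (⟪ unitʳ a ⁻¹ ⟫ ⨾ ((f ⊗ id 0) ⨾ ⟪ unitʳ b ⟫))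
    ≈⟨ ⨾-congˡ (≈-trans ⨾-assoc′ (≈-trans (≈-sym (≈-trans (perm-cast (+-identityʳ ⌊ a ⌋) _ (f ⊗ id 0))
         (⨾-cong (⨾-congʳ (⟪⟫-cast⁻¹ (unitʳ a) (sym (+-identityʳ ⌊ a ⌋)) (unit-toℕ a))) (⟪⟫-cast (unitʳ b) (+-identityʳ ⌊ b ⌋) (unit-toℕ b)))))
         (⊗-idʳ f))) ⟩
  ⟪ unitʳ a ⟫ ⨾ f ∎
  where
  unit-toℕ : ∀ a x → toℕ (to (enum (a ⊞ fin 0)) x) ≡ toℕ (to (enum a) (to (unitʳ a) x))
  unit-toℕ a (inj₁ x) = toℕ-↑ˡ (to (enum a) x) 0

inverse-unique : {f : Term S m n} {g g′ : Term S n m} →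
                 g ⨾ f ≈ id n → f ⨾ g′ ≈ id m → g ≈ g′
inverse-unique gf fg′ = ≈-trans (≈-sym (⨾-idʳ _)) (≈-trans (⨾-congˡ (≈-sym fg′))
  (≈-trans ⨾-assoc′ (≈-trans (⨾-congʳ gf) (⨾-idˡ _))))

⟪⟫-enum : ∀ a → ⟪_⟫ {S = S} (enum a) ≈ id ⌊ a ⌋
⟪⟫-enum a = ≈-trans (⟪⟫-perm (enum a) idₚ λ _ → refl) perm-id

cancelˡ : (π : a ⇄ b) {f g : Term S ⌊ b ⌋ n} → ⟪ π ⟫ ⨾ f ≈ ⟪ π ⟫ ⨾ g → f ≈ g
cancelˡ π e = ≈-trans (≈-sym (strip _)) (≈-trans (⨾-congˡ e) (strip _))
  where
  strip : ∀ h → ⟪ π ⁻¹ ⟫ ⨾ (⟪ π ⟫ ⨾ h) ≈ h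
  strip h = ≈-trans ⨾-assoc′ (≈-trans (⨾-congʳ (⟪⟫-inverse (π ⁻¹))) (⨾-idˡ _))

Swaps : Generators → Code → Code → Set
Swaps S a b = σ {S} ⌊ a ⌋ ⌊ b ⌋ ≈ ⟪ swapᵇ a b ⟫

⟪swap⟫-fin : ∀ a b → ⟪_⟫ {S = S} (swapᵇ a b) ≈ ⟪ swapᵇ (fin ⌊ a ⌋) (fin ⌊ b ⌋) ⟫
⟪swap⟫-fin a b = begin
  ⟪ swapᵇ a b ⟫
    ≈⟨ ≈-trans (≈-sym (⨾-idʳ _)) (⨾-congˡ (≈-sym (enum₂ b a))) ⟩
  ⟪ swapᵇ a b ⟫ ⨾ ⟪ enum b ⊞₁ enum a ⟫
    ≈⟨ ≈-trans (⟪⟫-⨾ _ _) (≈-trans (⟪⟫-cong _ _ λ { (inj₁ _) → refl ; (inj₂ _) → refl }) (≈-sym (⟪⟫-⨾ _ _))) ⟩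
  ⟪ enum a ⊞₁ enum b ⟫ ⨾ ⟪ swapᵇ (fin ⌊ a ⌋) (fin ⌊ b ⌋) ⟫
    ≈⟨ ≈-trans (⨾-congʳ (enum₂ a b)) (⨾-idˡ _) ⟩
  ⟪ swapᵇ (fin ⌊ a ⌋) (fin ⌊ b ⌋) ⟫ ∎
  where
  enum₂ : ∀ a b → ⟪ enum a ⊞₁ enum b ⟫ ≈ id (⌊ a ⌋ + ⌊ b ⌋)
  enum₂ a b = ≈-trans (≈-sym (⟪⟫-⊗ _ _)) (≈-trans (⊗-cong (⟪⟫-enum a) (⟪⟫-enum b)) ⊗-id)

swaps-fin : ∀ a b → Swaps S (fin ⌊ a ⌋) (fin ⌊ b ⌋) → Swaps S a b
swaps-fin a b e = ≈-trans e (≈-sym (⟪swap⟫-fin a b))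

swaps-unit : ∀ a → Swaps S a (fin 0)
swaps-unit a = cancelˡ (unitʳ a ⁻¹) (begin
  ⟪ unitʳ a ⁻¹ ⟫ ⨾ σ ⌊ a ⌋ 0
    ≈⟨ ≈-sym (≈-trans (perm-cast (+-identityʳ ⌊ a ⌋) refl (σ ⌊ a ⌋ 0))
         (≈-trans (⨾-cong (⨾-congʳ (⟪⟫-cast⁻¹ (unitʳ a) (sym (+-identityʳ ⌊ a ⌋)) λ { (inj₁ x) → toℕ-↑ˡ (to (enum a) x) 0 }))
                 (≈-trans (perm-cong (cast-id refl) idₚ (cast-is-id refl)) perm-id)) (⨾-idʳ _))) ⟩
  cast (+-identityʳ ⌊ a ⌋) refl (σ ⌊ a ⌋ 0)
    ≈⟨ σ-unit ⟩
  id ⌊ a ⌋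
    ≈⟨ ≈-sym (≈-trans (⟪⟫-⨾ (unitʳ a ⁻¹ ⍮ swapᵇ a (fin 0)) (unitˡ a)) (⟪⟫-id _ λ _ → refl)) ⟩
  ⟪ unitʳ a ⁻¹ ⍮ swapᵇ a (fin 0) ⟫ ⨾ ⟪ unitˡ a ⟫
    ≈⟨ ≈-trans (⨾-congˡ (≈-trans (⟪⟫-perm (unitˡ a) idₚ λ { (inj₂ _) → refl }) perm-id)) (⨾-idʳ _) ⟩
  ⟪ unitʳ a ⁻¹ ⍮ swapᵇ a (fin 0) ⟫
    ≈⟨ ≈-sym (⟪⟫-⨾ _ _) ⟩
  ⟪ unitʳ a ⁻¹ ⟫ ⨾ ⟪ swapᵇ a (fin 0) ⟫ ∎)

swaps-sym : ∀ a b → Swaps S a b → Swaps S b a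
swaps-sym a b e = inverse-unique σ-inverse (≈-trans (⨾-congʳ e)
  (≈-trans (⟪⟫-⨾ _ _) (⟪⟫-id _ λ { (inj₁ _) → refl ; (inj₂ _) → refl })))

swaps-⊞ : ∀ a b c → Swaps S a b → Swaps S a c → Swaps S a (b ⊞ c)
swaps-⊞ a b c e₁ e₂ = begin
  σ ⌊ a ⌋ (⌊ b ⌋ + ⌊ c ⌋)
    ≈⟨ σ-hexagon {m = ⌊ a ⌋} {n = ⌊ b ⌋} {p = ⌊ c ⌋} ⟩
  cast (+-assoc ⌊ a ⌋ ⌊ b ⌋ ⌊ c ⌋) (+-assoc ⌊ b ⌋ ⌊ a ⌋ ⌊ c ⌋) (σ ⌊ a ⌋ ⌊ b ⌋ ⊗ id ⌊ c ⌋)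
    ⨾ cast refl (sym (+-assoc ⌊ b ⌋ ⌊ c ⌋ ⌊ a ⌋)) (id ⌊ b ⌋ ⊗ σ ⌊ a ⌋ ⌊ c ⌋)
    ≈⟨ ⨾-cong (≈-trans (cast-assoc a b c b a c _) (⨾-congʳ (⨾-congˡ (≈-trans (⊗-cong e₁ (id≈ c)) (⟪⟫-⊗ _ _)))))
              (≈-trans (perm-cast refl (sym (+-assoc ⌊ b ⌋ ⌊ c ⌋ ⌊ a ⌋)) (id ⌊ b ⌋ ⊗ σ ⌊ a ⌋ ⌊ c ⌋))
                (⨾-cong (≈-trans (⨾-cong (≈-trans (perm-cong (cast-id refl) idₚ (cast-is-id refl)) perm-id)
                  (≈-trans (⊗-cong (id≈ b) e₂) (⟪⟫-⊗ _ _))) (⨾-idˡ _))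
                  (⟪⟫-cast⁻¹ (assocʳ b c a) (sym (+-assoc ⌊ b ⌋ ⌊ c ⌋ ⌊ a ⌋)) (assoc-toℕ b c a)))) ⟩
  (⟪ assocʳ a b c ⁻¹ ⟫ ⨾ ⟪ swapᵇ a b ⊞₁ idᵇ {c} ⟫ ⨾ ⟪ assocʳ b a c ⟫)
    ⨾ (⟪ idᵇ {b} ⊞₁ swapᵇ a c ⟫ ⨾ ⟪ assocʳ b c a ⁻¹ ⟫)
    ≈⟨ ≈-trans (⨾-cong (≈-trans (⨾-congʳ (⟪⟫-⨾ _ _)) (⟪⟫-⨾ _ _)) (⟪⟫-⨾ _ _))
       (≈-trans (⟪⟫-⨾ _ _) (⟪⟫-cong _ _ λ
         { (inj₁ x) → refl ; (inj₂ (inj₁ x)) → refl ; (inj₂ (inj₂ x)) → refl })) ⟩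
  ⟪ swapᵇ a (b ⊞ c) ⟫ ∎

-- Everything is generated from σ 1 1 by the hexagon, first in one argument and then,
-- since σ n m is inverse to σ m n, in the other.
σ-swap : ∀ a b → σ {S} ⌊ a ⌋ ⌊ b ⌋ ≈ ⟪ swapᵇ a b ⟫
σ-swap a b = swaps-fin a b (fins ⌊ a ⌋ ⌊ b ⌋)
  where
  extend : ∀ a → Swaps S a (fin 1) → ∀ n → Swaps S a (fin n)
  extend a e zero    = swaps-unit a
  extend a e (suc n) = ≈-trans (swaps-⊞ a (fin 1) (fin n) e (extend a e n))
    (≈-trans (⟪swap⟫-fin a (fin 1 ⊞ fin n)) (≈-sym (⟪swap⟫-fin a (fin (suc n)))))
  fins : ∀ m n → Swaps S (fin m) (fin n)
  fins m n = extend (fin m)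
    (swaps-sym (fin 1) (fin m) (extend (fin 1) (≈-sym ⟪⟫-swap₁₁) m)) n

-- A commuting square whose horizontal sides are permutations:
--
--      ⟪ π ⟫
--   a ───────→ b
--   │ s        │ t
--   ↓          ↓
--   a′ ──────→ b′
--      ⟪ π′ ⟫
record Sq {S} (π : a ⇄ b) (s : Term S ⌊ a ⌋ ⌊ a′ ⌋) (t : Term S ⌊ b ⌋ ⌊ b′ ⌋) (π′ : a′ ⇄ b′) : Set where
  constructor sq
  field
    square : s ⨾ ⟪ π′ ⟫ ≈ ⟪ π ⟫ ⨾ t

open Sq public

sq-cong : {π ρ : a ⇄ b} {π′ ρ′ : a′ ⇄ b′} {s : Term S ⌊ a ⌋ ⌊ a′ ⌋} {t : Term S ⌊ b ⌋ ⌊ b′ ⌋} →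
          Sq π s t π′ → (∀ x → to π x ≡ to ρ x) → (∀ x → to π′ x ≡ to ρ′ x) → Sq ρ s t ρ′
sq-cong (sq e) h h′ = sq (≈-trans (⨾-congˡ (⟪⟫-cong _ _ λ x → sym (h′ x)))
                         (≈-trans e (⨾-congʳ (⟪⟫-cong _ _ h))))

sq-≈ : {π : a ⇄ b} {π′ : a′ ⇄ b′} {s s′ : Term S ⌊ a ⌋ ⌊ a′ ⌋} {t t′ : Term S ⌊ b ⌋ ⌊ b′ ⌋} →
       s ≈ s′ → t ≈ t′ → Sq π s t π′ → Sq π s′ t′ π′
sq-≈ e e′ (sq h) = sq (≈-trans (⨾-congʳ (≈-sym e)) (≈-trans h (⨾-congˡ e′)))

sq-refl : (s : Term S ⌊ a ⌋ ⌊ b ⌋) → Sq (idᵇ {a}) s s (idᵇ {b})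
sq-refl {a = a} {b = b} s = sq (≈-trans (⨾-congˡ (≈-sym (id≈ b)))
  (≈-trans (⨾-idʳ _) (≈-trans (≈-sym (⨾-idˡ _)) (⨾-congʳ (id≈ a)))))

sq⇒≈ : {s t : Term S ⌊ a ⌋ ⌊ b ⌋} → Sq (idᵇ {a}) s t (idᵇ {b}) → s ≈ t
sq⇒≈ {a = a} {b = b} (sq e) = ≈-trans (≈-sym (⨾-idʳ _)) (≈-trans (⨾-congˡ (id≈ b))
  (≈-trans e (≈-trans (⨾-congʳ (≈-sym (id≈ a))) (⨾-idˡ _))))

sq-sym : {π : a ⇄ b} {π′ : a′ ⇄ b′} {s : Term S ⌊ a ⌋ ⌊ a′ ⌋} {t : Term S ⌊ b ⌋ ⌊ b′ ⌋} →
         Sq π s t π′ → Sq (π ⁻¹) t s (π′ ⁻¹)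
sq-sym {π = π} {π′ = π′} (sq e) = sq (cancelˡ π (≈-trans ⨾-assoc′ (≈-trans (⨾-congʳ (≈-sym e))
  (≈-trans (⨾-assoc _ _ _) (≈-trans (⨾-congˡ (⟪⟫-inverse π′)) (≈-trans (⨾-idʳ _)
  (≈-trans (≈-sym (⨾-idˡ _)) (≈-trans (⨾-congʳ (≈-sym (⟪⟫-inverse π))) (⨾-assoc _ _ _)))))))))

sq-⍮ : {π : a ⇄ b} {π′ : a′ ⇄ b′} {ρ : b ⇄ c} {ρ′ : b′ ⇄ c′}
       {s : Term S ⌊ a ⌋ ⌊ a′ ⌋} {t : Term S ⌊ b ⌋ ⌊ b′ ⌋} {u : Term S ⌊ c ⌋ ⌊ c′ ⌋} →
       Sq π s t π′ → Sq ρ t u ρ′ → Sq (π ⍮ ρ) s u (π′ ⍮ ρ′)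
sq-⍮ (sq e) (sq h) = sq (≈-trans (⨾-congˡ (≈-sym (⟪⟫-⨾ _ _))) (≈-trans ⨾-assoc′
  (≈-trans (⨾-congʳ e) (≈-trans (⨾-assoc _ _ _) (≈-trans (⨾-congˡ h) (≈-trans ⨾-assoc′
  (⨾-congʳ (⟪⟫-⨾ _ _))))))))

sq-⨾ : {π : a ⇄ b} {π′ : a′ ⇄ b′} {π″ : a″ ⇄ b″}
       {s : Term S ⌊ a ⌋ ⌊ a′ ⌋} {t : Term S ⌊ b ⌋ ⌊ b′ ⌋}
       {s′ : Term S ⌊ a′ ⌋ ⌊ a″ ⌋} {t′ : Term S ⌊ b′ ⌋ ⌊ b″ ⌋} →
       Sq π s t π′ → Sq π′ s′ t′ π″ → Sq π (s ⨾ s′) (t ⨾ t′) π″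
sq-⨾ (sq e) (sq h) = sq (≈-trans (⨾-assoc _ _ _) (≈-trans (⨾-congˡ h)
  (≈-trans ⨾-assoc′ (≈-trans (⨾-congʳ e) (⨾-assoc _ _ _)))))

sq-⊗ : {π : a ⇄ b} {π′ : a′ ⇄ b′} {ρ : c ⇄ d} {ρ′ : c′ ⇄ d′}
       {s : Term S ⌊ a ⌋ ⌊ a′ ⌋} {t : Term S ⌊ b ⌋ ⌊ b′ ⌋}
       {u : Term S ⌊ c ⌋ ⌊ c′ ⌋} {v : Term S ⌊ d ⌋ ⌊ d′ ⌋} →
       Sq π s t π′ → Sq ρ u v ρ′ → Sq (π ⊞₁ ρ) (s ⊗ u) (t ⊗ v) (π′ ⊞₁ ρ′)
sq-⊗ (sq e) (sq h) = sq (≈-trans (⨾-congˡ (≈-sym (⟪⟫-⊗ _ _))) (≈-trans (≈-sym (⊗-⨾ _ _ _ _))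
  (≈-trans (⊗-cong e h) (≈-trans (⊗-⨾ _ _ _ _) (⨾-congʳ (⟪⟫-⊗ _ _))))))

sq-⟪⟫ : {π : a ⇄ b} {π′ : a′ ⇄ b′} {α : a ⇄ a′} {β : b ⇄ b′} →
        (∀ x → to π′ (to α x) ≡ to β (to π x)) → Sq {S = S} π ⟪ α ⟫ ⟪ β ⟫ π′
sq-⟪⟫ h = sq (≈-trans (⟪⟫-⨾ _ _) (≈-trans (⟪⟫-cong _ _ h) (≈-sym (⟪⟫-⨾ _ _))))

sq-assoc : ∀ a b c a′ b′ c′ {f : Term S ⌊ a ⌋ ⌊ a′ ⌋} {g : Term S ⌊ b ⌋ ⌊ b′ ⌋} {h : Term S ⌊ c ⌋ ⌊ c′ ⌋} →
           Sq (assocʳ a b c) ((f ⊗ g) ⊗ h) (f ⊗ (g ⊗ h)) (assocʳ a′ b′ c′)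
sq-assoc a b c a′ b′ c′ = sq (⊗-assoc-⟪⟫ a b c a′ b′ c′)

sq-swap : ∀ a b a′ b′ {f : Term S ⌊ a ⌋ ⌊ a′ ⌋} {g : Term S ⌊ b ⌋ ⌊ b′ ⌋} →
          Sq (swapᵇ a b) (f ⊗ g) (g ⊗ f) (swapᵇ a′ b′)
sq-swap a b a′ b′ = sq (≈-trans (⨾-congˡ (≈-sym (σ-swap a′ b′)))
  (≈-trans (σ-natural _ _) (⨾-congʳ (σ-swap a b))))

sq-unitʳ : ∀ a b {f : Term S ⌊ a ⌋ ⌊ b ⌋} → Sq (unitʳ a) (f ⊗ id 0) f (unitʳ b)
sq-unitʳ a b = sq (⊗-id₀ a b)

id⊗⟪⟫ : ∀ a (π : b ⇄ c) → id {S} ⌊ a ⌋ ⊗ ⟪ π ⟫ ≈ ⟪ idᵇ {a} ⊞₁ π ⟫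
id⊗⟪⟫ a π = ≈-trans (⊗-congʳ (id≈ a)) (⟪⟫-⊗ _ _)

exchᵇ : ∀ a b c → (a ⊞ (b ⊞ c)) ⇄ (b ⊞ (a ⊞ c))
exchᵇ a b c = assocʳ a b c ⁻¹ ⍮ (swapᵇ a b ⊞₁ idᵇ {c}) ⍮ assocʳ b a c

sq-exch : ∀ a b c a′ b′ c′ {f : Term S ⌊ a ⌋ ⌊ a′ ⌋} {g : Term S ⌊ b ⌋ ⌊ b′ ⌋} {h : Term S ⌊ c ⌋ ⌊ c′ ⌋} →
          Sq (exchᵇ a b c) (f ⊗ (g ⊗ h)) (g ⊗ (f ⊗ h)) (exchᵇ a′ b′ c′)
sq-exch a b c a′ b′ c′ = sq-⍮ (sq-⍮ (sq-sym (sq-assoc a b c a′ b′ c′))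
  (sq-⊗ (sq-swap a b a′ b′) (sq-refl {a = c} {b = c′} _))) (sq-assoc b a c b′ a′ c′)

midᵇ : ∀ a b c d → ((a ⊞ b) ⊞ (c ⊞ d)) ⇄ ((a ⊞ c) ⊞ (b ⊞ d))
midᵇ a b c d = assocʳ a b (c ⊞ d) ⍮ (idᵇ {a} ⊞₁ exchᵇ b c d) ⍮ assocʳ a c (b ⊞ d) ⁻¹

sq-mid : ∀ a b c d a′ b′ c′ d′ {f : Term S ⌊ a ⌋ ⌊ a′ ⌋} {g : Term S ⌊ b ⌋ ⌊ b′ ⌋}
         {h : Term S ⌊ c ⌋ ⌊ c′ ⌋} {k : Term S ⌊ d ⌋ ⌊ d′ ⌋} →
         Sq (midᵇ a b c d) ((f ⊗ g) ⊗ (h ⊗ k)) ((f ⊗ h) ⊗ (g ⊗ k)) (midᵇ a′ b′ c′ d′)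
sq-mid a b c d a′ b′ c′ d′ = sq-⍮ (sq-⍮ (sq-assoc a b (c ⊞ d) a′ b′ (c′ ⊞ d′))
  (sq-⊗ (sq-refl {a = a} {b = a′} _) (sq-exch b c d b′ c′ d′)))
  (sq-sym (sq-assoc a c (b ⊞ d) a′ c′ (b′ ⊞ d′)))

tightenˡ : ∀ {x} (f : Term S m n) (g : Term S (x + n) (x + p)) →
           Tr x ((id x ⊗ f) ⨾ g) ≈ f ⨾ Tr x g
tightenˡ f g = ≈-trans (Tr-cong (≈-sym (≈-trans (⨾-congˡ ⊗-id) (⨾-idʳ _))))
  (≈-trans (tightening f g (id _)) (⨾-idʳ _))

tightenʳ : ∀ {x} (g : Term S (x + m) (x + n)) (h : Term S n p) →
           Tr x (g ⨾ (id x ⊗ h)) ≈ Tr x g ⨾ h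
tightenʳ g h = ≈-trans (Tr-cong (⨾-congʳ (≈-sym (≈-trans (⨾-congʳ ⊗-id) (⨾-idˡ _)))))
  (≈-trans (tightening (id _) g h) (⨾-congʳ (⨾-idˡ _)))

tr-slide : (ν : a ⇄ b) {f : Term S (⌊ b ⌋ + m) (⌊ b ⌋ + n)} →
           Tr ⌊ a ⌋ ((⟪ ν ⟫ ⊗ id m) ⨾ f ⨾ (⟪ ν ⁻¹ ⟫ ⊗ id n)) ≈ Tr ⌊ b ⌋ f
tr-slide ν {f} = ≈-trans (sliding _ _) (Tr-cong (≈-trans ⨾-assoc′ (≈-trans
  (⨾-congʳ (≈-trans (≈-sym ⨾-⊗id) (≈-trans (⊗-congʳ (⟪⟫-inverse (ν ⁻¹))) ⊗-id))) (⨾-idˡ _))))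

sq-Tr : {ν : a ⇄ b} {π : c ⇄ d} {π′ : c′ ⇄ d′}
        {f : Term S (⌊ a ⌋ + ⌊ c ⌋) (⌊ a ⌋ + ⌊ c′ ⌋)} {g : Term S (⌊ b ⌋ + ⌊ d ⌋) (⌊ b ⌋ + ⌊ d′ ⌋)} →
        Sq (ν ⊞₁ π) f g (ν ⊞₁ π′) → Sq π (Tr ⌊ a ⌋ f) (Tr ⌊ b ⌋ g) π′
sq-Tr {a = a} {b = b} {ν = ν} {π = π} {π′ = π′} {f = f} {g = g} (sq e) = sq (begin
  Tr ⌊ a ⌋ f ⨾ ⟪ π′ ⟫
    ≈⟨ ≈-sym (tightenʳ f _) ⟩
  Tr ⌊ a ⌋ (f ⨾ (id _ ⊗ ⟪ π′ ⟫))
    ≈⟨ Tr-cong (⨾-congˡ (≈-trans (⊗-cong (≈-sym (⟪⟫-inverse ν)) (≈-sym (⨾-idʳ _))) (⊗-⨾ _ _ _ _))) ⟩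
  Tr ⌊ a ⌋ (f ⨾ ((⟪ ν ⟫ ⊗ ⟪ π′ ⟫) ⨾ (⟪ ν ⁻¹ ⟫ ⊗ id _)))
    ≈⟨ Tr-cong (≈-trans ⨾-assoc′ (⨾-congʳ (≈-trans (⨾-congˡ (⟪⟫-⊗ _ _)) (≈-trans e
         (⨾-congʳ (≈-sym (⟪⟫-⊗ _ _))))))) ⟩
  Tr ⌊ a ⌋ ((⟪ ν ⟫ ⊗ ⟪ π ⟫) ⨾ g ⨾ (⟪ ν ⁻¹ ⟫ ⊗ id _))
    ≈⟨ Tr-cong (⨾-congʳ (≈-trans (⨾-congʳ ⊗-split) (⨾-assoc _ _ _))) ⟩
  Tr ⌊ a ⌋ ((⟪ ν ⟫ ⊗ id _) ⨾ ((id _ ⊗ ⟪ π ⟫) ⨾ g) ⨾ (⟪ ν ⁻¹ ⟫ ⊗ id _))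
    ≈⟨ tr-slide ν ⟩
  Tr ⌊ b ⌋ ((id _ ⊗ ⟪ π ⟫) ⨾ g)
    ≈⟨ tightenˡ _ _ ⟩
  ⟪ π ⟫ ⨾ Tr ⌊ b ⌋ g ∎)

tr-cong-sq : ∀ a b c c′ (ν : a ⇄ b)
        {f : Term S (⌊ a ⌋ + ⌊ c ⌋) (⌊ a ⌋ + ⌊ c′ ⌋)} {g : Term S (⌊ b ⌋ + ⌊ c ⌋) (⌊ b ⌋ + ⌊ c′ ⌋)} →
        Sq (ν ⊞₁ idᵇ {c}) f g (ν ⊞₁ idᵇ {c′}) → Tr ⌊ a ⌋ f ≈ Tr ⌊ b ⌋ g
tr-cong-sq a b c c′ ν h = sq⇒≈ {a = c} {b = c′} (sq-Tr {π = idᵇ {c}} {π′ = idᵇ {c′}} h)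

conj : (π : a ⇄ b) (π′ : a′ ⇄ b′) → Term S ⌊ b ⌋ ⌊ b′ ⌋ → Term S ⌊ a ⌋ ⌊ a′ ⌋
conj π π′ f = ⟪ π ⟫ ⨾ f ⨾ ⟪ π′ ⁻¹ ⟫

sq-conj : (π : a ⇄ b) (π′ : a′ ⇄ b′) (f : Term S ⌊ b ⌋ ⌊ b′ ⌋) → Sq π (conj π π′ f) f π′
sq-conj π π′ f = sq (≈-trans (⨾-assoc _ _ _) (≈-trans (⨾-congˡ (⟪⟫-inverse (π′ ⁻¹))) (⨾-idʳ _)))

sq⇒conj : {π : a ⇄ b} {π′ : a′ ⇄ b′} {s : Term S ⌊ a ⌋ ⌊ a′ ⌋} {t : Term S ⌊ b ⌋ ⌊ b′ ⌋} →
          Sq π s t π′ → s ≈ conj π π′ t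
sq⇒conj {π′ = π′} (sq e) = ≈-trans (≈-sym (⨾-idʳ _)) (≈-trans (⨾-congˡ (≈-sym (⟪⟫-inverse π′)))
  (≈-trans ⨾-assoc′ (⨾-congʳ e)))

tr-tr : ∀ x y c d {F : Term S (⌊ x ⊞ y ⌋ + ⌊ c ⌋) (⌊ x ⊞ y ⌋ + ⌊ d ⌋)}
        {G : Term S (⌊ x ⌋ + ⌊ y ⊞ c ⌋) (⌊ x ⌋ + ⌊ y ⊞ d ⌋)} →
        Sq (assocʳ x y c) F G (assocʳ x y d) → Tr ⌊ x ⊞ y ⌋ F ≈ Tr ⌊ y ⌋ (Tr ⌊ x ⌋ G)
tr-tr x y c d {F} {G} h = ≈-trans (vanishing₊ {x = ⌊ x ⌋} {y = ⌊ y ⌋} F) (Tr-cong (Tr-cong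
  (≈-trans (cast-assoc x y c x y d F) (≈-sym (sq⇒conj (sq-sym h))))))

tr-⊗id : ∀ x c d p {f : Term S (⌊ x ⌋ + ⌊ c ⌋) (⌊ x ⌋ + ⌊ d ⌋)}
         {G : Term S (⌊ x ⌋ + ⌊ c ⊞ p ⌋) (⌊ x ⌋ + ⌊ d ⊞ p ⌋)} →
         Sq (assocʳ x c p) (f ⊗ id ⌊ p ⌋) G (assocʳ x d p) → Tr ⌊ x ⌋ f ⊗ id ⌊ p ⌋ ≈ Tr ⌊ x ⌋ G
tr-⊗id x c d p {f} {G} h = ≈-trans (superposing {x = ⌊ x ⌋} f) (Tr-cong
  (≈-trans (cast-assoc x c p x d p _) (≈-sym (sq⇒conj (sq-sym h)))))

tr-⊗ˡ : ∀ x c d p q {f : Term S (⌊ x ⌋ + ⌊ c ⌋) (⌊ x ⌋ + ⌊ d ⌋)} {g : Term S ⌊ p ⌋ ⌊ q ⌋} →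
        Tr ⌊ x ⌋ f ⊗ g ≈ Tr ⌊ x ⌋ (conj (assocʳ x c p ⁻¹) (assocʳ x d q ⁻¹) (f ⊗ g))
tr-⊗ˡ x c d p q {f} {g} = begin
  Tr ⌊ x ⌋ f ⊗ g
    ≈⟨ ≈-trans ⊗-split (⨾-congʳ (tr-⊗id x c d p (sq-sym (sq-conj (assocʳ x c p ⁻¹) (assocʳ x d p ⁻¹) _)))) ⟩
  Tr ⌊ x ⌋ (conj (assocʳ x c p ⁻¹) (assocʳ x d p ⁻¹) (f ⊗ id _)) ⨾ (id _ ⊗ g)
    ≈⟨ ≈-sym (tightenʳ _ _) ⟩
  Tr ⌊ x ⌋ (conj (assocʳ x c p ⁻¹) (assocʳ x d p ⁻¹) (f ⊗ id _) ⨾ (id ⌊ x ⌋ ⊗ (id ⌊ d ⌋ ⊗ g)))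
    ≈⟨ Tr-cong (≈-trans (sq⇒conj (sq-⨾ (sq-conj (assocʳ x c p ⁻¹) (assocʳ x d p ⁻¹) (f ⊗ id _))
         (sq-sym (sq-assoc x d p x d q)))) (⨾-congʳ (⨾-congˡ
         (≈-trans (⨾-congˡ (⊗-congʳ (⊗-id {m = ⌊ x ⌋} {n = ⌊ d ⌋}))) (≈-sym ⊗-split))))) ⟩
  Tr ⌊ x ⌋ (conj (assocʳ x c p ⁻¹) (assocʳ x d q ⁻¹) (f ⊗ g)) ∎

tr-⊗ʳ : ∀ x c d p q {f : Term S (⌊ x ⌋ + ⌊ c ⌋) (⌊ x ⌋ + ⌊ d ⌋)} {g : Term S ⌊ p ⌋ ⌊ q ⌋} →
        g ⊗ Tr ⌊ x ⌋ f ≈ Tr ⌊ x ⌋ (conj (exchᵇ x p c) (exchᵇ x q d) (g ⊗ f))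
tr-⊗ʳ x c d p q {f} {g} = sq⇒≈ {a = p ⊞ c} {b = q ⊞ d} (sq-cong
  (sq-⍮ (sq-swap p c q d)
    (sq-≈ (≈-sym (tr-⊗ˡ x c d p q)) ≈-refl (sq-Tr {ν = idᵇ {x}} (sq-cong
      {ρ = idᵇ {x} ⊞₁ swapᵇ c p} {ρ′ = idᵇ {x} ⊞₁ swapᵇ d q}
      (sq-⍮ (sq-⍮ (sq-conj (assocʳ x c p ⁻¹) (assocʳ x d q ⁻¹) (f ⊗ g))
              (sq-swap (x ⊞ c) p (x ⊞ d) q))
            (sq-sym (sq-conj (exchᵇ x p c) (exchᵇ x q d) (g ⊗ f))))
      pointwise pointwise))))
  (λ { (inj₁ _) → refl ; (inj₂ _) → refl }) (λ { (inj₁ _) → refl ; (inj₂ _) → refl }))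
  where
  pointwise : ∀ {x c p} v →
    to (assocʳ x c p ⁻¹ ⍮ swapᵇ (x ⊞ c) p ⍮ exchᵇ x p c ⁻¹) v ≡ to (idᵇ {x} ⊞₁ swapᵇ c p) v
  pointwise (inj₁ _) = refl
  pointwise (inj₂ (inj₁ _)) = refl
  pointwise (inj₂ (inj₂ _)) = refl

tr-exch : ∀ x y c d (F : Term S (⌊ x ⌋ + ⌊ y ⊞ c ⌋) (⌊ x ⌋ + ⌊ y ⊞ d ⌋)) →
          Tr ⌊ y ⌋ (Tr ⌊ x ⌋ F) ≈ Tr ⌊ x ⌋ (Tr ⌊ y ⌋ (conj (exchᵇ y x c) (exchᵇ y x d) F))
tr-exch x y c d F = begin
  Tr ⌊ y ⌋ (Tr ⌊ x ⌋ F)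
    ≈⟨ ≈-sym (tr-tr x y c d (sq-conj (assocʳ x y c) (assocʳ x y d) F)) ⟩
  Tr ⌊ x ⊞ y ⌋ (conj (assocʳ x y c) (assocʳ x y d) F)
    ≈⟨ tr-cong-sq (x ⊞ y) (y ⊞ x) c d (swapᵇ x y) (sq-cong
         (sq-⍮ (sq-⍮ (sq-conj (assocʳ x y c) (assocʳ x y d) F)
           (sq-sym (sq-conj (exchᵇ y x c) (exchᵇ y x d) F)))
           (sq-sym (sq-conj (assocʳ y x c) (assocʳ y x d) (conj (exchᵇ y x c) (exchᵇ y x d) F))))
         pointwise pointwise) ⟩
  Tr ⌊ y ⊞ x ⌋ (conj (assocʳ y x c) (assocʳ y x d) (conj (exchᵇ y x c) (exchᵇ y x d) F))
    ≈⟨ tr-tr y x c d (sq-conj (assocʳ y x c) (assocʳ y x d) _) ⟩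
  Tr ⌊ x ⌋ (Tr ⌊ y ⌋ (conj (exchᵇ y x c) (exchᵇ y x d) F)) ∎
  where
  pointwise : ∀ {c} v → to (assocʳ x y c ⍮ exchᵇ y x c ⁻¹ ⍮ assocʳ y x c ⁻¹) v
                      ≡ to (swapᵇ x y ⊞₁ idᵇ {c}) v
  pointwise (inj₁ (inj₁ _)) = refl
  pointwise (inj₁ (inj₂ _)) = refl
  pointwise (inj₂ _) = refl

⨾-as-Tr : (f : Term S m n) (g : Term S n p) → f ⨾ g ≈ Tr n (σ n m ⨾ (f ⊗ g))
⨾-as-Tr {m = m} {n = n} f g = ≈-sym (begin
  Tr n (σ n m ⨾ (f ⊗ g))
    ≈⟨ Tr-cong (≈-trans (⨾-congˡ ⊗-split) ⨾-assoc′) ⟩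
  Tr n (σ n m ⨾ (f ⊗ id n) ⨾ (id n ⊗ g))
    ≈⟨ Tr-cong (⨾-congʳ (≈-sym (σ-natural (id n) f))) ⟩
  Tr n ((id n ⊗ f) ⨾ σ n n ⨾ (id n ⊗ g))
    ≈⟨ tightening f (σ n n) g ⟩
  f ⨾ Tr n (σ n n) ⨾ g
    ≈⟨ ⨾-congʳ (≈-trans (⨾-congˡ yanking) (⨾-idʳ _)) ⟩
  f ⨾ g ∎)

-- γ′ is the trace of γ over one wire: it follows γ, passing through the traced wire
-- when γ leads there.
record IsTrace₁ {m n : Code} (γ : (fin 1 ⊞ m) ⇄ (fin 1 ⊞ n)) (γ′ : m ⇄ n) : Set where
  field
    direct  : ∀ {x y} → to γ (inj₂ x) ≡ inj₂ y → to γ′ x ≡ y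
    through : ∀ {x} → to γ (inj₂ x) ≡ inj₁ zero → to γ (inj₁ zero) ≡ inj₂ (to γ′ x)
    nonloop : to γ (inj₁ zero) ≢ inj₁ zero

twistᵇ : ∀ r → (fin 1 ⊞ (fin 1 ⊞ r)) ⇄ (fin 1 ⊞ (fin 1 ⊞ r))
twistᵇ r = exchᵇ (fin 1) (fin 1) r

tr-twist : ∀ r → Tr 1 ⟪ twistᵇ r ⟫ ≈ id {S} ⌊ fin 1 ⊞ r ⌋
tr-twist r = ≈-trans (≈-sym (tr-⊗id (fin 1) (fin 1) (fin 1) r {f = σ 1 1} (sq-cong
    (sq-≈ (≈-trans (≈-sym (⟪⟫-⊗ _ _)) (⊗-cong (≈-sym (σ-swap (fin 1) (fin 1))) (≈-sym (id≈ r)))) ≈-refl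
      (sq-⟪⟫ {π = assocʳ (fin 1) (fin 1) r} {π′ = assocʳ (fin 1) (fin 1) r}
             {α = swapᵇ (fin 1) (fin 1) ⊞₁ idᵇ {r}} {β = twistᵇ r}
        λ { (inj₁ (inj₁ _)) → refl ; (inj₁ (inj₂ _)) → refl ; (inj₂ _) → refl }))
    (λ _ → refl) (λ _ → refl))))
  (≈-trans (⊗-congʳ yanking) ⊗-id)

extract : (z : Fin n) → Σ[ k ∈ ℕ ] Σ[ θ ∈ fin n ⇄ (fin 1 ⊞ fin k) ] to θ z ≡ inj₁ zero
extract {n = suc n} z = n , record
  { to = to′ ; from = from′ ; to-from = to-from′ ; from-to = from-to′ } , to′-z
  where
  to′ : Fin (suc n) → Fin 1 ⊎ Fin n
  to′ v with z ≟ v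
  ... | yes _ = inj₁ zero
  ... | no z≢v = inj₂ (punchOut z≢v)
  from′ : Fin 1 ⊎ Fin n → Fin (suc n)
  from′ (inj₁ _) = z
  from′ (inj₂ w) = punchIn z w
  to′-z : to′ z ≡ inj₁ zero
  to′-z with z ≟ z
  ... | yes _ = refl
  ... | no z≢z = contradiction refl z≢z
  to-from′ : ∀ y → to′ (from′ y) ≡ y
  to-from′ (inj₁ zero) = to′-z
  to-from′ (inj₂ w) with z ≟ punchIn z w
  ... | yes e = contradiction (sym e) (punchInᵢ≢i z w)
  ... | no _ = cong inj₂ (trans (punchOut-cong z refl) (punchOut-punchIn z))
  from-to′ : ∀ v → from′ (to′ v) ≡ v
  from-to′ v with z ≟ v
  ... | yes e = e
  ... | no z≢v = punchIn-punchOut z≢v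

tr-perm : {γ : (fin 1 ⊞ a) ⇄ (fin 1 ⊞ b)} {γ′ : a ⇄ b} → IsTrace₁ γ γ′ → Tr 1 (⟪_⟫ {S = S} γ) ≈ ⟪ γ′ ⟫
tr-perm {a = a} {b = b} {γ = γ} {γ′ = γ′} t = go (to γ (inj₁ zero)) refl
  where
  open IsTrace₁ t
  go : ∀ w → to γ (inj₁ zero) ≡ w → Tr 1 ⟪ γ ⟫ ≈ ⟪ γ′ ⟫
  go (inj₁ zero) e = contradiction e nonloop
  go (inj₂ z) e with extract (to (enum b) z)
  ... | k , θ₀ , θ₀-z = begin
    Tr 1 ⟪ γ ⟫
      ≈⟨ Tr-cong (≈-trans (⟪⟫-cong γ ((idᵇ ⊞₁ γ′) ⍮ ((idᵇ ⊞₁ θ) ⍮ twistᵇ (fin k) ⍮ (idᵇ ⊞₁ θ ⁻¹))) factor)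
           (≈-trans (≈-sym (⟪⟫-⨾ _ _)) (⨾-cong (≈-sym (≈-trans (⊗-congʳ (id≈ (fin 1))) (⟪⟫-⊗ _ _)))
             (≈-trans (≈-sym (⟪⟫-⨾ _ _)) (≈-trans (⨾-congʳ (≈-sym (⟪⟫-⨾ _ _)))
               (⨾-cong (⨾-congʳ (≈-sym (≈-trans (⊗-congʳ (id≈ (fin 1))) (⟪⟫-⊗ _ _))))
                 (≈-sym (≈-trans (⊗-congʳ (id≈ (fin 1))) (⟪⟫-⊗ _ _))))))))) ⟩
    Tr 1 ((id 1 ⊗ ⟪ γ′ ⟫) ⨾ ((id 1 ⊗ ⟪ θ ⟫) ⨾ ⟪ twistᵇ (fin k) ⟫ ⨾ (id 1 ⊗ ⟪ θ ⁻¹ ⟫)))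
      ≈⟨ ≈-trans (tightenˡ _ _) (⨾-congˡ (≈-trans (tightening _ _ _) (⨾-congʳ (≈-trans
           (⨾-congˡ (tr-twist (fin k))) (⨾-idʳ _))))) ⟩
    ⟪ γ′ ⟫ ⨾ (⟪ θ ⟫ ⨾ ⟪ θ ⁻¹ ⟫)
      ≈⟨ ≈-trans (⨾-congˡ (⟪⟫-inverse θ)) (⨾-idʳ _) ⟩
    ⟪ γ′ ⟫ ∎
    where
    θ : b ⇄ (fin 1 ⊞ fin k)
    θ = enum b ⍮ θ₀
    undo : ∀ {y u} → to θ y ≡ u → y ≡ from θ u
    undo {y} refl = sym (from-to θ y)
    factor : ∀ x → to γ x ≡ to ((idᵇ ⊞₁ γ′) ⍮ ((idᵇ ⊞₁ θ) ⍮ twistᵇ (fin k) ⍮ (idᵇ ⊞₁ θ ⁻¹))) x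
    factor (inj₁ zero) = trans e (cong inj₂ (undo θ₀-z))
    factor (inj₂ x) with to θ (to γ′ x) in eq | to γ (inj₂ x) in eq′
    ... | inj₁ zero | inj₁ zero = refl
    ... | inj₁ zero | inj₂ y = contradiction (trans (sym (to-injective γ {inj₁ zero} {inj₂ x}
            (trans e (trans (cong inj₂ (trans (undo θ₀-z) (trans (sym (undo eq)) (direct eq′)))) (sym eq′))))) refl)
            λ ()
    ... | inj₂ w | inj₁ zero = contradiction
            (trans (sym eq) (trans (cong (to θ) (inj₂-injective (trans (sym (through eq′)) e))) θ₀-z)) λ ()
    ... | inj₂ w | inj₂ y = cong inj₂ (trans (sym (direct eq′)) (undo eq))

loop : ∀ {m n} → Term S ⌊ a ⌋ ⌊ b ⌋ → (b ⊞ m) ⇄ (a ⊞ n) → Term S ⌊ m ⌋ ⌊ n ⌋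
loop {b = b} {n = n} s π = Tr ⌊ b ⌋ (⟪ π ⟫ ⨾ (s ⊗ id ⌊ n ⌋))

loop-sq : {s : Term S ⌊ a ⌋ ⌊ b ⌋} {s′ : Term S ⌊ a′ ⌋ ⌊ b′ ⌋} {α : a ⇄ a′} {β : b ⇄ b′}
          {π : (b ⊞ c) ⇄ (a ⊞ d)} {π′ : (b′ ⊞ c′) ⇄ (a′ ⊞ d′)} {γ : c ⇄ c′} {δ : d ⇄ d′} →
          Sq α s s′ β → (∀ x → to (α ⊞₁ δ) (to π x) ≡ to π′ (to (β ⊞₁ γ) x)) →
          Sq γ (loop s π) (loop s′ π′) δ
loop-sq {d = d} {d′ = d′} {α = α} {δ = δ} h e = sq-Tr (sq-⨾ (sq-⟪⟫ {π′ = α ⊞₁ δ} e)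
  (sq-⊗ h (sq-≈ (≈-sym (id≈ d)) (≈-sym (id≈ d′)) (sq-⟪⟫ {π = δ} {π′ = δ} {α = idᵇ} {β = idᵇ} λ _ → refl))))

tr-⊗-tr : ∀ b c d b′ c′ d′ {F : Term S ⌊ b ⊞ c ⌋ ⌊ b ⊞ d ⌋} {F′ : Term S ⌊ b′ ⊞ c′ ⌋ ⌊ b′ ⊞ d′ ⌋}
          {H : Term S ⌊ (b ⊞ b′) ⊞ (c ⊞ c′) ⌋ ⌊ (b ⊞ b′) ⊞ (d ⊞ d′) ⌋} →
          Sq (midᵇ b c b′ c′) (F ⊗ F′) H (midᵇ b d b′ d′) →
          Tr ⌊ b ⌋ F ⊗ Tr ⌊ b′ ⌋ F′ ≈ Tr ⌊ b ⊞ b′ ⌋ H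
tr-⊗-tr {S = S} b c d b′ c′ d′ {F} {F′} {H} h = begin
  Tr ⌊ b ⌋ F ⊗ Tr ⌊ b′ ⌋ F′
    ≈⟨ tr-⊗ʳ b′ c′ d′ c d ⟩
  Tr ⌊ b′ ⌋ (conj (exchᵇ b′ c c′) (exchᵇ b′ d d′) (Tr ⌊ b ⌋ F ⊗ F′))
    ≈⟨ Tr-cong (⨾-congʳ (⨾-congˡ (tr-⊗ˡ b c d (b′ ⊞ c′) (b′ ⊞ d′)))) ⟩
  Tr ⌊ b′ ⌋ (conj (exchᵇ b′ c c′) (exchᵇ b′ d d′) (Tr ⌊ b ⌋ G))
    ≈⟨ Tr-cong (≈-sym (tightening ⟪ exchᵇ b′ c c′ ⟫ G ⟪ exchᵇ b′ d d′ ⁻¹ ⟫)) ⟩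
  Tr ⌊ b′ ⌋ (Tr ⌊ b ⌋ ((id ⌊ b ⌋ ⊗ ⟪ exchᵇ b′ c c′ ⟫) ⨾ G ⨾ (id ⌊ b ⌋ ⊗ ⟪ exchᵇ b′ d d′ ⁻¹ ⟫)))
    ≈⟨ Tr-cong (Tr-cong (⨾-cong (⨾-congʳ (id⊗⟪⟫ b (exchᵇ b′ c c′)))
         (≈-trans (id⊗⟪⟫ b (exchᵇ b′ d d′ ⁻¹)) (⟪⟫-cong (idᵇ {b} ⊞₁ (exchᵇ b′ d d′ ⁻¹)) ((idᵇ {b} ⊞₁ exchᵇ b′ d d′) ⁻¹) λ _ → refl)))) ⟩
  Tr ⌊ b′ ⌋ (Tr ⌊ b ⌋ (conj (idᵇ {b} ⊞₁ exchᵇ b′ c c′) (idᵇ {b} ⊞₁ exchᵇ b′ d d′) G))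
    ≈⟨ ≈-sym (tr-tr b b′ (c ⊞ c′) (d ⊞ d′) {F = H} (sq-cong
         (sq-⍮ (sq-⍮ (sq-sym h)
           (sq-sym (sq-conj (assocʳ b c (b′ ⊞ c′) ⁻¹) (assocʳ b d (b′ ⊞ d′) ⁻¹) (F ⊗ F′))))
           (sq-sym (sq-conj (idᵇ {b} ⊞₁ exchᵇ b′ c c′) (idᵇ {b} ⊞₁ exchᵇ b′ d d′) G)))
         pointwise pointwise)) ⟩
  Tr ⌊ b ⊞ b′ ⌋ H ∎
  where
  G : Term S ⌊ b ⊞ (c ⊞ (b′ ⊞ c′)) ⌋ ⌊ b ⊞ (d ⊞ (b′ ⊞ d′)) ⌋
  G = conj (assocʳ b c (b′ ⊞ c′) ⁻¹) (assocʳ b d (b′ ⊞ d′) ⁻¹) (F ⊗ F′)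
  pointwise : ∀ {c c′} v →
    to (midᵇ b c b′ c′ ⁻¹ ⍮ assocʳ b c (b′ ⊞ c′) ⍮ (idᵇ {b} ⊞₁ exchᵇ b′ c c′) ⁻¹) v
    ≡ to (assocʳ b b′ (c ⊞ c′)) v
  pointwise (inj₁ (inj₁ _)) = refl
  pointwise (inj₁ (inj₂ _)) = refl
  pointwise (inj₂ (inj₁ _)) = refl
  pointwise (inj₂ (inj₂ _)) = refl

loop-⊗ : (s : Term S ⌊ a ⌋ ⌊ b ⌋) (s′ : Term S ⌊ a′ ⌋ ⌊ b′ ⌋)
         (π : (b ⊞ c) ⇄ (a ⊞ d)) (π′ : (b′ ⊞ c′) ⇄ (a′ ⊞ d′)) →
         loop s π ⊗ loop s′ π′
         ≈ loop {a = a ⊞ a′} {b = b ⊞ b′} {m = c ⊞ c′} {n = d ⊞ d′} (s ⊗ s′)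
             (midᵇ b b′ c c′ ⍮ (π ⊞₁ π′) ⍮ midᵇ a d a′ d′)
loop-⊗ {a = a} {b = b} {a′ = a′} {b′ = b′} {c = c} {d = d} {c′ = c′} {d′ = d′} s s′ π π′ =
  tr-⊗-tr b c d b′ c′ d′ (sq-≈
    (≈-trans (⨾-congʳ (≈-sym (⟪⟫-⊗ _ _))) (≈-sym (⊗-⨾ _ _ _ _)))
    (⨾-congˡ (⊗-congˡ (⊗-id {m = ⌊ d ⌋} {n = ⌊ d′ ⌋})))
    (sq-⨾ (sq-⟪⟫ {π = midᵇ b c b′ c′} {π′ = midᵇ a d a′ d′} {α = π ⊞₁ π′}
            {β = midᵇ b b′ c c′ ⍮ (π ⊞₁ π′) ⍮ midᵇ a d a′ d′}
            λ { (inj₁ (inj₁ _)) → refl ; (inj₁ (inj₂ _)) → refl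
              ; (inj₂ (inj₁ _)) → refl ; (inj₂ (inj₂ _)) → refl })
          (sq-mid a d a′ d′ b d b′ d′)))

loop-Tr : ∀ x m n (s : Term S ⌊ a ⌋ ⌊ b ⌋) (π : (b ⊞ (x ⊞ m)) ⇄ (a ⊞ (x ⊞ n))) →
          Tr ⌊ x ⌋ (loop {m = x ⊞ m} {n = x ⊞ n} s π)
          ≈ loop {a = a ⊞ x} {b = b ⊞ x} {m = m} {n = n} (s ⊗ id ⌊ x ⌋) (assocʳ b x m ⍮ π ⍮ assocʳ a x n ⁻¹)
loop-Tr {a = a} {b = b} x m n s π = ≈-sym (tr-tr b x m n (sq-⨾
  (sq-⟪⟫ {π = assocʳ b x m} {π′ = assocʳ a x n} {α = assocʳ b x m ⍮ π ⍮ assocʳ a x n ⁻¹} {β = π}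
    λ v → to-from (assocʳ a x n) _)
  (sq-≈ ≈-refl (⊗-congˡ ⊗-id) (sq-assoc a x n b x n))))

loop-yank : ∀ m n (s : Term S ⌊ a ⌋ ⌊ b ⌋) (π : (b ⊞ (fin 1 ⊞ m)) ⇄ (a ⊞ (fin 1 ⊞ n)))
            (π′ : (b ⊞ m) ⇄ (a ⊞ n)) → IsTrace₁ (exchᵇ (fin 1) b m ⍮ π ⍮ exchᵇ a (fin 1) n) π′ →
            Tr 1 (loop {m = fin 1 ⊞ m} {n = fin 1 ⊞ n} s π) ≈ loop {m = m} {n = n} s π′
loop-yank {a = a} {b = b} m n s π π′ t = begin
  Tr 1 (Tr ⌊ b ⌋ (⟪ π ⟫ ⨾ (s ⊗ id (1 + ⌊ n ⌋))))
    ≈⟨ tr-exch b (fin 1) m n _ ⟩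
  Tr ⌊ b ⌋ (Tr 1 (conj (exchᵇ (fin 1) b m) (exchᵇ (fin 1) b n) (⟪ π ⟫ ⨾ (s ⊗ id (1 + ⌊ n ⌋)))))
    ≈⟨ Tr-cong (Tr-cong (≈-sym (sq⇒conj (sq-⨾
         (sq-⟪⟫ {π = exchᵇ (fin 1) b m} {π′ = exchᵇ a (fin 1) n ⁻¹}
                {α = exchᵇ (fin 1) b m ⍮ π ⍮ exchᵇ a (fin 1) n} {β = π}
            λ v → from-to (exchᵇ a (fin 1) n) _)
         (sq-cong (sq-≈ ≈-refl (⊗-congˡ ⊗-id) (sq-sym (sq-exch a (fin 1) n b (fin 1) n)))
            (λ _ → refl) λ { (inj₁ _) → refl ; (inj₂ (inj₁ _)) → refl ; (inj₂ (inj₂ _)) → refl }))))) ⟩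
  Tr ⌊ b ⌋ (Tr 1 (⟪ exchᵇ (fin 1) b m ⍮ π ⍮ exchᵇ a (fin 1) n ⟫ ⨾ (id 1 ⊗ (s ⊗ id ⌊ n ⌋))))
    ≈⟨ Tr-cong (≈-trans (tightenʳ _ _) (⨾-congʳ (tr-perm t))) ⟩
  Tr ⌊ b ⌋ (⟪ π′ ⟫ ⨾ (s ⊗ id ⌊ n ⌋)) ∎

-- Tensor products of generators

Box : ∀ S k (l : Fin k → Gen S) → Term S (total k (dom S ∘ l)) (total k (cod S ∘ l))
Box S zero    l = id 0
Box S (suc k) l = gen (l zero) ⊗ Box S k (l ∘ suc)

⟪Σ-suc⟫ : ∀ k f → ⟪_⟫ {S = S} (Σ-suc k f) ≈ id (total (suc k) f)
⟪Σ-suc⟫ k f = ≈-trans (⟪⟫-perm (Σ-suc k f) idₚ λ _ → refl) perm-id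

sq-Σ-suc : ∀ k f g {s : Term S (total (suc k) f) (total (suc k) g)} → Sq (Σ-suc k f) s s (Σ-suc k g)
sq-Σ-suc k f g = sq (≈-trans (⨾-congˡ (⟪Σ-suc⟫ k g)) (≈-trans (⨾-idʳ _)
  (≈-trans (≈-sym (⨾-idˡ _)) (⨾-congʳ (≈-sym (⟪Σ-suc⟫ k f))))))

pullᵇ : ∀ k (e : Fin (suc k)) f → Σᶜ (suc k) f ⇄ (fin (f e) ⊞ Σᶜ k (f ∘ punchIn e))
pullᵇ k       zero    f = Σ-suc k f
pullᵇ (suc k) (suc e) f =
  Σ-suc (suc k) f ⍮ (idᵇ {fin (f zero)} ⊞₁ pullᵇ k e (f ∘ suc))
  ⍮ exchᵇ (fin (f zero)) (fin (f (suc e))) (Σᶜ k (f ∘ suc ∘ punchIn e))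
  ⍮ (idᵇ {fin (f (suc e))} ⊞₁ Σ-suc k (f ∘ punchIn (suc e)) ⁻¹)

pull-here : ∀ k (e : Fin (suc k)) f i → from (pullᵇ k e f) (inj₁ i) ≡ (e , i)
pull-here k       zero    f i = refl
pull-here (suc k) (suc e) f i rewrite pull-here k e (f ∘ suc) i = refl

pull-there : ∀ k (e : Fin (suc k)) f e′ i → from (pullᵇ k e f) (inj₂ (e′ , i)) ≡ (punchIn e e′ , i)
pull-there k       zero    f e′ i = refl
pull-there (suc k) (suc e) f zero i = refl
pull-there (suc k) (suc e) f (suc e′) i rewrite pull-there k e (f ∘ suc) e′ i = refl

Box-pull : ∀ S k (e : Fin (suc k)) (l : Fin (suc k) → Gen S) →
           Sq (pullᵇ k e (dom S ∘ l)) (Box S (suc k) l)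
              (gen (l e) ⊗ Box S k (l ∘ punchIn e)) (pullᵇ k e (cod S ∘ l))
Box-pull S k zero l = sq-Σ-suc k (dom S ∘ l) (cod S ∘ l)
Box-pull S (suc k) (suc e) l =
  sq-⍮ (sq-⍮ (sq-⍮ (sq-Σ-suc (suc k) (dom S ∘ l) (cod S ∘ l))
    (sq-⊗ (sq-refl {a = fin (dom S (l zero))} {b = fin (cod S (l zero))} (gen (l zero)))
          (Box-pull S k e (l ∘ suc))))
    (sq-exch (fin (dom S (l zero))) (fin (dom S (l (suc e)))) (Σᶜ k (dom S ∘ l ∘ suc ∘ punchIn e))
             (fin (cod S (l zero))) (fin (cod S (l (suc e)))) (Σᶜ k (cod S ∘ l ∘ suc ∘ punchIn e))))
    (sq-⊗ (sq-refl {a = fin (dom S (l (suc e)))} {b = fin (cod S (l (suc e)))} (gen (l (suc e))))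
          (sq-sym (sq-Σ-suc k (dom S ∘ l ∘ punchIn (suc e)) (cod S ∘ l ∘ punchIn (suc e)))))

Σ-≡ : ∀ {f : Fin k → ℕ} {e e′ : Fin k} {i : Fin (f e)} {i′ : Fin (f e′)} →
      e ≡ e′ → toℕ i ≡ toℕ i′ → _≡_ {A = Σ (Fin k) (Fin ∘ f)} (e , i) (e′ , i′)
Σ-≡ refl h = cong (_ ,_) (toℕ-injective h)

castᵇ : .(m ≡ n) → fin m ⇄ fin n
castᵇ e = record
  { to = Fin.cast e ; from = Fin.cast (sym e)
  ; to-from = λ y → toℕ-injective (trans (toℕ-cast e _) (toℕ-cast (sym e) y))
  ; from-to = λ x → toℕ-injective (trans (toℕ-cast (sym e) _) (toℕ-cast e x))
  }

slotsᵇ : ∀ {A : Set} (f : A → ℕ) (l : Fin k → A) (l′ : Fin k′ → A) (ε : Permutation k k′) →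
         (∀ e → l′ (ε ⟨$⟩ʳ e) ≡ l e) → Σᶜ k (f ∘ l) ⇄ Σᶜ k′ (f ∘ l′)
slotsᵇ f l l′ ε h = record
  { to = λ (e , i) → ε ⟨$⟩ʳ e , Fin.cast (forth e) i
  ; from = λ (e , i) → ε ⟨$⟩ˡ e , Fin.cast (back e) i
  ; to-from = λ (e , i) → Σ-≡ (perm-inverseʳ ε)
      (trans (toℕ-cast (forth (ε ⟨$⟩ˡ e)) (Fin.cast (back e) i)) (toℕ-cast (back e) i))
  ; from-to = λ (e , i) → Σ-≡ (perm-inverseˡ ε)
      (trans (toℕ-cast (back (ε ⟨$⟩ʳ e)) (Fin.cast (forth e) i)) (toℕ-cast (forth e) i))
  }
  where
  forth : ∀ e → f (l e) ≡ f (l′ (ε ⟨$⟩ʳ e))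
  forth e = cong f (sym (h e))
  back : ∀ e → f (l′ e) ≡ f (l (ε ⟨$⟩ˡ e))
  back e = cong f (trans (cong l′ (sym (perm-inverseʳ ε))) (h (ε ⟨$⟩ˡ e)))

sq-gen : ∀ S {φ φ′ : Gen S} (e : φ ≡ φ′) →
         Sq (castᵇ (cong (dom S) e)) (gen φ) (gen φ′) (castᵇ (cong (cod S) e))
sq-gen S {φ = φ} refl = sq-cong (sq-refl {a = fin (dom S φ)} {b = fin (cod S φ)} (gen φ))
  (λ x → sym (cast-is-id refl x)) (λ x → sym (cast-is-id refl x))

Box-perm : ∀ S k k′ (l : Fin k → Gen S) (l′ : Fin k′ → Gen S) (ε : Permutation k k′)
           (h : ∀ e → l′ (ε ⟨$⟩ʳ e) ≡ l e) →
           Sq (slotsᵇ (dom S) l l′ ε h) (Box S k l) (Box S k′ l′) (slotsᵇ (cod S) l l′ ε h)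
Box-perm S zero zero l l′ ε h = sq (≈-trans (⨾-idˡ _) (≈-trans (≈-trans
  (⟪⟫-perm (slotsᵇ (cod S) l l′ ε h) idₚ λ ()) (≈-sym (⟪⟫-perm (slotsᵇ (dom S) l l′ ε h) idₚ λ ()))) (≈-sym (⨾-idʳ _))))
Box-perm S zero (suc k′) l l′ ε h with () ← ε ⟨$⟩ˡ zero
Box-perm S (suc k) zero l l′ ε h with () ← ε ⟨$⟩ʳ zero
Box-perm S (suc k) (suc k′) l l′ ε h = sq-cong
  (sq-⍮ (sq-⍮ (sq-Σ-suc k (dom S ∘ l) (cod S ∘ l)) (sq-⊗ (sq-gen S (sym (h zero))) (Box-perm S k k′ (l ∘ suc) (l′ ∘ punchIn e₀) ε′ h′)))
        (sq-sym (Box-pull S k′ e₀ l′)))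
  (pointwise (dom S)) (pointwise (cod S))
  where
  e₀ = ε ⟨$⟩ʳ zero
  ε′ = remove zero ε
  h′ : ∀ e → l′ (punchIn e₀ (ε′ ⟨$⟩ʳ e)) ≡ l (suc e)
  h′ e = trans (cong l′ (sym (punchIn-permute ε zero e))) (h (suc e))
  pointwise : ∀ f x →
    to (Σ-suc k (f ∘ l) ⍮ (castᵇ (cong f (sym (h zero))) ⊞₁ slotsᵇ f (l ∘ suc) (l′ ∘ punchIn e₀) ε′ h′) ⍮ pullᵇ k′ e₀ (f ∘ l′) ⁻¹) x
    ≡ to (slotsᵇ f l l′ ε h) x
  pointwise f (zero , i) = pull-here k′ e₀ (f ∘ l′) _
  pointwise f (suc e , i) = trans (pull-there k′ e₀ (f ∘ l′) _ _)
    (Σ-≡ (sym (punchIn-permute ε zero e)) (trans (toℕ-cast (cong f (sym (h′ e))) i) (sym (toℕ-cast (cong f (sym (h (suc e)))) i))))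

splitᵇ : ∀ k k′ f → Σᶜ (k + k′) f ⇄ (Σᶜ k (f ∘ (_↑ˡ k′)) ⊞ Σᶜ k′ (f ∘ (k ↑ʳ_)))
splitᵇ zero k′ f = record
  { to = inj₂ ; from = λ { (inj₁ ()) ; (inj₂ x) → x }
  ; to-from = λ { (inj₁ ()) ; (inj₂ x) → refl } ; from-to = λ _ → refl }
splitᵇ (suc k) k′ f =
  Σ-suc (k + k′) f ⍮ (idᵇ {fin (f zero)} ⊞₁ splitᵇ k k′ (f ∘ suc))
  ⍮ assocʳ (fin (f zero)) (Σᶜ k (f ∘ suc ∘ (_↑ˡ k′))) (Σᶜ k′ (f ∘ suc ∘ (k ↑ʳ_))) ⁻¹
  ⍮ (Σ-suc k (f ∘ (_↑ˡ k′)) ⁻¹ ⊞₁ idᵇ {Σᶜ k′ (f ∘ suc ∘ (k ↑ʳ_))})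

split-left : ∀ k k′ f e i → from (splitᵇ k k′ f) (inj₁ (e , i)) ≡ (e ↑ˡ k′ , i)
split-left (suc k) k′ f zero    i = refl
split-left (suc k) k′ f (suc e) i rewrite split-left k k′ (f ∘ suc) e i = refl

split-right : ∀ k k′ f e i → from (splitᵇ k k′ f) (inj₂ (e , i)) ≡ (k ↑ʳ e , i)
split-right zero    k′ f e i = refl
split-right (suc k) k′ f e i rewrite split-right k k′ (f ∘ suc) e i = refl

Box-split : ∀ S k k′ (l : Fin (k + k′) → Gen S) →
            Sq (splitᵇ k k′ (dom S ∘ l)) (Box S (k + k′) l)
               (Box S k (l ∘ (_↑ˡ k′)) ⊗ Box S k′ (l ∘ (k ↑ʳ_))) (splitᵇ k k′ (cod S ∘ l))
Box-split S zero k′ l = sq (≈-trans (⨾-congˡ (trivial (cod S ∘ l)))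
  (≈-trans (⨾-idʳ _) (≈-trans (≈-sym (⊗-idˡ _)) (≈-trans (≈-sym (⨾-idˡ _))
    (⨾-congʳ (≈-sym (trivial (dom S ∘ l))))))))
  where
  trivial : ∀ f → ⟪_⟫ {S = S} (splitᵇ zero k′ f) ≈ id (total k′ f)
  trivial f = ≈-trans (⟪⟫-perm (splitᵇ zero k′ f) idₚ λ _ → refl) perm-id
Box-split S (suc k) k′ l =
  sq-⍮ (sq-⍮ (sq-⍮ (sq-Σ-suc (k + k′) (dom S ∘ l) (cod S ∘ l))
    (sq-⊗ (sq-refl {a = fin (dom S (l zero))} {b = fin (cod S (l zero))} (gen (l zero)))
          (Box-split S k k′ (l ∘ suc))))
    (sq-sym (sq-assoc (fin (dom S (l zero))) (Σᶜ k (dom S ∘ l ∘ suc ∘ (_↑ˡ k′))) (Σᶜ k′ (dom S ∘ l ∘ suc ∘ (k ↑ʳ_)))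
                      (fin (cod S (l zero))) (Σᶜ k (cod S ∘ l ∘ suc ∘ (_↑ˡ k′))) (Σᶜ k′ (cod S ∘ l ∘ suc ∘ (k ↑ʳ_))))))
    (sq-⊗ (sq-sym (sq-Σ-suc k (dom S ∘ l ∘ (_↑ˡ k′)) (cod S ∘ l ∘ (_↑ˡ k′))))
          (sq-refl {a = Σᶜ k′ (dom S ∘ l ∘ (suc k ↑ʳ_))} {b = Σᶜ k′ (cod S ∘ l ∘ (suc k ↑ʳ_))} _))

-- Monogamous cospans, by bijections

Sources Targets : Hypergraph S → Code
Sources {S} F = Σᶜ (#E F) (dom S ∘ label F)
Targets {S} F = Σᶜ (#E F) (cod S ∘ label F)

sourceAt : (F : Hypergraph S) → El (Sources F) → Fin (#V F)
sourceAt F (e , i) = lookup (sources F e) (Fin.cast (sym (arity F e)) i)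

targetAt : (F : Hypergraph S) → El (Targets F) → Fin (#V F)
targetAt F (e , i) = lookup (targets F e) (Fin.cast (sym (coarity F e)) i)

lookup-cong : ∀ {A : Set} {xs ys : List A} → xs ≡ ys → (i : Fin (length xs)) (j : Fin (length ys)) →
              toℕ i ≡ toℕ j → lookup xs i ≡ lookup ys j
lookup-cong {xs = xs} refl i j h = cong (lookup xs) (toℕ-injective h)

lookup-map : ∀ {A B : Set} (f : A → B) xs (i : Fin (length (map f xs))) (j : Fin (length xs)) →
             toℕ i ≡ toℕ j → lookup (map f xs) i ≡ f (lookup xs j)
lookup-map f (x ∷ xs) zero    zero    h = refl
lookup-map f (x ∷ xs) (suc i) (suc j) h = lookup-map f xs i j (Data.Nat.Properties.suc-injective h)
  where import Data.Nat.Properties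

source-natural : (h : X ⟶ Y) (e : Fin (#E X)) (e′ : Fin (#E Y)) → onE h e ≡ e′ →
                 ∀ i j → toℕ i ≡ toℕ j → onV h (sourceAt X (e , i)) ≡ sourceAt Y (e′ , j)
source-natural {X = X} {Y = Y} h e _ refl i j i≡j = sym (trans
  (lookup-cong (onE-sources h e) _ (Fin.cast (sym (trans (length-map (onV h) (sources X e)) (arity X e))) i)
    (trans (toℕ-cast _ j) (trans (sym i≡j) (sym (toℕ-cast _ i)))))
  (lookup-map (onV h) (sources X e) _ _ (trans (toℕ-cast _ i) (sym (toℕ-cast _ i)))))

target-natural : (h : X ⟶ Y) (e : Fin (#E X)) (e′ : Fin (#E Y)) → onE h e ≡ e′ →
                 ∀ i j → toℕ i ≡ toℕ j → onV h (targetAt X (e , i)) ≡ targetAt Y (e′ , j)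
target-natural {X = X} {Y = Y} h e _ refl i j i≡j = sym (trans
  (lookup-cong (onE-targets h e) _ (Fin.cast (sym (trans (length-map (onV h) (targets X e)) (coarity X e))) i)
    (trans (toℕ-cast _ j) (trans (sym i≡j) (sym (toℕ-cast _ i)))))
  (lookup-map (onV h) (targets X e) _ _ (trans (toℕ-cast _ i) (sym (toℕ-cast _ i)))))

-- Partial monogamy as two bijections onto the vertices: every vertex is consumed exactly once,
-- by a source slot or an output, and produced exactly once, by a target slot or an input,
-- except that the isolated vertices off the boundary (the circles) count as their own
-- consumers and producers.
record Monogamy (P : Cospan S m n) : Set where
  no-eta-equality
  field
    circles  : ℕ
    consumer : ((Sources (apex P) ⊞ fin circles) ⊞ fin n) ⇄ fin (#V (apex P))
    producer : ((Targets (apex P) ⊞ fin circles) ⊞ fin m) ⇄ fin (#V (apex P))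
    consumer-source : ∀ x → to consumer (inj₁ (inj₁ x)) ≡ sourceAt (apex P) x
    consumer-output : ∀ o → to consumer (inj₂ o) ≡ onV (outputs P) o
    producer-target : ∀ x → to producer (inj₁ (inj₁ x)) ≡ targetAt (apex P) x
    producer-input  : ∀ o → to producer (inj₂ o) ≡ onV (inputs P) o
    circle : ∀ c → to consumer (inj₁ (inj₂ c)) ≡ to producer (inj₁ (inj₂ c))

open Monogamy public

wiring : {P : Cospan S m n} (M : Monogamy P) →
         ((Targets (apex P) ⊞ fin (circles M)) ⊞ fin m) ⇄ ((Sources (apex P) ⊞ fin (circles M)) ⊞ fin n)
wiring M = producer M ⍮ consumer M ⁻¹

nf : {P : Cospan S m n} → Monogamy P → Term S m n
nf {S = S} {m = m} {n = n} {P = P} M =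
  loop {a = Sources F ⊞ fin (circles M)} {b = Targets F ⊞ fin (circles M)} {m = fin m} {n = fin n}
       (Box S (#E F) (label F) ⊗ id (circles M)) (wiring M)
  where F = apex P

infix 4 _≅_

record _≅_ {S m n} (P Q : Cospan S m n) : Set where
  field
    fwd : apex P ⟶ apex Q
    bwd : apex Q ⟶ apex P
    fwd-bwdⱽ : ∀ v → onV fwd (onV bwd v) ≡ v
    fwd-bwdᴱ : ∀ e → onE fwd (onE bwd e) ≡ e
    bwd-fwdⱽ : ∀ v → onV bwd (onV fwd v) ≡ v
    bwd-fwdᴱ : ∀ e → onE bwd (onE fwd e) ≡ e
    fwd-inputs  : ∀ a → onV fwd (onV (inputs P) a) ≡ onV (inputs Q) a
    fwd-outputs : ∀ a → onV fwd (onV (outputs P) a) ≡ onV (outputs Q) a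

open _≅_ public

≅-V : {P Q : Cospan S m n} → P ≅ Q → fin (#V (apex P)) ⇄ fin (#V (apex Q))
≅-V θ = record { to = onV (fwd θ) ; from = onV (bwd θ) ; to-from = fwd-bwdⱽ θ ; from-to = bwd-fwdⱽ θ }

≅-E : {P Q : Cospan S m n} → P ≅ Q → Permutation (#E (apex P)) (#E (apex Q))
≅-E θ = Data.Fin.Permutation.permutation (onE (fwd θ)) (onE (bwd θ)) (fwd-bwdᴱ θ) (bwd-fwdᴱ θ)
  where import Data.Fin.Permutation

middle : ∀ {a a′ w w′ c c′} (θ : ((a ⊞ w) ⊞ c) ⇄ ((a′ ⊞ w′) ⊞ c′)) (α : a ⇄ a′) (γ : c ⇄ c′) →
         (∀ x → to θ (inj₁ (inj₁ x)) ≡ inj₁ (inj₁ (to α x))) →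
         (∀ x → to θ (inj₂ x) ≡ inj₂ (to γ x)) →
         Σ[ κ ∈ w ⇄ w′ ] (∀ x → to θ (inj₁ (inj₂ x)) ≡ inj₁ (inj₂ (to κ x)))
middle {w = w} {w′ = w′} θ α γ hα hγ = record
  { to = λ x → proj₁ (forth x)
  ; from = λ y → proj₁ (back y)
  ; to-from = λ y → inj-middle (trans (sym (proj₂ (forth _)))
      (trans (cong (to θ) (sym (proj₂ (back y)))) (to-from θ _)))
  ; from-to = λ x → inj-middle (trans (sym (proj₂ (back _)))
      (trans (cong (from θ) (sym (proj₂ (forth x)))) (from-to θ _)))
  } , λ x → proj₂ (forth x)
  where
  inj-middle : ∀ {A B C : Set} {x y : B} → _≡_ {A = (A ⊎ B) ⊎ C} (inj₁ (inj₂ x)) (inj₁ (inj₂ y)) → x ≡ y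
  inj-middle refl = refl
  forth : ∀ x → Σ[ y ∈ El w′ ] to θ (inj₁ (inj₂ x)) ≡ inj₁ (inj₂ y)
  forth x with to θ (inj₁ (inj₂ x)) in eq
  ... | inj₁ (inj₂ y) = y , refl
  ... | inj₁ (inj₁ y) with () ← to-injective θ (trans eq (trans (cong (inj₁ ∘ inj₁) (sym (to-from α y))) (sym (hα (from α y)))))
  ... | inj₂ y with () ← to-injective θ (trans eq (trans (cong inj₂ (sym (to-from γ y))) (sym (hγ (from γ y)))))
  back : ∀ y → Σ[ x ∈ El w ] from θ (inj₁ (inj₂ y)) ≡ inj₁ (inj₂ x)
  back y with from θ (inj₁ (inj₂ y)) in eq
  ... | inj₁ (inj₂ x) = x , refl
  ... | inj₁ (inj₁ x) with () ← trans (sym (hα x)) (trans (cong (to θ) (sym eq)) (to-from θ _))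
  ... | inj₂ x with () ← trans (sym (hγ x)) (trans (cong (to θ) (sym eq)) (to-from θ _))

nf-≅ : {P Q : Cospan S m n} → P ≅ Q → (M : Monogamy P) (N : Monogamy Q) → nf M ≈ nf N
nf-≅ {S = S} {m = m} {n = n} {P = P} {Q = Q} θ M N = sq⇒≈ {a = fin m} {b = fin n} (loop-sq {γ = idᵇ} {δ = idᵇ}
  (sq-⊗ (Box-perm S (#E F) (#E G) (label F) (label G) (≅-E θ) (onE-label (fwd θ)))
        (sq-≈ (≈-sym (id≈ (fin (circles M)))) (≈-sym (id≈ (fin (circles N))))
          (sq-⟪⟫ {π = κ} {π′ = κ} {α = idᵇ} {β = idᵇ} λ _ → refl)))
  λ x → trans (sym (from-to (consumer N) _)) (trans (cong (from (consumer N))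
    (trans (consumers (to (wiring M) x)) (trans (cong (onV (fwd θ)) (to-from (consumer M) _)) (producers x))))
    refl))
  where
  F = apex P
  G = apex Q
  α = slotsᵇ (dom S) (label F) (label G) (≅-E θ) (onE-label (fwd θ))
  β = slotsᵇ (cod S) (label F) (label G) (≅-E θ) (onE-label (fwd θ))
  source-slots : ∀ x → to (consumer N) (inj₁ (inj₁ (to α x))) ≡ onV (fwd θ) (to (consumer M) (inj₁ (inj₁ x)))
  source-slots (e , i) = trans (consumer-source N _) (trans
    (sym (source-natural (fwd θ) e _ refl i _ (sym (toℕ-cast _ i))))
    (cong (onV (fwd θ)) (sym (consumer-source M (e , i)))))
  target-slots : ∀ x → to (producer N) (inj₁ (inj₁ (to β x))) ≡ onV (fwd θ) (to (producer M) (inj₁ (inj₁ x)))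
  target-slots (e , i) = trans (producer-target N _) (trans
    (sym (target-natural (fwd θ) e _ refl i _ (sym (toℕ-cast _ i))))
    (cong (onV (fwd θ)) (sym (producer-target M (e , i)))))
  outs : ∀ x → to (consumer N) (inj₂ x) ≡ onV (fwd θ) (to (consumer M) (inj₂ x))
  outs x = trans (consumer-output N x) (trans (sym (fwd-outputs θ x))
    (cong (onV (fwd θ)) (sym (consumer-output M x))))
  ins′ : ∀ x → to (producer N) (inj₂ x) ≡ onV (fwd θ) (to (producer M) (inj₂ x))
  ins′ x = trans (producer-input N x) (trans (sym (fwd-inputs θ x))
    (cong (onV (fwd θ)) (sym (producer-input M x))))
  invert : ∀ {a b} (π : a ⇄ b) {x y} → to π x ≡ y → from π y ≡ x
  invert π e = trans (cong (from π) (sym e)) (from-to π _)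
  κ′ = middle (consumer M ⍮ ≅-V θ ⍮ consumer N ⁻¹) α idᵇ
         (λ x → invert (consumer N) (source-slots x)) (λ x → invert (consumer N) (outs x))
  κ = proj₁ κ′
  circles-κ : ∀ x → to (consumer N) (inj₁ (inj₂ (to κ x))) ≡ onV (fwd θ) (to (consumer M) (inj₁ (inj₂ x)))
  circles-κ x = trans (cong (to (consumer N)) (sym (proj₂ κ′ x))) (to-from (consumer N) _)
  consumers : ∀ y → to (consumer N) (to ((α ⊞₁ κ) ⊞₁ idᵇ) y) ≡ onV (fwd θ) (to (consumer M) y)
  consumers (inj₁ (inj₁ x)) = source-slots x
  consumers (inj₁ (inj₂ x)) = circles-κ x
  consumers (inj₂ x) = outs x
  producers : ∀ y → onV (fwd θ) (to (producer M) y) ≡ to (producer N) (to ((β ⊞₁ κ) ⊞₁ idᵇ) y)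
  producers (inj₁ (inj₁ x)) = sym (target-slots x)
  producers (inj₁ (inj₂ x)) = trans (cong (onV (fwd θ)) (sym (circle M x)))
    (trans (sym (circles-κ x)) (circle N (to κ x)))
  producers (inj₂ x) = sym (ins′ x)

infix 4 _⊩_

_⊩_ : Cospan S m n → Term S m n → Set
P ⊩ f = Σ[ M ∈ Monogamy P ] nf M ≈ f

⊩-≈ : {P : Cospan S m n} {f g : Term S m n} → f ≈ g → P ⊩ f → P ⊩ g
⊩-≈ e (M , h) = M , ≈-trans h e

≅-monogamy : {P Q : Cospan S m n} → P ≅ Q → Monogamy P → Monogamy Q
≅-monogamy {S = S} {P = P} {Q = Q} θ M = record
  { circles = circles M
  ; consumer = ((α ⁻¹ ⊞₁ idᵇ) ⊞₁ idᵇ) ⍮ consumer M ⍮ ≅-V θ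
  ; producer = ((β ⁻¹ ⊞₁ idᵇ) ⊞₁ idᵇ) ⍮ producer M ⍮ ≅-V θ
  ; consumer-source = λ (e , i) → trans (cong (onV (fwd θ)) (consumer-source M _))
      (source-natural (fwd θ) _ e (fwd-bwdᴱ θ e) _ i (toℕ-cast _ i))
  ; consumer-output = λ o → trans (cong (onV (fwd θ)) (consumer-output M o)) (fwd-outputs θ o)
  ; producer-target = λ (e , i) → trans (cong (onV (fwd θ)) (producer-target M _))
      (target-natural (fwd θ) _ e (fwd-bwdᴱ θ e) _ i (toℕ-cast _ i))
  ; producer-input = λ o → trans (cong (onV (fwd θ)) (producer-input M o)) (fwd-inputs θ o)
  ; circle = λ x → cong (onV (fwd θ)) (circle M x)
  }
  where
  α = slotsᵇ (dom S) (label (apex P)) (label (apex Q)) (≅-E θ) (onE-label (fwd θ))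
  β = slotsᵇ (cod S) (label (apex P)) (label (apex Q)) (≅-E θ) (onE-label (fwd θ))

⊩-≅ : {P Q : Cospan S m n} {f : Term S m n} → P ≅ Q → P ⊩ f → Q ⊩ f
⊩-≅ θ (M , h) = ≅-monogamy θ M , ≈-trans (≈-sym (nf-≅ θ M (≅-monogamy θ M))) h

⟪join⟫ : ∀ m n → ⟪_⟫ {S = S} (join⇄ m n) ≈ id (m + n)
⟪join⟫ m n = ≈-trans (⟪⟫-perm (join⇄ m n) idₚ λ { (inj₁ _) → refl ; (inj₂ _) → refl }) perm-id

sq-join : ∀ m n m′ n′ {f : Term S (m + n) (m′ + n′)} → Sq (join⇄ m n) f f (join⇄ m′ n′)
sq-join m n m′ n′ = sq (≈-trans (⨾-congˡ (⟪join⟫ m′ n′)) (≈-trans (⨾-idʳ _)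
  (≈-trans (≈-sym (⨾-idˡ _)) (⨾-congʳ (≈-sym (⟪join⟫ m n))))))

sq-join⇒≈ : ∀ m n m′ n′ {f g : Term S (m + n) (m′ + n′)} → Sq (join⇄ m n) f g (join⇄ m′ n′) → f ≈ g
sq-join⇒≈ m n m′ n′ (sq e) = ≈-trans (≈-sym (⨾-idʳ _)) (≈-trans (⨾-congˡ (≈-sym (⟪join⟫ m′ n′)))
  (≈-trans e (≈-trans (⨾-congʳ (⟪join⟫ m n)) (⨾-idˡ _))))

sq-id : (π : a ⇄ b) → Sq {S = S} π (id ⌊ a ⌋) (id ⌊ b ⌋) π
sq-id {a = a} {b = b} π = sq-≈ (≈-sym (id≈ a)) (≈-sym (id≈ b))
  (sq-⟪⟫ {π = π} {π′ = π} {α = idᵇ} {β = idᵇ} λ _ → refl)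

⟪Σ-zero⟫ : ∀ f → ⟪_⟫ {S = S} (Σ-zero f) ≈ id 0
⟪Σ-zero⟫ f = ≈-trans (⟪⟫-perm (Σ-zero f) idₚ λ ()) perm-id

sq-Σ-zero : ∀ f g → Sq {S = S} (Σ-zero f) (id 0) (id 0) (Σ-zero g)
sq-Σ-zero f g = sq (≈-trans (⨾-congˡ (⟪Σ-zero⟫ g)) (⨾-congʳ (≈-sym (⟪Σ-zero⟫ f))))

oneᵇ : ∀ f → Σᶜ 1 f ⇄ fin (f zero)
oneᵇ f = Σ-suc 0 f ⍮ (idᵇ ⊞₁ Σ-zero (f ∘ suc)) ⍮ unitʳ (fin (f zero))

sq-one : ∀ S (l : Fin 1 → Gen S) → Sq (oneᵇ (dom S ∘ l)) (Box S 1 l) (gen (l zero)) (oneᵇ (cod S ∘ l))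
sq-one S l = sq-⍮ (sq-⍮ (sq-Σ-suc 0 (dom S ∘ l) (cod S ∘ l))
  (sq-⊗ (sq-refl {a = fin (dom S (l zero))} {b = fin (cod S (l zero))} (gen (l zero)))
        (sq-Σ-zero (dom S ∘ l ∘ suc) (cod S ∘ l ∘ suc))))
  (sq-unitʳ (fin (dom S (l zero))) (fin (cod S (l zero))))

gen-⊩ : (φ : Gen S) → genᶜ φ ⊩ gen φ
gen-⊩ {S = S} φ = M , ≈-trans (≈-trans nf≈ (Tr-cong (⨾-congʳ (≈-sym (σ-swap (fin (cod S φ)) (fin (dom S φ)))))))
  (≈-trans (≈-sym (⨾-as-Tr (gen φ) (id (cod S φ)))) (⨾-idʳ _))
  where
  one : ∀ (f : Gen S → ℕ) → (Σᶜ 1 (λ _ → f φ) ⊞ fin 0) ⇄ fin (f φ)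
  one f = (oneᵇ (λ _ → f φ) ⊞₁ idᵇ) ⍮ unitʳ (fin (f φ))
  M : Monogamy (genᶜ φ)
  M = record
    { circles = 0
    ; consumer = (one (dom S) ⊞₁ idᵇ) ⍮ join⇄ (dom S φ) (cod S φ)
    ; producer = (one (cod S) ⊞₁ idᵇ) ⍮ swapᵇ (fin (cod S φ)) (fin (dom S φ)) ⍮ join⇄ (dom S φ) (cod S φ)
    ; consumer-source = λ { (zero , i) → sym (lookup-tabulate (_↑ˡ cod S φ) i) }
    ; consumer-output = λ _ → refl
    ; producer-target = λ { (zero , i) → sym (lookup-tabulate (dom S φ ↑ʳ_) i) }
    ; producer-input = λ _ → refl
    ; circle = λ ()
    }
  nf≈ : nf M ≈ loop {a = fin (dom S φ)} {b = fin (cod S φ)} {m = fin (dom S φ)} {n = fin (cod S φ)}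
                    (gen φ) (swapᵇ (fin (cod S φ)) (fin (dom S φ)))
  nf≈ = sq⇒≈ {a = fin (dom S φ)} {b = fin (cod S φ)} (loop-sq {γ = idᵇ} {δ = idᵇ}
    (sq-⍮ (sq-⊗ (sq-one S (λ _ → φ)) (sq-id {a = fin 0} idᵇ))
          (sq-unitʳ (fin (dom S φ)) (fin (cod S φ))))
    λ x → trans (to-from (one (dom S) ⊞₁ idᵇ) _)
                (splitAt-join (dom S φ) (cod S φ) (Sum.swap (to (one (cod S) ⊞₁ idᵇ) x))))

wireᶜ : (ι : fin m ⇄ fin k) (o : fin n ⇄ fin k) → Cospan S m n
wireᶜ {k = k} ι o = record { apex = discrete k ; inputs = pick (to ι) ; outputs = pick (to o) }

wire-⊩ : (ι : fin m ⇄ fin k) (o : fin n ⇄ fin k) → wireᶜ {S = S} ι o ⊩ ⟪ ι ⍮ o ⁻¹ ⟫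
wire-⊩ {m = m} {k = k} {n = n} {S = S} ι o = M , ≈-trans nf≈ (≈-trans (vanishing₀ _)
    (≈-trans (⨾-cong (⟪unitˡ⟫ (ι ⍮ o ⁻¹)) (⊗-idˡ _)) (⨾-idʳ _)))
  where
  none : ∀ f → (Σᶜ 0 f ⊞ fin 0) ⇄ fin 0
  none f = (Σ-zero f ⊞₁ idᵇ) ⍮ unitʳ (fin 0)
  M : Monogamy (wireᶜ ι o)
  M = record
    { circles = 0
    ; consumer = (none _ ⊞₁ o) ⍮ unitˡ (fin k)
    ; producer = (none _ ⊞₁ ι) ⍮ unitˡ (fin k)
    ; consumer-source = λ () ; consumer-output = λ _ → refl
    ; producer-target = λ () ; producer-input = λ _ → refl
    ; circle = λ ()
    }
  nf≈ : nf M ≈ loop {a = fin 0} {b = fin 0} {m = fin m} {n = fin n} (id 0) (idᵇ ⊞₁ (ι ⍮ o ⁻¹))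
  nf≈ = sq⇒≈ {a = fin m} {b = fin n} (loop-sq {γ = idᵇ} {δ = idᵇ}
    (sq-⍮ (sq-⊗ (sq-Σ-zero _ _) (sq-id {a = fin 0} idᵇ)) (sq-unitʳ (fin 0) (fin 0)))
    λ { (inj₁ (inj₂ ())) ; (inj₂ x) → refl })
  ⟪unitˡ⟫ : ∀ {a b} (π : a ⇄ b) → ⟪_⟫ {S = S} (idᵇ {fin 0} ⊞₁ π) ≈ ⟪ π ⟫
  ⟪unitˡ⟫ π = ≈-trans (≈-sym (⟪⟫-⊗ (idᵇ {fin 0}) π))
    (≈-trans (⊗-congʳ (≈-sym (id≈ (fin 0)))) (⊗-idˡ _))

id-⊩ : ∀ n → idᶜ n ⊩ id {S} n
id-⊩ n = ⊩-≈ (⟪⟫-id {a = fin n} _ λ _ → refl) (wire-⊩ {k = n} idᵇ idᵇ)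

≅-boundary : {P : Cospan S m n} {f : discrete m ⟶ apex P} {g : discrete n ⟶ apex P} →
             (∀ i → onV (inputs P) i ≡ onV f i) → (∀ i → onV (outputs P) i ≡ onV g i) →
             P ≅ record { apex = apex P ; inputs = f ; outputs = g }
≅-boundary e h = record
  { fwd = idₕ ; bwd = idₕ
  ; fwd-bwdⱽ = λ _ → refl ; fwd-bwdᴱ = λ _ → refl ; bwd-fwdⱽ = λ _ → refl ; bwd-fwdᴱ = λ _ → refl
  ; fwd-inputs = e ; fwd-outputs = h }
  where
  idₕ : ∀ {X : Hypergraph S} → X ⟶ X
  idₕ = record { onV = λ v → v ; onE = λ e → e ; onE-label = λ _ → refl
               ; onE-sources = λ _ → sym (map-id _) ; onE-targets = λ _ → sym (map-id _) }

σ-⊩ : ∀ m n → σᶜ m n ⊩ σ {S} m n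
σ-⊩ {S} m n = ⊩-≅ (≅-boundary (λ _ → refl) outputs-swap)
  (⊩-≈ σ≈ (wire-⊩ {k = m + n} idᵇ (join⇄ n m ⁻¹ ⍮ swapᵇ (fin n) (fin m) ⍮ join⇄ m n)))
  where
  outputs-swap : ∀ i → join m n (Sum.swap (splitAt n i)) ≡ [ (m ↑ʳ_) , (_↑ˡ n) ]′ (splitAt n i)
  outputs-swap i with splitAt n i
  ... | inj₁ _ = refl
  ... | inj₂ _ = refl
  σ≈ : ⟪_⟫ {S = S} (idᵇ ⍮ (join⇄ n m ⁻¹ ⍮ swapᵇ (fin n) (fin m) ⍮ join⇄ m n) ⁻¹) ≈ σ m n
  σ≈ = ≈-sym (≈-trans (σ-swap (fin m) (fin n)) (sq-join⇒≈ m n n m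
    (sq-⟪⟫ {π = join⇄ m n} {π′ = join⇄ n m} {α = swapᵇ (fin m) (fin n)}
      λ x → cong (join n m ∘ Sum.swap) (sym (splitAt-join m n x)))))

reindexᶜ : fin m′ ⇄ fin m → Cospan S m n → Cospan S m′ n
reindexᶜ γ P = record { apex = apex P ; inputs = inputs P ∘ₕ pick (to γ) ; outputs = outputs P }

reindex-⊩ : (γ : fin m′ ⇄ fin m) {P : Cospan S m n} {f : Term S m n} → P ⊩ f → reindexᶜ γ P ⊩ ⟪ γ ⟫ ⨾ f
reindex-⊩ {m′ = m′} {m = m} {n = n} γ {P} (M , e) = M′ ,
  ≈-trans (≈-trans (≈-sym (⨾-idʳ _)) (⨾-congˡ (id≈ (fin n)))) (≈-trans (square nf-sq) (⨾-congˡ e))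
  where
  M′ : Monogamy (reindexᶜ γ P)
  M′ = record
    { circles = circles M
    ; consumer = consumer M
    ; producer = (idᵇ ⊞₁ γ) ⍮ producer M
    ; consumer-source = consumer-source M ; consumer-output = consumer-output M
    ; producer-target = producer-target M ; producer-input = λ x → producer-input M (to γ x)
    ; circle = circle M
    }
  nf-sq : Sq γ (nf M′) (nf M) (idᵇ {fin n})
  nf-sq = loop-sq {γ = γ} {δ = idᵇ} (sq-refl {a = Sources (apex P) ⊞ fin (circles M)}
    {b = Targets (apex P) ⊞ fin (circles M)} _) λ x → ⊎-map-id _

map-∘-map : ∀ {A B C A′ B′ C′ : Set} (f : B → C) (g : A → B) (f′ : B′ → C′) (g′ : A′ → B′) x →
            Sum.map f f′ (Sum.map g g′ x) ≡ Sum.map (f ∘ g) (f′ ∘ g′) x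
map-∘-map _ _ _ _ (inj₁ _) = refl
map-∘-map _ _ _ _ (inj₂ _) = refl

module Sum-⊩ {S} {m n p q} {P : Cospan S m n} {Q : Cospan S p q} (M : Monogamy P) (N : Monogamy Q) where
  private
    F = apex P
    G = apex Q
    w = circles M
    w′ = circles N

    splitting : (f : Gen S → ℕ) → Σᶜ (#E F + #E G) (f ∘ label (F ⊕ G))
                                ⇄ (Σᶜ (#E F) (f ∘ label F) ⊞ Σᶜ (#E G) (f ∘ label G))
    splitting f = splitᵇ (#E F) (#E G) (f ∘ label (F ⊕ G)) ⍮
      (slotsᵇ f (label (F ⊕ G) ∘ (_↑ˡ #E G)) (label F) idₚ (λ e → sym (onE-label (ι₁ {F = F} {G = G}) e))
       ⊞₁ slotsᵇ f (label (F ⊕ G) ∘ (#E F ↑ʳ_)) (label G) idₚ (λ e → sym (onE-label (ι₂ {G = G} {F = F}) e)))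

    sq-Box : Sq (splitting (dom S)) (Box S (#E F + #E G) (label (F ⊕ G)))
                (Box S (#E F) (label F) ⊗ Box S (#E G) (label G)) (splitting (cod S))
    sq-Box = sq-⍮ (Box-split S (#E F) (#E G) (label (F ⊕ G)))
      (sq-⊗ (Box-perm S (#E F) (#E F) (label (F ⊕ G) ∘ (_↑ˡ #E G)) (label F) idₚ (λ e → sym (onE-label (ι₁ {F = F} {G = G}) e)))
            (Box-perm S (#E G) (#E G) (label (F ⊕ G) ∘ (#E F ↑ʳ_)) (label G) idₚ (λ e → sym (onE-label (ι₂ {G = G} {F = F}) e))))

    split-source : ∀ y → sourceAt (F ⊕ G) (from (splitting (dom S)) y)
                       ≡ join (#V F) (#V G) (Sum.map (sourceAt F) (sourceAt G) y)
    split-source (inj₁ (e , i)) = trans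
      (cong (sourceAt (F ⊕ G)) (split-left (#E F) (#E G) (dom S ∘ label (F ⊕ G)) e _))
      (sym (source-natural (ι₁ {F = F} {G = G}) e _ refl i _ (sym (toℕ-cast _ i))))
    split-source (inj₂ (e , i)) = trans
      (cong (sourceAt (F ⊕ G)) (split-right (#E F) (#E G) (dom S ∘ label (F ⊕ G)) e _))
      (sym (source-natural (ι₂ {G = G} {F = F}) e _ refl i _ (sym (toℕ-cast _ i))))

    split-target : ∀ y → targetAt (F ⊕ G) (from (splitting (cod S)) y)
                       ≡ join (#V F) (#V G) (Sum.map (targetAt F) (targetAt G) y)
    split-target (inj₁ (e , i)) = trans
      (cong (targetAt (F ⊕ G)) (split-left (#E F) (#E G) (cod S ∘ label (F ⊕ G)) e _))
      (sym (target-natural (ι₁ {F = F} {G = G}) e _ refl i _ (sym (toℕ-cast _ i))))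
    split-target (inj₂ (e , i)) = trans
      (cong (targetAt (F ⊕ G)) (split-right (#E F) (#E G) (cod S ∘ label (F ⊕ G)) e _))
      (sym (target-natural (ι₂ {G = G} {F = F}) e _ refl i _ (sym (toℕ-cast _ i))))

    arrange : (f : Gen S → ℕ) → (Σᶜ (#E F + #E G) (f ∘ label (F ⊕ G)) ⊞ fin (w + w′))
              ⇄ ((Σᶜ (#E F) (f ∘ label F) ⊞ fin w) ⊞ (Σᶜ (#E G) (f ∘ label G) ⊞ fin w′))
    arrange f = (splitting f ⊞₁ join⇄ w w′ ⁻¹) ⍮ midᵇ _ _ _ _

    spread : ∀ {a a′ b b′ : Code} {k k′ l l′} → ((a ⊞ b) ⊞ fin k) ⇄ fin l → ((a′ ⊞ b′) ⊞ fin k′) ⇄ fin l′ →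
             (((a ⊞ b) ⊞ (a′ ⊞ b′)) ⊞ fin (k + k′)) ⇄ fin (l + l′)
    spread {k = k} {k′} {l} {l′} π ρ = (idᵇ ⊞₁ join⇄ k k′ ⁻¹) ⍮ midᵇ _ _ _ _ ⍮ (π ⊞₁ ρ) ⍮ join⇄ l l′

  monogamy : Monogamy (P ⊗ᶜ Q)
  monogamy = record
    { circles = w + w′
    ; consumer = (arrange (dom S) ⊞₁ idᵇ) ⍮ spread (consumer M) (consumer N)
    ; producer = (arrange (cod S) ⊞₁ idᵇ) ⍮ spread (producer M) (producer N)
    ; consumer-source = λ x → trans (consumer-source′ (to (splitting (dom S)) x))
        (trans (sym (split-source (to (splitting (dom S)) x))) (cong (sourceAt (F ⊕ G)) (from-to (splitting (dom S)) x)))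
    ; consumer-output = λ o → outputs′ (splitAt n o)
    ; producer-target = λ x → trans (producer-target′ (to (splitting (cod S)) x))
        (trans (sym (split-target (to (splitting (cod S)) x))) (cong (targetAt (F ⊕ G)) (from-to (splitting (cod S)) x)))
    ; producer-input = λ o → inputs′ (splitAt m o)
    ; circle = λ x → circles′ (splitAt w x)
    }
    where
    rest : ∀ f → (El (Σᶜ (#E F) (f ∘ label F)) ⊎ El (Σᶜ (#E G) (f ∘ label G))) ⊎ (Fin w ⊎ Fin w′) → _
    rest f = to (midᵇ (Σᶜ (#E F) (f ∘ label F)) (Σᶜ (#E G) (f ∘ label G)) (fin w) (fin w′))
    consumer-source′ : ∀ y → to (spread (consumer M) (consumer N)) (inj₁ (rest (dom S) (inj₁ y)))
                           ≡ join (#V F) (#V G) (Sum.map (sourceAt F) (sourceAt G) y)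
    consumer-source′ (inj₁ x) = cong (_↑ˡ #V G) (consumer-source M x)
    consumer-source′ (inj₂ x) = cong (#V F ↑ʳ_) (consumer-source N x)
    producer-target′ : ∀ y → to (spread (producer M) (producer N)) (inj₁ (rest (cod S) (inj₁ y)))
                           ≡ join (#V F) (#V G) (Sum.map (targetAt F) (targetAt G) y)
    producer-target′ (inj₁ x) = cong (_↑ˡ #V G) (producer-target M x)
    producer-target′ (inj₂ x) = cong (#V F ↑ʳ_) (producer-target N x)
    circles′ : ∀ y → to (spread (consumer M) (consumer N)) (inj₁ (rest (dom S) (inj₂ y)))
                   ≡ to (spread (producer M) (producer N)) (inj₁ (rest (cod S) (inj₂ y)))
    circles′ (inj₁ x) = cong (_↑ˡ #V G) (circle M x)
    circles′ (inj₂ x) = cong (#V F ↑ʳ_) (circle N x)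
    outputs′ : ∀ (y : Fin n ⊎ Fin q) →
      join (#V F) (#V G) (Sum.map (to (consumer M)) (to (consumer N))
        (to (midᵇ (Sources F ⊞ fin w) (Sources G ⊞ fin w′) (fin n) (fin q)) (inj₂ y)))
      ≡ [ _ , _ ]′ y
    outputs′ (inj₁ x) = cong (_↑ˡ #V G) (consumer-output M x)
    outputs′ (inj₂ x) = cong (#V F ↑ʳ_) (consumer-output N x)
    inputs′ : ∀ (y : Fin m ⊎ Fin p) →
      join (#V F) (#V G) (Sum.map (to (producer M)) (to (producer N))
        (to (midᵇ (Targets F ⊞ fin w) (Targets G ⊞ fin w′) (fin m) (fin p)) (inj₂ y)))
      ≡ [ _ , _ ]′ y
    inputs′ (inj₁ x) = cong (_↑ˡ #V G) (producer-input M x)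
    inputs′ (inj₂ x) = cong (#V F ↑ʳ_) (producer-input N x)

  nf-monogamy : nf monogamy ≈ nf M ⊗ nf N
  nf-monogamy = ≈-trans (≈-sym (sq-join⇒≈ m p n q (sq-sym
      (loop-sq {c = fin (m + p)} {d = fin (n + q)} {π = wiring monogamy} {π′ = total-wiring}
        {γ = join⇄ m p ⁻¹} {δ = join⇄ n q ⁻¹} sq-boxes pointwise))))
    (≈-sym (loop-⊗ _ _ (wiring M) (wiring N)))
    where
    total-wiring = midᵇ (Targets F ⊞ fin w) (Targets G ⊞ fin w′) (fin m) (fin p)
                   ⍮ (wiring M ⊞₁ wiring N) ⍮ midᵇ (Sources F ⊞ fin w) (fin n) (Sources G ⊞ fin w′) (fin q)
    sq-boxes : Sq (arrange (dom S)) (Box S (#E F + #E G) (label (F ⊕ G)) ⊗ id (w + w′))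
                  ((Box S (#E F) (label F) ⊗ id w) ⊗ (Box S (#E G) (label G) ⊗ id w′)) (arrange (cod S))
    sq-boxes = sq-⍮ (sq-⊗ sq-Box (sq-≈ ≈-refl (≈-sym ⊗-id) (sq-sym (sq-join w w′ w w′))))
      (sq-mid (Sources F) (Sources G) (fin w) (fin w′) (Targets F) (Targets G) (fin w) (fin w′))
    mid-inverse : ∀ a b c d x → from (midᵇ a b c d) x ≡ to (midᵇ a c b d) x
    mid-inverse a b c d (inj₁ (inj₁ _)) = refl
    mid-inverse a b c d (inj₁ (inj₂ _)) = refl
    mid-inverse a b c d (inj₂ (inj₁ _)) = refl
    mid-inverse a b c d (inj₂ (inj₂ _)) = refl
    outer : ∀ y → Sum.map (to (arrange (dom S))) (splitAt n) (Sum.map (from (arrange (dom S))) (λ z → z)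
                    (Sum.map (λ z → z) (join n q) y)) ≡ y
    outer (inj₁ y) = cong inj₁ (to-from (arrange (dom S)) y)
    outer (inj₂ y) = cong inj₂ (splitAt-join n q y)
    pointwise : ∀ x → to (arrange (dom S) ⊞₁ join⇄ n q ⁻¹) (to (wiring monogamy) x)
                    ≡ to total-wiring (to (arrange (cod S) ⊞₁ join⇄ m p ⁻¹) x)
    pointwise x = trans (outer (to mid⁻ (Sum.map (from (consumer M)) (from (consumer N))
        (splitAt (#V F) (join (#V F) (#V G) z)))))
      (trans (cong (to mid⁻ ∘ Sum.map (from (consumer M)) (from (consumer N)))
               (splitAt-join (#V F) (#V G) z))
      (trans (mid-inverse (Sources F ⊞ fin w) (Sources G ⊞ fin w′) (fin n) (fin q) (Sum.map (from (consumer M)) (from (consumer N)) z))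
      (cong (to (midᵇ (Sources F ⊞ fin w) (fin n) (Sources G ⊞ fin w′) (fin q)))
        (trans (map-∘-map (from (consumer M)) (to (producer M)) (from (consumer N)) (to (producer N)) (to mid⁺ y₀))
          (cong (to (wiring M ⊞₁ wiring N) ∘ to mid⁺)
            (map-∘-map (λ v → v) (to (arrange (cod S))) (splitAt m) (λ v → v) x))))))
      where
      mid⁻ = midᵇ (Sources F ⊞ fin w) (Sources G ⊞ fin w′) (fin n) (fin q) ⁻¹
      mid⁺ = midᵇ (Targets F ⊞ fin w) (Targets G ⊞ fin w′) (fin m) (fin p)
      y₀ = Sum.map (λ v → v) (splitAt m) (Sum.map (to (arrange (cod S))) (λ v → v) x)
      z = Sum.map (to (producer M)) (to (producer N)) (to mid⁺ y₀)

  summed : P ⊗ᶜ Q ⊩ nf M ⊗ nf N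
  summed = monogamy , nf-monogamy

⊗-⊩ : {P : Cospan S m n} {Q : Cospan S p q} {f : Term S m n} {g : Term S p q} →
      P ⊩ f → Q ⊩ g → P ⊗ᶜ Q ⊩ f ⊗ g
⊗-⊩ (M , e) (N , h) = ⊩-≈ (⊗-cong e h) (Sum-⊩.summed M N)

bijection : (f : El a → El b) → (∀ {x y} → f x ≡ f y → x ≡ y) → (∀ y → Σ[ x ∈ El a ] f x ≡ y) → a ⇄ b
bijection f inj sur = record
  { to = f ; from = λ y → proj₁ (sur y)
  ; to-from = λ y → proj₂ (sur y) ; from-to = λ x → inj (proj₂ (sur (f x))) }

module _ {n} {f g : Fin 1 → Fin n} (mg : Merge f g) where
  open Merge mg

  private
    u = f zero
    v = g zero

  merge-kernel : ∀ {x y} → quot x ≡ quot y → x ≡ y ⊎ (x ≡ u × y ≡ v) ⊎ (x ≡ v × y ≡ u)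
  merge-kernel {x} {y} e = cases (v ≟ x) (v ≟ y) (trans (sym (minimal h h-eq x))
                                   (trans (cong (h ∘ rep) e) (minimal h h-eq y)))
    where
    pick-u : ∀ {x} → Dec (v ≡ x) → Fin n
    pick-u (yes _) = u
    pick-u {x} (no _) = x
    h : Fin n → Fin n
    h x = pick-u (v ≟ x)
    h-u : ∀ d → pick-u {u} d ≡ u
    h-u (yes _) = refl
    h-u (no _)  = refl
    h-v : ∀ d → pick-u {v} d ≡ u
    h-v (yes _)  = refl
    h-v (no v≢v) = contradiction refl v≢v
    h-eq : ∀ i → h (f i) ≡ h (g i)
    h-eq zero = trans (h-u (v ≟ u)) (sym (h-v (v ≟ v)))
    cases : ∀ {x y} (d : Dec (v ≡ x)) (d′ : Dec (v ≡ y)) → pick-u d ≡ pick-u d′ →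
            x ≡ y ⊎ (x ≡ u × y ≡ v) ⊎ (x ≡ v × y ≡ u)
    cases (yes p) (yes q) e = inj₁ (trans (sym p) q)
    cases (yes p) (no _)  e = inj₂ (inj₂ (sym p , sym e))
    cases (no _)  (yes q) e = inj₂ (inj₁ (e , sym q))
    cases (no _)  (no _)  e = inj₁ e

  merge-trivial : u ≡ v → fin n ⇄ fin size
  merge-trivial u≡v = bijection quot injective (λ w → rep w , quot-rep w)
    where
    injective : ∀ {x y} → quot x ≡ quot y → x ≡ y
    injective e with merge-kernel e
    ... | inj₁ x≡y = x≡y
    ... | inj₂ (inj₁ (x≡u , y≡v)) = trans x≡u (trans u≡v (sym y≡v))
    ... | inj₂ (inj₂ (x≡v , y≡u)) = trans x≡v (trans (sym u≡v) (sym y≡u))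

  contract : u ≢ v → (π : (fin 1 ⊞ a) ⇄ fin n) → to π (inj₁ zero) ≡ u ⊎ to π (inj₁ zero) ≡ v →
             a ⇄ fin size
  contract {a = a} u≢v π hit = bijection (λ x → quot (to π (inj₂ x))) injective surjective
    where
    Hit = to π (inj₁ zero) ≡ u ⊎ to π (inj₁ zero) ≡ v
    not-both : Hit → ∀ {x y} → to π (inj₂ x) ≡ u → to π (inj₂ y) ≡ v → ∀ {A : Set} → A
    not-both (inj₁ h) xu yv with () ← to-injective π (trans h (sym xu))
    not-both (inj₂ h) xu yv with () ← to-injective π (trans h (sym yv))
    injective : ∀ {x y} → quot (to π (inj₂ x)) ≡ quot (to π (inj₂ y)) → x ≡ y
    injective e with merge-kernel e
    ... | inj₁ h with refl ← to-injective π h = refl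
    ... | inj₂ (inj₁ (xu , yv)) = not-both hit xu yv
    ... | inj₂ (inj₂ (xv , yu)) = not-both hit yu xv
    other : ∀ {z t} → to π (inj₁ zero) ≡ z → quot t ≡ quot z → t ≢ z →
            Σ[ x ∈ El a ] quot (to π (inj₂ x)) ≡ quot (to π (inj₁ zero))
    other {z} {t} hz qt t≢z with from π t in eq
    ... | inj₁ zero = contradiction (trans (sym (to-from π t)) (trans (cong (to π) eq) hz)) t≢z
    ... | inj₂ x = x , trans (cong quot (trans (cong (to π) (sym eq)) (to-from π t)))
                         (trans qt (cong quot (sym hz)))
    missing : Hit → Σ[ x ∈ El a ] quot (to π (inj₂ x)) ≡ quot (to π (inj₁ zero))
    missing (inj₁ h) = other h (sym (merges zero)) (u≢v ∘ sym)
    missing (inj₂ h) = other h (merges zero) u≢v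
    surjective : ∀ w → Σ[ x ∈ El a ] quot (to π (inj₂ x)) ≡ w
    surjective w with from π (rep w) in eq
    ... | inj₂ x = x , trans (cong quot (trans (cong (to π) (sym eq)) (to-from π _))) (quot-rep w)
    ... | inj₁ zero = proj₁ (missing hit) , trans (proj₂ (missing hit))
            (trans (cong quot (trans (cong (to π) (sym eq)) (to-from π _))) (quot-rep w))

  contract-trace : (u≢v : u ≢ v) (π : (fin 1 ⊞ a) ⇄ fin n) (ρ : (fin 1 ⊞ b) ⇄ fin n)
                   (hπ : to π (inj₁ zero) ≡ u) (hρ : to ρ (inj₁ zero) ≡ v) →
                   IsTrace₁ (π ⍮ ρ ⁻¹) (contract u≢v π (inj₁ hπ) ⍮ contract u≢v ρ (inj₂ hρ) ⁻¹)
  contract-trace u≢v π ρ hπ hρ = record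
    { direct = λ {x} {y} e → trans (cong (from ρ′) (cong quot (solve e))) (from-to ρ′ y)
    ; through = λ {x} e → trough x (to (π ⍮ ρ ⁻¹) (inj₁ zero)) refl e
    ; nonloop = λ e → u≢v (trans (sym hπ) (trans (solve e) hρ))
    }
    where
    ρ′ = contract u≢v ρ (inj₂ hρ)
    solve : ∀ {x y} → from ρ (to π x) ≡ y → to π x ≡ to ρ y
    solve e = trans (sym (to-from ρ _)) (cong (to ρ) e)
    trough : ∀ x z → from ρ (to π (inj₁ zero)) ≡ z → from ρ (to π (inj₂ x)) ≡ inj₁ zero →
             from ρ (to π (inj₁ zero)) ≡ inj₂ (from ρ′ (quot (to π (inj₂ x))))
    trough x (inj₁ zero) e h = contradiction (trans (sym hπ) (trans (solve e) hρ)) u≢v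
    trough x (inj₂ y) e h = trans e (cong inj₂ (sym (trans
      (cong (from ρ′) (trans (cong quot (trans (solve h) hρ)) (trans (sym (merges zero))
        (cong quot (trans (sym hπ) (solve e)))))) (from-to ρ′ y))))

module Trace₁ {S} {m n} {P : Cospan S (1 + m) (1 + n)} (M : Monogamy P) where
  private
    F = apex P
    w = circles M
    f g : Fin 1 → Fin (#V F)
    f _ = onV (inputs P) zero
    g _ = onV (outputs P) zero
    TP : Cospan S m n
    TP = Trᶜ {m = m} {n = n} 1 P
    mg : Merge _ _
    mg = merge 1 (onV (inputs P ∘ₕ pick {n = 1} (_↑ˡ m))) (onV (outputs P ∘ₕ pick {n = 1} (_↑ˡ n)))
    open Merge mg
    ins₁ = Targets F ⊞ fin w
    outs₁ = Sources F ⊞ fin w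

    quotient : F ⟶ apex TP
    quotient = Coequalizer.arrow (coequalizer (inputs P ∘ₕ pick {n = 1} (_↑ˡ m)) (outputs P ∘ₕ pick {n = 1} (_↑ˡ n)))

    producer₁ : (fin 1 ⊞ (ins₁ ⊞ fin m)) ⇄ fin (#V F)
    producer₁ = exchᵇ (fin 1) ins₁ (fin m) ⍮ ((idᵇ ⊞₁ join⇄ 1 m) ⍮ producer M)

    consumer₁ : (fin 1 ⊞ (outs₁ ⊞ fin n)) ⇄ fin (#V F)
    consumer₁ = exchᵇ (fin 1) outs₁ (fin n) ⍮ ((idᵇ ⊞₁ join⇄ 1 n) ⍮ consumer M)

    producer-u : to producer₁ (inj₁ zero) ≡ onV (inputs P) zero
    producer-u = producer-input M zero

    consumer-v : to consumer₁ (inj₁ zero) ≡ onV (outputs P) zero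
    consumer-v = consumer-output M zero

    sourceQ : ∀ x → quot (sourceAt F x) ≡ sourceAt (apex TP) x
    sourceQ (e , i) = source-natural quotient e e refl i i refl

    targetQ : ∀ x → quot (targetAt F x) ≡ targetAt (apex TP) x
    targetQ (e , i) = target-natural quotient e e refl i i refl

    wiring₁ : (ins₁ ⊞ (fin 1 ⊞ fin m)) ⇄ (outs₁ ⊞ (fin 1 ⊞ fin n))
    wiring₁ = (idᵇ ⊞₁ join⇄ 1 m) ⍮ wiring M ⍮ (idᵇ ⊞₁ join⇄ 1 n) ⁻¹

    box = Box S (#E F) (label F) ⊗ id w

    nf-wiring₁ : nf M ≈ loop {a = outs₁} {b = ins₁} {m = fin 1 ⊞ fin m} {n = fin 1 ⊞ fin n} box wiring₁
    nf-wiring₁ = ≈-sym (sq-join⇒≈ 1 m 1 n (loop-sq {a = outs₁} {b = ins₁} {γ = join⇄ 1 m} {δ = join⇄ 1 n}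
      (sq-refl {a = outs₁} {b = ins₁} box) λ x → to-from (idᵇ {outs₁} ⊞₁ join⇄ 1 n) _))

  merged : onV (inputs P) zero ≢ onV (outputs P) zero → TP ⊩ Tr 1 (nf M)
  merged u≢v = N , ≈-sym (≈-trans (Tr-cong nf-wiring₁)
      (loop-yank (fin m) (fin n) box wiring₁ (wiring N)
        (trace-cong (contract-trace mg u≢v producer₁ consumer₁ producer-u consumer-v))))
    where
    N : Monogamy TP
    N = record
      { circles = w
      ; consumer = contract mg u≢v consumer₁ (inj₂ consumer-v)
      ; producer = contract mg u≢v producer₁ (inj₁ producer-u)
      ; consumer-source = λ x → trans (cong quot (consumer-source M x)) (sourceQ x)
      ; consumer-output = λ o → cong quot (consumer-output M (suc o))
      ; producer-target = λ x → trans (cong quot (producer-target M x)) (targetQ x)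
      ; producer-input = λ o → cong quot (producer-input M (suc o))
      ; circle = λ x → cong quot (circle M x)
      }
    trace-cong : IsTrace₁ (producer₁ ⍮ consumer₁ ⁻¹) (wiring N) →
                 IsTrace₁ (exchᵇ (fin 1) ins₁ (fin m) ⍮ wiring₁ ⍮ exchᵇ outs₁ (fin 1) (fin n)) (wiring N)
    trace-cong t = record
      { direct = λ {x} e → direct {x} (trans (sym (same (inj₂ x))) e)
      ; through = λ {x} e → trans (same (inj₁ zero)) (through {x} (trans (sym (same (inj₂ x))) e))
      ; nonloop = λ e → nonloop (trans (sym (same (inj₁ zero))) e)
      }
      where
      open IsTrace₁ t
      exch-inverse : ∀ x → to (exchᵇ outs₁ (fin 1) (fin n)) x ≡ from (exchᵇ (fin 1) outs₁ (fin n)) x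
      exch-inverse (inj₁ _) = refl
      exch-inverse (inj₂ (inj₁ _)) = refl
      exch-inverse (inj₂ (inj₂ _)) = refl
      same : ∀ x → to (exchᵇ (fin 1) ins₁ (fin m) ⍮ wiring₁ ⍮ exchᵇ outs₁ (fin 1) (fin n)) x
                 ≡ to (producer₁ ⍮ consumer₁ ⁻¹) x
      same x = exch-inverse (to (exchᵇ (fin 1) ins₁ (fin m) ⍮ wiring₁) x)

  unmerged : onV (inputs P) zero ≡ onV (outputs P) zero → TP ⊩ Tr 1 (nf M)
  unmerged u≡v = N , ≈-sym (≈-trans (≈-trans (Tr-cong nf-wiring₁) (loop-Tr (fin 1) (fin m) (fin n) box wiring₁))
    (sq⇒≈ {a = fin m} {b = fin n} (sq-sym (loop-sq {γ = idᵇ} {δ = idᵇ} sq-circle pointwise))))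
    where
    absorb : ∀ a → (a ⊞ fin (w + 1)) ⇄ ((a ⊞ fin w) ⊞ fin 1)
    absorb a = (idᵇ ⊞₁ join⇄ w 1 ⁻¹) ⍮ assocʳ a (fin w) (fin 1) ⁻¹
    extend : ∀ {a k} → ((a ⊞ fin w) ⊞ fin (1 + k)) ⇄ fin (#V F) →
             ((a ⊞ fin (w + 1)) ⊞ fin k) ⇄ fin size
    extend {a} {k} π = (absorb a ⊞₁ idᵇ) ⍮ (assocʳ (a ⊞ fin w) (fin 1) (fin k)
      ⍮ (idᵇ ⊞₁ join⇄ 1 k) ⍮ π ⍮ merge-trivial mg u≡v)
    circle′ : ∀ x → to (extend (consumer M)) (inj₁ (inj₂ x)) ≡ to (extend (producer M)) (inj₁ (inj₂ x))
    circle′ x with splitAt w x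
    ... | inj₁ y = cong quot (circle M y)
    ... | inj₂ zero = cong quot (trans consumer-v (trans (sym u≡v) (sym producer-u)))
    N : Monogamy TP
    N = record
      { circles = w + 1
      ; consumer = extend (consumer M)
      ; producer = extend (producer M)
      ; consumer-source = λ x → trans (cong quot (consumer-source M x)) (sourceQ x)
      ; consumer-output = λ o → cong quot (consumer-output M (suc o))
      ; producer-target = λ x → trans (cong quot (producer-target M x)) (targetQ x)
      ; producer-input = λ o → cong quot (producer-input M (suc o))
      ; circle = circle′
      }
    sq-circle : Sq (absorb (Sources F)) (Box S (#E F) (label F) ⊗ id (w + 1)) (box ⊗ id 1) (absorb (Targets F))
    sq-circle = sq-⍮ (sq-⊗ (sq-refl {a = Sources F} {b = Targets F} (Box S (#E F) (label F)))
                           (sq-≈ ≈-refl (≈-sym ⊗-id) (sq-sym (sq-join w 1 w 1))))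
      (sq-sym (sq-assoc (Sources F) (fin w) (fin 1) (Targets F) (fin w) (fin 1)))
    pointwise : ∀ x → to (absorb (Sources F) ⊞₁ idᵇ) (to (wiring N) x)
                    ≡ to (assocʳ ins₁ (fin 1) (fin m) ⍮ wiring₁ ⍮ assocʳ outs₁ (fin 1) (fin n) ⁻¹)
                         (to (absorb (Targets F) ⊞₁ idᵇ) x)
    pointwise x = trans (to-from (absorb (Sources F) ⊞₁ idᵇ) _)
      (cong (from (assocʳ outs₁ (fin 1) (fin n)) ∘ from (idᵇ {outs₁} ⊞₁ join⇄ 1 n) ∘ from (consumer M))
            (from-to (merge-trivial mg u≡v) _))

  traced : TP ⊩ Tr 1 (nf M)
  traced with onV (inputs P) zero ≟ onV (outputs P) zero
  ... | yes e = unmerged e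
  ... | no ne = merged ne

Tr₁-⊩ : {P : Cospan S (1 + m) (1 + n)} {f : Term S (1 + m) (1 + n)} → P ⊩ f → Trᶜ 1 P ⊩ Tr 1 f
Tr₁-⊩ (M , e) = ⊩-≈ (Tr-cong e) (Trace₁.traced M)

-- Homomorphisms of hypergraphs without their proof components, so that
-- composition is associative and unital by computation.
record Map (X Y : Hypergraph S) : Set where
  constructor map⟨_,_⟩
  field
    vertexMap : Fin (#V X) → Fin (#V Y)
    edgeMap   : Fin (#E X) → Fin (#E Y)

open Map public

⌞_⌟ : X ⟶ Y → Map X Y
⌞ f ⌟ = map⟨ onV f , onE f ⟩

infixr 9 _∙_
_∙_ : Map Y Z → Map X Y → Map X Z
g ∙ f = map⟨ vertexMap g ∘ vertexMap f , edgeMap g ∘ edgeMap f ⟩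

idₘ : Map X X
idₘ = map⟨ (λ v → v) , (λ e → e) ⟩

infix 4 _≃_
record _≃_ {S} {X Y : Hypergraph S} (f g : Map X Y) : Set where
  constructor _⸴_
  field
    ≃V : ∀ v → vertexMap f v ≡ vertexMap g v
    ≃E : ∀ e → edgeMap f e ≡ edgeMap g e

open _≃_ public

≃-refl : {f : Map X Y} → f ≃ f
≃-refl = (λ _ → refl) ⸴ (λ _ → refl)

≃-sym : {f g : Map X Y} → f ≃ g → g ≃ f
≃-sym (v ⸴ e) = (λ a → sym (v a)) ⸴ (λ a → sym (e a))

infixr 5 _▷_
_▷_ : {f g h : Map X Y} → f ≃ g → g ≃ h → f ≃ h
(v ⸴ e) ▷ (v′ ⸴ e′) = (λ a → trans (v a) (v′ a)) ⸴ (λ a → trans (e a) (e′ a))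

infixr 7 _⋆_
infixl 8 _⋆′_
_⋆_ : (h : Map Y Z) {f g : Map X Y} → f ≃ g → h ∙ f ≃ h ∙ g
h ⋆ (v ⸴ e) = (λ a → cong (vertexMap h) (v a)) ⸴ (λ a → cong (edgeMap h) (e a))

_⋆′_ : {f g : Map Y Z} → f ≃ g → (h : Map X Y) → f ∙ h ≃ g ∙ h
(v ⸴ e) ⋆′ h = (λ a → v (vertexMap h a)) ⸴ (λ a → e (edgeMap h a))

≐⇒≃ : (f g : X ⟶ Y) → f ≐ g → ⌞ f ⌟ ≃ ⌞ g ⌟
≐⇒≃ f g (v , e) = v ⸴ e

≃⇒≐ : (f g : X ⟶ Y) → ⌞ f ⌟ ≃ ⌞ g ⌟ → f ≐ g
≃⇒≐ f g (v ⸴ e) = v , e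

idₕ : X ⟶ X
idₕ = record { onV = λ v → v ; onE = λ e → e ; onE-label = λ _ → refl
             ; onE-sources = λ _ → sym (map-id _) ; onE-targets = λ _ → sym (map-id _) }

pick-ext : {f g : Map (discrete {S} n) Y} → (∀ v → vertexMap f v ≡ vertexMap g v) → f ≃ g
pick-ext e = e ⸴ λ ()

mk≅ : {P Q : Cospan S m n} (f : apex P ⟶ apex Q) (g : apex Q ⟶ apex P) →
      ⌞ f ⌟ ∙ ⌞ g ⌟ ≃ idₘ → ⌞ g ⌟ ∙ ⌞ f ⌟ ≃ idₘ →
      (∀ a → onV f (onV (inputs P) a) ≡ onV (inputs Q) a) →
      (∀ a → onV f (onV (outputs P) a) ≡ onV (outputs Q) a) → P ≅ Q
mk≅ f g fg gf i o = record
  { fwd = f ; bwd = g ; fwd-bwdⱽ = ≃V fg ; fwd-bwdᴱ = ≃E fg ; bwd-fwdⱽ = ≃V gf ; bwd-fwdᴱ = ≃E gf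
  ; fwd-inputs = i ; fwd-outputs = o }

fwd∙bwd : (θ : P ≅ Q) → ⌞ fwd θ ⌟ ∙ ⌞ bwd θ ⌟ ≃ idₘ
fwd∙bwd θ = fwd-bwdⱽ θ ⸴ fwd-bwdᴱ θ

bwd∙fwd : (θ : P ≅ Q) → ⌞ bwd θ ⌟ ∙ ⌞ fwd θ ⌟ ≃ idₘ
bwd∙fwd θ = bwd-fwdⱽ θ ⸴ bwd-fwdᴱ θ

≅-refl : P ≅ P
≅-refl = mk≅ idₕ idₕ ≃-refl ≃-refl (λ _ → refl) (λ _ → refl)

≅-sym : P ≅ Q → Q ≅ P
≅-sym θ = mk≅ (bwd θ) (fwd θ) (bwd∙fwd θ) (fwd∙bwd θ)
  (λ a → trans (cong (onV (bwd θ)) (sym (fwd-inputs θ a))) (bwd-fwdⱽ θ _))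
  (λ a → trans (cong (onV (bwd θ)) (sym (fwd-outputs θ a))) (bwd-fwdⱽ θ _))

≅-trans : P ≅ Q → Q ≅ R → P ≅ R
≅-trans θ η = mk≅ (fwd η ∘ₕ fwd θ) (bwd θ ∘ₕ bwd η)
  (⌞ fwd η ⌟ ⋆ fwd∙bwd θ ⋆′ ⌞ bwd η ⌟ ▷ fwd∙bwd η)
  (⌞ bwd θ ⌟ ⋆ bwd∙fwd η ⋆′ ⌞ fwd θ ⌟ ▷ bwd∙fwd θ)
  (λ a → trans (cong (onV (fwd η)) (fwd-inputs θ a)) (fwd-inputs η a))
  (λ a → trans (cong (onV (fwd η)) (fwd-outputs θ a)) (fwd-outputs η a))

-- The universal properties of composites, traces and sums

module Comp {S} {m n p} (P : Cospan S m n) (Q : Cospan S n p) where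
  private
    module Po = Pushout (pushout (outputs P) (inputs Q))
    module Is = IsPushout Po.isPushout

  inL : apex P ⟶ apex (P ⨾ᶜ Q)
  inL = Po.inˡ

  inR : apex Q ⟶ apex (P ⨾ᶜ Q)
  inR = Po.inʳ

  glue : ∀ a → onV inL (onV (outputs P) a) ≡ onV inR (onV (inputs Q) a)
  glue = proj₁ Is.commutes

  module _ {K : Hypergraph S} where
    opaque
      rec : (h : apex P ⟶ K) (k : apex Q ⟶ K) →
            (∀ a → onV h (onV (outputs P) a) ≡ onV k (onV (inputs Q) a)) → apex (P ⨾ᶜ Q) ⟶ K
      rec h k e = proj₁ (Is.universal h k (e , λ ()))

      rec-L : ∀ h k e → ⌞ rec h k e ⌟ ∙ ⌞ inL ⌟ ≃ ⌞ h ⌟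
      rec-L h k e = ≐⇒≃ (rec h k e ∘ₕ inL) h (proj₁ (proj₁ (proj₂ (Is.universal h k (e , λ ())))))

      rec-R : ∀ h k e → ⌞ rec h k e ⌟ ∙ ⌞ inR ⌟ ≃ ⌞ k ⌟
      rec-R h k e = ≐⇒≃ (rec h k e ∘ₕ inR) k (proj₂ (proj₁ (proj₂ (Is.universal h k (e , λ ())))))

    ext : (u w : apex (P ⨾ᶜ Q) ⟶ K) → ⌞ u ⌟ ∙ ⌞ inL ⌟ ≃ ⌞ w ⌟ ∙ ⌞ inL ⌟ →
          ⌞ u ⌟ ∙ ⌞ inR ⌟ ≃ ⌞ w ⌟ ∙ ⌞ inR ⌟ → ⌞ u ⌟ ≃ ⌞ w ⌟
    ext u w l r = ≐⇒≃ u (proj₁ factored) (proj₂ (proj₂ factored) u (≃⇒≐ (u ∘ₕ inL) (w ∘ₕ inL) l) (≃⇒≐ (u ∘ₕ inR) (w ∘ₕ inR) r))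
      ▷ ≃-sym (≐⇒≃ w (proj₁ factored) (proj₂ (proj₂ factored) w (≃⇒≐ (w ∘ₕ inL) (w ∘ₕ inL) ≃-refl) (≃⇒≐ (w ∘ₕ inR) (w ∘ₕ inR) ≃-refl)))
      where
      factored = Is.universal (w ∘ₕ inL) (w ∘ₕ inR) ((λ a → cong (onV w) (glue a)) , λ ())

module Trace {S} {m n} (x : ℕ) (P : Cospan S (x + m) (x + n)) where
  private
    module Co = Coequalizer (coequalizer (inputs P ∘ₕ pick {n = x} (_↑ˡ m)) (outputs P ∘ₕ pick {n = x} (_↑ˡ n)))
    module Is = IsCoequalizer Co.isCoequalizer

  inT : apex P ⟶ apex (Trᶜ x P)
  inT = Co.arrow

  glue : ∀ a → onV inT (onV (inputs P) (a ↑ˡ m)) ≡ onV inT (onV (outputs P) (a ↑ˡ n))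
  glue = proj₁ Is.commutes

  module _ {K : Hypergraph S} where
    opaque
      rec : (h : apex P ⟶ K) → (∀ a → onV h (onV (inputs P) (a ↑ˡ m)) ≡ onV h (onV (outputs P) (a ↑ˡ n))) →
            apex (Trᶜ x P) ⟶ K
      rec h e = proj₁ (Is.universal h (e , λ ()))

      rec-T : ∀ h e → ⌞ rec h e ⌟ ∙ ⌞ inT ⌟ ≃ ⌞ h ⌟
      rec-T h e = ≐⇒≃ (rec h e ∘ₕ inT) h (proj₁ (proj₂ (Is.universal h (e , λ ()))))

    ext : (u w : apex (Trᶜ x P) ⟶ K) → ⌞ u ⌟ ∙ ⌞ inT ⌟ ≃ ⌞ w ⌟ ∙ ⌞ inT ⌟ → ⌞ u ⌟ ≃ ⌞ w ⌟
    ext u w l = ≐⇒≃ u (proj₁ factored) (proj₂ (proj₂ factored) u (≃⇒≐ (u ∘ₕ inT) (w ∘ₕ inT) l))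
      ▷ ≃-sym (≐⇒≃ w (proj₁ factored) (proj₂ (proj₂ factored) w (≃⇒≐ (w ∘ₕ inT) (w ∘ₕ inT) ≃-refl)))
      where
      factored = Is.universal (w ∘ₕ inT) ((λ a → cong (onV w) (glue a)) , λ ())

module Plus {S} (X Y : Hypergraph S) where
  in₁ : X ⟶ X ⊕ Y
  in₁ = ι₁ {F = X} {G = Y}

  in₂ : Y ⟶ X ⊕ Y
  in₂ = ι₂ {G = Y} {F = X}

  module _ {K : Hypergraph S} where
    opaque
      rec : X ⟶ K → Y ⟶ K → X ⊕ Y ⟶ K
      rec = copair

      rec-1 : ∀ h k → ⌞ rec h k ⌟ ∙ ⌞ in₁ ⌟ ≃ ⌞ h ⌟
      rec-1 h k = ≐⇒≃ (rec h k ∘ₕ in₁) h (copair-ι₁ h k)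

      rec-2 : ∀ h k → ⌞ rec h k ⌟ ∙ ⌞ in₂ ⌟ ≃ ⌞ k ⌟
      rec-2 h k = ≐⇒≃ (rec h k ∘ₕ in₂) k (copair-ι₂ h k)

    ext : (u w : X ⊕ Y ⟶ K) → ⌞ u ⌟ ∙ ⌞ in₁ ⌟ ≃ ⌞ w ⌟ ∙ ⌞ in₁ ⌟ →
          ⌞ u ⌟ ∙ ⌞ in₂ ⌟ ≃ ⌞ w ⌟ ∙ ⌞ in₂ ⌟ → ⌞ u ⌟ ≃ ⌞ w ⌟
    ext u w l r = ≐⇒≃ u w (⊕-ext X Y u w (≃⇒≐ (u ∘ₕ in₁) (w ∘ₕ in₁) l) (≃⇒≐ (u ∘ₕ in₂) (w ∘ₕ in₂) r))

module Tensor {S} {m n p q} (P : Cospan S m n) (Q : Cospan S p q) where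
  open Plus (apex P) (apex Q) public

  inputs₁ : ∀ a → onV (inputs (P ⊗ᶜ Q)) (a ↑ˡ p) ≡ onV in₁ (onV (inputs P) a)
  inputs₁ a = cong [ _ , _ ]′ (splitAt-↑ˡ m a p)

  inputs₂ : ∀ a → onV (inputs (P ⊗ᶜ Q)) (m ↑ʳ a) ≡ onV in₂ (onV (inputs Q) a)
  inputs₂ a = cong [ _ , _ ]′ (splitAt-↑ʳ m p a)

  outputs₁ : ∀ a → onV (outputs (P ⊗ᶜ Q)) (a ↑ˡ q) ≡ onV in₁ (onV (outputs P) a)
  outputs₁ a = cong [ _ , _ ]′ (splitAt-↑ˡ n a q)

  outputs₂ : ∀ a → onV (outputs (P ⊗ᶜ Q)) (n ↑ʳ a) ≡ onV in₂ (onV (outputs Q) a)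
  outputs₂ a = cong [ _ , _ ]′ (splitAt-↑ʳ n q a)

⨾ᶜ-cong : P ≅ P′ → Q ≅ Q′ → P ⨾ᶜ Q ≅ P′ ⨾ᶜ Q′
⨾ᶜ-cong {S} {m} {n} {P} {P′} {p} {Q} {Q′} θ η = mk≅ f g
  (C′.ext (f ∘ₕ g) idₕ
    (⌞ f ⌟ ⋆ C′.rec-L _ _ _ ▷ C.rec-L _ _ _ ⋆′ ⌞ bwd θ ⌟ ▷ ⌞ C′.inL ⌟ ⋆ fwd∙bwd θ)
    (⌞ f ⌟ ⋆ C′.rec-R _ _ _ ▷ C.rec-R _ _ _ ⋆′ ⌞ bwd η ⌟ ▷ ⌞ C′.inR ⌟ ⋆ fwd∙bwd η))
  (C.ext (g ∘ₕ f) idₕ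
    (⌞ g ⌟ ⋆ C.rec-L _ _ _ ▷ C′.rec-L _ _ _ ⋆′ ⌞ fwd θ ⌟ ▷ ⌞ C.inL ⌟ ⋆ bwd∙fwd θ)
    (⌞ g ⌟ ⋆ C.rec-R _ _ _ ▷ C′.rec-R _ _ _ ⋆′ ⌞ fwd η ⌟ ▷ ⌞ C.inR ⌟ ⋆ bwd∙fwd η))
  (λ a → trans (≃V (C.rec-L _ _ _) _) (cong (onV C′.inL) (fwd-inputs θ a)))
  (λ a → trans (≃V (C.rec-R _ _ _) _) (cong (onV C′.inR) (fwd-outputs η a)))
  where
  module C = Comp P Q
  module C′ = Comp P′ Q′
  f : apex (P ⨾ᶜ Q) ⟶ apex (P′ ⨾ᶜ Q′)
  f = C.rec (C′.inL ∘ₕ fwd θ) (C′.inR ∘ₕ fwd η) λ a → trans (cong (onV C′.inL) (fwd-outputs θ a))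
        (trans (C′.glue a) (cong (onV C′.inR) (sym (fwd-inputs η a))))
  g : apex (P′ ⨾ᶜ Q′) ⟶ apex (P ⨾ᶜ Q)
  g = C′.rec (C.inL ∘ₕ bwd θ) (C.inR ∘ₕ bwd η) λ a → trans (cong (onV C.inL) (fwd-outputs (≅-sym θ) a))
        (trans (C.glue a) (cong (onV C.inR) (sym (fwd-inputs (≅-sym η) a))))

[]-glue : ∀ {A B C C′ D : Set} {h : C → D} {h′ : C′ → D}
          {f : A → C} {f′ : A → C′} {g : B → C} {g′ : B → C′} →
          (∀ a → h (f a) ≡ h′ (f′ a)) → (∀ b → h (g b) ≡ h′ (g′ b)) →
          ∀ s → h ([ f , g ]′ s) ≡ h′ ([ f′ , g′ ]′ s)
[]-glue l r (inj₁ a) = l a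
[]-glue l r (inj₂ b) = r b

⊗ᶜ-cong : P ≅ P′ → Q ≅ Q′ → P ⊗ᶜ Q ≅ P′ ⊗ᶜ Q′
⊗ᶜ-cong {S} {m} {n} {P} {P′} {p} {q} {Q} {Q′} θ η = mk≅ f g
  (T′.ext (f ∘ₕ g) idₕ
    (⌞ f ⌟ ⋆ T′.rec-1 _ _ ▷ T.rec-1 _ _ ⋆′ ⌞ bwd θ ⌟ ▷ ⌞ T′.in₁ ⌟ ⋆ fwd∙bwd θ)
    (⌞ f ⌟ ⋆ T′.rec-2 _ _ ▷ T.rec-2 _ _ ⋆′ ⌞ bwd η ⌟ ▷ ⌞ T′.in₂ ⌟ ⋆ fwd∙bwd η))
  (T.ext (g ∘ₕ f) idₕ
    (⌞ g ⌟ ⋆ T.rec-1 _ _ ▷ T′.rec-1 _ _ ⋆′ ⌞ fwd θ ⌟ ▷ ⌞ T.in₁ ⌟ ⋆ bwd∙fwd θ)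
    (⌞ g ⌟ ⋆ T.rec-2 _ _ ▷ T′.rec-2 _ _ ⋆′ ⌞ fwd η ⌟ ▷ ⌞ T.in₂ ⌟ ⋆ bwd∙fwd η))
  (λ a → []-glue {h = onV f} {h′ = λ v → v}
    (λ b → trans (≃V (T.rec-1 _ _) _) (cong (onV T′.in₁) (fwd-inputs θ b)))
    (λ b → trans (≃V (T.rec-2 _ _) _) (cong (onV T′.in₂) (fwd-inputs η b))) (splitAt m a))
  (λ a → []-glue {h = onV f} {h′ = λ v → v}
    (λ b → trans (≃V (T.rec-1 _ _) _) (cong (onV T′.in₁) (fwd-outputs θ b)))
    (λ b → trans (≃V (T.rec-2 _ _) _) (cong (onV T′.in₂) (fwd-outputs η b))) (splitAt n a))
  where
  module T = Tensor P Q
  module T′ = Tensor P′ Q′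
  f : apex (P ⊗ᶜ Q) ⟶ apex (P′ ⊗ᶜ Q′)
  f = T.rec (T′.in₁ ∘ₕ fwd θ) (T′.in₂ ∘ₕ fwd η)
  g : apex (P′ ⊗ᶜ Q′) ⟶ apex (P ⊗ᶜ Q)
  g = T′.rec (T.in₁ ∘ₕ bwd θ) (T.in₂ ∘ₕ bwd η)

Trᶜ-cong : ∀ x {P Q : Cospan S (x + m) (x + n)} → P ≅ Q → Trᶜ {m = m} {n = n} x P ≅ Trᶜ x Q
Trᶜ-cong {S} {m} {n} x {P} {Q} θ = mk≅ f g
  (T′.ext (f ∘ₕ g) idₕ (⌞ f ⌟ ⋆ T′.rec-T _ _ ▷ T.rec-T _ _ ⋆′ ⌞ bwd θ ⌟ ▷ ⌞ T′.inT ⌟ ⋆ fwd∙bwd θ))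
  (T.ext (g ∘ₕ f) idₕ (⌞ g ⌟ ⋆ T.rec-T _ _ ▷ T′.rec-T _ _ ⋆′ ⌞ fwd θ ⌟ ▷ ⌞ T.inT ⌟ ⋆ bwd∙fwd θ))
  (λ a → trans (≃V (T.rec-T _ _) _) (cong (onV T′.inT) (fwd-inputs θ (x ↑ʳ a))))
  (λ a → trans (≃V (T.rec-T _ _) _) (cong (onV T′.inT) (fwd-outputs θ (x ↑ʳ a))))
  where
  module T = Trace {m = m} {n = n} x P
  module T′ = Trace {m = m} {n = n} x Q
  f : apex (Trᶜ x P) ⟶ apex (Trᶜ x Q)
  f = T.rec (T′.inT ∘ₕ fwd θ) λ a → trans (cong (onV T′.inT) (fwd-inputs θ _))
        (trans (T′.glue a) (cong (onV T′.inT) (sym (fwd-outputs θ _))))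
  g : apex (Trᶜ x Q) ⟶ apex (Trᶜ x P)
  g = T′.rec (T.inT ∘ₕ bwd θ) λ a → trans (cong (onV T.inT) (fwd-inputs (≅-sym θ) _))
        (trans (T.glue a) (cong (onV T.inT) (sym (fwd-outputs (≅-sym θ) _))))

⨾ᶜ-assoc : (P : Cospan S m n) (Q : Cospan S n p) (R : Cospan S p q) → (P ⨾ᶜ Q) ⨾ᶜ R ≅ P ⨾ᶜ (Q ⨾ᶜ R)
⨾ᶜ-assoc {S} {m} {n} {p} {q} P Q R = mk≅ f g
  (B.ext (f ∘ₕ g) idₕ
    (⌞ f ⌟ ⋆ B.rec-L _ _ _ ▷ B′.rec-L _ _ _ ⋆′ ⌞ A.inL ⌟ ▷ A.rec-L _ _ _)
    (A′.ext (f ∘ₕ g ∘ₕ B.inR) B.inR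
      (⌞ f ⌟ ⋆ (B.rec-R _ _ _ ⋆′ ⌞ A′.inL ⌟ ▷ A′.rec-L _ _ _)
        ▷ B′.rec-L _ _ _ ⋆′ ⌞ A.inR ⌟ ▷ A.rec-R _ _ _)
      (⌞ f ⌟ ⋆ (B.rec-R _ _ _ ⋆′ ⌞ A′.inR ⌟ ▷ A′.rec-R _ _ _) ▷ B′.rec-R _ _ _)))
  (B′.ext (g ∘ₕ f) idₕ
    (A.ext (g ∘ₕ f ∘ₕ B′.inL) B′.inL
      (⌞ g ⌟ ⋆ (B′.rec-L _ _ _ ⋆′ ⌞ A.inL ⌟ ▷ A.rec-L _ _ _) ▷ B.rec-L _ _ _)
      (⌞ g ⌟ ⋆ (B′.rec-L _ _ _ ⋆′ ⌞ A.inR ⌟ ▷ A.rec-R _ _ _)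
        ▷ B.rec-R _ _ _ ⋆′ ⌞ A′.inL ⌟ ▷ A′.rec-L _ _ _))
    (⌞ g ⌟ ⋆ B′.rec-R _ _ _ ▷ B.rec-R _ _ _ ⋆′ ⌞ A′.inR ⌟ ▷ A′.rec-R _ _ _))
  (λ a → trans (≃V (B′.rec-L _ _ _) _) (≃V (A.rec-L _ _ _) _))
  (λ a → ≃V (B′.rec-R _ _ _) _)
  where
  module A = Comp P Q
  module B′ = Comp (P ⨾ᶜ Q) R
  module A′ = Comp Q R
  module B = Comp P (Q ⨾ᶜ R)
  f : apex ((P ⨾ᶜ Q) ⨾ᶜ R) ⟶ apex (P ⨾ᶜ (Q ⨾ᶜ R))
  f = B′.rec (A.rec B.inL (B.inR ∘ₕ A′.inL) B.glue) (B.inR ∘ₕ A′.inR)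
        λ a → trans (≃V (A.rec-R _ _ _) _) (cong (onV B.inR) (A′.glue a))
  g : apex (P ⨾ᶜ (Q ⨾ᶜ R)) ⟶ apex ((P ⨾ᶜ Q) ⨾ᶜ R)
  g = B.rec (B′.inL ∘ₕ A.inL) (A′.rec (B′.inL ∘ₕ A.inR) B′.inR B′.glue)
        λ a → trans (cong (onV B′.inL) (A.glue a)) (sym (≃V (A′.rec-L _ _ _) _))

⊗ᶜ-⨾ᶜ : (P : Cospan S m n) (Q : Cospan S n p) (P′ : Cospan S i j) (Q′ : Cospan S j l) →
        (P ⨾ᶜ Q) ⊗ᶜ (P′ ⨾ᶜ Q′) ≅ (P ⊗ᶜ P′) ⨾ᶜ (Q ⊗ᶜ Q′)
⊗ᶜ-⨾ᶜ {S} {m} {n} {p} {i} {j} {l} P Q P′ Q′ = mk≅ f g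
  (D.ext (f ∘ₕ g) idₕ
    (T₁.ext (f ∘ₕ g ∘ₕ D.inL) D.inL
      (⌞ f ⌟ ⋆ (D.rec-L _ _ _ ⋆′ ⌞ T₁.in₁ ⌟ ▷ T₁.rec-1 _ _) ▷ T.rec-1 _ _ ⋆′ ⌞ A.inL ⌟ ▷ A.rec-L _ _ _)
      (⌞ f ⌟ ⋆ (D.rec-L _ _ _ ⋆′ ⌞ T₁.in₂ ⌟ ▷ T₁.rec-2 _ _) ▷ T.rec-2 _ _ ⋆′ ⌞ B.inL ⌟ ▷ B.rec-L _ _ _))
    (T₂.ext (f ∘ₕ g ∘ₕ D.inR) D.inR
      (⌞ f ⌟ ⋆ (D.rec-R _ _ _ ⋆′ ⌞ T₂.in₁ ⌟ ▷ T₂.rec-1 _ _) ▷ T.rec-1 _ _ ⋆′ ⌞ A.inR ⌟ ▷ A.rec-R _ _ _)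
      (⌞ f ⌟ ⋆ (D.rec-R _ _ _ ⋆′ ⌞ T₂.in₂ ⌟ ▷ T₂.rec-2 _ _) ▷ T.rec-2 _ _ ⋆′ ⌞ B.inR ⌟ ▷ B.rec-R _ _ _)))
  (T.ext (g ∘ₕ f) idₕ
    (A.ext (g ∘ₕ f ∘ₕ T.in₁) T.in₁
      (⌞ g ⌟ ⋆ (T.rec-1 _ _ ⋆′ ⌞ A.inL ⌟ ▷ A.rec-L _ _ _) ▷ D.rec-L _ _ _ ⋆′ ⌞ T₁.in₁ ⌟ ▷ T₁.rec-1 _ _)
      (⌞ g ⌟ ⋆ (T.rec-1 _ _ ⋆′ ⌞ A.inR ⌟ ▷ A.rec-R _ _ _) ▷ D.rec-R _ _ _ ⋆′ ⌞ T₂.in₁ ⌟ ▷ T₂.rec-1 _ _))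
    (B.ext (g ∘ₕ f ∘ₕ T.in₂) T.in₂
      (⌞ g ⌟ ⋆ (T.rec-2 _ _ ⋆′ ⌞ B.inL ⌟ ▷ B.rec-L _ _ _) ▷ D.rec-L _ _ _ ⋆′ ⌞ T₁.in₂ ⌟ ▷ T₁.rec-2 _ _)
      (⌞ g ⌟ ⋆ (T.rec-2 _ _ ⋆′ ⌞ B.inR ⌟ ▷ B.rec-R _ _ _) ▷ D.rec-R _ _ _ ⋆′ ⌞ T₂.in₂ ⌟ ▷ T₂.rec-2 _ _)))
  (λ a → []-glue {h = onV f} {h′ = onV D.inL}
    (λ b → trans (≃V (T.rec-1 _ _) _) (≃V (A.rec-L _ _ _) _))
    (λ b → trans (≃V (T.rec-2 _ _) _) (≃V (B.rec-L _ _ _) _)) (splitAt m a))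
  (λ a → []-glue {h = onV f} {h′ = onV D.inR}
    (λ b → trans (≃V (T.rec-1 _ _) _) (≃V (A.rec-R _ _ _) _))
    (λ b → trans (≃V (T.rec-2 _ _) _) (≃V (B.rec-R _ _ _) _)) (splitAt p a))
  where
  module A = Comp P Q
  module B = Comp P′ Q′
  module T = Tensor (P ⨾ᶜ Q) (P′ ⨾ᶜ Q′)
  module T₁ = Tensor P P′
  module T₂ = Tensor Q Q′
  module D = Comp (P ⊗ᶜ P′) (Q ⊗ᶜ Q′)
  f : apex ((P ⨾ᶜ Q) ⊗ᶜ (P′ ⨾ᶜ Q′)) ⟶ apex ((P ⊗ᶜ P′) ⨾ᶜ (Q ⊗ᶜ Q′))
  f = T.rec
    (A.rec (D.inL ∘ₕ T₁.in₁) (D.inR ∘ₕ T₂.in₁) λ a → trans (cong (onV D.inL) (sym (T₁.outputs₁ a)))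
      (trans (D.glue (a ↑ˡ j)) (cong (onV D.inR) (T₂.inputs₁ a))))
    (B.rec (D.inL ∘ₕ T₁.in₂) (D.inR ∘ₕ T₂.in₂) λ a → trans (cong (onV D.inL) (sym (T₁.outputs₂ a)))
      (trans (D.glue (n ↑ʳ a)) (cong (onV D.inR) (T₂.inputs₂ a))))
  g : apex ((P ⊗ᶜ P′) ⨾ᶜ (Q ⊗ᶜ Q′)) ⟶ apex ((P ⨾ᶜ Q) ⊗ᶜ (P′ ⨾ᶜ Q′))
  g = D.rec (T₁.rec (T.in₁ ∘ₕ A.inL) (T.in₂ ∘ₕ B.inL)) (T₂.rec (T.in₁ ∘ₕ A.inR) (T.in₂ ∘ₕ B.inR))
    λ a → []-glue {h = onV (T₁.rec _ _)} {h′ = onV (T₂.rec _ _)}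
      (λ b → trans (≃V (T₁.rec-1 _ _) _) (trans (cong (onV T.in₁) (A.glue b)) (sym (≃V (T₂.rec-1 _ _) _))))
      (λ b → trans (≃V (T₁.rec-2 _ _) _) (trans (cong (onV T.in₂) (B.glue b)) (sym (≃V (T₂.rec-2 _ _) _))))
      (splitAt n a)

relabelᶜ : (Fin m′ → Fin m) → (Fin n′ → Fin n) → Cospan S m n → Cospan S m′ n′
relabelᶜ γ δ P = record { apex = apex P ; inputs = inputs P ∘ₕ pick γ ; outputs = outputs P ∘ₕ pick δ }

relabel-cong : {γ γ′ : Fin m′ → Fin m} {δ δ′ : Fin n′ → Fin n} →
               (∀ a → γ a ≡ γ′ a) → (∀ a → δ a ≡ δ′ a) → P ≅ Q → relabelᶜ γ δ P ≅ relabelᶜ γ′ δ′ Q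
relabel-cong {Q = Q} γ≡ δ≡ θ = mk≅ (fwd θ) (bwd θ) (fwd∙bwd θ) (bwd∙fwd θ)
  (λ a → trans (fwd-inputs θ _) (cong (onV (inputs Q)) (γ≡ a)))
  (λ a → trans (fwd-outputs θ _) (cong (onV (outputs Q)) (δ≡ a)))

wire-⨾ : (ι : fin m ⇄ fin k) (o : fin n ⇄ fin k) (P : Cospan S n p) →
         wireᶜ ι o ⨾ᶜ P ≅ relabelᶜ (from o ∘ to ι) (λ a → a) P
wire-⨾ ι o P = mk≅ f C.inR (C.rec-R _ _ _)
  (C.ext (C.inR ∘ₕ f) idₕ
    (pick-ext λ v → trans (cong (onV C.inR) (≃V (C.rec-L _ _ _) v))
      (trans (sym (C.glue (from o v))) (cong (onV C.inL) (to-from o v))))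
    (⌞ C.inR ⌟ ⋆ C.rec-R _ _ _))
  (λ a → ≃V (C.rec-L _ _ _) _) (λ a → ≃V (C.rec-R _ _ _) _)
  where
  module C = Comp (wireᶜ ι o) P
  f : apex (wireᶜ ι o ⨾ᶜ P) ⟶ apex P
  f = C.rec (pick (onV (inputs P) ∘ from o)) idₕ λ a → cong (onV (inputs P)) (from-to o a)

⨾-wire : (P : Cospan S p m) (ι : fin m ⇄ fin k) (o : fin n ⇄ fin k) →
         P ⨾ᶜ wireᶜ ι o ≅ relabelᶜ (λ a → a) (from ι ∘ to o) P
⨾-wire P ι o = mk≅ f C.inL (C.rec-L _ _ _)
  (C.ext (C.inL ∘ₕ f) idₕ
    (⌞ C.inL ⌟ ⋆ C.rec-L _ _ _)
    (pick-ext λ v → trans (cong (onV C.inL) (≃V (C.rec-R _ _ _) v))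
      (trans (C.glue (from ι v)) (cong (onV C.inR) (to-from ι v)))))
  (λ a → ≃V (C.rec-L _ _ _) _) (λ a → ≃V (C.rec-R _ _ _) _)
  where
  module C = Comp P (wireᶜ ι o)
  f : apex (P ⨾ᶜ wireᶜ ι o) ⟶ apex P
  f = C.rec idₕ (pick (onV (outputs P) ∘ from ι)) λ a → cong (onV (outputs P)) (sym (from-to ι a))

wire-≅ : (ι : fin m ⇄ fin k) (o : fin n ⇄ fin k) (ι′ : fin m ⇄ fin k′) (o′ : fin n ⇄ fin k′) →
         (∀ a → from o (to ι a) ≡ from o′ (to ι′ a)) → wireᶜ {S = S} ι o ≅ wireᶜ ι′ o′
wire-≅ ι o ι′ o′ e = mk≅ (pick (to ι′ ∘ from ι)) (pick (to ι ∘ from ι′))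
  (pick-ext λ v → trans (cong (to ι′) (from-to ι _)) (to-from ι′ v))
  (pick-ext λ v → trans (cong (to ι) (from-to ι′ _)) (to-from ι v))
  (λ a → cong (to ι′) (from-to ι a))
  (λ b → trans (sym (to-from o′ _)) (trans (cong (to o′) (trans (sym (e _))
    (cong (from o) (to-from ι _)))) (cong (to o′) (from-to o b))))

_⊕ᵇ_ : fin m ⇄ fin n → fin p ⇄ fin q → fin (m + p) ⇄ fin (n + q)
_⊕ᵇ_ {m} {n} {p} {q} π ρ = join⇄ m p ⁻¹ ⍮ (π ⊞₁ ρ) ⍮ join⇄ n q

wire-⊗ : (ι : fin m ⇄ fin k) (o : fin n ⇄ fin k) (ι′ : fin m′ ⇄ fin k′) (o′ : fin n′ ⇄ fin k′) →
         wireᶜ {S = S} ι o ⊗ᶜ wireᶜ ι′ o′ ≅ wireᶜ (ι ⊕ᵇ ι′) (o ⊕ᵇ o′)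
wire-⊗ {m = m} {k = k} {n = n} {k′ = k′} ι o ι′ o′ = mk≅
  (record { onV = λ v → v ; onE = λ () ; onE-label = λ () ; onE-sources = λ () ; onE-targets = λ () })
  (pick λ v → v) (pick-ext λ _ → refl) ((λ _ → refl) ⸴ (λ ()))
  (λ a → [join] (splitAt m a)) (λ a → [join] (splitAt n a))
  where
  [join] : ∀ {A B : Set} {f : A → Fin k} {g : B → Fin k′} s →
           [ (λ a → f a ↑ˡ k′) , (λ b → k ↑ʳ g b) ]′ s ≡ join k k′ (Sum.map f g s)
  [join] (inj₁ _) = refl
  [join] (inj₂ _) = refl

relabel-id : relabelᶜ (λ a → a) (λ a → a) P ≅ P
relabel-id = mk≅ idₕ idₕ ≃-refl ≃-refl (λ _ → refl) (λ _ → refl)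

idᶜ-⨾ : (P : Cospan S m n) → idᶜ m ⨾ᶜ P ≅ P
idᶜ-⨾ P = ≅-trans (wire-⨾ idᵇ idᵇ P) relabel-id

⨾-idᶜ : (P : Cospan S m n) → P ⨾ᶜ idᶜ n ≅ P
⨾-idᶜ P = ≅-trans (⨾-wire P idᵇ idᵇ) relabel-id

idᶜ-⊗ : ∀ m n → idᶜ {S} m ⊗ᶜ idᶜ n ≅ idᶜ (m + n)
idᶜ-⊗ m n = ≅-trans (wire-⊗ idᵇ idᵇ idᵇ idᵇ) (wire-≅ (idᵇ {fin m} ⊕ᵇ idᵇ {fin n}) (idᵇ {fin m} ⊕ᵇ idᵇ {fin n}) idᵇ idᵇ
  λ a → from-to (idᵇ {fin m} ⊕ᵇ idᵇ {fin n}) a)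

swapF : ∀ m n → fin (m + n) ⇄ fin (n + m)
swapF m n = join⇄ m n ⁻¹ ⍮ swapᵇ (fin m) (fin n) ⍮ join⇄ n m

σᶜ≅wire : ∀ m n → σᶜ {S} m n ≅ wireᶜ (swapF m n) idᵇ
σᶜ≅wire m n = ≅-trans (≅-boundary (λ _ → refl) (λ a → []→join (splitAt n a)))
  (wire-≅ idᵇ (swapF n m) (swapF m n) idᵇ λ a → refl)
  where
  []→join : ∀ s → [ (m ↑ʳ_) , (_↑ˡ n) ]′ s ≡ join m n (Sum.swap s)
  []→join (inj₁ _) = refl
  []→join (inj₂ _) = refl

castA : ∀ m n p → Fin (m + (n + p)) → Fin ((m + n) + p)
castA m n p = Fin.cast (sym (+-assoc m n p))

castA₁ : ∀ m n p a → castA m n p (a ↑ˡ (n + p)) ≡ (a ↑ˡ n) ↑ˡ p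
castA₁ m n p a = toℕ-injective (trans (toℕ-cast (sym (+-assoc m n p)) _) (trans (toℕ-↑ˡ a (n + p))
  (sym (trans (toℕ-↑ˡ (a ↑ˡ n) p) (toℕ-↑ˡ a n)))))

castA₂ : ∀ m n p b → castA m n p (m ↑ʳ (b ↑ˡ p)) ≡ (m ↑ʳ b) ↑ˡ p
castA₂ m n p b = toℕ-injective (trans (toℕ-cast (sym (+-assoc m n p)) _) (trans (toℕ-↑ʳ m (b ↑ˡ p))
  (trans (cong (m +_) (toℕ-↑ˡ b p)) (sym (trans (toℕ-↑ˡ (m ↑ʳ b) p) (toℕ-↑ʳ m b))))))

castA₃ : ∀ m n p c → castA m n p (m ↑ʳ (n ↑ʳ c)) ≡ (m + n) ↑ʳ c
castA₃ m n p c = toℕ-injective (trans (toℕ-cast (sym (+-assoc m n p)) _) (trans (toℕ-↑ʳ m (n ↑ʳ c))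
  (trans (cong (m +_) (toℕ-↑ʳ n c)) (trans (sym (+-assoc m n _)) (sym (toℕ-↑ʳ (m + n) c))))))

idᶜ-⊗-unit : (P : Cospan S m n) → idᶜ 0 ⊗ᶜ P ≅ P
idᶜ-⊗-unit P = mk≅ f T.in₂ (T.rec-2 _ _)
  (T.ext (T.in₂ ∘ₕ f) idₕ (pick-ext λ ()) (⌞ T.in₂ ⌟ ⋆ T.rec-2 _ _))
  (λ a → ≃V (T.rec-2 _ _) _) (λ a → ≃V (T.rec-2 _ _) _)
  where
  module T = Tensor (idᶜ 0) P
  f : apex (idᶜ 0 ⊗ᶜ P) ⟶ apex P
  f = T.rec (pick λ ()) idₕ

⊗-idᶜ-unit : (P : Cospan S m n) →
             relabelᶜ (Fin.cast (sym (+-identityʳ m))) (Fin.cast (sym (+-identityʳ n))) (P ⊗ᶜ idᶜ 0) ≅ P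
⊗-idᶜ-unit {S} {m} {n} P = mk≅ f T.in₁ (T.rec-1 _ _)
  (T.ext (T.in₁ ∘ₕ f) idₕ (⌞ T.in₁ ⌟ ⋆ T.rec-1 _ _) (pick-ext λ ()))
  (λ a → trans (cong (onV f) (trans (cong (onV (inputs (P ⊗ᶜ idᶜ 0))) (cast-↑ˡ m a)) (T.inputs₁ a)))
               (≃V (T.rec-1 _ _) _))
  (λ a → trans (cong (onV f) (trans (cong (onV (outputs (P ⊗ᶜ idᶜ 0))) (cast-↑ˡ n a)) (T.outputs₁ a)))
               (≃V (T.rec-1 _ _) _))
  where
  module T = Tensor P (idᶜ 0)
  f : apex (P ⊗ᶜ idᶜ 0) ⟶ apex P
  f = T.rec idₕ (pick λ ())
  cast-↑ˡ : ∀ m (a : Fin m) → Fin.cast (sym (+-identityʳ m)) a ≡ a ↑ˡ 0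
  cast-↑ˡ m a = toℕ-injective (trans (toℕ-cast _ a) (sym (toℕ-↑ˡ a 0)))

⊗ᶜ-assoc : (P : Cospan S m m′) (Q : Cospan S n n′) (R : Cospan S p p′) →
           relabelᶜ (castA m n p) (castA m′ n′ p′) ((P ⊗ᶜ Q) ⊗ᶜ R) ≅ P ⊗ᶜ (Q ⊗ᶜ R)
⊗ᶜ-assoc {S} {m} {m′} {n} {n′} {p} {p′} P Q R = mk≅ f g
  (U.ext (f ∘ₕ g) idₕ
    (⌞ f ⌟ ⋆ U.rec-1 _ _ ▷ T.rec-1 _ _ ⋆′ ⌞ T₁.in₁ ⌟ ▷ T₁.rec-1 _ _)
    (U₁.ext (f ∘ₕ g ∘ₕ U.in₂) U.in₂
      (⌞ f ⌟ ⋆ (U.rec-2 _ _ ⋆′ ⌞ U₁.in₁ ⌟ ▷ U₁.rec-1 _ _) ▷ T.rec-1 _ _ ⋆′ ⌞ T₁.in₂ ⌟ ▷ T₁.rec-2 _ _)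
      (⌞ f ⌟ ⋆ (U.rec-2 _ _ ⋆′ ⌞ U₁.in₂ ⌟ ▷ U₁.rec-2 _ _) ▷ T.rec-2 _ _)))
  (T.ext (g ∘ₕ f) idₕ
    (T₁.ext (g ∘ₕ f ∘ₕ T.in₁) T.in₁
      (⌞ g ⌟ ⋆ (T.rec-1 _ _ ⋆′ ⌞ T₁.in₁ ⌟ ▷ T₁.rec-1 _ _) ▷ U.rec-1 _ _)
      (⌞ g ⌟ ⋆ (T.rec-1 _ _ ⋆′ ⌞ T₁.in₂ ⌟ ▷ T₁.rec-2 _ _) ▷ U.rec-2 _ _ ⋆′ ⌞ U₁.in₁ ⌟ ▷ U₁.rec-1 _ _))
    (⌞ g ⌟ ⋆ T.rec-2 _ _ ▷ U.rec-2 _ _ ⋆′ ⌞ U₁.in₂ ⌟ ▷ U₁.rec-2 _ _))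
  (↑-elim m _
    (λ a → trans (cong (onV f) (trans (cong (onV (inputs ((P ⊗ᶜ Q) ⊗ᶜ R))) (castA₁ m n p a))
        (trans (T.inputs₁ _) (cong (onV T.in₁) (T₁.inputs₁ a)))))
      (trans (trans (≃V (T.rec-1 _ _) _) (≃V (T₁.rec-1 _ _) _)) (sym (U.inputs₁ a))))
    (↑-elim n _
      (λ b → trans (cong (onV f) (trans (cong (onV (inputs ((P ⊗ᶜ Q) ⊗ᶜ R))) (castA₂ m n p b))
          (trans (T.inputs₁ _) (cong (onV T.in₁) (T₁.inputs₂ b)))))
        (trans (trans (≃V (T.rec-1 _ _) _) (≃V (T₁.rec-2 _ _) _))
          (sym (trans (U.inputs₂ _) (cong (onV U.in₂) (U₁.inputs₁ b))))))
      (λ c → trans (cong (onV f) (trans (cong (onV (inputs ((P ⊗ᶜ Q) ⊗ᶜ R))) (castA₃ m n p c)) (T.inputs₂ c)))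
        (trans (≃V (T.rec-2 _ _) _)
          (sym (trans (U.inputs₂ _) (cong (onV U.in₂) (U₁.inputs₂ c))))))))
  (↑-elim m′ _
    (λ a → trans (cong (onV f) (trans (cong (onV (outputs ((P ⊗ᶜ Q) ⊗ᶜ R))) (castA₁ m′ n′ p′ a))
        (trans (T.outputs₁ _) (cong (onV T.in₁) (T₁.outputs₁ a)))))
      (trans (trans (≃V (T.rec-1 _ _) _) (≃V (T₁.rec-1 _ _) _)) (sym (U.outputs₁ a))))
    (↑-elim n′ _
      (λ b → trans (cong (onV f) (trans (cong (onV (outputs ((P ⊗ᶜ Q) ⊗ᶜ R))) (castA₂ m′ n′ p′ b))
          (trans (T.outputs₁ _) (cong (onV T.in₁) (T₁.outputs₂ b)))))
        (trans (trans (≃V (T.rec-1 _ _) _) (≃V (T₁.rec-2 _ _) _))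
          (sym (trans (U.outputs₂ _) (cong (onV U.in₂) (U₁.outputs₁ b))))))
      (λ c → trans (cong (onV f) (trans (cong (onV (outputs ((P ⊗ᶜ Q) ⊗ᶜ R))) (castA₃ m′ n′ p′ c)) (T.outputs₂ c)))
        (trans (≃V (T.rec-2 _ _) _)
          (sym (trans (U.outputs₂ _) (cong (onV U.in₂) (U₁.outputs₂ c))))))))
  where
  module T₁ = Tensor P Q
  module T = Tensor (P ⊗ᶜ Q) R
  module U₁ = Tensor Q R
  module U = Tensor P (Q ⊗ᶜ R)
  f : apex ((P ⊗ᶜ Q) ⊗ᶜ R) ⟶ apex (P ⊗ᶜ (Q ⊗ᶜ R))
  f = T.rec (T₁.rec U.in₁ (U.in₂ ∘ₕ U₁.in₁)) (U.in₂ ∘ₕ U₁.in₂)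
  g : apex (P ⊗ᶜ (Q ⊗ᶜ R)) ⟶ apex ((P ⊗ᶜ Q) ⊗ᶜ R)
  g = U.rec (T.in₁ ∘ₕ T₁.in₁) (U₁.rec (T.in₁ ∘ₕ T₁.in₂) T.in₂)

⊗ᶜ-swap : (P : Cospan S m n) (Q : Cospan S p q) →
          relabelᶜ (λ a → a) (to (swapF q n)) (P ⊗ᶜ Q) ≅ relabelᶜ (to (swapF m p)) (λ a → a) (Q ⊗ᶜ P)
⊗ᶜ-swap {S} {m} {n} {p} {q} P Q = mk≅ f g
  (U.ext (f ∘ₕ g) idₕ (⌞ f ⌟ ⋆ U.rec-1 _ _ ▷ T.rec-2 _ _) (⌞ f ⌟ ⋆ U.rec-2 _ _ ▷ T.rec-1 _ _))
  (T.ext (g ∘ₕ f) idₕ (⌞ g ⌟ ⋆ T.rec-1 _ _ ▷ U.rec-2 _ _) (⌞ g ⌟ ⋆ T.rec-2 _ _ ▷ U.rec-1 _ _))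
  (λ a → trans (on-inputs (splitAt m a)) (cong [ _ , _ ]′ (sym (splitAt-join p m (Sum.swap (splitAt m a))))))
  (λ a → trans (cong (onV f ∘ [ _ , _ ]′) (splitAt-join n q (Sum.swap (splitAt q a)))) (on-outputs (splitAt q a)))
  where
  module T = Tensor P Q
  module U = Tensor Q P
  f : apex (P ⊗ᶜ Q) ⟶ apex (Q ⊗ᶜ P)
  f = T.rec U.in₂ U.in₁
  g : apex (Q ⊗ᶜ P) ⟶ apex (P ⊗ᶜ Q)
  g = U.rec T.in₂ T.in₁
  on-inputs : ∀ s → onV f ([ onV T.in₁ ∘ onV (inputs P) , onV T.in₂ ∘ onV (inputs Q) ]′ s)
                  ≡ [ onV U.in₁ ∘ onV (inputs Q) , onV U.in₂ ∘ onV (inputs P) ]′ (Sum.swap s)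
  on-inputs (inj₁ a) = ≃V (T.rec-1 _ _) _
  on-inputs (inj₂ b) = ≃V (T.rec-2 _ _) _
  on-outputs : ∀ s → onV f ([ onV T.in₁ ∘ onV (outputs P) , onV T.in₂ ∘ onV (outputs Q) ]′ (Sum.swap s))
                   ≡ [ onV U.in₁ ∘ onV (outputs Q) , onV U.in₂ ∘ onV (outputs P) ]′ s
  on-outputs (inj₁ a) = ≃V (T.rec-2 _ _) _
  on-outputs (inj₂ b) = ≃V (T.rec-1 _ _) _

Trᶜ-vanishing₀ : (P : Cospan S m n) → Trᶜ 0 P ≅ P
Trᶜ-vanishing₀ {m = m} {n = n} P = mk≅ f A.inT (A.rec-T _ _)
  (A.ext (A.inT ∘ₕ f) idₕ (⌞ A.inT ⌟ ⋆ A.rec-T _ _))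
  (λ a → ≃V (A.rec-T _ _) _) (λ a → ≃V (A.rec-T _ _) _)
  where
  module A = Trace {m = m} {n = n} 0 P
  f : apex (Trᶜ 0 P) ⟶ apex P
  f = A.rec idₕ λ ()

Trᶜ-vanishing₊ : ∀ x y m n (P : Cospan S ((x + y) + m) ((x + y) + n)) →
                 Trᶜ {m = m} {n = n} (x + y) P
                 ≅ Trᶜ {m = m} {n = n} y (Trᶜ {m = y + m} {n = y + n} x (relabelᶜ (castA x y m) (castA x y n) P))
Trᶜ-vanishing₊ {S} x y m n P = mk≅ f g
  (C.ext (f ∘ₕ g) idₕ (B.ext (f ∘ₕ g ∘ₕ C.inT) C.inT
    (⌞ f ⌟ ⋆ (C.rec-T _ _ ⋆′ ⌞ B.inT ⌟ ▷ B.rec-T _ _) ▷ A.rec-T _ _)))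
  (A.ext (g ∘ₕ f) idₕ (⌞ g ⌟ ⋆ A.rec-T _ _ ▷ C.rec-T _ _ ⋆′ ⌞ B.inT ⌟ ▷ B.rec-T _ _))
  (λ a → trans (≃V (A.rec-T _ _) _) (cong (onV C.inT ∘ onV B.inT ∘ onV (inputs P)) (sym (castA₃ x y m a))))
  (λ a → trans (≃V (A.rec-T _ _) _) (cong (onV C.inT ∘ onV B.inT ∘ onV (outputs P)) (sym (castA₃ x y n a))))
  where
  Pᵃ = relabelᶜ (castA x y m) (castA x y n) P
  module A = Trace {m = m} {n = n} (x + y) P
  module B = Trace {m = y + m} {n = y + n} x Pᵃ
  module C = Trace {m = m} {n = n} y (Trᶜ {m = y + m} {n = y + n} x Pᵃ)
  f : apex (Trᶜ {m = m} {n = n} (x + y) P) ⟶ apex (Trᶜ {m = m} {n = n} y (Trᶜ {m = y + m} {n = y + n} x Pᵃ))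
  f = A.rec (C.inT ∘ₕ B.inT) (↑-elim x _
    (λ a → trans (cong (onV C.inT ∘ onV B.inT ∘ onV (inputs P)) (sym (castA₁ x y m a)))
      (trans (cong (onV C.inT) (B.glue a)) (cong (onV C.inT ∘ onV B.inT ∘ onV (outputs P)) (castA₁ x y n a))))
    (λ b → trans (cong (onV C.inT ∘ onV B.inT ∘ onV (inputs P)) (sym (castA₂ x y m b)))
      (trans (C.glue b) (cong (onV C.inT ∘ onV B.inT ∘ onV (outputs P)) (castA₂ x y n b)))))
  g : apex (Trᶜ {m = m} {n = n} y (Trᶜ {m = y + m} {n = y + n} x Pᵃ)) ⟶ apex (Trᶜ {m = m} {n = n} (x + y) P)
  g = C.rec (B.rec A.inT λ a → trans (cong (onV A.inT ∘ onV (inputs P)) (castA₁ x y m a))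
              (trans (A.glue (a ↑ˡ y)) (cong (onV A.inT ∘ onV (outputs P)) (sym (castA₁ x y n a)))))
    λ b → trans (≃V (B.rec-T _ _) _) (trans (cong (onV A.inT ∘ onV (inputs P)) (castA₂ x y m b))
      (trans (A.glue (x ↑ʳ b)) (trans (cong (onV A.inT ∘ onV (outputs P)) (sym (castA₂ x y n b)))
        (sym (≃V (B.rec-T _ _) _)))))

Trᶜ-superposing : ∀ x m n p q (P : Cospan S (x + m) (x + n)) (Q : Cospan S p q) →
                  Trᶜ {m = m} {n = n} x P ⊗ᶜ Q
                  ≅ Trᶜ {m = m + p} {n = n + q} x (relabelᶜ (castA x m p) (castA x n q) (P ⊗ᶜ Q))
Trᶜ-superposing {S} x m n p q P Q = mk≅ f g
  (B.ext (f ∘ₕ g) idₕ (U.ext (f ∘ₕ g ∘ₕ B.inT) B.inT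
    (⌞ f ⌟ ⋆ (B.rec-T _ _ ⋆′ ⌞ U.in₁ ⌟ ▷ U.rec-1 _ _) ▷ T.rec-1 _ _ ⋆′ ⌞ A.inT ⌟ ▷ A.rec-T _ _)
    (⌞ f ⌟ ⋆ (B.rec-T _ _ ⋆′ ⌞ U.in₂ ⌟ ▷ U.rec-2 _ _) ▷ T.rec-2 _ _)))
  (T.ext (g ∘ₕ f) idₕ
    (A.ext (g ∘ₕ f ∘ₕ T.in₁) T.in₁
      (⌞ g ⌟ ⋆ (T.rec-1 _ _ ⋆′ ⌞ A.inT ⌟ ▷ A.rec-T _ _) ▷ B.rec-T _ _ ⋆′ ⌞ U.in₁ ⌟ ▷ U.rec-1 _ _))
    (⌞ g ⌟ ⋆ T.rec-2 _ _ ▷ B.rec-T _ _ ⋆′ ⌞ U.in₂ ⌟ ▷ U.rec-2 _ _))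
  (↑-elim m _
    (λ a → trans (cong (onV f) (T.inputs₁ a)) (trans (≃V (T.rec-1 _ _) _) (trans (≃V (A.rec-T _ _) _)
      (cong (onV B.inT) (sym (trans (cong (onV (inputs (P ⊗ᶜ Q))) (castA₂ x m p a)) (U.inputs₁ _)))))))
    (λ b → trans (cong (onV f) (T.inputs₂ b)) (trans (≃V (T.rec-2 _ _) _)
      (cong (onV B.inT) (sym (trans (cong (onV (inputs (P ⊗ᶜ Q))) (castA₃ x m p b)) (U.inputs₂ _)))))))
  (↑-elim n _
    (λ a → trans (cong (onV f) (T.outputs₁ a)) (trans (≃V (T.rec-1 _ _) _) (trans (≃V (A.rec-T _ _) _)
      (cong (onV B.inT) (sym (trans (cong (onV (outputs (P ⊗ᶜ Q))) (castA₂ x n q a)) (U.outputs₁ _)))))))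
    (λ b → trans (cong (onV f) (T.outputs₂ b)) (trans (≃V (T.rec-2 _ _) _)
      (cong (onV B.inT) (sym (trans (cong (onV (outputs (P ⊗ᶜ Q))) (castA₃ x n q b)) (U.outputs₂ _)))))))
  where
  PQ = relabelᶜ (castA x m p) (castA x n q) (P ⊗ᶜ Q)
  module A = Trace {m = m} {n = n} x P
  module T = Tensor (Trᶜ {m = m} {n = n} x P) Q
  module U = Tensor P Q
  module B = Trace {m = m + p} {n = n + q} x PQ
  in-PQ : ∀ a → onV (inputs PQ) (a ↑ˡ (m + p)) ≡ onV U.in₁ (onV (inputs P) (a ↑ˡ m))
  in-PQ a = trans (cong (onV (inputs (P ⊗ᶜ Q))) (castA₁ x m p a)) (U.inputs₁ _)
  out-PQ : ∀ a → onV (outputs PQ) (a ↑ˡ (n + q)) ≡ onV U.in₁ (onV (outputs P) (a ↑ˡ n))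
  out-PQ a = trans (cong (onV (outputs (P ⊗ᶜ Q))) (castA₁ x n q a)) (U.outputs₁ _)
  f : apex (Trᶜ {m = m} {n = n} x P ⊗ᶜ Q) ⟶ apex (Trᶜ {m = m + p} {n = n + q} x PQ)
  f = T.rec (A.rec (B.inT ∘ₕ U.in₁) λ a → trans (cong (onV B.inT) (sym (in-PQ a)))
              (trans (B.glue a) (cong (onV B.inT) (out-PQ a)))) (B.inT ∘ₕ U.in₂)
  g : apex (Trᶜ {m = m + p} {n = n + q} x PQ) ⟶ apex (Trᶜ {m = m} {n = n} x P ⊗ᶜ Q)
  g = B.rec (U.rec (T.in₁ ∘ₕ A.inT) T.in₂) λ a → trans (cong (onV (U.rec _ _)) (in-PQ a))
    (trans (≃V (U.rec-1 _ _) _) (trans (cong (onV T.in₁) (A.glue a))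
      (trans (sym (≃V (U.rec-1 _ _) _)) (cong (onV (U.rec _ _)) (sym (out-PQ a))))))

Trᶜ-yanking : ∀ x → Trᶜ {m = x} {n = x} x (σᶜ {S} x x) ≅ idᶜ x
Trᶜ-yanking {S} x = mk≅ f g (pick-ext λ v → trans (≃V (A.rec-T _ _) _) (fold-↑ʳ v))
  (A.ext (g ∘ₕ f) idₕ (pick-ext (↑-elim x _
    (λ a → trans (cong (onV g) (trans (≃V (A.rec-T _ _) _) (fold-↑ˡ a)))
      (sym (trans (A.glue a) (cong (onV A.inT) (cong [ _ , _ ]′ (splitAt-↑ˡ x a x))))))
    (λ a → cong (onV g) (trans (≃V (A.rec-T _ _) _) (fold-↑ʳ a))))))
  (λ a → trans (≃V (A.rec-T _ _) _) (fold-↑ʳ a))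
  (λ a → trans (≃V (A.rec-T _ _) _) (trans (cong fold (cong [ _ , _ ]′ (splitAt-↑ʳ x x a))) (fold-↑ˡ a)))
  where
  module A = Trace {m = x} {n = x} x (σᶜ {S} x x)
  fold : Fin (x + x) → Fin x
  fold = [ (λ a → a) , (λ a → a) ]′ ∘ splitAt x
  fold-↑ˡ : ∀ a → fold (a ↑ˡ x) ≡ a
  fold-↑ˡ a = cong [ _ , _ ]′ (splitAt-↑ˡ x a x)
  fold-↑ʳ : ∀ a → fold (x ↑ʳ a) ≡ a
  fold-↑ʳ a = cong [ _ , _ ]′ (splitAt-↑ʳ x x a)
  f : apex (Trᶜ {m = x} {n = x} x (σᶜ {S} x x)) ⟶ discrete x
  f = A.rec (pick fold) λ a → trans (fold-↑ˡ a)
    (sym (trans (cong fold (cong [ _ , _ ]′ (splitAt-↑ˡ x a x))) (fold-↑ʳ a)))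
  g : discrete x ⟶ apex (Trᶜ {m = x} {n = x} x (σᶜ {S} x x))
  g = A.inT ∘ₕ pick (x ↑ʳ_)

swapF-↑ˡ : ∀ m n a → to (swapF m n) (a ↑ˡ n) ≡ n ↑ʳ a
swapF-↑ˡ m n a = cong (join n m ∘ Sum.swap) (splitAt-↑ˡ m a n)

swapF-↑ʳ : ∀ m n b → to (swapF m n) (m ↑ʳ b) ≡ b ↑ˡ m
swapF-↑ʳ m n b = cong (join n m ∘ Sum.swap) (splitAt-↑ʳ m n b)

⨾ᶜ-as-Trᶜ : (P : Cospan S m n) (Q : Cospan S n p) →
            P ⨾ᶜ Q ≅ Trᶜ {m = m} {n = p} n (reindexᶜ (swapF n m) (P ⊗ᶜ Q))
⨾ᶜ-as-Trᶜ {S} {m} {n} {p} P Q = mk≅ f g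
  (A.ext (f ∘ₕ g) idₕ (T.ext (f ∘ₕ g ∘ₕ A.inT) A.inT
    (⌞ f ⌟ ⋆ (A.rec-T _ _ ⋆′ ⌞ T.in₁ ⌟ ▷ T.rec-1 _ _) ▷ C.rec-L _ _ _)
    (⌞ f ⌟ ⋆ (A.rec-T _ _ ⋆′ ⌞ T.in₂ ⌟ ▷ T.rec-2 _ _) ▷ C.rec-R _ _ _)))
  (C.ext (g ∘ₕ f) idₕ
    (⌞ g ⌟ ⋆ C.rec-L _ _ _ ▷ A.rec-T _ _ ⋆′ ⌞ T.in₁ ⌟ ▷ T.rec-1 _ _)
    (⌞ g ⌟ ⋆ C.rec-R _ _ _ ▷ A.rec-T _ _ ⋆′ ⌞ T.in₂ ⌟ ▷ T.rec-2 _ _))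
  (λ a → trans (≃V (C.rec-L _ _ _) _) (cong (onV A.inT) (sym (trans
    (cong (onV (inputs (P ⊗ᶜ Q))) (swapF-↑ʳ n m a)) (T.inputs₁ a)))))
  (λ a → trans (≃V (C.rec-R _ _ _) _) (cong (onV A.inT) (sym (T.outputs₂ a))))
  where
  PQ = reindexᶜ (swapF n m) (P ⊗ᶜ Q)
  module C = Comp P Q
  module T = Tensor P Q
  module A = Trace {m = m} {n = p} n PQ
  in-PQ : ∀ a → onV (inputs PQ) (a ↑ˡ m) ≡ onV T.in₂ (onV (inputs Q) a)
  in-PQ a = trans (cong (onV (inputs (P ⊗ᶜ Q))) (swapF-↑ˡ n m a)) (T.inputs₂ a)
  f : apex (P ⨾ᶜ Q) ⟶ apex (Trᶜ {m = m} {n = p} n PQ)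
  f = C.rec (A.inT ∘ₕ T.in₁) (A.inT ∘ₕ T.in₂) λ a →
    trans (cong (onV A.inT) (sym (T.outputs₁ a))) (trans (sym (A.glue a)) (cong (onV A.inT) (in-PQ a)))
  g : apex (Trᶜ {m = m} {n = p} n PQ) ⟶ apex (P ⨾ᶜ Q)
  g = A.rec (T.rec C.inL C.inR) λ a → trans (cong (onV (T.rec _ _)) (in-PQ a)) (trans (≃V (T.rec-2 _ _) _)
    (trans (sym (C.glue a)) (trans (sym (≃V (T.rec-1 _ _) _)) (cong (onV (T.rec _ _)) (sym (T.outputs₁ a))))))

-- The universal properties again, now for cospans that are only known through them:
-- equality checking is much faster when the apexes do not unfold.

record IsComp {S m n p} (P : Cospan S m n) (Q : Cospan S n p) (PQ : Cospan S m p) : Set where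
  no-eta-equality
  field
    inL  : apex P ⟶ apex PQ
    inR  : apex Q ⟶ apex PQ
    glue : ∀ a → onV inL (onV (outputs P) a) ≡ onV inR (onV (inputs Q) a)
    rec  : ∀ {K} (h : apex P ⟶ K) (k : apex Q ⟶ K) →
           (∀ a → onV h (onV (outputs P) a) ≡ onV k (onV (inputs Q) a)) → apex PQ ⟶ K
    rec-L : ∀ {K} (h : apex P ⟶ K) k e → ⌞ rec h k e ⌟ ∙ ⌞ inL ⌟ ≃ ⌞ h ⌟
    rec-R : ∀ {K} (h : apex P ⟶ K) k e → ⌞ rec h k e ⌟ ∙ ⌞ inR ⌟ ≃ ⌞ k ⌟
    ext  : ∀ {K} (u w : apex PQ ⟶ K) → ⌞ u ⌟ ∙ ⌞ inL ⌟ ≃ ⌞ w ⌟ ∙ ⌞ inL ⌟ →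
           ⌞ u ⌟ ∙ ⌞ inR ⌟ ≃ ⌞ w ⌟ ∙ ⌞ inR ⌟ → ⌞ u ⌟ ≃ ⌞ w ⌟
    inputs-L  : ∀ a → onV (inputs PQ) a ≡ onV inL (onV (inputs P) a)
    outputs-R : ∀ a → onV (outputs PQ) a ≡ onV inR (onV (outputs Q) a)

record IsTrace {S m n} (x : ℕ) (P : Cospan S (x + m) (x + n)) (TP : Cospan S m n) : Set where
  no-eta-equality
  field
    inT   : apex P ⟶ apex TP
    glue  : ∀ a → onV inT (onV (inputs P) (a ↑ˡ m)) ≡ onV inT (onV (outputs P) (a ↑ˡ n))
    rec   : ∀ {K} (h : apex P ⟶ K) →
            (∀ a → onV h (onV (inputs P) (a ↑ˡ m)) ≡ onV h (onV (outputs P) (a ↑ˡ n))) → apex TP ⟶ K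
    rec-T : ∀ {K} (h : apex P ⟶ K) e → ⌞ rec h e ⌟ ∙ ⌞ inT ⌟ ≃ ⌞ h ⌟
    ext   : ∀ {K} (u w : apex TP ⟶ K) → ⌞ u ⌟ ∙ ⌞ inT ⌟ ≃ ⌞ w ⌟ ∙ ⌞ inT ⌟ → ⌞ u ⌟ ≃ ⌞ w ⌟
    inputs-T  : ∀ a → onV (inputs TP) a ≡ onV inT (onV (inputs P) (x ↑ʳ a))
    outputs-T : ∀ a → onV (outputs TP) a ≡ onV inT (onV (outputs P) (x ↑ʳ a))

record IsTensor {S m n p q} (P : Cospan S m n) (Q : Cospan S p q) (PQ : Cospan S (m + p) (n + q)) : Set where
  no-eta-equality
  field
    in₁   : apex P ⟶ apex PQ
    in₂   : apex Q ⟶ apex PQ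
    rec   : ∀ {K} (h : apex P ⟶ K) (k : apex Q ⟶ K) → apex PQ ⟶ K
    rec-1 : ∀ {K} (h : apex P ⟶ K) k → ⌞ rec h k ⌟ ∙ ⌞ in₁ ⌟ ≃ ⌞ h ⌟
    rec-2 : ∀ {K} (h : apex P ⟶ K) k → ⌞ rec h k ⌟ ∙ ⌞ in₂ ⌟ ≃ ⌞ k ⌟
    ext   : ∀ {K} (u w : apex PQ ⟶ K) → ⌞ u ⌟ ∙ ⌞ in₁ ⌟ ≃ ⌞ w ⌟ ∙ ⌞ in₁ ⌟ →
            ⌞ u ⌟ ∙ ⌞ in₂ ⌟ ≃ ⌞ w ⌟ ∙ ⌞ in₂ ⌟ → ⌞ u ⌟ ≃ ⌞ w ⌟
    inputs₁  : ∀ a → onV (inputs PQ) (a ↑ˡ p) ≡ onV in₁ (onV (inputs P) a)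
    inputs₂  : ∀ a → onV (inputs PQ) (m ↑ʳ a) ≡ onV in₂ (onV (inputs Q) a)
    outputs₁ : ∀ a → onV (outputs PQ) (a ↑ˡ q) ≡ onV in₁ (onV (outputs P) a)
    outputs₂ : ∀ a → onV (outputs PQ) (n ↑ʳ a) ≡ onV in₂ (onV (outputs Q) a)

isComp : (P : Cospan S m n) (Q : Cospan S n p) → IsComp P Q (P ⨾ᶜ Q)
isComp P Q = record
  { inL = C.inL ; inR = C.inR ; glue = C.glue ; rec = C.rec ; rec-L = C.rec-L ; rec-R = C.rec-R
  ; ext = C.ext ; inputs-L = λ _ → refl ; outputs-R = λ _ → refl }
  where module C = Comp P Q

isTrace : ∀ x m n (P : Cospan S (x + m) (x + n)) → IsTrace {m = m} {n = n} x P (Trᶜ x P)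
isTrace x m n P = record
  { inT = T.inT ; glue = T.glue ; rec = T.rec ; rec-T = T.rec-T ; ext = T.ext
  ; inputs-T = λ _ → refl ; outputs-T = λ _ → refl }
  where module T = Trace {m = m} {n = n} x P

isTensor : (P : Cospan S m n) (Q : Cospan S p q) → IsTensor P Q (P ⊗ᶜ Q)
isTensor P Q = record
  { in₁ = T.in₁ ; in₂ = T.in₂ ; rec = T.rec ; rec-1 = T.rec-1 ; rec-2 = T.rec-2 ; ext = T.ext
  ; inputs₁ = T.inputs₁ ; inputs₂ = T.inputs₂ ; outputs₁ = T.outputs₁ ; outputs₂ = T.outputs₂ }
  where module T = Tensor P Q

sliding-universal : ∀ {x y m n} {P : Cospan S (x + m) (y + n)} {Q : Cospan S y x} {Q₁ Q₂ PQ QP TPQ TQP} →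
  IsTensor Q (idᶜ n) Q₁ → IsTensor Q (idᶜ m) Q₂ →
  IsComp {n = y + n} P Q₁ PQ → IsComp {n = x + m} Q₂ P QP →
  IsTrace {m = m} {n = n} x PQ TPQ → IsTrace {m = m} {n = n} y QP TQP → TPQ ≅ TQP
sliding-universal {S} {x} {y} {m} {n} {P} {Q} {Q₁} {Q₂} {PQ} {QP} {TPQ} {TQP} isT isU isC isD isA isB = mk≅ f g
  (B.ext (f ∘ₕ g) idₕ (D.ext (f ∘ₕ g ∘ₕ B.inT) B.inT
    (U.ext (f ∘ₕ g ∘ₕ B.inT ∘ₕ D.inL) (B.inT ∘ₕ D.inL)
      (⌞ f ⌟ ⋆ g-Q ▷ f-Q)
      (⌞ f ⌟ ⋆ g-id ▷ pick-ext λ a → trans (≃V f-P _) (inputs-Q a)))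
    (⌞ f ⌟ ⋆ g-P ▷ f-P)))
  (A.ext (g ∘ₕ f) idₕ (C.ext (g ∘ₕ f ∘ₕ A.inT) A.inT
    (⌞ g ⌟ ⋆ f-P ▷ g-P)
    (T.ext (g ∘ₕ f ∘ₕ A.inT ∘ₕ C.inR) (A.inT ∘ₕ C.inR)
      (⌞ g ⌟ ⋆ f-Q ▷ g-Q)
      (⌞ g ⌟ ⋆ f-id ▷ pick-ext λ a → trans (≃V g-P _) (outputs-P a)))))
  (λ a → trans (cong (onV f) (trans (A.inputs-T a) (cong (onV A.inT) (C.inputs-L _)))) (trans (≃V f-P _)
    (trans (inputs-Q a) (sym (trans (B.inputs-T a) (cong (onV B.inT) (trans (D.inputs-L _) (cong (onV D.inL) (U.inputs₂ a)))))))))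
  (λ a → trans (cong (onV f) (trans (A.outputs-T a) (cong (onV A.inT) (trans (C.outputs-R _) (cong (onV C.inR) (T.outputs₂ a))))))
    (trans (≃V f-id a) (sym (trans (B.outputs-T a) (cong (onV B.inT) (D.outputs-R _))))))
  where
  module T = IsTensor isT
  module U = IsTensor isU
  module C = IsComp isC
  module D = IsComp isD
  module A = IsTrace isA
  module B = IsTrace isB
  inputs-Q : ∀ a → onV B.inT (onV D.inR (onV (inputs P) (x ↑ʳ a))) ≡ onV B.inT (onV D.inL (onV U.in₂ a))
  inputs-Q a = cong (onV B.inT) (trans (sym (D.glue (x ↑ʳ a))) (cong (onV D.inL) (U.outputs₂ a)))
  outputs-P : ∀ a → onV A.inT (onV C.inL (onV (outputs P) (y ↑ʳ a))) ≡ onV A.inT (onV C.inR (onV T.in₂ a))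
  outputs-P a = cong (onV A.inT) (trans (C.glue (y ↑ʳ a)) (cong (onV C.inR) (T.inputs₂ a)))
  pick-P : discrete n ⟶ apex TQP
  pick-P = pick λ b → onV B.inT (onV D.inR (onV (outputs P) (y ↑ʳ b)))
  pick-Q : discrete m ⟶ apex TPQ
  pick-Q = pick λ b → onV A.inT (onV C.inL (onV (inputs P) (x ↑ʳ b)))
  f : apex TPQ ⟶ apex TQP
  f = A.rec
    (C.rec (B.inT ∘ₕ D.inR) (T.rec (B.inT ∘ₕ D.inL ∘ₕ U.in₁) pick-P)
      (↑-elim y _
        (λ a → trans (trans (cong (onV B.inT) (sym (D.outputs-R _))) (trans (sym (B.glue a)) (cong (onV B.inT) (D.inputs-L _))))
          (trans (cong (onV B.inT ∘ onV D.inL) (U.inputs₁ a))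
          (sym (trans (cong (onV (T.rec _ _)) (T.inputs₁ a)) (≃V (T.rec-1 _ _) _)))))
        (λ b → sym (trans (cong (onV (T.rec _ _)) (T.inputs₂ b)) (≃V (T.rec-2 _ _) _)))))
    λ a → trans (trans (cong (onV (C.rec _ _ _)) (C.inputs-L _)) (≃V (C.rec-L _ _ _) _)) (trans (cong (onV B.inT) (trans (sym (D.glue (a ↑ˡ m)))
        (cong (onV D.inL) (U.outputs₁ a))))
      (sym (trans (cong (onV (C.rec _ _ _)) (trans (C.outputs-R _) (cong (onV C.inR) (T.outputs₁ a))))
        (trans (≃V (C.rec-R _ _ _) _) (≃V (T.rec-1 _ _) _)))))
  g : apex TQP ⟶ apex TPQ
  g = B.rec
    (D.rec (U.rec (A.inT ∘ₕ C.inR ∘ₕ T.in₁) pick-Q) (A.inT ∘ₕ C.inL)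
      (↑-elim x _
        (λ a → trans (trans (cong (onV (U.rec _ _)) (U.outputs₁ a)) (≃V (U.rec-1 _ _) _))
          (trans (cong (onV A.inT) (trans (cong (onV C.inR) (sym (T.outputs₁ a))) (sym (C.outputs-R _))))
            (trans (sym (A.glue a)) (cong (onV A.inT) (C.inputs-L _)))))
        (λ b → trans (cong (onV (U.rec _ _)) (U.outputs₂ b)) (≃V (U.rec-2 _ _) _))))
    λ a → trans (trans (cong (onV (D.rec _ _ _)) (trans (D.inputs-L _) (cong (onV D.inL) (U.inputs₁ a))))
        (trans (≃V (D.rec-L _ _ _) _) (≃V (U.rec-1 _ _) _)))
      (trans (cong (onV A.inT) (trans (cong (onV C.inR) (sym (T.inputs₁ a))) (sym (C.glue (a ↑ˡ n)))))
        (sym (trans (cong (onV (D.rec _ _ _)) (D.outputs-R _)) (≃V (D.rec-R _ _ _) _))))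
  f-P : ⌞ f ⌟ ∙ ⌞ A.inT ∘ₕ C.inL ⌟ ≃ ⌞ B.inT ∘ₕ D.inR ⌟
  f-P = A.rec-T _ _ ⋆′ ⌞ C.inL ⌟ ▷ C.rec-L _ _ _
  f-Q : ⌞ f ⌟ ∙ ⌞ A.inT ∘ₕ C.inR ∘ₕ T.in₁ ⌟ ≃ ⌞ B.inT ∘ₕ D.inL ∘ₕ U.in₁ ⌟
  f-Q = A.rec-T _ _ ⋆′ ⌞ C.inR ∘ₕ T.in₁ ⌟ ▷ C.rec-R _ _ _ ⋆′ ⌞ T.in₁ ⌟ ▷ T.rec-1 _ _
  f-id : ⌞ f ⌟ ∙ ⌞ A.inT ∘ₕ C.inR ∘ₕ T.in₂ ⌟ ≃ ⌞ pick-P ⌟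
  f-id = A.rec-T _ _ ⋆′ ⌞ C.inR ∘ₕ T.in₂ ⌟ ▷ C.rec-R _ _ _ ⋆′ ⌞ T.in₂ ⌟ ▷ T.rec-2 _ _
  g-P : ⌞ g ⌟ ∙ ⌞ B.inT ∘ₕ D.inR ⌟ ≃ ⌞ A.inT ∘ₕ C.inL ⌟
  g-P = B.rec-T _ _ ⋆′ ⌞ D.inR ⌟ ▷ D.rec-R _ _ _
  g-Q : ⌞ g ⌟ ∙ ⌞ B.inT ∘ₕ D.inL ∘ₕ U.in₁ ⌟ ≃ ⌞ A.inT ∘ₕ C.inR ∘ₕ T.in₁ ⌟
  g-Q = B.rec-T _ _ ⋆′ ⌞ D.inL ∘ₕ U.in₁ ⌟ ▷ D.rec-L _ _ _ ⋆′ ⌞ U.in₁ ⌟ ▷ U.rec-1 _ _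
  g-id : ⌞ g ⌟ ∙ ⌞ B.inT ∘ₕ D.inL ∘ₕ U.in₂ ⌟ ≃ ⌞ pick-Q ⌟
  g-id = B.rec-T _ _ ⋆′ ⌞ D.inL ∘ₕ U.in₂ ⌟ ▷ D.rec-L _ _ _ ⋆′ ⌞ U.in₂ ⌟ ▷ U.rec-2 _ _

tightening-universal : ∀ {x m n p q} {P : Cospan S m n} {Q : Cospan S (x + n) (x + p)} {R : Cospan S p q}
  {P₁ R₁ PQ PQR TPQR TQ PTQ PTQR} → IsTensor (idᶜ x) P P₁ → IsTensor (idᶜ x) R R₁ →
  IsComp {n = x + n} P₁ Q PQ → IsComp {n = x + p} PQ R₁ PQR → IsTrace {m = m} {n = q} x PQR TPQR →
  IsTrace {m = n} {n = p} x Q TQ → IsComp P TQ PTQ → IsComp PTQ R PTQR → TPQR ≅ PTQR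
tightening-universal {S} {x} {m} {n} {p} {q} {P} {Q} {R} {P₁} {R₁} {PQ} {PQR} {TPQR} {TQ} {PTQ} {PTQR}
  isT₁ isT₂ isC₁ isC₂ isA isB isD₁ isD₂ = mk≅ f g fg≃ gf≃
  (λ a → trans (cong (onV f) (trans (A.inputs-T a) (cong (onV A.inT) (trans (C₂.inputs-L _)
      (cong (onV C₂.inL) (trans (C₁.inputs-L _) (cong (onV C₁.inL) (T₁.inputs₂ a))))))))
    (trans (≃V f-P _) (sym (trans (D₂.inputs-L a) (cong (onV D₂.inL) (D₁.inputs-L a))))))
  (λ a → trans (cong (onV f) (trans (A.outputs-T a) (cong (onV A.inT) (trans (C₂.outputs-R _) (cong (onV C₂.inR) (T₂.outputs₂ a))))))
    (trans (≃V f-R _) (sym (D₂.outputs-R a))))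
  where
  module T₁ = IsTensor isT₁
  module T₂ = IsTensor isT₂
  module C₁ = IsComp isC₁
  module C₂ = IsComp isC₂
  module A = IsTrace isA
  module B = IsTrace isB
  module D₁ = IsComp isD₁
  module D₂ = IsComp isD₂
  onP : apex P ⟶ apex TPQR
  onP = A.inT ∘ₕ C₂.inL ∘ₕ C₁.inL ∘ₕ T₁.in₂
  onQ : apex Q ⟶ apex TPQR
  onQ = A.inT ∘ₕ C₂.inL ∘ₕ C₁.inR
  onR : apex R ⟶ apex TPQR
  onR = A.inT ∘ₕ C₂.inR ∘ₕ T₂.in₂
  Q-in₁ : ∀ a → onV onQ (onV (inputs Q) (a ↑ˡ n)) ≡ onV A.inT (onV C₂.inL (onV C₁.inL (onV T₁.in₁ a)))
  Q-in₁ a = cong (onV A.inT ∘ onV C₂.inL) (trans (sym (C₁.glue (a ↑ˡ n))) (cong (onV C₁.inL) (T₁.outputs₁ a)))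
  Q-out₁ : ∀ a → onV onQ (onV (outputs Q) (a ↑ˡ p)) ≡ onV A.inT (onV C₂.inR (onV T₂.in₁ a))
  Q-out₁ a = cong (onV A.inT) (trans (trans (cong (onV C₂.inL) (sym (C₁.outputs-R _))) (C₂.glue (a ↑ˡ p))) (cong (onV C₂.inR) (T₂.inputs₁ a)))
  fQ : apex Q ⟶ apex PTQR
  fQ = D₂.inL ∘ₕ D₁.inR ∘ₕ B.inT
  f₁ : apex P₁ ⟶ apex PTQR
  f₁ = T₁.rec (pick λ a → onV fQ (onV (inputs Q) (a ↑ˡ n))) (D₂.inL ∘ₕ D₁.inL)
  f₁-out : ∀ a → onV f₁ (onV (outputs P₁) a) ≡ onV fQ (onV (inputs Q) a)
  f₁-out = ↑-elim x _
    (λ a → trans (cong (onV f₁) (T₁.outputs₁ a)) (≃V (T₁.rec-1 _ _) _))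
    (λ b → trans (cong (onV f₁) (T₁.outputs₂ b))
      (trans (≃V (T₁.rec-2 _ _) _) (cong (onV D₂.inL) (trans (D₁.glue b) (cong (onV D₁.inR) (B.inputs-T b))))))
  f₂ : apex PQ ⟶ apex PTQR
  f₂ = C₁.rec f₁ fQ f₁-out
  f₂-P : ⌞ f₂ ⌟ ∙ ⌞ C₁.inL ⌟ ≃ ⌞ f₁ ⌟
  f₂-P = C₁.rec-L f₁ fQ f₁-out
  f₂-Q : ⌞ f₂ ⌟ ∙ ⌞ C₁.inR ⌟ ≃ ⌞ fQ ⌟
  f₂-Q = C₁.rec-R f₁ fQ f₁-out
  f₃ : apex R₁ ⟶ apex PTQR
  f₃ = T₂.rec (pick λ a → onV fQ (onV (outputs Q) (a ↑ˡ p))) D₂.inR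
  f₃-in : ∀ a → onV f₂ (onV (outputs PQ) a) ≡ onV f₃ (onV (inputs R₁) a)
  f₃-in a = trans (cong (onV f₂) (C₁.outputs-R a)) (trans (≃V f₂-Q _) (cases a))
    where
    cases : ∀ a → onV fQ (onV (outputs Q) a) ≡ onV f₃ (onV (inputs R₁) a)
    cases = ↑-elim x _
      (λ a → sym (trans (cong (onV f₃) (T₂.inputs₁ a)) (≃V (T₂.rec-1 _ _) _)))
      (λ b → trans (trans (cong (onV D₂.inL) (trans (cong (onV D₁.inR) (sym (B.outputs-T b))) (sym (D₁.outputs-R b)))) (D₂.glue b))
        (sym (trans (cong (onV f₃) (T₂.inputs₂ b)) (≃V (T₂.rec-2 _ _) _))))
  f₄ : apex PQR ⟶ apex PTQR
  f₄ = C₂.rec f₂ f₃ f₃-in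
  f₄-L : ⌞ f₄ ⌟ ∙ ⌞ C₂.inL ⌟ ≃ ⌞ f₂ ⌟
  f₄-L = C₂.rec-L f₂ f₃ f₃-in
  f₄-R : ⌞ f₄ ⌟ ∙ ⌞ C₂.inR ⌟ ≃ ⌞ f₃ ⌟
  f₄-R = C₂.rec-R f₂ f₃ f₃-in
  f₄-in : ∀ a → onV f₄ (onV (inputs PQR) a) ≡ onV f₁ (onV (inputs P₁) a)
  f₄-in a = trans (cong (onV f₄) (C₂.inputs-L a)) (trans (≃V f₄-L _)
    (trans (cong (onV f₂) (C₁.inputs-L a)) (≃V f₂-P _)))
  f₄-out : ∀ a → onV f₄ (onV (outputs PQR) a) ≡ onV f₃ (onV (outputs R₁) a)
  f₄-out a = trans (cong (onV f₄) (C₂.outputs-R a)) (≃V f₄-R _)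
  f₄-trace : ∀ a → onV f₄ (onV (inputs PQR) (a ↑ˡ m)) ≡ onV f₄ (onV (outputs PQR) (a ↑ˡ q))
  f₄-trace a = trans (trans (f₄-in _) (trans (cong (onV f₁) (T₁.inputs₁ a)) (≃V (T₁.rec-1 _ _) a)))
    (trans (cong (onV D₂.inL ∘ onV D₁.inR) (B.glue a))
      (sym (trans (f₄-out _) (trans (cong (onV f₃) (T₂.outputs₁ a)) (≃V (T₂.rec-1 _ _) a)))))
  f : apex TPQR ⟶ apex PTQR
  f = A.rec f₄ f₄-trace
  f-T : ⌞ f ⌟ ∙ ⌞ A.inT ⌟ ≃ ⌞ f₄ ⌟
  f-T = A.rec-T f₄ f₄-trace
  onQ-trace : ∀ a → onV onQ (onV (inputs Q) (a ↑ˡ n)) ≡ onV onQ (onV (outputs Q) (a ↑ˡ p))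
  onQ-trace a = trans (Q-in₁ a) (trans
    (trans (cong (onV A.inT) (sym (trans (C₂.inputs-L _) (cong (onV C₂.inL) (trans (C₁.inputs-L _) (cong (onV C₁.inL) (T₁.inputs₁ a)))))))
      (trans (A.glue a) (cong (onV A.inT) (trans (C₂.outputs-R _) (cong (onV C₂.inR) (T₂.outputs₁ a))))))
    (sym (Q-out₁ a)))
  g₁ : apex TQ ⟶ apex TPQR
  g₁ = B.rec onQ onQ-trace
  g₁-T : ⌞ g₁ ⌟ ∙ ⌞ B.inT ⌟ ≃ ⌞ onQ ⌟
  g₁-T = B.rec-T onQ onQ-trace
  g₁-in : ∀ b → onV onP (onV (outputs P) b) ≡ onV g₁ (onV (inputs TQ) b)
  g₁-in b = trans (cong (onV A.inT ∘ onV C₂.inL) (trans (cong (onV C₁.inL) (sym (T₁.outputs₂ b))) (C₁.glue (x ↑ʳ b))))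
    (sym (trans (cong (onV g₁) (B.inputs-T b)) (≃V g₁-T _)))
  g₂ : apex PTQ ⟶ apex TPQR
  g₂ = D₁.rec onP g₁ g₁-in
  g₂-P : ⌞ g₂ ⌟ ∙ ⌞ D₁.inL ⌟ ≃ ⌞ onP ⌟
  g₂-P = D₁.rec-L onP g₁ g₁-in
  g₂-Q : ⌞ g₂ ⌟ ∙ ⌞ D₁.inR ⌟ ≃ ⌞ g₁ ⌟
  g₂-Q = D₁.rec-R onP g₁ g₁-in
  g₂-out : ∀ b → onV g₂ (onV (outputs PTQ) b) ≡ onV onR (onV (inputs R) b)
  g₂-out b = trans (trans (cong (onV g₂) (D₁.outputs-R b)) (≃V g₂-Q _))
    (trans (trans (cong (onV g₁) (B.outputs-T b)) (≃V g₁-T _))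
    (cong (onV A.inT) (trans (trans (cong (onV C₂.inL) (sym (C₁.outputs-R _))) (C₂.glue (x ↑ʳ b))) (cong (onV C₂.inR) (T₂.inputs₂ b)))))
  g : apex PTQR ⟶ apex TPQR
  g = D₂.rec g₂ onR g₂-out
  g-L : ⌞ g ⌟ ∙ ⌞ D₂.inL ⌟ ≃ ⌞ g₂ ⌟
  g-L = D₂.rec-L g₂ onR g₂-out
  g-P : ⌞ g ⌟ ∙ ⌞ D₂.inL ∘ₕ D₁.inL ⌟ ≃ ⌞ onP ⌟
  g-P = g-L ⋆′ ⌞ D₁.inL ⌟ ▷ g₂-P
  g-Q : ⌞ g ⌟ ∙ ⌞ fQ ⌟ ≃ ⌞ onQ ⌟
  g-Q = g-L ⋆′ ⌞ D₁.inR ∘ₕ B.inT ⌟ ▷ g₂-Q ⋆′ ⌞ B.inT ⌟ ▷ g₁-T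
  g-R : ⌞ g ⌟ ∙ ⌞ D₂.inR ⌟ ≃ ⌞ onR ⌟
  g-R = D₂.rec-R g₂ onR g₂-out
  f-P₁ : ⌞ f ⌟ ∙ ⌞ A.inT ∘ₕ C₂.inL ∘ₕ C₁.inL ⌟ ≃ ⌞ f₁ ⌟
  f-P₁ = f-T ⋆′ ⌞ C₂.inL ∘ₕ C₁.inL ⌟ ▷ f₄-L ⋆′ ⌞ C₁.inL ⌟ ▷ f₂-P
  f-P : ⌞ f ⌟ ∙ ⌞ onP ⌟ ≃ ⌞ D₂.inL ∘ₕ D₁.inL ⌟
  f-P = f-P₁ ⋆′ ⌞ T₁.in₂ ⌟ ▷ T₁.rec-2 _ _
  f-Q : ⌞ f ⌟ ∙ ⌞ onQ ⌟ ≃ ⌞ fQ ⌟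
  f-Q = f-T ⋆′ ⌞ C₂.inL ∘ₕ C₁.inR ⌟ ▷ f₄-L ⋆′ ⌞ C₁.inR ⌟ ▷ f₂-Q
  f-R₁ : ⌞ f ⌟ ∙ ⌞ A.inT ∘ₕ C₂.inR ⌟ ≃ ⌞ f₃ ⌟
  f-R₁ = f-T ⋆′ ⌞ C₂.inR ⌟ ▷ f₄-R
  f-R : ⌞ f ⌟ ∙ ⌞ onR ⌟ ≃ ⌞ D₂.inR ⌟
  f-R = f-R₁ ⋆′ ⌞ T₂.in₂ ⌟ ▷ T₂.rec-2 _ _
  f-id₁ : ∀ a → onV f (onV A.inT (onV C₂.inL (onV C₁.inL (onV T₁.in₁ a)))) ≡ onV fQ (onV (inputs Q) (a ↑ˡ n))
  f-id₁ a = trans (≃V f-P₁ _) (≃V (T₁.rec-1 _ _) a)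
  f-id₂ : ∀ a → onV f (onV A.inT (onV C₂.inR (onV T₂.in₁ a))) ≡ onV fQ (onV (outputs Q) (a ↑ˡ p))
  f-id₂ a = trans (≃V f-R₁ _) (≃V (T₂.rec-1 _ _) a)
  fg≃ : ⌞ f ⌟ ∙ ⌞ g ⌟ ≃ idₘ
  fg≃ = D₂.ext (f ∘ₕ g) idₕ
    (D₁.ext (f ∘ₕ g ∘ₕ D₂.inL) D₂.inL (⌞ f ⌟ ⋆ g-P ▷ f-P)
      (B.ext (f ∘ₕ g ∘ₕ D₂.inL ∘ₕ D₁.inR) (D₂.inL ∘ₕ D₁.inR) (⌞ f ⌟ ⋆ g-Q ▷ f-Q)))
    (⌞ f ⌟ ⋆ g-R ▷ f-R)
  gf≃ : ⌞ g ⌟ ∙ ⌞ f ⌟ ≃ idₘ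
  gf≃ = A.ext (g ∘ₕ f) idₕ (C₂.ext (g ∘ₕ f ∘ₕ A.inT) A.inT
    (C₁.ext (g ∘ₕ f ∘ₕ A.inT ∘ₕ C₂.inL) (A.inT ∘ₕ C₂.inL)
      (T₁.ext (g ∘ₕ f ∘ₕ A.inT ∘ₕ C₂.inL ∘ₕ C₁.inL) (A.inT ∘ₕ C₂.inL ∘ₕ C₁.inL)
        (pick-ext λ a → trans (cong (onV g) (f-id₁ a)) (trans (≃V g-Q _) (Q-in₁ a)))
        (⌞ g ⌟ ⋆ f-P ▷ g-P))
      (⌞ g ⌟ ⋆ f-Q ▷ g-Q))
    (T₂.ext (g ∘ₕ f ∘ₕ A.inT ∘ₕ C₂.inR) (A.inT ∘ₕ C₂.inR)
      (pick-ext λ a → trans (cong (onV g) (f-id₂ a)) (trans (≃V g-Q _) (Q-out₁ a)))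
      (⌞ g ⌟ ⋆ f-R ▷ g-R)))

-- Circuits without generators

permᶜ : fin m ⇄ fin n → Cospan S m n
permᶜ π = wireᶜ π idᵇ

permᶜ-cong : (π ρ : fin m ⇄ fin n) → (∀ v → to π v ≡ to ρ v) → permᶜ {S = S} π ≅ permᶜ ρ
permᶜ-cong π ρ e = wire-≅ π idᵇ ρ idᵇ e

permᶜ-⨾ : (π : fin m ⇄ fin n) (ρ : fin n ⇄ fin p) → permᶜ {S = S} π ⨾ᶜ permᶜ ρ ≅ permᶜ (π ⍮ ρ)
permᶜ-⨾ π ρ = ≅-trans (wire-⨾ π idᵇ (permᶜ ρ)) (≅-boundary (λ _ → refl) (λ _ → refl))

permᶜ-⊗ : (π : fin m ⇄ fin n) (ρ : fin p ⇄ fin q) → permᶜ {S = S} π ⊗ᶜ permᶜ ρ ≅ permᶜ (π ⊕ᵇ ρ)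
permᶜ-⊗ {n = n} {q = q} π ρ = ≅-trans (wire-⊗ π idᵇ ρ idᵇ) (wire-≅ (π ⊕ᵇ ρ) (idᵇ {fin n} ⊕ᵇ idᵇ {fin q}) (π ⊕ᵇ ρ) idᵇ
  λ v → trans (sym (map-id-⊕ _)) (from-to (idᵇ {fin n} ⊕ᵇ idᵇ {fin q}) (to (π ⊕ᵇ ρ) v)))
  where
  map-id-⊕ : ∀ v → from (idᵇ {fin n} ⊕ᵇ idᵇ {fin q}) (to (idᵇ {fin n} ⊕ᵇ idᵇ {fin q}) v) ≡ from (idᵇ {fin n} ⊕ᵇ idᵇ {fin q}) v
  map-id-⊕ v = trans (from-to (idᵇ {fin n} ⊕ᵇ idᵇ {fin q}) v) (sym (trans (cong (join n q) (⊎-map-id (splitAt n v))) (join-splitAt n q v)))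

permᶜ-cast : .(e : m ≡ m′) .(e′ : n ≡ n′) (π : fin m ⇄ fin n) →
             relabelᶜ (Fin.cast (sym e)) (Fin.cast (sym e′)) (permᶜ {S = S} π)
             ≅ permᶜ (castᵇ (sym e) ⍮ π ⍮ castᵇ e′)
permᶜ-cast e e′ π = ≅-trans (≅-boundary (λ _ → refl) (λ _ → refl))
  (wire-≅ (castᵇ (sym e) ⍮ π) (castᵇ (sym e′)) (castᵇ (sym e) ⍮ π ⍮ castᵇ e′) idᵇ λ _ → refl)

record Enumerates (β : fin ⌊ a ⌋ ⇄ fin ⌊ b ⌋) (π : a ⇄ b) : Set where
  constructor enumerates
  field
    at : ∀ v → to β (to (enum a) v) ≡ to (enum b) (to π v)

open Enumerates

enumerates-⍮ : {β : fin ⌊ a ⌋ ⇄ fin ⌊ b ⌋} {γ : fin ⌊ b ⌋ ⇄ fin ⌊ c ⌋} {π : a ⇄ b} {ρ : b ⇄ c} →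
               Enumerates β π → Enumerates γ ρ → Enumerates (β ⍮ γ) (π ⍮ ρ)
enumerates-⍮ {γ = γ} {π = π} h h′ = enumerates λ v → trans (cong (to γ) (at h v)) (at h′ (to π v))

enumerates-id : ∀ a → Enumerates {a} idᵇ idᵇ
enumerates-id a = enumerates λ _ → refl

enumerates-⊕ : ∀ a b c d {β : fin ⌊ a ⌋ ⇄ fin ⌊ b ⌋} {γ : fin ⌊ c ⌋ ⇄ fin ⌊ d ⌋} {π : a ⇄ b} {ρ : c ⇄ d} →
               Enumerates β π → Enumerates γ ρ → Enumerates {a ⊞ c} {b ⊞ d} (β ⊕ᵇ γ) (π ⊞₁ ρ)
enumerates-⊕ a b c d {β} {γ} h h′ = enumerates λ
  { (inj₁ v) → trans
      (cong (join ⌊ b ⌋ ⌊ d ⌋ ∘ Sum.map (to β) (to γ)) (splitAt-↑ˡ ⌊ a ⌋ (to (enum a) v) ⌊ c ⌋))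
      (cong (_↑ˡ ⌊ d ⌋) (at h v))
  ; (inj₂ v) → trans
      (cong (join ⌊ b ⌋ ⌊ d ⌋ ∘ Sum.map (to β) (to γ)) (splitAt-↑ʳ ⌊ a ⌋ ⌊ c ⌋ (to (enum c) v)))
      (cong (⌊ b ⌋ ↑ʳ_) (at h′ v)) }

enumerates-swap : ∀ a b → Enumerates {a ⊞ b} {b ⊞ a} (swapF ⌊ a ⌋ ⌊ b ⌋) (swapᵇ a b)
enumerates-swap a b = enumerates λ
  { (inj₁ v) → swapF-↑ˡ ⌊ a ⌋ ⌊ b ⌋ (to (enum a) v)
  ; (inj₂ v) → swapF-↑ʳ ⌊ a ⌋ ⌊ b ⌋ (to (enum b) v) }

enumerates-assoc⁻¹ : ∀ a b c → Enumerates {a ⊞ (b ⊞ c)} {(a ⊞ b) ⊞ c}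
                     (castᵇ (sym (+-assoc ⌊ a ⌋ ⌊ b ⌋ ⌊ c ⌋))) (assocʳ a b c ⁻¹)
enumerates-assoc⁻¹ a b c = enumerates λ
  { (inj₁ v) → castA₁ ⌊ a ⌋ ⌊ b ⌋ ⌊ c ⌋ (to (enum a) v)
  ; (inj₂ (inj₁ v)) → castA₂ ⌊ a ⌋ ⌊ b ⌋ ⌊ c ⌋ (to (enum b) v)
  ; (inj₂ (inj₂ v)) → castA₃ ⌊ a ⌋ ⌊ b ⌋ ⌊ c ⌋ (to (enum c) v) }

enumerates-assoc : ∀ a b c → Enumerates {(a ⊞ b) ⊞ c} {a ⊞ (b ⊞ c)}
                   (castᵇ (+-assoc ⌊ a ⌋ ⌊ b ⌋ ⌊ c ⌋)) (assocʳ a b c)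
enumerates-assoc a b c = enumerates λ v → trans
  (cong (to (castᵇ (+-assoc ⌊ a ⌋ ⌊ b ⌋ ⌊ c ⌋)) ∘ to (enum ((a ⊞ b) ⊞ c))) (sym (from-to (assocʳ a b c) v)))
  (trans (cong (to (castᵇ (+-assoc ⌊ a ⌋ ⌊ b ⌋ ⌊ c ⌋))) (sym (at (enumerates-assoc⁻¹ a b c) (to (assocʳ a b c) v))))
    (to-from (castᵇ (+-assoc ⌊ a ⌋ ⌊ b ⌋ ⌊ c ⌋)) _))

enumerates-cong : {β γ : fin ⌊ a ⌋ ⇄ fin ⌊ b ⌋} {π ρ : a ⇄ b} → Enumerates β π → Enumerates γ ρ →
                  (∀ v → to π v ≡ to ρ v) → ∀ v → to β v ≡ to γ v
enumerates-cong {a} {b} {β} {γ} h h′ e v = trans (cong (to β) (sym (to-from (enum a) v)))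
  (trans (at h _) (trans (cong (to (enum b)) (e _)) (trans (sym (at h′ _)) (cong (to γ) (to-from (enum a) v)))))

σᶜ-inverse : ∀ m n → σᶜ {S} m n ⨾ᶜ σᶜ n m ≅ idᶜ (m + n)
σᶜ-inverse m n = ≅-trans (⨾ᶜ-cong (σᶜ≅wire m n) (σᶜ≅wire n m)) (≅-trans (permᶜ-⨾ (swapF m n) (swapF n m))
  (permᶜ-cong (swapF m n ⍮ swapF n m) idᵇ (enumerates-cong
    (enumerates-⍮ (enumerates-swap (fin m) (fin n)) (enumerates-swap (fin n) (fin m)))
    (enumerates-id (fin m ⊞ fin n)) λ { (inj₁ _) → refl ; (inj₂ _) → refl })))

σᶜ-unit : ∀ m → relabelᶜ (Fin.cast (sym (+-identityʳ m))) (Fin.cast (sym refl)) (σᶜ {S} m 0) ≅ idᶜ m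
σᶜ-unit {S} m = ≅-trans (relabel-cong {γ = Fin.cast (sym (+-identityʳ m))} {γ′ = Fin.cast (sym (+-identityʳ m))}
    {δ = Fin.cast (sym refl)} {δ′ = Fin.cast (sym refl)} (λ _ → refl) (λ _ → refl) (σᶜ≅wire m 0))
  (≅-trans (permᶜ-cast (+-identityʳ m) refl (swapF m 0))
    (permᶜ-cong (castᵇ (sym (+-identityʳ m)) ⍮ swapF m 0 ⍮ castᵇ refl) idᵇ λ v →
      trans (cast-is-id refl (to (swapF m 0) (Fin.cast (sym (+-identityʳ m)) v)))
      (trans (cong (to (swapF m 0)) (cast-↑ˡ v)) (swapF-↑ˡ m 0 v))))
  where
  cast-↑ˡ : ∀ v → Fin.cast (sym (+-identityʳ m)) v ≡ v ↑ˡ 0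
  cast-↑ˡ v = toℕ-injective (trans (toℕ-cast (sym (+-identityʳ m)) v) (sym (toℕ-↑ˡ v 0)))

σᶜ-hexagon : ∀ m n p → σᶜ {S} m (n + p) ≅
  relabelᶜ (Fin.cast (sym (+-assoc m n p))) (Fin.cast (sym (+-assoc n m p))) (σᶜ m n ⊗ᶜ idᶜ p)
  ⨾ᶜ relabelᶜ (Fin.cast (sym refl)) (Fin.cast (sym (sym (+-assoc n p m)))) (idᶜ n ⊗ᶜ σᶜ m p)
σᶜ-hexagon {S} m n p = ≅-trans (σᶜ≅wire m (n + p)) (≅-sym (≅-trans (⨾ᶜ-cong first≅ second≅)
  (≅-trans (permᶜ-⨾ first second) (permᶜ-cong (first ⍮ second) (swapF m (n + p)) pointwise))))
  where
  M = fin m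
  N = fin n
  L = fin p
  first : fin (m + (n + p)) ⇄ fin (n + (m + p))
  first = castᵇ (sym (+-assoc m n p)) ⍮ (swapF m n ⊕ᵇ idᵇ {L}) ⍮ castᵇ (+-assoc n m p)
  second : fin (n + (m + p)) ⇄ fin ((n + p) + m)
  second = castᵇ refl ⍮ (idᵇ {N} ⊕ᵇ swapF m p) ⍮ castᵇ (sym (+-assoc n p m))
  first≅ : relabelᶜ (Fin.cast (sym (+-assoc m n p))) (Fin.cast (sym (+-assoc n m p))) (σᶜ m n ⊗ᶜ idᶜ p)
           ≅ permᶜ {S = S} first
  first≅ = ≅-trans (relabel-cong {γ = Fin.cast (sym (+-assoc m n p))} {γ′ = Fin.cast (sym (+-assoc m n p))}
      {δ = Fin.cast (sym (+-assoc n m p))} {δ′ = Fin.cast (sym (+-assoc n m p))} (λ _ → refl) (λ _ → refl)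
      (≅-trans (⊗ᶜ-cong (σᶜ≅wire m n) (≅-refl {P = idᶜ p})) (permᶜ-⊗ (swapF m n) (idᵇ {L}))))
    (permᶜ-cast (+-assoc m n p) (+-assoc n m p) (swapF m n ⊕ᵇ idᵇ {L}))
  second≅ : relabelᶜ (Fin.cast (sym refl)) (Fin.cast (sym (sym (+-assoc n p m)))) (idᶜ n ⊗ᶜ σᶜ m p)
            ≅ permᶜ {S = S} second
  second≅ = ≅-trans (relabel-cong {γ = Fin.cast (sym refl)} {γ′ = Fin.cast (sym refl)}
      {δ = Fin.cast (sym (sym (+-assoc n p m)))} {δ′ = Fin.cast (sym (sym (+-assoc n p m)))} (λ _ → refl) (λ _ → refl)
      (≅-trans (⊗ᶜ-cong (≅-refl {P = idᶜ n}) (σᶜ≅wire m p)) (permᶜ-⊗ (idᵇ {N}) (swapF m p))))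
    (permᶜ-cast refl (sym (+-assoc n p m)) (idᵇ {N} ⊕ᵇ swapF m p))
  cast-enum : Enumerates {N ⊞ (M ⊞ L)} (castᵇ refl) idᵇ
  cast-enum = enumerates λ v → cast-is-id refl (to (enum (N ⊞ (M ⊞ L))) v)
  pointwise : ∀ v → to (first ⍮ second) v ≡ to (swapF m (n + p)) v
  pointwise = enumerates-cong
    (enumerates-⍮
      (enumerates-⍮ (enumerates-⍮ (enumerates-assoc⁻¹ M N L)
          (enumerates-⊕ (M ⊞ N) (N ⊞ M) L L (enumerates-swap M N) (enumerates-id L)))
        (enumerates-assoc N M L))
      (enumerates-⍮ (enumerates-⍮ cast-enum
          (enumerates-⊕ N N (M ⊞ L) (L ⊞ M) (enumerates-id N) (enumerates-swap M L)))
        (enumerates-assoc⁻¹ N L M)))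
    (enumerates-swap M (N ⊞ L))
    λ { (inj₁ _) → refl ; (inj₂ (inj₁ _)) → refl ; (inj₂ (inj₂ _)) → refl }

σᶜ-natural : (P : Cospan S m n) (Q : Cospan S p q) → (P ⊗ᶜ Q) ⨾ᶜ σᶜ n q ≅ σᶜ m p ⨾ᶜ (Q ⊗ᶜ P)
σᶜ-natural {m = m} {n = n} {p = p} {q = q} P Q = ≅-trans
  (≅-trans (⨾ᶜ-cong (≅-refl {P = P ⊗ᶜ Q}) (σᶜ≅wire n q)) (≅-trans (⨾-wire (P ⊗ᶜ Q) (swapF n q) idᵇ)
    (relabel-cong {γ = λ a → a} {γ′ = λ a → a} {δ = from (swapF n q)} {δ′ = to (swapF q n)}
      (λ _ → refl) (λ _ → refl) (≅-refl {P = P ⊗ᶜ Q}))))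
  (≅-trans (⊗ᶜ-swap P Q)
    (≅-sym (≅-trans (⨾ᶜ-cong (σᶜ≅wire m p) (≅-refl {P = Q ⊗ᶜ P})) (wire-⨾ (swapF m p) idᵇ (Q ⊗ᶜ P)))))

-- Soundness

⟦cast⟧ : (e : m ≡ m′) (e′ : n ≡ n′) (f : Term S m n) →
         ⟦ cast e e′ f ⟧ ≅ relabelᶜ (Fin.cast (sym e)) (Fin.cast (sym e′)) ⟦ f ⟧
⟦cast⟧ refl refl f = mk≅ idₕ idₕ ≃-refl ≃-refl
  (λ v → cong (onV (inputs ⟦ f ⟧)) (sym (cast-is-id refl v)))
  (λ v → cong (onV (outputs ⟦ f ⟧)) (sym (cast-is-id refl v)))

⟦cast-assoc⟧ : ∀ m n p m′ n′ p′ (f : Term S ((m + n) + p) ((m′ + n′) + p′)) →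
               ⟦ cast (+-assoc m n p) (+-assoc m′ n′ p′) f ⟧ ≅ relabelᶜ (castA m n p) (castA m′ n′ p′) ⟦ f ⟧
⟦cast-assoc⟧ m n p m′ n′ p′ f = ⟦cast⟧ (+-assoc m n p) (+-assoc m′ n′ p′) f

-- Statements about the subterms of a term, rather than about iterated composites of cospans,
-- keep the types compared by Agda from unfolding to pushouts.

⟦⨾⟧-isComp : (f : Term S m n) (g : Term S n p) → IsComp ⟦ f ⟧ ⟦ g ⟧ ⟦ f ⨾ g ⟧
⟦⨾⟧-isComp f g = isComp ⟦ f ⟧ ⟦ g ⟧

⟦Tr⟧-isTrace : ∀ x m n (f : Term S (x + m) (x + n)) → IsTrace {m = m} {n = n} x ⟦ f ⟧ ⟦ Tr x f ⟧
⟦Tr⟧-isTrace x m n f = isTrace x m n ⟦ f ⟧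

⟦⊗⟧-isTensor : (f : Term S m n) (g : Term S p q) → IsTensor ⟦ f ⟧ ⟦ g ⟧ ⟦ f ⊗ g ⟧
⟦⊗⟧-isTensor f g = isTensor ⟦ f ⟧ ⟦ g ⟧

⟦tightening⟧ : ∀ x m n p q (f : Term S m n) (g : Term S (x + n) (x + p)) (h : Term S p q) →
               ⟦ Tr {m = m} {n = q} x ((id x ⊗ f) ⨾ g ⨾ (id x ⊗ h)) ⟧ ≅ ⟦ f ⨾ Tr {m = n} {n = p} x g ⨾ h ⟧
⟦tightening⟧ x m n p q f g h = tightening-universal (⟦⊗⟧-isTensor (id x) f) (⟦⊗⟧-isTensor (id x) h)
  (⟦⨾⟧-isComp (id x ⊗ f) g) (⟦⨾⟧-isComp ((id x ⊗ f) ⨾ g) (id x ⊗ h))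
  (⟦Tr⟧-isTrace x m q ((id x ⊗ f) ⨾ g ⨾ (id x ⊗ h)))
  (⟦Tr⟧-isTrace x n p g) (⟦⨾⟧-isComp f (Tr x g)) (⟦⨾⟧-isComp (f ⨾ Tr x g) h)

⟦sliding⟧ : ∀ x y m n (f : Term S (x + m) (y + n)) (g : Term S y x) →
            ⟦ Tr {m = m} {n = n} x (f ⨾ (g ⊗ id n)) ⟧ ≅ ⟦ Tr {m = m} {n = n} y ((g ⊗ id m) ⨾ f) ⟧
⟦sliding⟧ x y m n f g = sliding-universal (⟦⊗⟧-isTensor g (id n)) (⟦⊗⟧-isTensor g (id m))
  (⟦⨾⟧-isComp f (g ⊗ id n)) (⟦⨾⟧-isComp (g ⊗ id m) f)
  (⟦Tr⟧-isTrace x m n (f ⨾ (g ⊗ id n))) (⟦Tr⟧-isTrace y m n ((g ⊗ id m) ⨾ f))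

⟦vanishing₊⟧ : ∀ x y m n (f : Term S ((x + y) + m) ((x + y) + n)) →
               ⟦ Tr {m = m} {n = n} (x + y) f ⟧
               ≅ ⟦ Tr {m = m} {n = n} y (Tr {m = y + m} {n = y + n} x (cast (+-assoc x y m) (+-assoc x y n) f)) ⟧
⟦vanishing₊⟧ {S} x y m n f = ≅-trans (Trᶜ-vanishing₊ x y m n ⟦ f ⟧) (Trᶜ-cong {m = m} {n = n} y
    {P = Trᶜ x (relabelᶜ (castA x y m) (castA x y n) ⟦ f ⟧)} {Q = ⟦ Tr x f′ ⟧} inner)
  where
  f′ : Term S (x + (y + m)) (x + (y + n))
  f′ = cast (+-assoc x y m) (+-assoc x y n) f
  inner : Trᶜ {m = y + m} {n = y + n} x (relabelᶜ (castA x y m) (castA x y n) ⟦ f ⟧) ≅ ⟦ Tr x f′ ⟧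
  inner = Trᶜ-cong {m = y + m} {n = y + n} x {relabelᶜ (castA x y m) (castA x y n) ⟦ f ⟧} {⟦ f′ ⟧} (≅-sym (⟦cast-assoc⟧ x y m x y n f))

⟦hexagon⟧ : ∀ m n p → ⟦ σ {S} m (n + p) ⟧
            ≅ ⟦ cast (+-assoc m n p) (+-assoc n m p) (σ m n ⊗ id p)
                ⨾ cast refl (sym (+-assoc n p m)) (id n ⊗ σ m p) ⟧
⟦hexagon⟧ {S} m n p = ≅-trans (σᶜ-hexagon m n p)
    (⨾ᶜ-cong {P = first} {⟦ first′ ⟧} {Q = second} {⟦ second′ ⟧}
      (≅-sym (⟦cast⟧ (+-assoc m n p) (+-assoc n m p) (σ m n ⊗ id p)))
      (≅-sym (⟦cast⟧ refl (sym (+-assoc n p m)) (id n ⊗ σ m p))))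
  where
  first : Cospan S (m + (n + p)) (n + (m + p))
  first = relabelᶜ (Fin.cast (sym (+-assoc m n p))) (Fin.cast (sym (+-assoc n m p))) (σᶜ m n ⊗ᶜ idᶜ p)
  first′ : Term S (m + (n + p)) (n + (m + p))
  first′ = cast (+-assoc m n p) (+-assoc n m p) (σ m n ⊗ id p)
  second : Cospan S (n + (m + p)) ((n + p) + m)
  second = relabelᶜ (Fin.cast (sym refl)) (Fin.cast (sym (sym (+-assoc n p m)))) (idᶜ n ⊗ᶜ σᶜ m p)
  second′ : Term S (n + (m + p)) ((n + p) + m)
  second′ = cast refl (sym (+-assoc n p m)) (id n ⊗ σ m p)

⟦⟧-sound : {f g : Term S m n} → f ≈ g → ⟦ f ⟧ ≅ ⟦ g ⟧
⟦⟧-sound ≈-refl = ≅-refl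
⟦⟧-sound (≈-sym e) = ≅-sym (⟦⟧-sound e)
⟦⟧-sound (≈-trans {f = f} {g} {h} e e′) = ≅-trans {P = ⟦ f ⟧} {⟦ g ⟧} {⟦ h ⟧} (⟦⟧-sound e) (⟦⟧-sound e′)
⟦⟧-sound (⨾-cong {f = f} {f′} {g} {g′} e h) = ⨾ᶜ-cong {P = ⟦ f ⟧} {⟦ f′ ⟧} {Q = ⟦ g ⟧} {⟦ g′ ⟧} (⟦⟧-sound e) (⟦⟧-sound h)
⟦⟧-sound (⊗-cong {f = f} {f′} {g = g} {g′} e h) = ⊗ᶜ-cong {P = ⟦ f ⟧} {⟦ f′ ⟧} {Q = ⟦ g ⟧} {⟦ g′ ⟧} (⟦⟧-sound e) (⟦⟧-sound h)
⟦⟧-sound (Tr-cong {x = x} {m = m} {n = n} {f} {f′} e) = Trᶜ-cong {m = m} {n = n} x {⟦ f ⟧} {⟦ f′ ⟧} (⟦⟧-sound e)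
⟦⟧-sound (⨾-idˡ f) = idᶜ-⨾ ⟦ f ⟧
⟦⟧-sound (⨾-idʳ f) = ⨾-idᶜ ⟦ f ⟧
⟦⟧-sound (⨾-assoc f g h) = ⨾ᶜ-assoc ⟦ f ⟧ ⟦ g ⟧ ⟦ h ⟧
⟦⟧-sound (⊗-id {m} {n}) = idᶜ-⊗ m n
⟦⟧-sound (⊗-⨾ f g h k) = ⊗ᶜ-⨾ᶜ ⟦ f ⟧ ⟦ g ⟧ ⟦ h ⟧ ⟦ k ⟧
⟦⟧-sound (⊗-idˡ f) = idᶜ-⊗-unit ⟦ f ⟧
⟦⟧-sound (⊗-idʳ f) = ≅-trans (⟦cast⟧ (+-identityʳ _) (+-identityʳ _) (f ⊗ id 0)) (⊗-idᶜ-unit ⟦ f ⟧)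
⟦⟧-sound (⊗-assoc {m} {m′} {n} {n′} {p} {p′} f g h) =
  ≅-trans (⟦cast-assoc⟧ m n p m′ n′ p′ ((f ⊗ g) ⊗ h)) (⊗ᶜ-assoc ⟦ f ⟧ ⟦ g ⟧ ⟦ h ⟧)
⟦⟧-sound (σ-natural f g) = σᶜ-natural ⟦ f ⟧ ⟦ g ⟧
⟦⟧-sound (σ-inverse {m} {n}) = σᶜ-inverse m n
⟦⟧-sound (σ-unit {m}) = ≅-trans (⟦cast⟧ (+-identityʳ m) refl (σ m 0)) (σᶜ-unit m)
⟦⟧-sound (σ-hexagon {m} {n} {p}) = ⟦hexagon⟧ m n p
⟦⟧-sound (tightening {m = m} {n = n} {x = x} {p = p} {q = q} f g h) = ⟦tightening⟧ x m n p q f g h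
⟦⟧-sound (sliding {x = x} {m = m} {y = y} {n = n} f g) = ⟦sliding⟧ x y m n f g
⟦⟧-sound (vanishing₀ f) = Trᶜ-vanishing₀ ⟦ f ⟧
⟦⟧-sound (vanishing₊ {x} {y} {m} {n} f) = ⟦vanishing₊⟧ x y m n f
⟦⟧-sound (superposing {x} {m} {n} {p} f) = ≅-trans (Trᶜ-superposing x m n p p ⟦ f ⟧ (idᶜ p))
  (Trᶜ-cong {m = m + p} {n = n + p} x {relabelᶜ (castA x m p) (castA x n p) (⟦ f ⟧ ⊗ᶜ idᶜ p)}
    {⟦ cast (+-assoc x m p) (+-assoc x n p) (f ⊗ id p) ⟧} (≅-sym (⟦cast-assoc⟧ x m p x n p (f ⊗ id p))))
⟦⟧-sound (yanking {x}) = Trᶜ-yanking x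

-- Completeness

Tr-⊩ : ∀ x m n {P : Cospan S (x + m) (x + n)} {f : Term S (x + m) (x + n)} →
       P ⊩ f → Trᶜ {m = m} {n = n} x P ⊩ Tr x f
Tr-⊩ zero m n {P} {f} r = ⊩-≈ (≈-sym (vanishing₀ f)) (⊩-≅ (≅-sym (Trᶜ-vanishing₀ P)) r)
Tr-⊩ {S} (suc x) m n {P} {f} r = ⊩-≈ (≈-sym (vanishing₊ {x = 1} {y = x} f))
  (⊩-≅ (≅-sym (Trᶜ-vanishing₊ 1 x m n P)) (Tr-⊩ x m n (Tr₁-⊩ (⊩-≅ recast r))))
  where
  recast : P ≅ relabelᶜ (castA 1 x m) (castA 1 x n) P
  recast = mk≅ idₕ idₕ ≃-refl ≃-refl
    (λ v → cong (onV (inputs P)) (sym (cast-is-id refl v)))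
    (λ v → cong (onV (outputs P)) (sym (cast-is-id refl v)))

⟪swapF⟫ : ∀ m n → ⟪_⟫ {S = S} (swapF m n) ≈ σ m n
⟪swapF⟫ m n = ≈-sym (≈-trans (σ-swap (fin m) (fin n)) (sq-join⇒≈ m n n m
  (sq-⟪⟫ {π = join⇄ m n} {π′ = join⇄ n m} {α = swapᵇ (fin m) (fin n)} {β = swapF m n}
    λ v → cong (join n m ∘ Sum.swap) (sym (splitAt-join m n v)))))

⟦⟧-⊩ : (f : Term S m n) → ⟦ f ⟧ ⊩ f
⟦⟧-⊩ (gen φ) = gen-⊩ φ
⟦⟧-⊩ (id n) = id-⊩ n
⟦⟧-⊩ (σ m n) = σ-⊩ m n
⟦⟧-⊩ (_⨾_ {m} {n} {p} f g) = ⊩-≈ (≈-trans (Tr-cong (⨾-congʳ (⟪swapF⟫ n m))) (≈-sym (⨾-as-Tr f g)))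
  (⊩-≅ (≅-sym (⨾ᶜ-as-Trᶜ ⟦ f ⟧ ⟦ g ⟧))
    (Tr-⊩ n m p (reindex-⊩ (swapF n m) (⊗-⊩ (⟦⟧-⊩ f) (⟦⟧-⊩ g)))))
⟦⟧-⊩ (f ⊗ g) = ⊗-⊩ (⟦⟧-⊩ f) (⟦⟧-⊩ g)
⟦⟧-⊩ (Tr {m = m} {n = n} x f) = Tr-⊩ x m n (⟦⟧-⊩ f)

⟦⟧-complete : (f g : Term S m n) → ⟦ f ⟧ ≅ ⟦ g ⟧ → f ≈ g
⟦⟧-complete f g θ = let M , e = ⟦⟧-⊩ f
                        N , h = ⟦⟧-⊩ g
                    in ≈-trans (≈-sym e) (≈-trans (nf-≅ θ M N) h)

-- Denotations of permutations

↔⇒⇄ : Permutation m n → fin m ⇄ fin n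
↔⇒⇄ π = record { to = π ⟨$⟩ʳ_ ; from = π ⟨$⟩ˡ_ ; to-from = λ _ → perm-inverseʳ π ; from-to = λ _ → perm-inverseˡ π }

insᵇ : Fin (suc n) → fin (suc n) ⇄ fin (suc n)
insᵇ zero = idᵇ
insᵇ {suc n} (suc b) = (swapF 1 1 ⊕ᵇ idᵇ {fin n}) ⍮ (idᵇ {fin 1} ⊕ᵇ insᵇ b)

insᵇ-zero : (b : Fin (suc n)) → to (insᵇ b) zero ≡ b
insᵇ-zero zero = refl
insᵇ-zero {suc n} (suc b) = cong suc (insᵇ-zero b)

insᵇ-suc : (b : Fin (suc n)) (j : Fin n) → to (insᵇ b) (suc j) ≡ punchIn b j
insᵇ-suc zero j = refl
insᵇ-suc {suc n} (suc b) zero = refl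
insᵇ-suc {suc n} (suc b) (suc j) = cong suc (insᵇ-suc b j)

record Denotes {S} {m n} (f : Term S m n) (π : fin m ⇄ fin n) : Set where
  no-eta-equality
  constructor denotes
  field
    denotation : ⟦ f ⟧ ≅ permᶜ π

open Denotes public

denotes-id : ∀ S n → Denotes (id {S} n) idᵇ
denotes-id S n = denotes (≅-refl {P = idᶜ n})

denotes-σ : ∀ S m n → Denotes (σ {S} m n) (swapF m n)
denotes-σ S m n = denotes (σᶜ≅wire m n)

denotes-⨾ : (f : Term S m n) (g : Term S n p) (π : fin m ⇄ fin n) (ρ : fin n ⇄ fin p) →
            Denotes f π → Denotes g ρ → Denotes (f ⨾ g) (π ⍮ ρ)
denotes-⨾ f g π ρ θ η = denotes (≅-trans (⨾ᶜ-cong (denotation θ) (denotation η)) (permᶜ-⨾ π ρ))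

denotes-⊗ : (f : Term S m n) (g : Term S p q) (π : fin m ⇄ fin n) (ρ : fin p ⇄ fin q) →
            Denotes f π → Denotes g ρ → Denotes (f ⊗ g) (π ⊕ᵇ ρ)
denotes-⊗ f g π ρ θ η = denotes (≅-trans (⊗ᶜ-cong (denotation θ) (denotation η)) (permᶜ-⊗ π ρ))

denotes-cong : (f : Term S m n) (π ρ : fin m ⇄ fin n) → (∀ v → to π v ≡ to ρ v) → Denotes f π → Denotes f ρ
denotes-cong f π ρ e θ = denotes (≅-trans (denotation θ) (permᶜ-cong π ρ e))

denotes-ins : ∀ S (b : Fin (suc n)) → Denotes (ins {S = S} b) (insᵇ b)
denotes-ins {n} S zero = denotes-id S (suc n)
denotes-ins {suc n} S (suc b) = denotes-⨾ (σ₁ n) (id 1 ⊗ ins b) (swapF 1 1 ⊕ᵇ idᵇ {fin n}) (idᵇ {fin 1} ⊕ᵇ insᵇ b)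
  (denotes-⊗ (σ 1 1) (id n) (swapF 1 1) (idᵇ {fin n}) (denotes-σ S 1 1) (denotes-id S n))
  (denotes-⊗ (id 1) (ins b) (idᵇ {fin 1}) (insᵇ b) (denotes-id S 1) (denotes-ins S b))

denotes-perm : ∀ S (π : Permutation m n) → Denotes (perm {S = S} π) (↔⇒⇄ π)
denotes-perm {zero} {zero} S π = denotes-cong (id 0) idᵇ (↔⇒⇄ π) (λ ()) (denotes-id S 0)
denotes-perm {zero} {suc n} S π with () ← π ⟨$⟩ˡ zero
denotes-perm {suc m} {zero} S π with () ← π ⟨$⟩ʳ zero
denotes-perm {suc m} {suc n} S π = denotes-cong (perm π) ((idᵇ {fin 1} ⊕ᵇ ↔⇒⇄ π′) ⍮ insᵇ b₀) (↔⇒⇄ π)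
  (λ { zero → insᵇ-zero b₀
     ; (suc v) → trans (insᵇ-suc b₀ (π′ ⟨$⟩ʳ v)) (sym (punchIn-permute π zero v)) })
  (denotes-⨾ (id 1 ⊗ perm π′) (ins b₀) (idᵇ {fin 1} ⊕ᵇ ↔⇒⇄ π′) (insᵇ b₀)
    (denotes-⊗ (id 1) (perm π′) (idᵇ {fin 1}) (↔⇒⇄ π′) (denotes-id S 1) (denotes-perm S π′))
    (denotes-ins S b₀))
  where
  π′ = remove zero π
  b₀ = π ⟨$⟩ʳ zero

enumerate : a ⇄ b → fin ⌊ a ⌋ ⇄ fin ⌊ b ⌋
enumerate {a} {b} π = enum a ⁻¹ ⍮ π ⍮ enum b

opaque
  unfolding ⟪_⟫

  denotes-⟪⟫ : ∀ S (π : a ⇄ b) → Denotes (⟪_⟫ {S = S} π) (enumerate π)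
  denotes-⟪⟫ S π = denotes-cong (perm (⇄⇒↔ (enumerate π))) (↔⇒⇄ (⇄⇒↔ (enumerate π))) (enumerate π) (λ _ → refl)
    (denotes-perm S (⇄⇒↔ (enumerate π)))

-- Definability

map-ext : ∀ {A B : Set} (f : A → B) (xs : List B) (ys : List A) {k l} (p : length xs ≡ k) (q : length ys ≡ l) →
          k ≡ l → (∀ i j → toℕ i ≡ toℕ j → lookup xs (Fin.cast (sym p) i) ≡ f (lookup ys (Fin.cast (sym q) j))) →
          xs ≡ map f ys
map-ext f []       []       refl refl e h = refl
map-ext f (x ∷ xs) (y ∷ ys) refl refl e h = cong₂ _∷_ (h zero zero refl)
  (map-ext f xs ys refl refl (ℕₚ.suc-injective e) λ i j i≡j → h (suc i) (suc j) (cong suc i≡j))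

mkHom : ∀ {S} {X Y : Hypergraph S} (v : Fin (#V X) → Fin (#V Y)) (e : Fin (#E X) → Fin (#E Y)) →
        (∀ a → label Y (e a) ≡ label X a) →
        (∀ a i j → toℕ i ≡ toℕ j → sourceAt Y (e a , i) ≡ v (sourceAt X (a , j))) →
        (∀ a i j → toℕ i ≡ toℕ j → targetAt Y (e a , i) ≡ v (targetAt X (a , j))) → X ⟶ Y
mkHom {S} {X} {Y} v e lab src tgt = record
  { onV = v ; onE = e ; onE-label = lab
  ; onE-sources = λ a → map-ext v (sources Y (e a)) (sources X a) (arity Y (e a)) (arity X a) (cong (dom S) (lab a)) (src a)
  ; onE-targets = λ a → map-ext v (targets Y (e a)) (targets X a) (coarity Y (e a)) (coarity X a) (cong (cod S) (lab a)) (tgt a)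
  }

record IsBox {S} (k : ℕ) (l : Fin k → Gen S) (P : Cospan S (total k (dom S ∘ l)) (total k (cod S ∘ l))) : Set where
  no-eta-equality
  field
    vertices : (fin (total k (dom S ∘ l)) ⊞ fin (total k (cod S ∘ l))) ⇄ fin (#V (apex P))
    vertices-input  : ∀ v → to vertices (inj₁ v) ≡ onV (inputs P) v
    vertices-output : ∀ v → to vertices (inj₂ v) ≡ onV (outputs P) v
    edges : fin k ⇄ fin (#E (apex P))
    edges-label  : ∀ e → label (apex P) e ≡ l (from edges e)
    edges-source : ∀ e i j → toℕ i ≡ toℕ j →
                   sourceAt (apex P) (e , i) ≡ onV (inputs P) (to (enumΣ k (dom S ∘ l)) (from edges e , j))
    edges-target : ∀ e i j → toℕ i ≡ toℕ j →
                   targetAt (apex P) (e , i) ≡ onV (outputs P) (to (enumΣ k (cod S ∘ l)) (from edges e , j))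

isBox-zero : ∀ S (l : Fin 0 → Gen S) → IsBox {S} 0 l (idᶜ 0)
isBox-zero S l = record
  { vertices = unitʳ (fin 0)
  ; vertices-input = λ () ; vertices-output = λ ()
  ; edges = idᵇ ; edges-label = λ () ; edges-source = λ () ; edges-target = λ () }

isBox-suc : ∀ S k (l : Fin (suc k) → Gen S) (P : Cospan S (total k (dom S ∘ l ∘ suc)) (total k (cod S ∘ l ∘ suc))) →
            IsBox k (l ∘ suc) P → IsBox (suc k) l (genᶜ (l zero) ⊗ᶜ P)
isBox-suc S k l P B = record
  { vertices = (join⇄ dom₀ (total k (dom S ∘ l ∘ suc)) ⁻¹ ⊞₁ join⇄ cod₀ (total k (cod S ∘ l ∘ suc)) ⁻¹)
      ⍮ midᵇ (fin dom₀) (fin _) (fin cod₀) (fin _) ⍮ (join⇄ dom₀ cod₀ ⊞₁ vertices) ⍮ join⇄ (dom₀ + cod₀) (#V (apex P))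
  ; vertices-input = λ v → on-input (splitAt dom₀ v)
  ; vertices-output = λ v → on-output (splitAt cod₀ v)
  ; edges = (idᵇ {fin 1} ⊕ᵇ edges)
  ; edges-label = λ { zero → refl ; (suc e) → edges-label e }
  ; edges-source = λ
      { zero i j i≡j → trans (sym (source-natural T.in₁ zero zero refl j i (sym i≡j)))
          (trans (cong (onV T.in₁) (lookup-tabulate (_↑ˡ cod₀) j)) (sym (T.inputs₁ j)))
      ; (suc e) i j i≡j → trans (sym (source-natural T.in₂ e (suc e) refl i i refl))
          (trans (cong (onV T.in₂) (edges-source e i j i≡j)) (sym (T.inputs₂ _))) }
  ; edges-target = λ
      { zero i j i≡j → trans (sym (target-natural T.in₁ zero zero refl j i (sym i≡j)))
          (trans (cong (onV T.in₁) (lookup-tabulate (dom₀ ↑ʳ_) j)) (sym (T.outputs₁ j)))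
      ; (suc e) i j i≡j → trans (sym (target-natural T.in₂ e (suc e) refl i i refl))
          (trans (cong (onV T.in₂) (edges-target e i j i≡j)) (sym (T.outputs₂ _))) }
  }
  where
  open IsBox B
  module T = Tensor (genᶜ (l zero)) P
  dom₀ = dom S (l zero)
  cod₀ = cod S (l zero)
  on-input : ∀ s → join (dom₀ + cod₀) (#V (apex P)) (Sum.map (join dom₀ cod₀) (to vertices)
               (to (midᵇ (fin dom₀) (fin _) (fin cod₀) (fin (total k (cod S ∘ l ∘ suc)))) (inj₁ s)))
             ≡ [ _ , _ ]′ s
  on-input (inj₁ _) = refl
  on-input (inj₂ v) = cong ((dom₀ + cod₀) ↑ʳ_) (vertices-input v)
  on-output : ∀ s → join (dom₀ + cod₀) (#V (apex P)) (Sum.map (join dom₀ cod₀) (to vertices)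
               (to (midᵇ (fin dom₀) (fin (total k (dom S ∘ l ∘ suc))) (fin cod₀) (fin _)) (inj₂ s)))
             ≡ [ _ , _ ]′ s
  on-output (inj₁ _) = refl
  on-output (inj₂ v) = cong ((dom₀ + cod₀) ↑ʳ_) (vertices-output v)

isBox-gen⊗ : ∀ {S} k (l : Fin (suc k) → Gen S) (t : Term S (total k (dom S ∘ l ∘ suc)) (total k (cod S ∘ l ∘ suc))) →
             IsBox k (l ∘ suc) ⟦ t ⟧ → IsBox (suc k) l ⟦ gen (l zero) ⊗ t ⟧
isBox-gen⊗ {S} k l t B = isBox-suc S k l ⟦ t ⟧ B

isBox : ∀ S k (l : Fin k → Gen S) → IsBox k l ⟦ Box S k l ⟧
isBox S zero    l = isBox-zero S l
isBox S (suc k) l = isBox-gen⊗ k l (Box S k (l ∘ suc)) (isBox S k (l ∘ suc))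

module Reassemble {S m n} {P : Cospan S m n} (M : Monogamy P)
  {X : Cospan S ⌊ Sources (apex P) ⌋ ⌊ Targets (apex P) ⌋}
  (isX : IsBox (#E (apex P)) (label (apex P)) X)
  {W₁ : Cospan S ⌊ Sources (apex P) ⊞ fin (circles M) ⌋ ⌊ Targets (apex P) ⊞ fin (circles M) ⌋}
  (isT₁ : IsTensor X (idᶜ (circles M)) W₁)
  {W : Cospan S ⌊ (Sources (apex P) ⊞ fin (circles M)) ⊞ fin n ⌋ ⌊ (Targets (apex P) ⊞ fin (circles M)) ⊞ fin n ⌋}
  (isT₂ : IsTensor W₁ (idᶜ n) W)
  {TZ : Cospan S m n}
  (isA : IsTrace {m = m} {n = n} ⌊ Targets (apex P) ⊞ fin (circles M) ⌋
           (relabelᶜ (to (enumerate (wiring M))) (λ v → v) W) TZ) where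
  private
    F = apex P
    w = circles M
    open module Bx = IsBox isX
    module T₁ = IsTensor isT₁
    module T₂ = IsTensor isT₂
    module A = IsTrace isA
    Ins = Targets F ⊞ fin w
    Outs = Sources F ⊞ fin w

    box-vertex : Fin ⌊ Sources F ⌋ ⊎ Fin ⌊ Targets F ⌋ → Fin (#V F)
    box-vertex (inj₁ v) = sourceAt F (from (enum (Sources F)) v)
    box-vertex (inj₂ v) = targetAt F (from (enum (Targets F)) v)

    box-input : ∀ x → box-vertex (from vertices (onV (inputs X) (to (enum (Sources F)) x))) ≡ sourceAt F x
    box-input x = trans (cong (box-vertex ∘ from vertices) (sym (vertices-input _)))
      (trans (cong box-vertex (from-to vertices _)) (cong (sourceAt F) (from-to (enum (Sources F)) x)))

    box-output : ∀ x → box-vertex (from vertices (onV (outputs X) (to (enum (Targets F)) x))) ≡ targetAt F x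
    box-output x = trans (cong (box-vertex ∘ from vertices) (sym (vertices-output _)))
      (trans (cong box-vertex (from-to vertices _)) (cong (targetAt F) (from-to (enum (Targets F)) x)))

    f₀ : apex X ⟶ F
    f₀ = mkHom (box-vertex ∘ from vertices) (from edges) (λ e → sym (edges-label e))
      (λ e i j i≡j → sym (trans (cong (box-vertex ∘ from vertices) (edges-source e j i (sym i≡j))) (box-input _)))
      (λ e i j i≡j → sym (trans (cong (box-vertex ∘ from vertices) (edges-target e j i (sym i≡j))) (box-output _)))

    f₁ : apex W₁ ⟶ F
    f₁ = T₁.rec f₀ (pick λ v → to (consumer M) (inj₁ (inj₂ v)))

    f₂ : apex W ⟶ F
    f₂ = T₂.rec f₁ (outputs P)

    f₂-X : ⌞ f₂ ⌟ ∙ ⌞ T₂.in₁ ∘ₕ T₁.in₁ ⌟ ≃ ⌞ f₀ ⌟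
    f₂-X = T₂.rec-1 _ _ ⋆′ ⌞ T₁.in₁ ⌟ ▷ T₁.rec-1 _ _

    f₂-w : ∀ v → onV f₂ (onV T₂.in₁ (onV T₁.in₂ v)) ≡ to (consumer M) (inj₁ (inj₂ v))
    f₂-w v = trans (≃V (T₂.rec-1 _ _) _) (≃V (T₁.rec-2 _ _) v)

    f₂-inputs : ∀ y → onV f₂ (onV (inputs W) (to (enum (Outs ⊞ fin n)) y)) ≡ to (consumer M) y
    f₂-inputs (inj₁ (inj₁ x)) = trans (cong (onV f₂) (trans (T₂.inputs₁ _) (cong (onV T₂.in₁) (T₁.inputs₁ _))))
      (trans (≃V f₂-X _) (trans (box-input x) (sym (consumer-source M x))))
    f₂-inputs (inj₁ (inj₂ v)) = trans (cong (onV f₂) (trans (T₂.inputs₁ _) (cong (onV T₂.in₁) (T₁.inputs₂ _)))) (f₂-w v)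
    f₂-inputs (inj₂ o) = trans (cong (onV f₂) (T₂.inputs₂ o)) (trans (≃V (T₂.rec-2 _ _) o) (sym (consumer-output M o)))

    f₂-outputs : ∀ y → onV f₂ (onV (outputs W) (to (enum (Ins ⊞ fin n)) (inj₁ y))) ≡ to (producer M) (inj₁ y)
    f₂-outputs (inj₁ x) = trans (cong (onV f₂) (trans (T₂.outputs₁ _) (cong (onV T₂.in₁) (T₁.outputs₁ _))))
      (trans (≃V f₂-X _) (trans (box-output x) (sym (producer-target M x))))
    f₂-outputs (inj₂ v) = trans (cong (onV f₂) (trans (T₂.outputs₁ _) (cong (onV T₂.in₁) (T₁.outputs₂ _))))
      (trans (f₂-w v) (circle M v))

    f₂-wired : ∀ y → onV f₂ (onV (inputs W) (to (enumerate (wiring M)) (to (enum (Ins ⊞ fin m)) y))) ≡ to (producer M) y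
    f₂-wired y = trans (cong (onV f₂ ∘ onV (inputs W) ∘ to (enum (Outs ⊞ fin n)) ∘ to (wiring M)) (from-to (enum (Ins ⊞ fin m)) y))
      (trans (f₂-inputs (to (wiring M) y)) (to-from (consumer M) (to (producer M) y)))

    f₂-trace : ∀ v → onV f₂ (onV (inputs W) (to (enumerate (wiring M)) (v ↑ˡ m))) ≡ onV f₂ (onV (outputs W) (v ↑ˡ n))
    f₂-trace v = trans (cong (λ u → onV f₂ (onV (inputs W) (to (enumerate (wiring M)) (u ↑ˡ m)))) (sym (to-from (enum Ins) v)))
      (trans (f₂-wired (inj₁ (from (enum Ins) v))) (trans (sym (f₂-outputs (from (enum Ins) v)))
        (cong (λ u → onV f₂ (onV (outputs W) (u ↑ˡ n))) (to-from (enum Ins) v))))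

    f : apex TZ ⟶ F
    f = A.rec f₂ f₂-trace

    f-T : ⌞ f ⌟ ∙ ⌞ A.inT ⌟ ≃ ⌞ f₂ ⌟
    f-T = A.rec-T f₂ f₂-trace

    inX : apex X ⟶ apex TZ
    inX = A.inT ∘ₕ T₂.in₁ ∘ₕ T₁.in₁

    -- The vertex consumed by y, in the trace.
    vertexAt : El (Outs ⊞ fin n) → Fin (#V (apex TZ))
    vertexAt y = onV A.inT (onV (inputs W) (to (enum (Outs ⊞ fin n)) y))

    at-source : ∀ x → vertexAt (inj₁ (inj₁ x)) ≡ onV inX (onV (inputs X) (to (enum (Sources F)) x))
    at-source x = cong (onV A.inT) (trans (T₂.inputs₁ _) (cong (onV T₂.in₁) (T₁.inputs₁ _)))

    at-producer : ∀ y → vertexAt (from (consumer M) (to (producer M) (inj₁ y)))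
                      ≡ onV A.inT (onV (outputs W) (to (enum (Ins ⊞ fin n)) (inj₁ y)))
    at-producer y = trans (cong (vertexAt ∘ to (wiring M)) (sym (from-to (enum (Ins ⊞ fin m)) (inj₁ y)))) (A.glue (to (enum Ins) y))

    at-target : ∀ x → vertexAt (from (consumer M) (targetAt F x)) ≡ onV inX (onV (outputs X) (to (enum (Targets F)) x))
    at-target x = trans (cong (vertexAt ∘ from (consumer M)) (sym (producer-target M x))) (trans (at-producer (inj₁ x))
      (cong (onV A.inT) (trans (T₂.outputs₁ _) (cong (onV T₂.in₁) (T₁.outputs₁ _)))))

    consumed : ∀ {v y} → to (consumer M) y ≡ v → vertexAt (from (consumer M) v) ≡ vertexAt y
    consumed e = cong vertexAt (trans (cong (from (consumer M)) (sym e)) (from-to (consumer M) _))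

    g-source : ∀ e i j → toℕ i ≡ toℕ j → sourceAt (apex TZ) (onE inX (to edges e) , i)
                                        ≡ vertexAt (from (consumer M) (sourceAt F (e , j)))
    g-source e i j i≡j = trans (sym (source-natural inX (to edges e) _ refl i′ i (toℕ-cast dom≡ i)))
      (trans (cong (onV inX) (trans (edges-source (to edges e) i′ j′ (trans (toℕ-cast dom≡ i) (trans i≡j (sym (toℕ-cast dom≡′ j)))))
        (cong (onV (inputs X) ∘ to (enum (Sources F))) (Σ-≡ (from-to edges e) (toℕ-cast dom≡′ j)))))
      (trans (sym (at-source (e , j))) (sym (consumed (consumer-source M (e , j))))))
      where
      dom≡ : dom S (label (apex TZ) (onE inX (to edges e))) ≡ dom S (label (apex X) (to edges e))
      dom≡ = cong (dom S) (onE-label inX (to edges e))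
      dom≡′ : dom S (label F e) ≡ dom S (label F (from edges (to edges e)))
      dom≡′ = cong (dom S ∘ label F) (sym (from-to edges e))
      i′ = Fin.cast dom≡ i
      j′ = Fin.cast dom≡′ j

    g-target : ∀ e i j → toℕ i ≡ toℕ j → targetAt (apex TZ) (onE inX (to edges e) , i)
                                        ≡ vertexAt (from (consumer M) (targetAt F (e , j)))
    g-target e i j i≡j = trans (sym (target-natural inX (to edges e) _ refl i′ i (toℕ-cast cod≡ i)))
      (trans (cong (onV inX) (trans (edges-target (to edges e) i′ j′ (trans (toℕ-cast cod≡ i) (trans i≡j (sym (toℕ-cast cod≡′ j)))))
        (cong (onV (outputs X) ∘ to (enum (Targets F))) (Σ-≡ (from-to edges e) (toℕ-cast cod≡′ j)))))
      (sym (at-target (e , j))))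
      where
      cod≡ : cod S (label (apex TZ) (onE inX (to edges e))) ≡ cod S (label (apex X) (to edges e))
      cod≡ = cong (cod S) (onE-label inX (to edges e))
      cod≡′ : cod S (label F e) ≡ cod S (label F (from edges (to edges e)))
      cod≡′ = cong (cod S ∘ label F) (sym (from-to edges e))
      i′ = Fin.cast cod≡ i
      j′ = Fin.cast cod≡′ j

    g : F ⟶ apex TZ
    g = mkHom (vertexAt ∘ from (consumer M)) (onE inX ∘ to edges)
      (λ e → trans (onE-label inX (to edges e)) (trans (edges-label (to edges e)) (cong (label F) (from-to edges e))))
      g-source g-target

    g-box : ∀ s → vertexAt (from (consumer M) (box-vertex s)) ≡ onV inX (to vertices s)
    g-box (inj₁ v) = trans (consumed (consumer-source M _)) (trans (at-source _)
      (cong (onV inX) (trans (cong (onV (inputs X)) (to-from (enum (Sources F)) v)) (sym (vertices-input v)))))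
    g-box (inj₂ v) = trans (at-target _)
      (cong (onV inX) (trans (cong (onV (outputs X)) (to-from (enum (Targets F)) v)) (sym (vertices-output v))))

    g∙f₀ : ⌞ g ⌟ ∙ ⌞ f₀ ⌟ ≃ ⌞ inX ⌟
    g∙f₀ = (λ v → trans (g-box (from vertices v)) (cong (onV inX) (to-from vertices v)))
         ⸴ (λ e → cong (onE inX) (to-from edges e))

  reassemble : TZ ≅ P
  reassemble = mk≅ f g
    ((λ v → trans (≃V f-T _) (trans (f₂-inputs (from (consumer M) v)) (to-from (consumer M) v)))
      ⸴ (λ e → trans (≃E f-T _) (trans (≃E f₂-X (to edges e)) (from-to edges e))))
    (A.ext (g ∘ₕ f) idₕ (T₂.ext (g ∘ₕ f ∘ₕ A.inT) A.inT
      (T₁.ext (g ∘ₕ f ∘ₕ A.inT ∘ₕ T₂.in₁) (A.inT ∘ₕ T₂.in₁)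
        (⌞ g ⌟ ⋆ (f-T ⋆′ ⌞ T₂.in₁ ∘ₕ T₁.in₁ ⌟ ▷ f₂-X) ▷ g∙f₀)
        (pick-ext λ v → trans (cong (onV g) (trans (≃V f-T _) (f₂-w v))) (trans (consumed refl)
          (cong (onV A.inT) (trans (T₂.inputs₁ _) (cong (onV T₂.in₁) (T₁.inputs₂ v)))))))
      (pick-ext λ v → trans (cong (onV g) (trans (≃V f-T _) (≃V (T₂.rec-2 _ _) v)))
        (trans (consumed (consumer-output M v)) (cong (onV A.inT) (T₂.inputs₂ v))))))
    (λ v → trans (cong (onV f) (A.inputs-T v)) (trans (≃V f-T _) (trans (f₂-wired (inj₂ v)) (producer-input M v))))
    (λ v → trans (cong (onV f) (A.outputs-T v)) (trans (≃V f-T _) (trans (cong (onV f₂) (T₂.outputs₂ v)) (≃V (T₂.rec-2 _ _) v))))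

isTrace-≅ : ∀ {S} x m n {Z Z′ : Cospan S (x + m) (x + n)} {T} → Z ≅ Z′ →
            IsTrace {m = m} {n = n} x Z T → IsTrace {m = m} {n = n} x Z′ T
isTrace-≅ x m n θ isT = record
  { inT = inT ∘ₕ bwd θ
  ; glue = λ a → trans (cong (onV inT) (fwd-inputs (≅-sym θ) _)) (trans (glue a) (cong (onV inT) (sym (fwd-outputs (≅-sym θ) _))))
  ; rec = λ h e → rec (h ∘ₕ fwd θ) (pull h e)
  ; rec-T = λ h e → rec-T (h ∘ₕ fwd θ) (pull h e) ⋆′ ⌞ bwd θ ⌟ ▷ ⌞ h ⌟ ⋆ fwd∙bwd θ
  ; ext = λ u w e → ext u w (≃-sym (⌞ u ⌟ ∙ ⌞ inT ⌟ ⋆ bwd∙fwd θ) ▷ e ⋆′ ⌞ fwd θ ⌟ ▷ ⌞ w ⌟ ∙ ⌞ inT ⌟ ⋆ bwd∙fwd θ)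
  ; inputs-T = λ a → trans (inputs-T a) (cong (onV inT) (sym (fwd-inputs (≅-sym θ) _)))
  ; outputs-T = λ a → trans (outputs-T a) (cong (onV inT) (sym (fwd-outputs (≅-sym θ) _)))
  }
  where
  open IsTrace isT
  pull : ∀ {K} (h : _ ⟶ K) → _ → ∀ a → _
  pull h e a = trans (cong (onV h) (fwd-inputs θ _)) (trans (e a) (cong (onV h) (sym (fwd-outputs θ _))))

denotes-⨾-relabel : ∀ {S m n p} {f : Term S m n} {π : fin m ⇄ fin n} (g : Term S n p) → Denotes f π →
                    ⟦ f ⨾ g ⟧ ≅ relabelᶜ (to π) (λ v → v) ⟦ g ⟧
denotes-⨾-relabel {π = π} g h = ≅-trans (⨾ᶜ-cong (denotation h) (≅-refl {P = ⟦ g ⟧})) (wire-⨾ π idᵇ ⟦ g ⟧)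

⟦nf⟧ : {P : Cospan S m n} (M : Monogamy P) → ⟦ nf M ⟧ ≅ P
⟦nf⟧ {S} {m} {n} {P} M = subst (λ t → ⟦ t ⟧ ≅ P) {x = closed box ⟪ wiring M ⟫} {y = nf M} refl
  (cut box (isBox S (#E (apex P)) (label (apex P))) ⟪ wiring M ⟫ (denotes-⟪⟫ S (wiring M)))
  where
  Ins = Targets (apex P) ⊞ fin (circles M)
  Outs = Sources (apex P) ⊞ fin (circles M)
  box : Term S ⌊ Sources (apex P) ⌋ ⌊ Targets (apex P) ⌋
  box = Box S (#E (apex P)) (label (apex P))
  closed : Term S ⌊ Sources (apex P) ⌋ ⌊ Targets (apex P) ⌋ → Term S ⌊ Ins ⊞ fin m ⌋ ⌊ Outs ⊞ fin n ⌋ → Term S m n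
  closed s t = Tr {m = m} {n = n} ⌊ Ins ⌋ (t ⨾ ((s ⊗ id (circles M)) ⊗ id n))
  cut : (s : Term S ⌊ Sources (apex P) ⌋ ⌊ Targets (apex P) ⌋) → IsBox (#E (apex P)) (label (apex P)) ⟦ s ⟧ →
        (t : Term S ⌊ Ins ⊞ fin m ⌋ ⌊ Outs ⊞ fin n ⌋) → Denotes t (enumerate (wiring M)) →
        ⟦ closed s t ⟧ ≅ P
  cut s isX t h = Reassemble.reassemble M {⟦ s ⟧} isX {⟦ s ⊗ id (circles M) ⟧} (⟦⊗⟧-isTensor s (id (circles M)))
    {⟦ (s ⊗ id (circles M)) ⊗ id n ⟧} (⟦⊗⟧-isTensor (s ⊗ id (circles M)) (id n))
    {⟦ closed s t ⟧}
    (isTrace-≅ ⌊ Ins ⌋ m n (denotes-⨾-relabel ((s ⊗ id (circles M)) ⊗ id n) h)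
      (⟦Tr⟧-isTrace ⌊ Ins ⌋ m n (t ⨾ ((s ⊗ id (circles M)) ⊗ id n))))

-- Degrees

count : Fin n → List (Fin n) → ℕ
count v xs = length (filter (v ≟_) xs)

count-none : ∀ (v : Fin n) xs → (∀ i → lookup xs i ≢ v) → count v xs ≡ 0
count-none v []       h = refl
count-none v (x ∷ xs) h with v ≟ x
... | yes v≡x = contradiction (sym v≡x) (h zero)
... | no  _   = count-none v xs (h ∘ suc)

none-count : ∀ (v : Fin n) xs → count v xs ≡ 0 → ∀ i → lookup xs i ≢ v
none-count v (x ∷ xs) e i with v ≟ x
none-count v (x ∷ xs) e zero    | no v≢x = v≢x ∘ sym
none-count v (x ∷ xs) e (suc i) | no v≢x = none-count v xs e i

count-one : ∀ (v : Fin n) xs i → lookup xs i ≡ v → (∀ j → lookup xs j ≡ v → j ≡ i) → count v xs ≡ 1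
count-one v (x ∷ xs) i e u with v ≟ x
count-one v (x ∷ xs) i e u | yes v≡x with u zero (sym v≡x)
... | refl = cong suc (count-none v xs λ j e′ → contradiction (u (suc j) e′) λ ())
count-one v (x ∷ xs) zero    e u | no v≢x = contradiction (sym e) v≢x
count-one v (x ∷ xs) (suc i) e u | no v≢x = count-one v xs i e λ j e′ → suc-injective (u (suc j) e′)

one-count : ∀ (v : Fin n) xs → count v xs ≤ 1 → ∀ i j → lookup xs i ≡ v → lookup xs j ≡ v → i ≡ j
one-count v (x ∷ xs) h i j e e′ with v ≟ x
one-count v (x ∷ xs) h zero zero e e′ | yes _ = refl
one-count v (x ∷ xs) (s≤s h) zero (suc j) e e′ | yes _ =
  contradiction e′ (none-count v xs (ℕₚ.n≤0⇒n≡0 h) j)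
one-count v (x ∷ xs) (s≤s h) (suc i) j e e′ | yes _ =
  contradiction e (none-count v xs (ℕₚ.n≤0⇒n≡0 h) i)
one-count v (x ∷ xs) h zero j e e′ | no v≢x = contradiction (sym e) v≢x
one-count v (x ∷ xs) h (suc i) zero e e′ | no v≢x = contradiction (sym e′) v≢x
one-count v (x ∷ xs) h (suc i) (suc j) e e′ | no v≢x = cong suc (one-count v xs h i j e e′)

count-occurs : ∀ (v : Fin n) xs {c} → count v xs ≡ suc c → ∃ λ i → lookup xs i ≡ v
count-occurs v (x ∷ xs) e with v ≟ x
... | yes v≡x = zero , sym v≡x
... | no  _   = let i , h = count-occurs v xs e in suc i , h

lookup-++ˡ : ∀ {A : Set} (xs ys : List A) i j → toℕ i ≡ toℕ j → lookup (xs ++ ys) i ≡ lookup xs j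
lookup-++ˡ (x ∷ xs) ys zero    zero    e = refl
lookup-++ˡ (x ∷ xs) ys (suc i) (suc j) e = lookup-++ˡ xs ys i j (ℕₚ.suc-injective e)

lookup-++ʳ : ∀ {A : Set} (xs ys : List A) i j → toℕ i ≡ length xs + toℕ j → lookup (xs ++ ys) i ≡ lookup ys j
lookup-++ʳ []       ys i       j e = cong (lookup ys) (toℕ-injective e)
lookup-++ʳ (x ∷ xs) ys (suc i) j e = lookup-++ʳ xs ys i j (ℕₚ.suc-injective e)

concatᵇ : ∀ {A : Set} k (xs : Fin k → List A) →
          Σ[ π ∈ Σᶜ k (length ∘ xs) ⇄ fin (length (concat (tabulate xs))) ]
            (∀ e i → lookup (concat (tabulate xs)) (to π (e , i)) ≡ lookup (xs e) i)
concatᵇ zero xs = Σ-zero _ , λ ()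
concatᵇ (suc k) xs with concatᵇ k (xs ∘ suc)
... | π , h = Σ-suc k (length ∘ xs) ⍮ (idᵇ ⊞₁ π) ⍮ join⇄ (length (xs zero)) (length rest) ⍮ castᵇ e , λ
    { zero i → lookup-++ˡ (xs zero) rest _ i (trans (toℕ-cast e _) (toℕ-↑ˡ i (length rest)))
    ; (suc e′) i → trans (lookup-++ʳ (xs zero) rest _ (to π (e′ , i))
        (trans (toℕ-cast e _) (toℕ-↑ʳ (length (xs zero)) (to π (e′ , i))))) (h e′ i) }
  where
  rest = concat (tabulate (xs ∘ suc))
  e = sym (length-++ (xs zero) {rest})

Σ-castᵇ : ∀ k (f g : Fin k → ℕ) → (∀ e → f e ≡ g e) → Σᶜ k f ⇄ Σᶜ k g
Σ-castᵇ k f g e≡ = record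
  { to = λ (e , i) → e , Fin.cast (e≡ e) i
  ; from = λ (e , i) → e , Fin.cast (sym (e≡ e)) i
  ; to-from = λ (e , i) → Σ-≡ refl (trans (toℕ-cast (e≡ e) _) (toℕ-cast (sym (e≡ e)) i))
  ; from-to = λ (e , i) → Σ-≡ refl (trans (toℕ-cast (sym (e≡ e)) _) (toℕ-cast (e≡ e) i))
  }

record Lists {n} (a : Code) (f : El a → Fin n) (xs : List (Fin n)) : Set where
  field
    position : a ⇄ fin (length xs)
    value    : ∀ x → lookup xs (to position x) ≡ f x

  value⁻¹ : ∀ i → f (from position i) ≡ lookup xs i
  value⁻¹ i = trans (sym (value _)) (cong (lookup xs) (to-from position i))

  degree-0 : ∀ {v} → (∀ x → f x ≢ v) → count v xs ≡ 0
  degree-0 h = count-none _ xs λ i e → h (from position i) (trans (value⁻¹ i) e)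

  0-degree : ∀ {v} → count v xs ≡ 0 → ∀ x → f x ≢ v
  0-degree e x e′ = none-count _ xs e (to position x) (trans (value x) e′)

  degree-1 : ∀ {v} x → f x ≡ v → (∀ y → f y ≡ v → y ≡ x) → count v xs ≡ 1
  degree-1 x e u = count-one _ xs (to position x) (trans (value x) e)
    λ j e′ → trans (sym (to-from position j)) (cong (to position) (u _ (trans (value⁻¹ j) e′)))

  ≤1-degree : ∀ {v} → count v xs ≤ 1 → ∀ x y → f x ≡ v → f y ≡ v → x ≡ y
  ≤1-degree h x y e e′ = to-injective position (one-count _ xs h _ _ (trans (value x) e) (trans (value y) e′))

  occurs : ∀ {v c} → count v xs ≡ suc c → ∃ λ x → f x ≡ v
  occurs e = let i , h = count-occurs _ xs e in from position i , trans (value⁻¹ i) h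

sources-list : (F : Hypergraph S) → Lists (Sources F) (sourceAt F) (concat (tabulate (sources F)))
sources-list F = record
  { position = Σ-castᵇ _ _ _ (λ e → sym (arity F e)) ⍮ proj₁ (concatᵇ (#E F) (sources F))
  ; value = λ (e , i) → proj₂ (concatᵇ (#E F) (sources F)) e _ }

targets-list : (F : Hypergraph S) → Lists (Targets F) (targetAt F) (concat (tabulate (targets F)))
targets-list F = record
  { position = Σ-castᵇ _ _ _ (λ e → sym (coarity F e)) ⍮ proj₁ (concatᵇ (#E F) (targets F))
  ; value = λ (e , i) → proj₂ (concatᵇ (#E F) (targets F)) e _ }

mono⇒injective : {F : Hypergraph S} {f : discrete n ⟶ F} → Mono f → ∀ {i j} → onV f i ≡ onV f j → i ≡ j
mono⇒injective mono {i} {j} e =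
  proj₁ (mono {discrete 1} (pick λ _ → i) (pick λ _ → j) ((λ _ → e) , λ ())) zero

injective⇒mono : {F : Hypergraph S} {f : discrete n ⟶ F} → (∀ {i j} → onV f i ≡ onV f j → i ≡ j) → Mono f
injective⇒mono inj g h (eV , eE) = (λ v → inj (eV v)) , λ e → contradiction (onE g e) λ ()

∈im? : {F : Hypergraph S} (f : discrete n ⟶ F) (v : Fin (#V F)) → Dec (v ∈im f)
∈im? f v = any? λ i → onV f i ≟ v

module _ {S m n} {P : Cospan S m n} (M : Monogamy P) where
  private
    F = apex P
    module Src = Lists (sources-list F)
    module Tgt = Lists (targets-list F)

    clash : ∀ {x y v} → to (consumer M) x ≡ v → to (consumer M) y ≡ v → x ≡ y
    clash e e′ = to-injective (consumer M) (trans e (sym e′))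

    clash′ : ∀ {x y v} → to (producer M) x ≡ v → to (producer M) y ≡ v → x ≡ y
    clash′ e e′ = to-injective (producer M) (trans e (sym e′))

    source-only : ∀ {v y} → to (consumer M) y ≡ v → (∀ x → y ≢ inj₁ (inj₁ x)) → outDegree F v ≡ 0
    source-only e h = Src.degree-0 λ x e′ → h x (clash e (trans (consumer-source M x) e′))

    target-only : ∀ {v y} → to (producer M) y ≡ v → (∀ x → y ≢ inj₁ (inj₁ x)) → inDegree F v ≡ 0
    target-only e h = Tgt.degree-0 λ x e′ → h x (clash′ e (trans (producer-target M x) e′))

    source-one : ∀ {v} x → to (consumer M) (inj₁ (inj₁ x)) ≡ v → outDegree F v ≡ 1
    source-one x e = Src.degree-1 x (trans (sym (consumer-source M x)) e) λ y e′ →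
      unwrap (clash (trans (consumer-source M y) e′) e)
      where
      unwrap : ∀ {A B C : Set} {x y : A} → _≡_ {A = (A ⊎ B) ⊎ C} (inj₁ (inj₁ x)) (inj₁ (inj₁ y)) → x ≡ y
      unwrap refl = refl

    target-one : ∀ {v} x → to (producer M) (inj₁ (inj₁ x)) ≡ v → inDegree F v ≡ 1
    target-one x e = Tgt.degree-1 x (trans (sym (producer-target M x)) e) λ y e′ →
      unwrap (clash′ (trans (producer-target M y) e′) e)
      where
      unwrap : ∀ {A B C : Set} {x y : A} → _≡_ {A = (A ⊎ B) ⊎ C} (inj₁ (inj₁ x)) (inj₁ (inj₁ y)) → x ≡ y
      unwrap refl = refl

    out-in : ∀ {v} → v ∈im outputs P → outDegree F v ≡ 0
    out-in (o , e) = source-only (trans (consumer-output M o) e) λ _ ()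

    in-in : ∀ {v} → v ∈im inputs P → inDegree F v ≡ 0
    in-in (o , e) = target-only (trans (producer-input M o) e) λ _ ()

    circle-degree : ∀ {v} c → to (consumer M) (inj₁ (inj₂ c)) ≡ v → degree F v ≡ (0 , 0)
    circle-degree c e = cong₂ _,_ (target-only (trans (sym (circle M c)) e) λ _ ()) (source-only e λ _ ())

    out-degree : ∀ v → v ∉im outputs P → outDegree F v ≡ 1 ⊎ degree F v ≡ (0 , 0) × v ∉im inputs P
    out-degree v v∉ with from (consumer M) v in eq
    ... | inj₁ (inj₁ x) = inj₁ (source-one x (trans (cong (to (consumer M)) (sym eq)) (to-from (consumer M) v)))
    ... | inj₁ (inj₂ c) = inj₂ (circle-degree c ec , λ { (i , e) → contradiction
              (clash′ (trans (sym (circle M c)) ec) (trans (producer-input M i) e)) λ () })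
      where ec = trans (cong (to (consumer M)) (sym eq)) (to-from (consumer M) v)
    ... | inj₂ o = contradiction (o , trans (sym (consumer-output M o))
              (trans (cong (to (consumer M)) (sym eq)) (to-from (consumer M) v))) v∉

    in-degree : ∀ v → v ∉im inputs P → inDegree F v ≡ 1 ⊎ degree F v ≡ (0 , 0) × v ∉im outputs P
    in-degree v v∉ with from (producer M) v in eq
    ... | inj₁ (inj₁ x) = inj₁ (target-one x (trans (cong (to (producer M)) (sym eq)) (to-from (producer M) v)))
    ... | inj₁ (inj₂ c) = inj₂ (circle-degree c ec , λ { (o , e) → contradiction
              (clash ec (trans (consumer-output M o) e)) λ () })
      where ec = trans (circle M c) (trans (cong (to (producer M)) (sym eq)) (to-from (producer M) v))
    ... | inj₂ i = contradiction (i , trans (sym (producer-input M i))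
              (trans (cong (to (producer M)) (sym eq)) (to-from (producer M) v))) v∉

  monogamy⇒partialMonogamous : PartialMonogamous P
  monogamy⇒partialMonogamous = record
    { mono-inputs = injective⇒mono {f = inputs P} λ {i} {j} e → unwrap (clash′ (trans (producer-input M i) e) (producer-input M j))
    ; mono-outputs = injective⇒mono {f = outputs P} λ {i} {j} e → unwrap (clash (trans (consumer-output M i) e) (consumer-output M j))
    ; degree-both = λ v v∈ v∈′ → cong₂ _,_ (in-in v∈) (out-in v∈′)
    ; degree-input = λ v v∈ v∉ → cong₂ _,_ (in-in v∈) (by-out v v∈ (out-degree v v∉))
    ; degree-output = λ v v∉ v∈ → cong₂ _,_ (by-in v v∈ (in-degree v v∉)) (out-in v∈)
    ; degree-neither = λ v v∉ v∉′ → neither v (in-degree v v∉) (out-degree v v∉′)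
    }
    where
    unwrap : ∀ {A B : Set} {x y : B} → _≡_ {A = A ⊎ B} (inj₂ x) (inj₂ y) → x ≡ y
    unwrap refl = refl
    by-out : ∀ v → v ∈im inputs P → outDegree F v ≡ 1 ⊎ degree F v ≡ (0 , 0) × v ∉im inputs P → outDegree F v ≡ 1
    by-out v v∈ (inj₁ e) = e
    by-out v v∈ (inj₂ (_ , v∉)) = contradiction v∈ v∉
    by-in : ∀ v → v ∈im outputs P → inDegree F v ≡ 1 ⊎ degree F v ≡ (0 , 0) × v ∉im outputs P → inDegree F v ≡ 1
    by-in v v∈ (inj₁ e) = e
    by-in v v∈ (inj₂ (_ , v∉)) = contradiction v∈ v∉
    neither : ∀ v → inDegree F v ≡ 1 ⊎ degree F v ≡ (0 , 0) × v ∉im outputs P →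
              outDegree F v ≡ 1 ⊎ degree F v ≡ (0 , 0) × v ∉im inputs P →
              degree F v ≡ (0 , 0) ⊎ degree F v ≡ (1 , 1)
    neither v (inj₁ e) (inj₁ e′) = inj₂ (cong₂ _,_ e e′)
    neither v (inj₂ (e , _)) _ = inj₁ e
    neither v _ (inj₂ (e , _)) = inj₁ e

Complement : (a : Code) (N : ℕ) → (El a → Fin N) → Set
Complement a N f = Σ[ w ∈ ℕ ] Σ[ π ∈ (a ⊞ fin w) ⇄ fin N ] (∀ x → to π (inj₁ x) ≡ f x)

module Hit {m N k} (f : Fin m → Fin (suc N)) (inj : ∀ {x y} → f x ≡ f y → x ≡ y)
           (z : Fin m) (fz : f z ≡ zero) (θ : fin m ⇄ (fin 1 ⊞ fin k)) (θz : to θ z ≡ inj₁ zero) where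
  f≢0 : ∀ y → zero ≢ f (from θ (inj₂ y))
  f≢0 y e with () ← trans (sym θz) (trans (cong (to θ) (inj (trans fz e))) (to-from θ (inj₂ y)))

  f′ : Fin k → Fin N
  f′ y = punchOut (f≢0 y)

  f′-injective : ∀ {x y} → f′ x ≡ f′ y → x ≡ y
  f′-injective {x} {y} e with refl ← trans (sym (to-from θ (inj₂ x))) (trans
    (cong (to θ) (inj (punchOut-injective (f≢0 x) (f≢0 y) e))) (to-from θ (inj₂ y))) = refl

  extend : Complement (fin k) N f′ → Complement (fin m) (suc N) f
  extend (w , π , h) = w , (θ ⊞₁ idᵇ) ⍮ assocʳ (fin 1) (fin k) (fin w) ⍮ (idᵇ ⊞₁ π) ⍮ join⇄ 1 N ,
    λ x → pointwise x (to θ x) refl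
    where
    pointwise : ∀ x s → to θ x ≡ s →
                join 1 N (Sum.map (λ v → v) (to π) (to (assocʳ (fin 1) (fin k) (fin w)) (inj₁ s))) ≡ f x
    pointwise x (inj₁ zero) e = trans (sym fz) (cong f (to-injective θ (trans θz (sym e))))
    pointwise x (inj₂ y) e = trans (cong suc (h y)) (trans (punchIn-punchOut (f≢0 y))
      (cong f (trans (cong (from θ) (sym e)) (from-to θ x))))

module Miss {m N} (f : Fin m → Fin (suc N)) (inj : ∀ {x y} → f x ≡ f y → x ≡ y)
            (≢f : ∀ x → zero ≢ f x) where
  f′ : Fin m → Fin N
  f′ x = punchOut (≢f x)

  f′-injective : ∀ {x y} → f′ x ≡ f′ y → x ≡ y
  f′-injective {x} {y} e = inj (punchOut-injective (≢f x) (≢f y) e)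

  extend : Complement (fin m) N f′ → Complement (fin m) (suc N) f
  extend (w , π , h) = suc w ,
    (idᵇ ⊞₁ join⇄ 1 w ⁻¹) ⍮ exchᵇ (fin m) (fin 1) (fin w) ⍮ (idᵇ ⊞₁ π) ⍮ join⇄ 1 N ,
    λ x → trans (cong suc (h x)) (punchIn-punchOut (≢f x))

findComplement-fin : ∀ m N (f : Fin m → Fin N) → (∀ {x y} → f x ≡ f y → x ≡ y) → Complement (fin m) N f
findComplement-fin m zero f inj = 0 , record
  { to = [ f , (λ ()) ]′ ; from = λ () ; to-from = λ ()
  ; from-to = λ { (inj₁ x) → contradiction (f x) λ () } } , λ _ → refl
findComplement-fin m (suc N) f inj with any? (λ x → f x ≟ zero)
... | yes (z , fz) = let k , θ , θz = extract z
                     in Hit.extend f inj z fz θ θz (findComplement-fin k N (Hit.f′ f inj z fz θ θz) (Hit.f′-injective f inj z fz θ θz))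
... | no f≢0 = Miss.extend f inj ≢f (findComplement-fin m N (Miss.f′ f inj ≢f) (Miss.f′-injective f inj ≢f))
  where
  ≢f : ∀ x → zero ≢ f x
  ≢f x e = f≢0 (x , sym e)

findComplement : ∀ a N (f : El a → Fin N) → (∀ {x y} → f x ≡ f y → x ≡ y) →
             Complement a N f
findComplement a N f inj with findComplement-fin ⌊ a ⌋ N (f ∘ from (enum a)) (λ e → to-injective (enum a ⁻¹) (inj e))
... | w , π , h = w , (enum a ⊞₁ idᵇ) ⍮ π , λ x → trans (h _) (cong f (from-to (enum a) x))

module _ {S m n} {P : Cospan S m n} (pm : PartialMonogamous P) where
  open PartialMonogamous pm
  private
    F = apex P
    module Src = Lists (sources-list F)
    module Tgt = Lists (targets-list F)
    inputs-injective : ∀ {i j} → onV (inputs P) i ≡ onV (inputs P) j → i ≡ j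
    inputs-injective = mono⇒injective {f = inputs P} mono-inputs
    outputs-injective : ∀ {i j} → onV (outputs P) i ≡ onV (outputs P) j → i ≡ j
    outputs-injective = mono⇒injective {f = outputs P} mono-outputs

    degrees≤1 : ∀ v → inDegree F v ≤ 1 × outDegree F v ≤ 1
    degrees≤1 v with ∈im? (inputs P) v | ∈im? (outputs P) v
    ... | yes p | yes q = small (degree-both v p q) z≤n z≤n
      where small : ∀ {i o i′ o′} → _≡_ {A = ℕ × ℕ} (i , o) (i′ , o′) → i′ ≤ 1 → o′ ≤ 1 → i ≤ 1 × o ≤ 1
            small refl p q = p , q
    ... | yes p | no q = small (degree-input v p q) z≤n (s≤s z≤n)
      where small : ∀ {i o i′ o′} → _≡_ {A = ℕ × ℕ} (i , o) (i′ , o′) → i′ ≤ 1 → o′ ≤ 1 → i ≤ 1 × o ≤ 1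
            small refl p q = p , q
    ... | no p | yes q = small (degree-output v p q) (s≤s z≤n) z≤n
      where small : ∀ {i o i′ o′} → _≡_ {A = ℕ × ℕ} (i , o) (i′ , o′) → i′ ≤ 1 → o′ ≤ 1 → i ≤ 1 × o ≤ 1
            small refl p q = p , q
    ... | no p | no q with degree-neither v p q
    ...   | inj₁ e = ℕₚ.≤-trans (ℕₚ.≤-reflexive (cong proj₁ e)) z≤n , ℕₚ.≤-trans (ℕₚ.≤-reflexive (cong proj₂ e)) z≤n
    ...   | inj₂ e = ℕₚ.≤-reflexive (cong proj₁ e) , ℕₚ.≤-reflexive (cong proj₂ e)

    output-outDegree : ∀ {v} → v ∈im outputs P → outDegree F v ≡ 0
    output-outDegree {v} q with ∈im? (inputs P) v
    ... | yes p = cong proj₂ (degree-both v p q)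
    ... | no  p = cong proj₂ (degree-output v p q)

    input-inDegree : ∀ {v} → v ∈im inputs P → inDegree F v ≡ 0
    input-inDegree {v} p with ∈im? (outputs P) v
    ... | yes q = cong proj₁ (degree-both v p q)
    ... | no  q = cong proj₁ (degree-input v p q)

    consume : El (Sources F ⊞ fin n) → Fin (#V F)
    consume (inj₁ x) = sourceAt F x
    consume (inj₂ o) = onV (outputs P) o

    consume-injective : ∀ {x y} → consume x ≡ consume y → x ≡ y
    consume-injective {inj₁ x} {inj₁ y} e = cong inj₁ (Src.≤1-degree (proj₂ (degrees≤1 _)) x y e refl)
    consume-injective {inj₁ x} {inj₂ o} e = contradiction e (Src.0-degree (output-outDegree (o , refl)) x)
    consume-injective {inj₂ o} {inj₁ y} e = contradiction (sym e) (Src.0-degree (output-outDegree (o , refl)) y)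
    consume-injective {inj₂ o} {inj₂ o′} e = cong inj₂ (outputs-injective e)

    produce : El (Targets F ⊞ fin m) → Fin (#V F)
    produce (inj₁ x) = targetAt F x
    produce (inj₂ i) = onV (inputs P) i

    produce-injective : ∀ {x y} → produce x ≡ produce y → x ≡ y
    produce-injective {inj₁ x} {inj₁ y} e = cong inj₁ (Tgt.≤1-degree (proj₁ (degrees≤1 _)) x y e refl)
    produce-injective {inj₁ x} {inj₂ i} e = contradiction e (Tgt.0-degree (input-inDegree (i , refl)) x)
    produce-injective {inj₂ i} {inj₁ y} e = contradiction (sym e) (Tgt.0-degree (input-inDegree (i , refl)) y)
    produce-injective {inj₂ i} {inj₂ i′} e = cong inj₂ (inputs-injective e)

    unconsumed⇒unproduced : ∀ v → (∀ x → consume x ≢ v) → ∀ y → produce y ≢ v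
    unconsumed⇒unproduced v h y e = go (∈im? (inputs P) v) y e
      where
      v∉out : v ∉im outputs P
      v∉out (o , e) = h (inj₂ o) e
      no-out : outDegree F v ≡ 0
      no-out = Src.degree-0 λ x → h (inj₁ x)
      go : Dec (v ∈im inputs P) → ∀ y → produce y ≡ v → ⊥
      go (yes p) y e = contradiction (trans (sym no-out) (cong proj₂ (degree-input v p v∉out))) λ ()
      go (no p) (inj₂ i) e = p (i , e)
      go (no p) (inj₁ x) e with degree-neither v p v∉out
      ... | inj₁ e′ = Tgt.0-degree (cong proj₁ e′) x e
      ... | inj₂ e′ = contradiction (trans (sym no-out) (cong proj₂ e′)) λ ()

    consumed⇒produced : ∀ v x → consume x ≡ v → ∃ λ y → produce y ≡ v
    consumed⇒produced v x e with ∈im? (inputs P) v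
    ... | yes (i , h) = inj₂ i , h
    ... | no p with ∈im? (outputs P) v
    ...   | yes q = let y , h = Tgt.occurs (cong proj₁ (degree-output v p q)) in inj₁ y , h
    ...   | no q with degree-neither v p q
    ...     | inj₂ e′ = let y , h = Tgt.occurs (cong proj₁ e′) in inj₁ y , h
    ...     | inj₁ e′ with x
    ...       | inj₁ x′ = contradiction e (Src.0-degree (cong proj₂ e′) x′)
    ...       | inj₂ o = contradiction (o , e) q

    loops = findComplement (Sources F ⊞ fin n) (#V F) consume consume-injective
    w = proj₁ loops
    consumer₀ : ((Sources F ⊞ fin n) ⊞ fin w) ⇄ fin (#V F)
    consumer₀ = proj₁ (proj₂ loops)
    consumer₀-consume : ∀ x → to consumer₀ (inj₁ x) ≡ consume x
    consumer₀-consume = proj₂ (proj₂ loops)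

    produce₀ : El ((Targets F ⊞ fin m) ⊞ fin w) → Fin (#V F)
    produce₀ (inj₁ y) = produce y
    produce₀ (inj₂ c) = to consumer₀ (inj₂ c)

    not-circle : ∀ c y → produce y ≢ to consumer₀ (inj₂ c)
    not-circle c = unconsumed⇒unproduced _ λ x e →
      contradiction (to-injective consumer₀ {inj₁ x} {inj₂ c} (trans (consumer₀-consume x) e)) λ ()

    producer₀ : ((Targets F ⊞ fin m) ⊞ fin w) ⇄ fin (#V F)
    producer₀ = bijection produce₀ injective surjective
      where
      injective : ∀ {x y} → produce₀ x ≡ produce₀ y → x ≡ y
      injective {inj₁ x} {inj₁ y} e = cong inj₁ (produce-injective e)
      injective {inj₁ x} {inj₂ c} e = contradiction e (not-circle c x)
      injective {inj₂ c} {inj₁ y} e = contradiction (sym e) (not-circle c y)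
      injective {inj₂ c} {inj₂ c′} e = cong inj₂ (inj₂-injective (to-injective consumer₀ {inj₂ c} {inj₂ c′} e))
      surjective : ∀ v → Σ[ x ∈ El ((Targets F ⊞ fin m) ⊞ fin w) ] produce₀ x ≡ v
      surjective v with from consumer₀ v in eq
      ... | inj₂ c = inj₂ c , trans (cong (to consumer₀) (sym eq)) (to-from consumer₀ v)
      ... | inj₁ x = let y , h = consumed⇒produced v x (trans (sym (consumer₀-consume x))
                               (trans (cong (to consumer₀) (sym eq)) (to-from consumer₀ v)))
                     in inj₁ y , h

    reorder : ∀ a b c → ((a ⊞ c) ⊞ b) ⇄ ((a ⊞ b) ⊞ c)
    reorder a b c = assocʳ a c b ⍮ (idᵇ ⊞₁ swapᵇ c b) ⍮ assocʳ a b c ⁻¹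

  partialMonogamous⇒monogamy : Monogamy P
  partialMonogamous⇒monogamy = record
    { circles = w
    ; consumer = reorder (Sources F) (fin n) (fin w) ⍮ consumer₀
    ; producer = reorder (Targets F) (fin m) (fin w) ⍮ producer₀
    ; consumer-source = λ x → consumer₀-consume (inj₁ x)
    ; consumer-output = λ o → consumer₀-consume (inj₂ o)
    ; producer-target = λ _ → refl
    ; producer-input = λ _ → refl
    ; circle = λ _ → refl
    }

-- Double pushout rewriting

-- T is Trⁱ((P ⊗ id) ⨾ Q): the side P of a rule plugged into the context Q.
record IsPlugged {S i j m n} (P : Cospan S i j) (Q : Cospan S (j + m) (i + n)) (T : Cospan S m n) : Set where
  no-eta-equality
  field
    {P₁}    : Cospan S (i + m) (j + m)
    {PQ}    : Cospan S (i + m) (i + n)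
    tensored : IsTensor P (idᶜ m) P₁
    composed   : IsComp {n = j + m} P₁ Q PQ
    traced  : IsTrace {m = m} {n = n} i PQ T

  private
    module Te = IsTensor tensored
    module C = IsComp composed
    module A = IsTrace traced

  c₁ : discrete i ⟶ apex Q
  c₁ = outputs Q ∘ₕ pick (_↑ˡ n)

  c₂ : discrete j ⟶ apex Q
  c₂ = inputs Q ∘ₕ pick (_↑ˡ m)

  d₁ : discrete m ⟶ apex Q
  d₁ = inputs Q ∘ₕ pick (j ↑ʳ_)

  d₂ : discrete n ⟶ apex Q
  d₂ = outputs Q ∘ₕ pick (i ↑ʳ_)

  fromRule : apex P ⟶ apex T
  fromRule = A.inT ∘ₕ C.inL ∘ₕ Te.in₁

  fromContext : apex Q ⟶ apex T
  fromContext = A.inT ∘ₕ C.inR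

  glue-inputs : ∀ a → onV fromRule (onV (inputs P) a) ≡ onV fromContext (onV c₁ a)
  glue-inputs a = trans (cong (onV A.inT) (trans (cong (onV C.inL) (sym (Te.inputs₁ a))) (sym (C.inputs-L _))))
    (trans (A.glue a) (cong (onV A.inT) (C.outputs-R _)))

  glue-outputs : ∀ b → onV fromRule (onV (outputs P) b) ≡ onV fromContext (onV c₂ b)
  glue-outputs b = cong (onV A.inT) (trans (cong (onV C.inL) (sym (Te.outputs₁ b))) (C.glue _))

  through-id : ∀ a → onV A.inT (onV C.inL (onV Te.in₂ a)) ≡ onV fromContext (onV d₁ a)
  through-id a = cong (onV A.inT) (trans (cong (onV C.inL) (sym (Te.outputs₂ a))) (C.glue _))

  context-inputs : ∀ a → onV fromContext (onV d₁ a) ≡ onV (inputs T) a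
  context-inputs a = trans (sym (through-id a)) (sym (trans (A.inputs-T a) (cong (onV A.inT)
    (trans (C.inputs-L _) (cong (onV C.inL) (Te.inputs₂ a))))))

  context-outputs : ∀ a → onV fromContext (onV d₂ a) ≡ onV (outputs T) a
  context-outputs a = sym (trans (A.outputs-T a) (cong (onV A.inT) (C.outputs-R _)))

  module _ {K : Hypergraph S} (h : apex P ⟶ K) (k : apex Q ⟶ K)
           (eqᵢ : ∀ a → onV h (onV (inputs P) a) ≡ onV k (onV c₁ a))
           (eqₒ : ∀ b → onV h (onV (outputs P) b) ≡ onV k (onV c₂ b)) where
    private
      u₁ : apex P₁ ⟶ K
      u₁ = Te.rec h (k ∘ₕ d₁)
      u₁-out : ∀ a → onV u₁ (onV (outputs P₁) a) ≡ onV k (onV (inputs Q) a)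
      u₁-out = ↑-elim j _
        (λ b → trans (cong (onV u₁) (Te.outputs₁ b)) (trans (≃V (Te.rec-1 _ _) _) (eqₒ b)))
        (λ a → trans (cong (onV u₁) (Te.outputs₂ a)) (≃V (Te.rec-2 _ _) a))
      u₂ : apex PQ ⟶ K
      u₂ = C.rec u₁ k u₁-out
      u₂-trace : ∀ a → onV u₂ (onV (inputs PQ) (a ↑ˡ m)) ≡ onV u₂ (onV (outputs PQ) (a ↑ˡ n))
      u₂-trace a = trans (trans (cong (onV u₂) (C.inputs-L _)) (trans (≃V (C.rec-L u₁ k u₁-out) _)
          (trans (cong (onV u₁) (Te.inputs₁ a)) (≃V (Te.rec-1 _ _) _))))
        (trans (eqᵢ a) (sym (trans (cong (onV u₂) (C.outputs-R _)) (≃V (C.rec-R u₁ k u₁-out) _))))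

    mediate : apex T ⟶ K
    mediate = A.rec u₂ u₂-trace

    mediate-rule : ⌞ mediate ⌟ ∙ ⌞ fromRule ⌟ ≃ ⌞ h ⌟
    mediate-rule = A.rec-T u₂ u₂-trace ⋆′ ⌞ C.inL ∘ₕ Te.in₁ ⌟ ▷ C.rec-L u₁ k u₁-out ⋆′ ⌞ Te.in₁ ⌟ ▷ Te.rec-1 _ _

    mediate-context : ⌞ mediate ⌟ ∙ ⌞ fromContext ⌟ ≃ ⌞ k ⌟
    mediate-context = A.rec-T u₂ u₂-trace ⋆′ ⌞ C.inR ⌟ ▷ C.rec-R u₁ k u₁-out

  jointly-epic : ∀ {K} (u w : apex T ⟶ K) → ⌞ u ⌟ ∙ ⌞ fromRule ⌟ ≃ ⌞ w ⌟ ∙ ⌞ fromRule ⌟ →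
                 ⌞ u ⌟ ∙ ⌞ fromContext ⌟ ≃ ⌞ w ⌟ ∙ ⌞ fromContext ⌟ → ⌞ u ⌟ ≃ ⌞ w ⌟
  jointly-epic u w l r = A.ext u w (C.ext (u ∘ₕ A.inT) (w ∘ₕ A.inT)
    (Te.ext (u ∘ₕ A.inT ∘ₕ C.inL) (w ∘ₕ A.inT ∘ₕ C.inL) l
      (pick-ext λ a → trans (cong (onV u) (through-id a)) (trans (≃V r _) (cong (onV w) (sym (through-id a))))))
    r)

  isPushout : IsPushout [ inputs P , outputs P ] [ c₁ , c₂ ] fromRule fromContext
  isPushout = record
    { commutes = (λ a → []-glue {h = onV fromRule} {h′ = onV fromContext} glue-inputs glue-outputs (splitAt i a)) , λ ()
    ; universal = λ h k (eq , _) →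
        let eqᵢ = λ a → subst (λ s → onV h ([ onV (inputs P) , onV (outputs P) ]′ s) ≡ onV k ([ onV c₁ , onV c₂ ]′ s))
                          (splitAt-↑ˡ i a j) (eq (a ↑ˡ j))
            eqₒ = λ b → subst (λ s → onV h ([ onV (inputs P) , onV (outputs P) ]′ s) ≡ onV k ([ onV c₁ , onV c₂ ]′ s))
                          (splitAt-↑ʳ i j b) (eq (i ↑ʳ b))
            u = mediate h k eqᵢ eqₒ
            uₗ = mediate-rule h k eqᵢ eqₒ
            uᵣ = mediate-context h k eqᵢ eqₒ
        in u , (≃⇒≐ (u ∘ₕ fromRule) h uₗ , ≃⇒≐ (u ∘ₕ fromContext) k uᵣ) , λ u′ l r → ≃⇒≐ u′ u (jointly-epic u′ u
             (≐⇒≃ (u′ ∘ₕ fromRule) h l ▷ ≃-sym uₗ) (≐⇒≃ (u′ ∘ₕ fromContext) k r ▷ ≃-sym uᵣ))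
    }

module _ {S} {A B C D : Hypergraph S} {f : A ⟶ B} {g : A ⟶ C} {s : B ⟶ D} {t : C ⟶ D} where

  pushout-flip : IsPushout f g s t → IsPushout g f t s
  pushout-flip po = record
    { commutes = (λ v → sym (proj₁ commutes v)) , (λ e → sym (proj₂ commutes e))
    ; universal = λ h k (eV , eE) →
        let u , (l , r) , unique = universal k h ((λ v → sym (eV v)) , (λ e → sym (eE e)))
        in u , (r , l) , λ u′ l′ r′ → unique u′ r′ l′
    }
    where open IsPushout po

  pushout-transport : {D′ : Hypergraph S} (p : D ⟶ D′) (q : D′ ⟶ D) →
                      ⌞ p ⌟ ∙ ⌞ q ⌟ ≃ idₘ → ⌞ q ⌟ ∙ ⌞ p ⌟ ≃ idₘ →
                      IsPushout f g s t → IsPushout f g (p ∘ₕ s) (p ∘ₕ t)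
  pushout-transport p q pq qp po = record
    { commutes = (λ v → cong (onV p) (proj₁ commutes v)) , (λ e → cong (onE p) (proj₂ commutes e))
    ; universal = λ h k eq →
        let u , (l , r) , unique = universal h k eq
        in u ∘ₕ q
         , (≃⇒≐ (u ∘ₕ q ∘ₕ p ∘ₕ s) h (⌞ u ⌟ ⋆ qp ⋆′ ⌞ s ⌟ ▷ ≐⇒≃ (u ∘ₕ s) h l)
           , ≃⇒≐ (u ∘ₕ q ∘ₕ p ∘ₕ t) k (⌞ u ⌟ ⋆ qp ⋆′ ⌞ t ⌟ ▷ ≐⇒≃ (u ∘ₕ t) k r))
         , λ u′ l′ r′ → ≃⇒≐ u′ (u ∘ₕ q) (≃-sym (⌞ u′ ⌟ ⋆ pq) ▷ ≐⇒≃ (u′ ∘ₕ p) u (unique (u′ ∘ₕ p) l′ r′) ⋆′ ⌞ q ⌟)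
    }
    where open IsPushout po

relabel-monogamy : ∀ {S m n m′ n′} {P : Cospan S m n} {f : discrete m′ ⟶ apex P} {g : discrete n′ ⟶ apex P}
                   (γ : fin m′ ⇄ fin m) (δ : fin n′ ⇄ fin n) →
                   (∀ a → onV (inputs P) (to γ a) ≡ onV f a) → (∀ b → onV (outputs P) (to δ b) ≡ onV g b) →
                   Monogamy P → Monogamy (record { apex = apex P ; inputs = f ; outputs = g })
relabel-monogamy γ δ e h M = record
  { circles = circles M
  ; consumer = (idᵇ ⊞₁ δ) ⍮ consumer M
  ; producer = (idᵇ ⊞₁ γ) ⍮ producer M
  ; consumer-source = consumer-source M
  ; consumer-output = λ b → trans (consumer-output M (to δ b)) (h b)
  ; producer-target = producer-target M
  ; producer-input = λ a → trans (producer-input M (to γ a)) (e a)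
  ; circle = circle M
  }

[]-join : ∀ {A : Set} m {n} (f : Fin m → A) (g : Fin n → A) (h : Fin (m + n) → A) →
          (∀ a → h (a ↑ˡ n) ≡ f a) → (∀ b → h (m ↑ʳ b) ≡ g b) → ∀ v → h v ≡ [ f , g ]′ (splitAt m v)
[]-join m {n} f g h l r = ↑-elim m _
  (λ a → trans (l a) (sym (cong [ f , g ]′ (splitAt-↑ˡ m a n))))
  (λ b → trans (r b) (sym (cong [ f , g ]′ (splitAt-↑ʳ m n b))))

[]-swap : ∀ {A : Set} m n (f : Fin m → A) (g : Fin n → A) v →
          [ f , g ]′ (splitAt m (to (swapF n m) v)) ≡ [ g , f ]′ (splitAt n v)
[]-swap m n f g v = trans (cong [ f , g ]′ (splitAt-join m n (Sum.swap (splitAt n v)))) (go (splitAt n v))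
  where
  go : ∀ s → [ f , g ]′ (Sum.swap s) ≡ [ g , f ]′ s
  go (inj₁ _) = refl
  go (inj₂ _) = refl

[]-left : ∀ {A : Set} m n (f : Fin m → A) (g : Fin n → A) a → [ f , g ]′ (splitAt m (a ↑ˡ n)) ≡ f a
[]-left m n f g a = cong [ f , g ]′ (splitAt-↑ˡ m a n)

[]-right : ∀ {A : Set} m n (f : Fin m → A) (g : Fin n → A) b → [ f , g ]′ (splitAt m (m ↑ʳ b)) ≡ g b
[]-right m n f g b = cong [ f , g ]′ (splitAt-↑ʳ m n b)

cospan : ∀ {S m n} {X : Hypergraph S} → discrete m ⟶ X → discrete n ⟶ X → Cospan S m n
cospan {X = X} f g = record { apex = X ; inputs = f ; outputs = g }

module Match {S i j m n} {P : Cospan S i j} {Q : Cospan S (j + m) (i + n)} {T : Cospan S m n} (plugged : IsPlugged P Q T)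
  {C : Hypergraph S}
  (c₁ : discrete i ⟶ C) (c₂ : discrete j ⟶ C) (d₁ : discrete m ⟶ C) (d₂ : discrete n ⟶ C)
  (κ : Q ≅ cospan [ c₂ , d₁ ] [ c₁ , d₂ ])
  (G : Cospan S m n) (s : apex P ⟶ apex G) (t : C ⟶ apex G)
  (po : IsPushout [ inputs P , outputs P ] [ c₁ , c₂ ] s t)
  (interface-eq : t ∘ₕ [ d₁ , d₂ ] ≐ [ inputs G , outputs G ]) where
  private
    module R = IsPlugged plugged
    module Po = IsPushout po

    κ-c₁ : ∀ a → onV (fwd κ) (onV R.c₁ a) ≡ onV c₁ a
    κ-c₁ a = trans (fwd-outputs κ (a ↑ˡ n)) ([]-left i n (onV c₁) (onV d₂) a)
    κ-c₂ : ∀ b → onV (fwd κ) (onV R.c₂ b) ≡ onV c₂ b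
    κ-c₂ b = trans (fwd-inputs κ (b ↑ˡ m)) ([]-left j m (onV c₂) (onV d₁) b)
    κ-d₁ : ∀ a → onV (fwd κ) (onV R.d₁ a) ≡ onV d₁ a
    κ-d₁ a = trans (fwd-inputs κ (j ↑ʳ a)) ([]-right j m (onV c₂) (onV d₁) a)
    κ-d₂ : ∀ b → onV (fwd κ) (onV R.d₂ b) ≡ onV d₂ b
    κ-d₂ b = trans (fwd-outputs κ (i ↑ʳ b)) ([]-right i n (onV c₁) (onV d₂) b)

    s-inputs : ∀ a → onV s (onV (inputs P) a) ≡ onV t (onV c₁ a)
    s-inputs a = trans (cong (onV s) (sym ([]-left i j (onV (inputs P)) (onV (outputs P)) a)))
      (trans (proj₁ Po.commutes (a ↑ˡ j)) (cong (onV t) ([]-left i j (onV c₁) (onV c₂) a)))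
    s-outputs : ∀ b → onV s (onV (outputs P) b) ≡ onV t (onV c₂ b)
    s-outputs b = trans (cong (onV s) (sym ([]-right i j (onV (inputs P)) (onV (outputs P)) b)))
      (trans (proj₁ Po.commutes (i ↑ʳ b)) (cong (onV t) ([]-right i j (onV c₁) (onV c₂) b)))

    t-d₁ : ∀ a → onV t (onV d₁ a) ≡ onV (inputs G) a
    t-d₁ a = trans (cong (onV t) (sym ([]-left m n (onV d₁) (onV d₂) a)))
      (trans (proj₁ interface-eq (a ↑ˡ n)) ([]-left m n (onV (inputs G)) (onV (outputs G)) a))
    t-d₂ : ∀ b → onV t (onV d₂ b) ≡ onV (outputs G) b
    t-d₂ b = trans (cong (onV t) (sym ([]-right m n (onV d₁) (onV d₂) b)))
      (trans (proj₁ interface-eq (m ↑ʳ b)) ([]-right m n (onV (inputs G)) (onV (outputs G)) b))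

    eqᵢ : ∀ a → onV s (onV (inputs P) a) ≡ onV (t ∘ₕ fwd κ) (onV R.c₁ a)
    eqᵢ a = trans (s-inputs a) (cong (onV t) (sym (κ-c₁ a)))
    eqₒ : ∀ b → onV s (onV (outputs P) b) ≡ onV (t ∘ₕ fwd κ) (onV R.c₂ b)
    eqₒ b = trans (s-outputs b) (cong (onV t) (sym (κ-c₂ b)))

    f : apex T ⟶ apex G
    f = R.mediate s (t ∘ₕ fwd κ) eqᵢ eqₒ
    f-rule : ⌞ f ⌟ ∙ ⌞ R.fromRule ⌟ ≃ ⌞ s ⌟
    f-rule = R.mediate-rule s (t ∘ₕ fwd κ) eqᵢ eqₒ
    f-context : ⌞ f ⌟ ∙ ⌞ R.fromContext ⌟ ≃ ⌞ t ∘ₕ fwd κ ⌟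
    f-context = R.mediate-context s (t ∘ₕ fwd κ) eqᵢ eqₒ

    back : C ⟶ apex T
    back = R.fromContext ∘ₕ bwd κ

    back-eq : R.fromRule ∘ₕ [ inputs P , outputs P ] ≐ back ∘ₕ [ c₁ , c₂ ]
    back-eq = (λ v → []-glue {h = onV R.fromRule} {h′ = onV back}
      (λ a → trans (R.glue-inputs a) (cong (onV R.fromContext) (trans (sym (bwd-fwdⱽ κ _)) (cong (onV (bwd κ)) (κ-c₁ a)))))
      (λ b → trans (R.glue-outputs b) (cong (onV R.fromContext) (trans (sym (bwd-fwdⱽ κ _)) (cong (onV (bwd κ)) (κ-c₂ b)))))
      (splitAt i v)) , λ ()

    mediated = Po.universal R.fromRule back back-eq
    g : apex G ⟶ apex T
    g = proj₁ mediated
    g-s : ⌞ g ⌟ ∙ ⌞ s ⌟ ≃ ⌞ R.fromRule ⌟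
    g-s = ≐⇒≃ (g ∘ₕ s) R.fromRule (proj₁ (proj₁ (proj₂ mediated)))
    g-t : ⌞ g ⌟ ∙ ⌞ t ⌟ ≃ ⌞ back ⌟
    g-t = ≐⇒≃ (g ∘ₕ t) back (proj₂ (proj₁ (proj₂ mediated)))

    fg : ⌞ f ⌟ ∙ ⌞ g ⌟ ≃ idₘ
    fg = ≐⇒≃ (f ∘ₕ g) (proj₁ self) (unique (f ∘ₕ g)
          (≃⇒≐ (f ∘ₕ g ∘ₕ s) s (⌞ f ⌟ ⋆ g-s ▷ f-rule))
          (≃⇒≐ (f ∘ₕ g ∘ₕ t) t (⌞ f ⌟ ⋆ g-t ▷ f-context ⋆′ ⌞ bwd κ ⌟ ▷ ⌞ t ⌟ ⋆ fwd∙bwd κ)))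
        ▷ ≃-sym (≐⇒≃ idₕ (proj₁ self) (unique idₕ (≃⇒≐ s s ≃-refl) (≃⇒≐ t t ≃-refl)))
      where
      self = Po.universal s t Po.commutes
      unique = proj₂ (proj₂ self)

    gf : ⌞ g ⌟ ∙ ⌞ f ⌟ ≃ idₘ
    gf = R.jointly-epic (g ∘ₕ f) idₕ (⌞ g ⌟ ⋆ f-rule ▷ g-s)
      (⌞ g ⌟ ⋆ f-context ▷ g-t ⋆′ ⌞ fwd κ ⌟ ▷ ⌞ R.fromContext ⌟ ⋆ bwd∙fwd κ)

  match : T ≅ G
  match = mk≅ f g fg gf
    (λ a → trans (cong (onV f) (sym (R.context-inputs a))) (trans (≃V f-context _)
      (trans (cong (onV t) (κ-d₁ a)) (t-d₁ a))))
    (λ b → trans (cong (onV f) (sym (R.context-outputs b))) (trans (≃V f-context _)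
      (trans (cong (onV t) (κ-d₂ b)) (t-d₂ b))))

complement-of : ∀ {S i j m n} {Q : Cospan S (j + m) (i + n)} → Monogamy Q →
                TracedBoundaryComplement (outputs Q ∘ₕ pick {n = i} (_↑ˡ n)) (inputs Q ∘ₕ pick {n = j} (_↑ˡ m))
                                         (inputs Q ∘ₕ pick {n = m} (j ↑ʳ_)) (outputs Q ∘ₕ pick {n = n} (i ↑ʳ_))
complement-of {S} {i} {j} {m} {n} {Q} M = record
  { mono-c₁ = injective⇒mono {f = outputs Q ∘ₕ pick (_↑ˡ n)}
      λ e → ↑ˡ-injective n _ _ (mono⇒injective {f = outputs Q} (PartialMonogamous.mono-outputs pm) e)
  ; mono-c₂ = injective⇒mono {f = inputs Q ∘ₕ pick (_↑ˡ m)}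
      λ e → ↑ˡ-injective m _ _ (mono⇒injective {f = inputs Q} (PartialMonogamous.mono-inputs pm) e)
  ; partialMonogamous = monogamy⇒partialMonogamous (relabel-monogamy {P = Q} idᵇ (swapF n i)
      ([]-join j _ _ (onV (inputs Q)) (λ _ → refl) (λ _ → refl))
      (λ v → trans ([]-join i _ _ (onV (outputs Q)) (λ _ → refl) (λ _ → refl) (to (swapF n i) v))
        ([]-swap i n (λ a → onV (outputs Q) (a ↑ˡ n)) (λ b → onV (outputs Q) (i ↑ʳ b)) v)) M)
  }
  where
  pm = monogamy⇒partialMonogamous M

plugged⇒dpo : ∀ {S i j m n} {P P′ : Cospan S i j} {Q : Cospan S (j + m) (i + n)} {T T′ G H : Cospan S m n} →
              IsPlugged P Q T → IsPlugged P′ Q T′ → Monogamy Q → T ≅ G → T′ ≅ H →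
              ⌜ G ⌝ ⇝⟨ record { left = ⌜ P ⌝ ; right = ⌜ P′ ⌝ } ⟩ ⌜ H ⌝
plugged⇒dpo {m = m} {Q = Q} pluggedˡ pluggedʳ M θ η = record
  { C = apex Q ; c₁ = L.c₁ ; c₂ = L.c₂ ; d₁ = L.d₁ ; d₂ = L.d₂
  ; L⟶G = fwd θ ∘ₕ L.fromRule ; C⟶G = fwd θ ∘ₕ L.fromContext
  ; C⟶H = fwd η ∘ₕ R.fromContext ; R⟶H = fwd η ∘ₕ R.fromRule
  ; leftPushout = pushout-transport (fwd θ) (bwd θ) (fwd∙bwd θ) (bwd∙fwd θ) L.isPushout
  ; rightPushout = pushout-flip (pushout-transport (fwd η) (bwd η) (fwd∙bwd η) (bwd∙fwd η) R.isPushout)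
  ; interface-G = (λ v → []-glue {h = onV (fwd θ ∘ₕ L.fromContext)} {h′ = λ v → v}
      (λ a → trans (cong (onV (fwd θ)) (L.context-inputs a)) (fwd-inputs θ a))
      (λ b → trans (cong (onV (fwd θ)) (L.context-outputs b)) (fwd-outputs θ b)) (splitAt m v)) , λ ()
  ; interface-H = (λ v → []-glue {h = onV (fwd η ∘ₕ R.fromContext)} {h′ = λ v → v}
      (λ a → trans (cong (onV (fwd η)) (R.context-inputs a)) (fwd-inputs η a))
      (λ b → trans (cong (onV (fwd η)) (R.context-outputs b)) (fwd-outputs η b)) (splitAt m v)) , λ ()
  ; complement = complement-of M
  }
  where
  module L = IsPlugged pluggedˡ
  module R = IsPlugged pluggedʳ

plug : ∀ {S i j m n} → Term S i j → Term S (j + m) (i + n) → Term S m n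
plug {i = i} {m = m} {n = n} r c = Tr {m = m} {n = n} i ((r ⊗ id m) ⨾ c)

⟦plug⟧ : ∀ {S i j m n} (r : Term S i j) (c : Term S (j + m) (i + n)) → IsPlugged {m = m} {n = n} ⟦ r ⟧ ⟦ c ⟧ ⟦ plug {m = m} {n = n} r c ⟧
⟦plug⟧ {S} {i} {j} {m} {n} r c = record
  { P₁ = ⟦ r ⊗ id m ⟧ ; PQ = ⟦ (r ⊗ id m) ⨾ c ⟧
  ; tensored = ⟦⊗⟧-isTensor r (id m)
  ; composed = ⟦⨾⟧-isComp (r ⊗ id m) c
  ; traced = ⟦Tr⟧-isTrace i m n ((r ⊗ id m) ⨾ c)
  }

rewrite⇒dpo : ∀ {S i j m n} (r : RewriteRule S i j) (g h : Term S m n) →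
              g ⇒⟨ r ⟩ h → ⌜ ⟦ g ⟧ ⌝ ⇝⟨ ⟦ r ⟧ʳ ⟩ ⌜ ⟦ h ⟧ ⌝
rewrite⇒dpo ⟨ l , r ⟩ g h (c , g≈ , h≈) =
  plugged⇒dpo (⟦plug⟧ l c) (⟦plug⟧ r c) (proj₁ (⟦⟧-⊩ c)) (⟦⟧-sound (≈-sym g≈)) (⟦⟧-sound (≈-sym h≈))

dpo⇒rewrite : ∀ {S i j m n} (r : RewriteRule S i j) (g h : Term S m n) →
              ⌜ ⟦ g ⟧ ⌝ ⇝⟨ ⟦ r ⟧ʳ ⟩ ⌜ ⟦ h ⟧ ⌝ → g ⇒⟨ r ⟩ h
dpo⇒rewrite {S} {i} {j} {m} {n} ⟨ l , r ⟩ g h step = t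
  , ⟦⟧-complete g (plug l t) (≅-sym (Match.match (⟦plug⟧ l t) c₁ c₂ d₁ d₂ κ ⟦ g ⟧ L⟶G C⟶G leftPushout interface-G))
  , ⟦⟧-complete h (plug r t) (≅-sym (Match.match (⟦plug⟧ r t) c₁ c₂ d₁ d₂ κ ⟦ h ⟧ R⟶H C⟶H (pushout-flip rightPushout) interface-H))
  where
  open _⇝⟨_⟩_ step using (C; c₁; c₂; d₁; d₂; L⟶G; C⟶G; C⟶H; R⟶H; leftPushout; rightPushout; interface-G; interface-H; complement)
  K : Cospan S (j + m) (i + n)
  K = cospan [ c₂ , d₁ ] [ c₁ , d₂ ]
  M : Monogamy K
  M = relabel-monogamy idᵇ (swapF i n) (λ _ → refl) ([]-swap n i (onV d₂) (onV c₁))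
        (partialMonogamous⇒monogamy (TracedBoundaryComplement.partialMonogamous complement))
  t : Term S (j + m) (i + n)
  t = nf M
  κ : ⟦ t ⟧ ≅ K
  κ = ⟦nf⟧ M

theorem9p46 : (S : Generators) {i j m n : ℕ} (r : RewriteRule S i j) (g h : Term S m n) →
    (g ⇒⟨ r ⟩ h) ⇔ (⌜ ⟦ g ⟧ ⌝ ⇝⟨ ⟦ r ⟧ʳ ⟩ ⌜ ⟦ h ⟧ ⌝)
theorem9p46 S r g h = mk⇔ (rewrite⇒dpo r g h) (dpo⇒rewrite r g h)
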